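{- Let $a_1,a_2,a_3,a_4,b_1,b_2,b_3,b_4\in\mathbb{Z}$ and put $\psi_1(\mathbf{x})=a_1x_1^2+a_2x_2^2+a_3x_3^2+a_4x_4^2$ and $\psi_2(\mathbf{x})=b_1x_1^2+b_2x_2^2+b_3x_3^2+b_4x_4^2$. Assume that every $2\times 2$ minor $a_ib_j-a_jb_i$ ($1\le i<j\le 4$) of the matrix $\begin{pmatrix}a_1&a_2&a_3&a_4\\ b_1&b_2&b_3&b_4\end{pmatrix}$ is non-zero, and that $\alpha=a_1a_2a_3a_4$ is not a perfect square. For $B\ge 1$ let $$M(B)=\#\{\mathbf{x}\in\mathbb{Z}^4:\ \psi_1(\mathbf{x})=0,\ \psi_2(\mathbf{x})\text{ is a perfect square},\ |x_i|\le B\ (i=1,\dots,4)\}.$$ Then for every $\epsilon>0$, $$M(B)\ll B^{5/3+\epsilon},$$ where the implied constant depends only on $\psi_1,\psi_2$ and $\epsilon$.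
   Context: A perfect square means an integer of the form $m^2$ with $m\in\mathbb{Z}$ (including $0$). -}

module Defs where

open import Data.Nat as ℕ using (ℕ; zero; suc)
import Data.Nat.Properties as ℕP
open import Data.Integer as ℤ using (ℤ; +_; -[1+_]; ∣_∣; _*_; _+_; _-_; -_)
import Data.Integer.Properties as ℤP
open import Data.Fin using (Fin; toℕ; fromℕ<)
open import Data.Fin.Properties using (any?; toℕ-fromℕ<)
open import Data.Vec using (Vec; []; _∷_)
open import Data.List as List using (List; []; _∷_; map; concatMap; filter; length; upTo)
open import Data.Product using (Σ; ∃; ∃-syntax; _,_; _×_)
open import Relation.Nullary using (Dec; yes; no; ¬_)
open import Relation.Nullary.Decidable using (_×-dec_)
open import Relation.Binary.PropositionalEquality

IsSquare : ℤ → Set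
IsSquare n = ∃[ m ] n ≡ m * m

private
  sq-abs : ∀ m → m * m ≡ + (∣ m ∣ ℕ.* ∣ m ∣)
  sq-abs (+ k) = sym (ℤP.pos-* k k)
  sq-abs -[1+ k ] = refl

  le-sq : ∀ k → k ℕ.≤ k ℕ.* k
  le-sq zero = ℕ.z≤n
  le-sq (suc k) = ℕP.m≤m*n (suc k) (suc k)

private
  bound : ∀ n m → n ≡ m * m → ∣ m ∣ ℕ.≤ ∣ n ∣
  bound n m eq rewrite eq | sq-abs m = le-sq ∣ m ∣

isSquare? : ∀ n → Dec (IsSquare n)
isSquare? n with any? {n = suc ∣ n ∣} (λ (i : Fin (suc ∣ n ∣)) → n ℤ.≟ + (toℕ i ℕ.* toℕ i))
... | yes (i , eq) = yes (+ toℕ i , trans eq (ℤP.pos-* (toℕ i) (toℕ i)))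
... | no ¬p = no λ where
  (m , eq) → ¬p (fromℕ< {∣ m ∣} (ℕ.s≤s (bound n m eq)) ,
                 trans eq (trans (sq-abs m) (cong (λ t → + (t ℕ.* t)) (sym (toℕ-fromℕ< (ℕ.s≤s (bound n m eq)))))))

diagForm : Vec ℤ 4 → Vec ℤ 4 → ℤ
diagForm (c₁ ∷ c₂ ∷ c₃ ∷ c₄ ∷ []) (x₁ ∷ x₂ ∷ x₃ ∷ x₄ ∷ []) =
  c₁ * (x₁ * x₁) + c₂ * (x₂ * x₂) + c₃ * (x₃ * x₃) + c₄ * (x₄ * x₄)

coeffProd : Vec ℤ 4 → ℤ
coeffProd (c₁ ∷ c₂ ∷ c₃ ∷ c₄ ∷ []) = c₁ * c₂ * c₃ * c₄

range : ℕ → List ℤ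
range B = map (λ i → + i - + B) (upTo (suc (B ℕ.+ B)))

box : (n : ℕ) → ℕ → List (Vec ℤ n)
box zero B = [] ∷ []
box (suc n) B = concatMap (λ x → map (x ∷_) (box n B)) (range B)

Counted : Vec ℤ 4 → Vec ℤ 4 → Vec ℤ 4 → Set
Counted a b x = diagForm a x ≡ + 0 × IsSquare (diagForm b x)

counted? : ∀ a b x → Dec (Counted a b x)
counted? a b x = (diagForm a x ℤ.≟ + 0) ×-dec isSquare? (diagForm b x)

M : Vec ℤ 4 → Vec ℤ 4 → ℕ → ℕ
M a b B = length (filter (counted? a b) (box 4 B))

{-# OPTIONS --safe #-}
-- The p-adic determinant method on the surface ψ₁(x) = 0, ψ₂(x) = y², run with a prime p = B^o(1) that divides neither the
-- minors and coefficients nor x₁x₂x₃x₄y. For points (x , y), (x' , y') congruent modulo p^l up to scaling, δ = y x' - y' x is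
-- divisible by p^l and lies in the tangent plane modulo p^2l. Hence the 5 × 5 determinants on a class of such points are
-- divisible by a high power of p, and vanish once it exceeds their trivial bound 120 n⁵. A class splits into p² classes of the
-- next level, but into at most 2p once these determinants vanish, because it then lies on a conic modulo p. Since α is not a
-- square the quadric ψ₁ = 0 contains no rational line, so no three points are collinear; five points in a plane determine a
-- member of the pencil vanishing on that plane, which then contains a coordinate axis because the minors are nonzero, and this
-- gives divisibility for the last stage. Altogether a class has at most 4 p^s 2^s points with p^3s ≪ B⁵, and 2^s is B^ε as p is large.
-- Dividing by the content g of x keeps track of a factor 1/g, whose sum over g costs a logarithm. Solutions with a vanishing
-- coordinate or y = 0 lie on conics and are O(B^(1+ε)) in number by the same descent with pairs of points.
module Submission where

-- A stage ends because the determinants of its class vanish, so the next stage has to borrow points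
-- to have a nonzero determinant at all. The last class that spans the five-dimensional space is
-- kept as `G₅`, and a class in a hyperplane completes four of its points by one of `G₅`. The last
-- class for which this succeeds is kept as `G₄`, and a class in a plane completes three of its
-- points by one of `G₄` and one of `G₅`. Borrowed points are congruent only modulo lower powers of
-- p, which is why the divisibility lemmas carry several moduli. With k₃ levels in the last stage
-- the available exponents of p are 6 l₅, then 6 l₅ + 4 k₄, then 6 l₅ + 4 k₄ + 3 k₃, while s = 2 l₅
-- + k₄ + k₃ factors of size p have been lost. Each exponent dominates 3 s at its stage, and this is
-- the origin of 5/3. In the last stage the tangency of the differences alone would yield only 2 per
-- level; the coordinate axis in the plane supplies the third.

-- Selections from lists, pigeonhole arguments and the descent scheme.

module Lists where
  open import Data.Nat using (ℕ; zero; suc; _+_; _*_; _^_; _≤_; _<_; z≤n; s≤s; _≟_; _≤?_)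
  open import Data.Nat.Properties
  open import Data.List.Base using (List; []; _∷_; length; filter)
  open import Data.List.Properties using (filter-accept; filter-reject)
  open import Data.List.Membership.Propositional using (_∈_)
  open import Data.List.Membership.Propositional.Properties using (∈-filter⁻)
  open import Data.List.Relation.Unary.Any using (here; there)
  open import Data.List.Relation.Unary.Unique.Propositional using (Unique)
  import Data.List.Relation.Unary.Unique.Propositional.Properties as Unique
  open import Data.Product using (∃-syntax; _×_; _,_; proj₁; proj₂)
  open import Data.Sum using (_⊎_; inj₁; inj₂)
  open import Data.Empty using (⊥-elim)
  open import Relation.Nullary using (Dec; yes; no; ¬_)
  open import Relation.Nullary.Decidable using (¬?)
  open import Relation.Unary using (Pred; Decidable)
  open import Relation.Binary.PropositionalEquality
  open import Level using (0ℓ)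

  infix 4 _⊑_
  -- Only the inheritance of members and of distinctness is recorded, so selections of different
  -- origin compose without tracking positions.
  _⊑_ : ∀ {A : Set} → List A → List A → Set
  c' ⊑ c = (∀ {x} → x ∈ c' → x ∈ c) × (Unique c → Unique c')

  ⊑-refl : ∀ {A : Set} {c : List A} → c ⊑ c
  ⊑-refl = (λ i → i) , (λ u → u)

  ⊑-trans : ∀ {A : Set} {c d e : List A} → c ⊑ d → d ⊑ e → c ⊑ e
  ⊑-trans (f , u) (g , v) = (λ i → g (f i)) , (λ w → u (v w))

  filter-⊑ : ∀ {A : Set} {P : Pred A 0ℓ} (P? : Decidable P) (c : List A) → filter P? c ⊑ c
  filter-⊑ P? c = (λ i → proj₁ (∈-filter⁻ P? i)) , Unique.filter⁺ P?

  sumTo : ℕ → (ℕ → ℕ) → ℕ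
  sumTo zero f = 0
  sumTo (suc n) f = f n + sumTo n f

  sumTo-mono : ∀ n {f g} → (∀ k → f k ≤ g k) → sumTo n f ≤ sumTo n g
  sumTo-mono zero le = z≤n
  sumTo-mono (suc n) le = +-mono-≤ (le n) (sumTo-mono n le)

  sumTo-bump : ∀ n {f g} k → k < n → (∀ j → f j ≤ g j) → suc (f k) ≤ g k → suc (sumTo n f) ≤ sumTo n g
  sumTo-bump (suc n) {f} {g} k k<n le bump with k ≟ n
  ... | yes refl = +-mono-≤ bump (sumTo-mono n le)
  ... | no k≢n = ≤-trans (≤-reflexive (sym (+-suc (f n) _)))
          (+-mono-≤ (le n) (sumTo-bump n k (≤∧≢⇒< (≤-pred k<n) k≢n) le bump))

  argmax : ∀ n (f : ℕ → ℕ) → ∃[ k ] sumTo n f ≤ n * f k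
  argmax zero f = 0 , z≤n
  argmax (suc n) f with argmax n f
  ... | k , le with f k ≤? f n
  ...   | yes fk≤fn = n , +-monoʳ-≤ (f n) (≤-trans le (*-monoʳ-≤ n fk≤fn))
  ...   | no fk≰fn = k , +-mono-≤ (<⇒≤ (≰⇒> fk≰fn)) le

  module _ {A : Set} (key : A → ℕ) where

    fiber : ℕ → List A → List A
    fiber k = filter (λ x → key x ≟ k)

    fiber-key : ∀ {k c x} → x ∈ fiber k c → key x ≡ k
    fiber-key {k} {c} i = proj₂ (∈-filter⁻ (λ x → key x ≟ k) {xs = c} i)

    fiber-⊑ : ∀ k c → fiber k c ⊑ c
    fiber-⊑ k = filter-⊑ (λ x → key x ≟ k)

    private
      fiber-grows : ∀ k x c → length (fiber k c) ≤ length (fiber k (x ∷ c))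
      fiber-grows k x c with key x ≟ k
      ... | yes e = ≤-trans (n≤1+n _) (≤-reflexive (cong length (sym (filter-accept (λ y → key y ≟ k) e))))
      ... | no ¬e = ≤-reflexive (cong length (sym (filter-reject (λ y → key y ≟ k) ¬e)))

      fiber-gains : ∀ x c → suc (length (fiber (key x) c)) ≤ length (fiber (key x) (x ∷ c))
      fiber-gains x c = ≤-reflexive (cong length (sym (filter-accept (λ y → key y ≟ key x) refl)))

    length≤sum-fibers : ∀ n c → (∀ {x} → x ∈ c → key x < n) → length c ≤ sumTo n (λ k → length (fiber k c))
    length≤sum-fibers n [] lt = z≤n
    length≤sum-fibers n (x ∷ c) lt = ≤-trans (s≤s (length≤sum-fibers n c (λ i → lt (there i))))
      (sumTo-bump n (key x) (lt (here refl)) (λ k → fiber-grows k x c) (fiber-gains x c))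

    -- The descent never sums over classes: it passes to a largest one and pays the number of
    -- classes as a factor, so that every estimate for a class is a product of such factors.
    pigeonhole : ∀ n c → (∀ {x} → x ∈ c → key x < n) → ∃[ k ] length c ≤ n * length (fiber k c)
    pigeonhole n c lt with argmax n (λ k → length (fiber k c))
    ... | k , le = k , ≤-trans (length≤sum-fibers n c lt) le

  length-split : ∀ {A : Set} {P : Pred A 0ℓ} (P? : Decidable P) (c : List A) →
    length c ≡ length (filter P? c) + length (filter (λ x → ¬? (P? x)) c)
  length-split P? [] = refl
  length-split P? (x ∷ c) with P? x
  ... | yes _ = cong suc (length-split P? c)
  ... | no _ = trans (cong suc (length-split P? c)) (sym (+-suc _ _))

  larger-half : ∀ {A : Set} {P : Pred A 0ℓ} (P? : Decidable P) (c : List A) →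
    length c ≤ 2 * length (filter P? c) ⊎ length c ≤ 2 * length (filter (λ x → ¬? (P? x)) c)
  larger-half P? c with length (filter (λ x → ¬? (P? x)) c) ≤? length (filter P? c)
  ... | yes le = inj₁ (≤-trans (≤-reflexive (length-split P? c))
        (+-monoʳ-≤ (length (filter P? c)) (≤-trans le (≤-reflexive (sym (+-identityʳ _))))))
  ... | no ≰ = inj₂ (≤-trans (≤-reflexive (length-split P? c)) (≤-trans (+-monoˡ-≤ _ (<⇒≤ (≰⇒> ≰)))
        (≤-reflexive (cong (length (filter (λ x → ¬? (P? x)) c) +_) (sym (+-identityʳ _))))))

  -- Elements whose key differs from that of the first element agree with each other, by the
  -- hypothesis applied to the first element and two of them. So there are at most two keys, and the
  -- larger part is kept.
  two-values : ∀ {A : Set} (key : A → ℕ) (c : List A) →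
    (∀ {x y z} → x ∈ c → y ∈ c → z ∈ c → key x ≡ key y ⊎ key x ≡ key z ⊎ key y ≡ key z) →
    ∃[ d ] d ⊑ c × (∀ {x y} → x ∈ d → y ∈ d → key x ≡ key y) × length c ≤ 2 * length d
  two-values key [] h = [] , ⊑-refl , (λ ()) , z≤n
  two-values {A} key c@(x ∷ _) h with larger-half (λ y → key y ≟ key x) c
  ... | inj₁ le = fiber key (key x) c , fiber-⊑ key (key x) c ,
        (λ i j → trans (fiber-key key {c = c} i) (sym (fiber-key key {c = c} j))) , le
  ... | inj₂ le = filter Q? c , filter-⊑ Q? c , same , le
    where
    Q? : (y : A) → Dec (¬ (key y ≡ key x))
    Q? y = ¬? (key y ≟ key x)
    same : ∀ {y z} → y ∈ filter Q? c → z ∈ filter Q? c → key y ≡ key z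
    same i j with ∈-filter⁻ Q? {xs = c} i | ∈-filter⁻ Q? {xs = c} j
    ... | (i' , ny) | (j' , nz) with h (here refl) i' j'
    ...   | inj₁ e = ⊥-elim (ny (sym e))
    ...   | inj₂ (inj₁ e) = ⊥-elim (nz (sym e))
    ...   | inj₂ (inj₂ e) = e

  module _ {A : Set} (Lev : ℕ → List A → Set) (Good : List A → Set) (Good? : ∀ c → Dec (Good c)) (K L : ℕ)
    (step : ∀ l c → Lev l c → ∃[ d ] d ⊑ c × Lev (suc l) d × length c ≤ K * length d)
    (bounded : ∀ l c → Lev l c → Good c → l ≤ L)
    where

    private
      go : ∀ fuel l c → L < fuel + l → Lev l c → Good c →
        ∃[ m ] ∃[ d ] ∃[ e ] d ⊑ c × Lev (m + l) d × Good d × e ⊑ d × Lev (suc (m + l)) e × ¬ Good e × length c ≤ K ^ suc m * length e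
      go zero l c L<l lev good = ⊥-elim (<⇒≱ L<l (bounded l c lev good))
      go (suc fuel) l c lt lev good with step l c lev
      ... | d , d⊑c , lev' , le with Good? d
      ...   | no ¬good = 0 , c , d , ⊑-refl , lev , good , d⊑c , lev' , ¬good ,
              ≤-trans le (≤-reflexive (cong (_* length d) (sym (*-identityʳ K))))
      ...   | yes good' with go fuel (suc l) d (≤-trans lt (≤-reflexive (sym (+-suc fuel l)))) lev' good'
      ...     | m , d' , e , d'⊑d , levd , gd , e⊑d' , leve , ¬ge , le' =
                suc m , d' , e , ⊑-trans d'⊑d d⊑c , subst (λ k → Lev k d') (+-suc m l) levd , gd , e⊑d' ,
                subst (λ k → Lev (suc k) e) (+-suc m l) leve , ¬ge ,
                ≤-trans le (≤-trans (*-monoʳ-≤ K le') (≤-reflexive (sym (*-assoc K (K ^ suc m) (length e)))))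

    -- Since `Good` bounds the level, `L` yields enough fuel. Both ends of the last step are
    -- returned: the last good class `d` supplies the inequality between sizes, and the first bad
    -- class `e` supplies the degeneracy with which the next stage begins.
    descend : ∀ l c → Lev l c → Good c →
      ∃[ m ] ∃[ d ] ∃[ e ] d ⊑ c × Lev (m + l) d × Good d × e ⊑ d × Lev (suc (m + l)) e × ¬ Good e × length c ≤ K ^ suc m * length e
    descend l c = go (suc L) l c (s≤s (m≤m+n L l))

open Lists

-- Powers, integer roots and the harmonic sum.

module Naturals where
  open import Data.Nat
  open import Data.Nat.Properties
  open import Data.Nat.Divisibility
  open import Data.Nat.DivMod using (m/n*n≤m; m/n<m; m/n*n≡m; /-mono-≤; m≡m%n+[m/n]*n; m%n<n)
  open import Data.Nat.Primality
  open import Data.Nat.Induction using (<-wellFounded)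
  open import Induction.WellFounded using (Acc; acc)
  open import Data.Nat.Solver using (module +-*-Solver)
  open import Data.List.Base using (List; []; _∷_; length; filter; map; upTo)
  open import Data.Nat.ListAction using (product)
  open import Data.List.Properties using (length-map; length-upTo; filter-accept; filter-reject)
  open import Data.List.Membership.Propositional using (_∈_)
  open import Data.List.Membership.Propositional.Properties using (∈-filter⁻; ∈-filter⁺; ∈-map⁻; ∈-upTo⁺; ∈-upTo⁻)
  open import Data.List.Relation.Unary.Any using (here; there)
  open import Data.List.Relation.Unary.All as All using (All; []; _∷_)
  open import Data.List.Relation.Unary.AllPairs using ([]; _∷_)
  open import Data.List.Relation.Unary.Unique.Propositional using (Unique)
  import Data.List.Relation.Unary.Unique.Propositional.Properties as Unique
  open import Data.Product using (∃-syntax; _×_; _,_; proj₁; proj₂)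
  open import Data.Sum using (inj₁; inj₂)
  open import Data.Empty using (⊥-elim)
  open import Relation.Nullary using (Dec; yes; no; ¬_)
  open import Relation.Nullary.Decidable using (¬?; _×-dec_)
  open import Relation.Unary using (Decidable)
  open import Relation.Binary.PropositionalEquality

  ^-monoʳ-1≤ : ∀ a {m n} → 1 ≤ a → m ≤ n → a ^ m ≤ a ^ n
  ^-monoʳ-1≤ (suc a) _ le = ^-monoʳ-≤ (suc a) le

  1≤^ : ∀ a n → 1 ≤ a → 1 ≤ a ^ n
  1≤^ a n 1≤a = ^-monoʳ-1≤ a 1≤a (z≤n {n})

  ^-distribʳ-* : ∀ k a b → (a * b) ^ k ≡ a ^ k * b ^ k
  ^-distribʳ-* zero a b = refl
  ^-distribʳ-* (suc k) a b = trans (cong (a * b *_) (^-distribʳ-* k a b)) (solve 4 (λ a b c d → a :* b :* (c :* d) := a :* c :* (b :* d)) refl a b (a ^ k) (b ^ k))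
    where open +-*-Solver

  n<2^n : ∀ n → n < 2 ^ n
  n<2^n zero = s≤s z≤n
  n<2^n (suc n) = ≤-trans (+-mono-≤ (1≤^ 2 n (s≤s z≤n)) (n<2^n n)) (≤-reflexive (cong (2 ^ n +_) (sym (+-identityʳ _))))

  root : ∀ k → 1 ≤ k → ∀ w → ∃[ z ] z ^ k ≤ w × w < suc z ^ k
  root k@(suc _) _ zero = 0 , z≤n , ≤-reflexive (sym (^-zeroˡ k))
  root k 1≤k (suc w) with root k 1≤k w
  ... | z , lo , hi with suc z ^ k ≤? suc w
  ...   | yes le = suc z , le , ≤-<-trans hi (^-monoˡ-< k {{>-nonZero 1≤k}} (n<1+n (suc z)))
  ...   | no ≰ = z , m≤n⇒m≤1+n lo , ≰⇒> ≰

  ^-cancelʳ-≤ : ∀ j {m n} → 1 ≤ j → m ^ j ≤ n ^ j → m ≤ n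
  ^-cancelʳ-≤ j {m} {n} 1≤j le with m ≤? n
  ... | yes p = p
  ... | no ¬p = ⊥-elim (<⇒≱ (^-monoˡ-< j {{>-nonZero 1≤j}} (≰⇒> ¬p)) le)

  -- A j-th root is taken by cancelling the power; the constant becomes a j-th power through C ≤
  -- (suc C) ^ j.
  power-root : ∀ j k e {C N B} → 1 ≤ j → N ^ (k * j) ≤ C * B ^ (e * j) → N ^ k ≤ suc C * B ^ e
  power-root j k e {C} {N} {B} 1≤j le = ^-cancelʳ-≤ j 1≤j (begin
    (N ^ k) ^ j             ≡⟨ ^-*-assoc N k j ⟩
    N ^ (k * j)             ≤⟨ le ⟩
    C * B ^ (e * j)         ≡⟨ cong (C *_) (sym (^-*-assoc B e j)) ⟩
    C * (B ^ e) ^ j         ≤⟨ *-monoˡ-≤ _ (≤-trans (n≤1+n C) (≤-trans (≤-reflexive (sym (^-identityʳ (suc C)))) (^-monoʳ-≤ (suc C) 1≤j))) ⟩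
    suc C ^ j * (B ^ e) ^ j ≡⟨ sym (^-distribʳ-* j (suc C) (B ^ e)) ⟩
    (suc C * B ^ e) ^ j     ∎)
    where open ≤-Reasoning

  -- The harmonic sum over 1 ≤ g < 2 ^ k, block by dyadic block.
  harmonic : ∀ V (f : ℕ → ℕ) → f 0 ≡ 0 → (∀ g → g * f g ≤ V) → ∀ k → sumTo (2 ^ k) f ≤ k * V
  harmonic V f f0 h zero = ≤-reflexive (trans (+-identityʳ (f 0)) f0)
  harmonic V f f0 h (suc k) = ≤-trans (≤-reflexive (trans (cong (λ n → sumTo (2 ^ k + n) f) (+-identityʳ (2 ^ k))) (sumTo-+ (2 ^ k) (2 ^ k))))
      (+-mono-≤ block (harmonic V f f0 h k))
    where
    sumTo-+ : ∀ m n → sumTo (m + n) f ≡ sumTo m (λ i → f (i + n)) + sumTo n f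
    sumTo-+ zero n = refl
    sumTo-+ (suc m) n = trans (cong (f (m + n) +_) (sumTo-+ m n)) (sym (+-assoc (f (m + n)) _ _))
    bounded : ∀ N n {g} → (∀ i → N * g i ≤ V) → N * sumTo n g ≤ n * V
    bounded N zero h = ≤-reflexive (*-zeroʳ N)
    bounded N (suc n) {g} h = ≤-trans (≤-reflexive (*-distribˡ-+ N (g n) (sumTo n g))) (+-mono-≤ (h n) (bounded N n h))
    block : sumTo (2 ^ k) (λ i → f (i + 2 ^ k)) ≤ V
    block = *-cancelˡ-≤ (2 ^ k) {{m^n≢0 2 k}} (bounded (2 ^ k) (2 ^ k) (λ i → ≤-trans (*-monoˡ-≤ (f (i + 2 ^ k)) (m≤n+m (2 ^ k) i)) (h (i + 2 ^ k))))

  -- This absorbs a power of a logarithm: n will be a binary logarithm. Division of n by k gives suc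
  -- n ≤ k (n / k + 1) ≤ 2 k 2 ^ (n / k), and the k-th power of 2 ^ (n / k) is at most 2 ^ n.
  poly≤exp : ∀ k → 1 ≤ k → ∀ n → suc n ^ k ≤ (2 * k) ^ k * 2 ^ n
  poly≤exp k 1≤k n = begin
    suc n ^ k                       ≤⟨ ^-monoˡ-≤ k bound ⟩
    (2 * k * 2 ^ (n / k)) ^ k       ≡⟨ ^-distribʳ-* k (2 * k) (2 ^ (n / k)) ⟩
    (2 * k) ^ k * (2 ^ (n / k)) ^ k ≡⟨ cong ((2 * k) ^ k *_) (^-*-assoc 2 (n / k) k) ⟩
    (2 * k) ^ k * 2 ^ (n / k * k)   ≤⟨ *-monoʳ-≤ ((2 * k) ^ k) (^-monoʳ-≤ 2 (m/n*n≤m n k)) ⟩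
    (2 * k) ^ k * 2 ^ n             ∎
    where
    open ≤-Reasoning
    instance
      k≢0 : NonZero k
      k≢0 = >-nonZero 1≤k
    bound : suc n ≤ 2 * k * 2 ^ (n / k)
    bound = begin
      suc n                  ≤⟨ s≤s (≤-reflexive (m≡m%n+[m/n]*n n k)) ⟩
      suc (n % k) + n / k * k ≤⟨ +-monoˡ-≤ (n / k * k) (m%n<n n k) ⟩
      k + n / k * k          ≡⟨⟩
      suc (n / k) * k        ≤⟨ *-monoˡ-≤ k (n<2^n (n / k)) ⟩
      2 ^ (n / k) * k        ≡⟨ *-comm _ k ⟩
      k * 2 ^ (n / k)        ≤⟨ *-monoˡ-≤ (2 ^ (n / k)) (m≤m+n k (k + 0)) ⟩
      2 * k * 2 ^ (n / k)    ∎

  -- Smooth numbers and a small prime outside the divisors of an integer.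

  Smooth : List ℕ → ℕ → Set
  Smooth qs m = ∀ {r} → Prime r → r ∣ m → r ∈ qs

  private
    prime>1 : ∀ {q} → Prime q → 2 ≤ q
    prime>1 {q} pr = nonTrivial⇒n>1 q {{prime⇒nonTrivial pr}}

  prime-divisor : ∀ n → 2 ≤ n → ∃[ r ] Prime r × r ∣ n
  prime-divisor n 2≤n = go n 2≤n (<-wellFounded n)
    where
    go : ∀ n → 2 ≤ n → Acc _<_ n → ∃[ r ] Prime r × r ∣ n
    go n 2≤n (acc rec) with prime? n
    ... | yes pr = n , pr , ∣-refl
    ... | no ¬pr with ¬prime⇒composite {n} {{n>1⇒nonTrivial 2≤n}} ¬pr
    ...   | composite {d} d<n d∣n with go d (nonTrivial⇒n>1 d) (rec d<n)
    ...     | r , pr , r∣d = r , pr , ∣-trans r∣d d∣n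

  private
    -- The hypotheses say A ≤ √Y / 4 and B ≤ √Y / √2, and 1/4 + 1/√2 < 1. Free of roots this is 12
    -- (A + B)² + 4 (3 A - B)² = 48 A² + 16 B²; the case distinction in `amgm` writes the difference
    -- 3 A - B as a natural number.
    square-step : ∀ A B Y → 16 * (A * A) ≤ Y → 2 * (B * B) ≤ Y → (A + B) * (A + B) ≤ Y
    square-step A B Y a b = *-cancelˡ-≤ 12 (begin
      12 * ((A + B) * (A + B)) ≤⟨ amgm ⟩
      48 * (A * A) + 16 * (B * B) ≡⟨ solve 2 (λ a b → con 48 :* a :+ con 16 :* b := con 3 :* (con 16 :* a) :+ con 8 :* (con 2 :* b)) refl (A * A) (B * B) ⟩
      3 * (16 * (A * A)) + 8 * (2 * (B * B)) ≤⟨ +-mono-≤ (*-monoʳ-≤ 3 a) (*-monoʳ-≤ 8 b) ⟩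
      3 * Y + 8 * Y ≤⟨ m≤m+n _ Y ⟩
      3 * Y + 8 * Y + Y ≡⟨ solve 1 (λ y → con 3 :* y :+ con 8 :* y :+ y := con 12 :* y) refl Y ⟩
      12 * Y ∎)
      where
      open ≤-Reasoning
      open +-*-Solver
      amgm : 12 * ((A + B) * (A + B)) ≤ 48 * (A * A) + 16 * (B * B)
      amgm with ≤-total (3 * A) B
      ... | inj₁ le with m≤n⇒∃[o]m+o≡n le
      ...   | d , refl = ≤-trans (m≤m+n _ (4 * (d * d))) (≤-reflexive (solve 2 (λ a d → con 12 :* ((a :+ (con 3 :* a :+ d)) :* (a :+ (con 3 :* a :+ d))) :+ con 4 :* (d :* d) := con 48 :* (a :* a) :+ con 16 :* ((con 3 :* a :+ d) :* (con 3 :* a :+ d))) refl A d))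
      amgm | inj₂ le with m≤n⇒∃[o]m+o≡n le
      -- After multiplication by 9 the variable A occurs only as 3 * A, which can be replaced by B +
      -- d.
      ...   | d , e = *-cancelˡ-≤ 9 (≤-trans (m≤m+n _ (36 * (d * d))) (≤-reflexive (lem A B d e)))
        where
        lem : ∀ A B d → B + d ≡ 3 * A → 9 * (12 * ((A + B) * (A + B))) + 36 * (d * d) ≡ 9 * (48 * (A * A) + 16 * (B * B))
        lem A B d e = trans (solve 3 (λ a b d → con 9 :* (con 12 :* ((a :+ b) :* (a :+ b))) :+ con 36 :* (d :* d) := con 12 :* ((con 3 :* a :+ con 3 :* b) :* (con 3 :* a :+ con 3 :* b)) :+ con 36 :* (d :* d)) refl A B d)
          (trans (cong (λ t → 12 * ((t + 3 * B) * (t + 3 * B)) + 36 * (d * d)) (sym e))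
          (trans (solve 2 (λ b d → con 12 :* ((b :+ d :+ con 3 :* b) :* (b :+ d :+ con 3 :* b)) :+ con 36 :* (d :* d) := con 48 :* ((b :+ d) :* (b :+ d)) :+ con 144 :* (b :* b)) refl B d)
          (trans (cong (λ t → 48 * (t * t) + 144 * (B * B)) e)
          (solve 2 (λ a b → con 48 :* ((con 3 :* a) :* (con 3 :* a)) :+ con 144 :* (b :* b) := con 9 :* (con 48 :* (a :* a) :+ con 16 :* (b :* b))) refl A B))))

  -- Split by divisibility by the first prime q. The non-multiples are smooth over one prime less,
  -- which saves a factor 16; the multiples, divided by q, are smooth over the same primes up to x /
  -- q ≤ x / 2. `square-step` puts the two square-root bounds together.
  smooth-count : ∀ qs → All Prime qs → ∀ x ms → Unique ms → (∀ {m} → m ∈ ms → 1 ≤ m × m ≤ x × Smooth qs m) →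
    length ms * length ms ≤ 16 ^ length qs * x
  smooth-count [] _ x [] u h = z≤n
  smooth-count [] _ x (m ∷ []) u h with h (here refl)
  ... | 1≤m , m≤x , _ = ≤-trans (≤-trans 1≤m m≤x) (m≤m+n x 0)
  smooth-count [] _ x (m ∷ m' ∷ ms) ((m≢m' ∷ _) ∷ _) h =
    ⊥-elim (m≢m' (trans (one (h (here refl))) (sym (one (h (there (here refl)))))))
    where
    one : ∀ {m} → 1 ≤ m × m ≤ x × Smooth [] m → m ≡ 1
    one {zero} (() , _)
    one {suc zero} _ = refl
    one {2+ m} (_ , _ , s) with prime-divisor (2+ m) (s≤s (s≤s z≤n))
    ... | r , pr , d with s pr d
    ...   | ()
  smooth-count (q ∷ qs) (pq ∷ pqs) x ms u h = go x (<-wellFounded x) ms u h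
    where
    instance
      q≢0 : NonZero q
      q≢0 = prime⇒nonZero pq
    Y : ℕ → ℕ
    Y x = 16 ^ length (q ∷ qs) * x
    go : ∀ x → Acc _<_ x → ∀ ms → Unique ms → (∀ {m} → m ∈ ms → 1 ≤ m × m ≤ x × Smooth (q ∷ qs) m) → length ms * length ms ≤ Y x
    go zero _ [] u h = z≤n
    go zero _ (m ∷ ms) u h with h (here refl)
    ... | 1≤m , m≤0 , _ = ⊥-elim (<⇒≱ 1≤m m≤0)
    go x@(suc x') (acc rec) ms u h = subst (λ t → t * t ≤ Y x) (sym total) (square-step (length as) (length bs) (Y x) boundA boundB)
      where
      div? : (m : ℕ) → Dec (¬ (q ∣ m))
      div? m = ¬? (q ∣? m)
      as = filter div? ms
      cs = filter (λ m → ¬? (div? m)) ms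
      bs = map (_/ q) cs
      q∣cs : ∀ {m} → m ∈ cs → q ∣ m
      q∣cs {m} i with q ∣? m | proj₂ (∈-filter⁻ (λ m → ¬? (div? m)) {xs = ms} i)
      ... | yes d | _ = d
      ... | no nd | k = ⊥-elim (k nd)
      total : length ms ≡ length as + length bs
      total = trans (length-split div? ms) (cong (length as +_) (sym (length-map (_/ q) cs)))
      sm-as : ∀ {m} → m ∈ as → 1 ≤ m × m ≤ x × Smooth qs m
      sm-as {m} i with ∈-filter⁻ div? {xs = ms} i
      ... | j , nd with h j
      ...   | 1≤m , m≤x , s = 1≤m , m≤x , λ pr r∣m → away pr r∣m (s pr r∣m)
        where
        away : ∀ {r} → Prime r → r ∣ m → r ∈ q ∷ qs → r ∈ qs
        away pr r∣m (here refl) = ⊥-elim (nd r∣m)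
        away pr r∣m (there k) = k
      boundA : 16 * (length as * length as) ≤ Y x
      boundA = ≤-trans (*-monoʳ-≤ 16 (smooth-count qs pqs x as (Unique.filter⁺ div? u) sm-as)) (≤-reflexive (sym (*-assoc 16 (16 ^ length qs) x)))
      uniq-map : ∀ {cs} → (∀ {m} → m ∈ cs → q ∣ m) → Unique cs → Unique (map (_/ q) cs)
      uniq-map d [] = []
      uniq-map {c ∷ cs} d (n ∷ u) = All.tabulate ne ∷ uniq-map (λ i → d (there i)) u
        where
        ne : ∀ {y} → y ∈ map (_/ q) cs → c / q ≢ y
        ne i e with ∈-map⁻ (_/ q) i
        ... | m , j , refl = All.lookup n j (trans (sym (m/n*n≡m (d (here refl)))) (trans (cong (_* q) e) (m/n*n≡m (d (there j)))))
      sm-bs : ∀ {b} → b ∈ bs → 1 ≤ b × b ≤ x / q × Smooth (q ∷ qs) b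
      sm-bs i with ∈-map⁻ (_/ q) i
      ... | m , j , refl with h (proj₁ (∈-filter⁻ (λ m → ¬? (div? m)) {xs = ms} j))
      ...   | 1≤m , m≤x , s = n≢0⇒n>0 nz , /-mono-≤ m≤x ≤-refl , (λ pr d → s pr (∣-trans d (divides q (trans (sym (m/n*n≡m (q∣cs j))) (*-comm (m / q) q)))))
        where
        nz : m / q ≢ 0
        nz e = <⇒≱ 1≤m (≤-reflexive (trans (sym (m/n*n≡m (q∣cs j))) (cong (_* q) e)))
      boundB : 2 * (length bs * length bs) ≤ Y x
      boundB = begin
        2 * (length bs * length bs) ≤⟨ *-monoʳ-≤ 2 (go (x / q) (rec (m/n<m x q (prime>1 pq))) bs (uniq-map q∣cs (Unique.filter⁺ (λ m → ¬? (div? m)) u)) sm-bs) ⟩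
        2 * (P * (x / q))           ≡⟨ solve 3 (λ a b c → a :* (b :* c) := b :* (c :* a)) refl 2 P (x / q) ⟩
        P * (x / q * 2)             ≤⟨ *-monoʳ-≤ P (≤-trans (*-monoʳ-≤ (x / q) (prime>1 pq)) (m/n*n≤m x q)) ⟩
        P * x                       ∎
        where
        open ≤-Reasoning
        open +-*-Solver
        P = 16 ^ length (q ∷ qs)

  prime-product-∣ : ∀ qs → All Prime qs → Unique qs → ∀ n → (∀ {q} → q ∈ qs → q ∣ n) → product qs ∣ n
  prime-product-∣ [] _ _ n _ = 1∣ n
  prime-product-∣ (q ∷ qs) (pq ∷ pqs) (q∉ ∷ u) n h with h (here refl)
  ... | divides n' refl = subst (_∣ n' * q) (*-comm (product qs) q) (*-monoˡ-∣ q (prime-product-∣ qs pqs u n' rest))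
    where
    rest : ∀ {r} → r ∈ qs → r ∣ n'
    rest {r} i with euclidsLemma n' q (All.lookup pqs i) (h (there i))
    ... | inj₁ d = d
    ... | inj₂ d with prime⇒irreducible pq d
    ...   | inj₁ refl = ⊥-elim (¬prime[1] (All.lookup pqs i))
    ...   | inj₂ e = ⊥-elim (All.lookup q∉ i (sym e))

  private
    Unique-bounded : ∀ n ms → Unique ms → (∀ {m} → m ∈ ms → m < n) → length ms ≤ n
    Unique-bounded n ms u h with pigeonhole (λ m → m) n ms h
    ... | k , le = ≤-trans le (≤-trans (*-monoʳ-≤ n (short (fiber (λ m → m) k ms) (proj₂ (fiber-⊑ (λ m → m) k ms) u) (λ {x} i → fiber-key (λ m → m) {c = ms} i))) (≤-reflexive (*-identityʳ n)))
      where
      short : ∀ xs → Unique xs → (∀ {x} → x ∈ xs → x ≡ k) → length xs ≤ 1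
      short [] _ _ = z≤n
      short (x ∷ []) _ _ = s≤s z≤n
      short (x ∷ y ∷ xs) ((ne ∷ _) ∷ _) e = ⊥-elim (ne (trans (e (here refl)) (sym (e (there (here refl))))))

    -- A member that is at least W pays for one factor W by its own size; the extra power of W pays
    -- for the smaller members, of which a list of distinct primes has at most W.
    power≤product : ∀ W qs → All (1 ≤_) qs → 1 ≤ W → W ^ length qs ≤ W ^ length (filter (_<? W) qs) * product qs
    power≤product W [] _ 1≤W = s≤s z≤n
    power≤product W (q ∷ qs) (1≤q ∷ qs≥1) 1≤W with q <? W
    ... | yes lt = subst (λ l → W * W ^ length qs ≤ W ^ length l * (q * product qs)) (sym (filter-accept (_<? W) lt)) (begin
        W * W ^ length qs                                        ≤⟨ *-monoʳ-≤ W (power≤product W qs qs≥1 1≤W) ⟩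
        W * (W ^ length (filter (_<? W) qs) * product qs)        ≤⟨ *-monoʳ-≤ W (*-monoʳ-≤ (W ^ length (filter (_<? W) qs)) (m≤n*m (product qs) q {{>-nonZero 1≤q}})) ⟩
        W * (W ^ length (filter (_<? W) qs) * (q * product qs))  ≡⟨ sym (*-assoc W _ _) ⟩
        W * W ^ length (filter (_<? W) qs) * (q * product qs)    ∎)
      where open ≤-Reasoning
    ... | no ≮ = subst (λ l → W * W ^ length qs ≤ W ^ length l * (q * product qs)) (sym (filter-reject (_<? W) ≮)) (begin
        W * W ^ length qs                                        ≤⟨ *-mono-≤ (≮⇒≥ ≮) (power≤product W qs qs≥1 1≤W) ⟩
        q * (W ^ length (filter (_<? W) qs) * product qs)        ≡⟨ solve 3 (λ a b c → a :* (b :* c) := b :* (a :* c)) refl q (W ^ length (filter (_<? W) qs)) (product qs) ⟩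
        W ^ length (filter (_<? W) qs) * (q * product qs)        ∎)
      where
      open ≤-Reasoning
      open +-*-Solver

  least : ∀ {P : ℕ → Set} → Decidable P → ∀ n → P n → ∃[ m ] P m × (∀ k → k < m → ¬ P k)
  least P? n pn = go n pn (<-wellFounded n)
    where
    go : ∀ n → _ → Acc _<_ n → _
    go n pn (acc rec) with anyUpTo? P? n
    ... | yes (m , m<n , pm) = go m pm (rec m<n)
    ... | no none = n , pn , λ k k<n pk → none (k , k<n , pk)

  -- Take the least prime p that does not divide n, and let t be the number of smaller primes. Their
  -- product divides n, and every positive m < p is smooth over them, so `smooth-count` gives p ≤ 2
  -- * 16 ^ t. Hence p ^ s ≤ 2 ^ s * W ^ t with W = 16 ^ s, and W ^ t is at most the constant W ^ W
  -- times the product of those primes.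
  small-nondivisor : ∀ s → ∃[ C ] (∀ n → 1 ≤ n → ∃[ p ] Prime p × ¬ p ∣ n × p ^ s ≤ C * n)
  small-nondivisor s = 2 ^ s * W ^ W , proof
    where
    W = 16 ^ s
    1≤W : 1 ≤ W
    1≤W = 1≤^ 16 s (s≤s z≤n)
    proof : ∀ n → 1 ≤ n → ∃[ p ] Prime p × ¬ p ∣ n × p ^ s ≤ 2 ^ s * W ^ W * n
    -- A prime factor of suc n cannot divide n, so the search for the least prime has a starting
    -- point.
    proof n 1≤n with prime-divisor (suc n) (s≤s 1≤n)
    ... | r , pr , r∣1+n with least (λ m → prime? m ×-dec ¬? (m ∣? n)) r (pr , λ r∣n → ¬prime[1] (subst Prime (∣1⇒≡1 (∣m+n∣m⇒∣n (subst (r ∣_) (+-comm 1 n) r∣1+n) r∣n)) pr))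
    ... | p@(suc p') , (pp , p∤n) , minimal = p , pp , p∤n , bound
      where
      qs = filter prime? (upTo p)
      t = length qs
      primes : All Prime qs
      primes = All.tabulate (λ i → proj₂ (∈-filter⁻ prime? {xs = upTo p} i))
      u : Unique qs
      u = Unique.filter⁺ prime? (Unique.upTo⁺ p)
      qs∣n : ∀ {q} → q ∈ qs → q ∣ n
      qs∣n {q} i with ∈-filter⁻ prime? {xs = upTo p} i
      ... | j , pq with q ∣? n
      ...   | yes d = d
      ...   | no nd = ⊥-elim (minimal q (∈-upTo⁻ j) (pq , nd))
      product≤n : product qs ≤ n
      product≤n = ∣⇒≤ {{>-nonZero 1≤n}} (prime-product-∣ qs primes u n qs∣n)
      ms = map suc (upTo p')
      smooth : ∀ {m} → m ∈ ms → 1 ≤ m × m ≤ p' × Smooth qs m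
      smooth i with ∈-map⁻ suc i
      ... | k , j , refl = s≤s z≤n , ∈-upTo⁻ j , λ pr d → ∈-filter⁺ prime? (∈-upTo⁺ (s≤s (≤-trans (∣⇒≤ d) (∈-upTo⁻ j)))) pr
      len : length ms ≡ p'
      len = trans (length-map suc (upTo p')) (length-upTo p')
      p'≤ : p' ≤ 16 ^ t
      p'≤ = cancel p' (16 ^ t) (subst (λ a → a * a ≤ 16 ^ t * p') len
            (smooth-count qs primes p' ms (Unique.map⁺ suc-injective (Unique.upTo⁺ p')) smooth))
        where
        cancel : ∀ k X → k * k ≤ X * k → k ≤ X
        cancel zero X _ = z≤n
        cancel k@(suc _) X le = *-cancelʳ-≤ k X k le
      p≤ : p ≤ 2 * 16 ^ t
      p≤ = ≤-trans (+-mono-≤ (1≤^ 16 t (s≤s z≤n)) p'≤) (≤-reflexive (cong (16 ^ t +_) (sym (+-identityʳ _))))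
      bound : p ^ s ≤ 2 ^ s * W ^ W * n
      bound = begin
        p ^ s                                              ≤⟨ ^-monoˡ-≤ s p≤ ⟩
        (2 * 16 ^ t) ^ s                                   ≡⟨ ^-distribʳ-* s 2 (16 ^ t) ⟩
        2 ^ s * (16 ^ t) ^ s                               ≡⟨ cong (2 ^ s *_) (trans (^-*-assoc 16 t s) (trans (cong (16 ^_) (*-comm t s)) (sym (^-*-assoc 16 s t)))) ⟩
        2 ^ s * W ^ t                                      ≤⟨ *-monoʳ-≤ (2 ^ s) (power≤product W qs (All.map (λ pr → <⇒≤ (prime>1 pr)) primes) 1≤W) ⟩
        2 ^ s * (W ^ length (filter (_<? W) qs) * product qs) ≤⟨ *-monoʳ-≤ (2 ^ s) (*-mono-≤ (^-monoʳ-1≤ W 1≤W (Unique-bounded W (filter (_<? W) qs) (Unique.filter⁺ (_<? W) u) (λ i → proj₂ (∈-filter⁻ (_<? W) {xs = qs} i)))) product≤n) ⟩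
        2 ^ s * (W ^ W * n)                                ≡⟨ sym (*-assoc (2 ^ s) (W ^ W) n) ⟩
        2 ^ s * W ^ W * n                                  ∎
        where open ≤-Reasoning
    proof n 1≤n | r , pr , r∣1+n | zero , (p0 , _) , _ = ⊥-elim (¬prime[0] p0)

-- Linear algebra in four and five dimensions over the integers.

module Geometry where
  import Data.Nat.Divisibility as ℕ
  import Data.Nat.Properties as ℕ
  open import Data.Empty using (⊥-elim; ⊥)
  open import Data.Fin.Base using (Fin; zero; suc; _↑ˡ_; _↑ʳ_; combine)
  open import Data.Integer using (ℤ; _+_; _*_; _-_; -_; 0ℤ; 1ℤ; +_; NonZero; ≢-nonZero; _≟_) renaming (∣_∣ to abs)
  open import Data.Integer.DivMod using (_%ℕ_; n%ℕd<d; a≡a%ℕn+[a/ℕn]*n; _/ℕ_)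
  open import Data.Integer.Divisibility.Signed
  open import Data.Integer.Properties
  open import Data.Integer.Solver using (module +-*-Solver)
  open import Data.Integer.Tactic.RingSolver using (solve-∀)
  open import Data.List.Base using (List; []; _∷_; length)
  open import Data.List.Membership.Propositional using (_∈_)
  open import Data.List.Relation.Unary.Any using (here; there)
  open import Data.Nat as ℕ using (ℕ; zero; suc; z≤n)
  open import Data.Nat.Coprimality using (Coprime; coprime-divisor)
  open import Data.Nat.GCD using (gcd; gcd[m,n]∣m; gcd[m,n]∣n; gcd-greatest; gcd[m,n]≡0⇒m≡0)
  open import Data.Nat.Primality using (Prime; euclidsLemma; prime⇒nonZero; prime⇒nonTrivial)
  open import Data.Product using (_×_; _,_; proj₁; proj₂; ∃-syntax)
  open import Data.Sum using (_⊎_; inj₁; inj₂; [_,_])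
  open import Data.Vec.Base as Vec using (Vec; []; _∷_)
  open import Data.Vec.N-ary using (N-ary; _$ⁿ_)
  open import Relation.Binary.PropositionalEquality hiding ([_])
  open import Relation.Nullary using (¬_; Dec; yes; no)
  open +-*-Solver using (Polynomial; var; con; _:+_; _:*_; _:-_; :-_; _:=_; normalise; ⟦_⟧; correct)

  record V4 : Set where
    constructor v4
    field c1 c2 c3 c4 : ℤ
  open V4 public

  record V5 : Set where
    constructor v5
    field
      vec : V4
      last : ℤ
  open V5 public

  record B6 : Set where
    constructor b6
    field b12 b13 b14 b23 b24 b34 : ℤ
  open B6 public

  v4-ext : ∀ {u v} → c1 u ≡ c1 v → c2 u ≡ c2 v → c3 u ≡ c3 v → c4 u ≡ c4 v → u ≡ v
  v4-ext refl refl refl refl = refl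

  b6-ext : ∀ {A B} → b12 A ≡ b12 B → b13 A ≡ b13 B → b14 A ≡ b14 B →
    b23 A ≡ b23 B → b24 A ≡ b24 B → b34 A ≡ b34 B → A ≡ B
  b6-ext refl refl refl refl refl refl = refl

  dot : V4 → V4 → ℤ
  dot k u = c1 k * c1 u + c2 k * c2 u + c3 k * c3 u + c4 k * c4 u

  dot5 : V5 → V5 → ℤ
  dot5 k u = dot (vec k) (vec u) + last k * last u

  wedge : V4 → V4 → B6
  wedge u v = b6 (c1 u * c2 v - c2 u * c1 v) (c1 u * c3 v - c3 u * c1 v) (c1 u * c4 v - c4 u * c1 v)
                 (c2 u * c3 v - c3 u * c2 v) (c2 u * c4 v - c4 u * c2 v) (c3 u * c4 v - c4 u * c3 v)

  pair : B6 → B6 → ℤ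
  pair A B = b12 A * b34 B - b13 A * b24 B + b14 A * b23 B + b23 A * b14 B - b24 A * b13 B + b34 A * b12 B

  infixl 7 _•_
  _•_ : ℤ → V4 → V4
  z • u = v4 (z * c1 u) (z * c2 u) (z * c3 u) (z * c4 u)

  infixl 6 _⊝_ _⊞_
  _⊝_ _⊞_ : V4 → V4 → V4
  u ⊝ v = v4 (c1 u - c1 v) (c2 u - c2 v) (c3 u - c3 v) (c4 u - c4 v)
  u ⊞ v = v4 (c1 u + c1 v) (c2 u + c2 v) (c3 u + c3 v) (c4 u + c4 v)

  infixl 7 _⊛_
  _⊛_ : V4 → V4 → V4
  k ⊛ x = v4 (c1 k * c1 x) (c2 k * c2 x) (c3 k * c3 x) (c4 k * c4 x)

  bil : V4 → V4 → V4 → ℤ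
  bil k u v = c1 k * (c1 u * c1 v) + c2 k * (c2 u * c2 v) + c3 k * (c3 u * c3 v) + c4 k * (c4 u * c4 v)

  quad : V4 → V4 → ℤ
  quad k u = bil k u u

  opaque
    -- Laplace expansion along two complementary pairs of rows. The divisibility proofs estimate the
    -- bivectors `wedge u v` and `wedge w z` separately and then pair them.
    det4 : V4 → V4 → V4 → V4 → ℤ
    det4 u v w z = pair (wedge u v) (wedge w z)

    det5 : V5 → V5 → V5 → V5 → V5 → ℤ
    det5 (v5 r₀ t₀) (v5 r₁ t₁) (v5 r₂ t₂) (v5 r₃ t₃) (v5 r₄ t₄) =
      t₀ * det4 r₁ r₂ r₃ r₄ - t₁ * det4 r₀ r₂ r₃ r₄ + t₂ * det4 r₀ r₁ r₃ r₄ - t₃ * det4 r₀ r₁ r₂ r₄ + t₄ * det4 r₀ r₁ r₂ r₃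

  -- Polynomial counterparts (prefixed by a colon) of the operations on vectors, so that the ring solver applies to identities between vectors.

  record P4 (n : ℕ) : Set where
    constructor p4
    field x1 x2 x3 x4 : Polynomial n
  open P4 public

  record P6 (n : ℕ) : Set where
    constructor p6
    field x12 x13 x14 x23 x24 x34 : Polynomial n
  open P6 public

  module _ {n : ℕ} where

    :dot : P4 n → P4 n → Polynomial n
    :dot k u = x1 k :* x1 u :+ x2 k :* x2 u :+ x3 k :* x3 u :+ x4 k :* x4 u

    :wedge : P4 n → P4 n → P6 n
    :wedge u v = p6 (x1 u :* x2 v :- x2 u :* x1 v) (x1 u :* x3 v :- x3 u :* x1 v) (x1 u :* x4 v :- x4 u :* x1 v)
                    (x2 u :* x3 v :- x3 u :* x2 v) (x2 u :* x4 v :- x4 u :* x2 v) (x3 u :* x4 v :- x4 u :* x3 v)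

    :pair : P6 n → P6 n → Polynomial n
    :pair A B = x12 A :* x34 B :- x13 A :* x24 B :+ x14 A :* x23 B :+ x23 A :* x14 B :- x24 A :* x13 B :+ x34 A :* x12 B

    :det4 : P4 n → P4 n → P4 n → P4 n → Polynomial n
    :det4 u v w z = :pair (:wedge u v) (:wedge w z)

    :det5 : P4 n → P4 n → P4 n → P4 n → P4 n → Polynomial n → Polynomial n → Polynomial n → Polynomial n → Polynomial n → Polynomial n
    :det5 r₀ r₁ r₂ r₃ r₄ t₀ t₁ t₂ t₃ t₄ =
      t₀ :* :det4 r₁ r₂ r₃ r₄ :- t₁ :* :det4 r₀ r₂ r₃ r₄ :+ t₂ :* :det4 r₀ r₁ r₃ r₄ :- t₃ :* :det4 r₀ r₁ r₂ r₄ :+ t₄ :* :det4 r₀ r₁ r₂ r₃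

    infixl 7 _:•_ _:⊛_
    infixl 6 _:⊝_ _:⊞_
    _:•_ : Polynomial n → P4 n → P4 n
    z :• u = p4 (z :* x1 u) (z :* x2 u) (z :* x3 u) (z :* x4 u)

    _:⊝_ _:⊞_ _:⊛_ : P4 n → P4 n → P4 n
    u :⊝ v = p4 (x1 u :- x1 v) (x2 u :- x2 v) (x3 u :- x3 v) (x4 u :- x4 v)
    u :⊞ v = p4 (x1 u :+ x1 v) (x2 u :+ x2 v) (x3 u :+ x3 v) (x4 u :+ x4 v)
    k :⊛ u = p4 (x1 k :* x1 u) (x2 k :* x2 u) (x3 k :* x3 u) (x4 k :* x4 u)

    :bil : P4 n → P4 n → P4 n → Polynomial n
    :bil k u v = x1 k :* (x1 u :* x1 v) :+ x2 k :* (x2 u :* x2 v) :+ x3 k :* (x3 u :* x3 v) :+ x4 k :* (x4 u :* x4 v)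

    :quad : P4 n → P4 n → Polynomial n
    :quad k u = :bil k u u

  module _ {m s : ℕ} (xs : Vec V4 m) (zs : Vec ℤ s)
    (f : N-ary m (P4 (m ℕ.* 4 ℕ.+ s)) (N-ary s (Polynomial (m ℕ.* 4 ℕ.+ s)) (Polynomial (m ℕ.* 4 ℕ.+ s) × Polynomial (m ℕ.* 4 ℕ.+ s)))) where

    private
      entry : Fin m → Fin 4 → Polynomial (m ℕ.* 4 ℕ.+ s)
      entry i j = var (combine i j ↑ˡ s)

      vector : Fin m → P4 (m ℕ.* 4 ℕ.+ s)
      vector i = p4 (entry i zero) (entry i (suc zero)) (entry i (suc (suc zero))) (entry i (suc (suc (suc zero))))

      sides : Polynomial (m ℕ.* 4 ℕ.+ s) × Polynomial (m ℕ.* 4 ℕ.+ s)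
      sides = _$ⁿ_ {n = s} (_$ⁿ_ {n = m} f (Vec.tabulate vector)) (Vec.tabulate (λ j → var ((m ℕ.* 4) ↑ʳ j)))

      ρ : Vec ℤ (m ℕ.* 4 ℕ.+ s)
      ρ = Vec.concat (Vec.map (λ u → c1 u ∷ c2 u ∷ c3 u ∷ c4 u ∷ []) xs) Vec.++ zs

    by-ring : normalise (proj₁ sides) ≡ normalise (proj₂ sides) → ⟦ proj₁ sides ⟧ ρ ≡ ⟦ proj₂ sides ⟧ ρ
    by-ring e = trans (sym (correct (proj₁ sides) ρ)) (trans (cong (λ q → +-*-Solver.⟦_⟧N q ρ) e) (correct (proj₂ sides) ρ))

  x≡-x⇒x≡0 : ∀ {x} → x ≡ - x → x ≡ 0ℤ
  x≡-x⇒x≡0 {x} e with i*j≡0⇒i≡0∨j≡0 (+ 2) (trans (by-ring [] (x ∷ []) (λ x → con (+ 2) :* x := x :+ x) refl) (trans (cong (_+ x) e) (+-inverseˡ x)))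
  ... | inj₂ q = q

  δ : V5 → V5 → V4
  δ (v5 o y) (v5 r t) = y • r ⊝ t • o

  T : V4 → V4 → V4 → V4
  T g h u = v4 (c1 u) (c2 u) (dot g u) (dot h u)

  cof4 : V4 → V4 → V4 → V4
  cof4 v w z = v4 (c2 v * b34 B - c3 v * b24 B + c4 v * b23 B) (- (c1 v * b34 B) + c3 v * b14 B - c4 v * b13 B)
                  (c1 v * b24 B - c2 v * b14 B + c4 v * b12 B) (- (c1 v * b23 B) + c2 v * b13 B - c3 v * b12 B)
    where B = wedge w z

  cof5 : V5 → V5 → V5 → V5 → V5
  cof5 (v5 r₀ t₀) (v5 r₁ t₁) (v5 r₂ t₂) (v5 r₃ t₃) = v5
    (t₃ • cof4 r₀ r₁ r₂ ⊝ t₂ • cof4 r₀ r₁ r₃ ⊞ t₁ • cof4 r₀ r₂ r₃ ⊝ t₀ • cof4 r₁ r₂ r₃) (det4 r₀ r₁ r₂ r₃)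

  private
    :cof4 : ∀ {n} → P4 n → P4 n → P4 n → P4 n
    :cof4 v w z = p4 (x2 v :* x34 B :- x3 v :* x24 B :+ x4 v :* x23 B) (:- (x1 v :* x34 B) :+ x3 v :* x14 B :- x4 v :* x13 B)
                     (x1 v :* x24 B :- x2 v :* x14 B :+ x4 v :* x12 B) (:- (x1 v :* x23 B) :+ x2 v :* x13 B :- x3 v :* x12 B)
      where B = :wedge w z

  opaque
    unfolding det4 det5

    det4-swap₁₂ : ∀ u v w z → det4 v u w z ≡ - det4 u v w z
    det4-swap₁₂ u v w z = by-ring (u ∷ v ∷ w ∷ z ∷ []) [] (λ u v w z → :det4 v u w z := :- :det4 u v w z) refl

    det4-rot₄ : ∀ a b c d → det4 b c d a ≡ - det4 a b c d
    det4-rot₄ a b c d = by-ring (a ∷ b ∷ c ∷ d ∷ []) [] (λ a b c d → :det4 b c d a := :- :det4 a b c d) refl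

    det4-rot₃ : ∀ a b c d → det4 b c a d ≡ det4 a b c d
    det4-rot₃ a b c d = by-ring (a ∷ b ∷ c ∷ d ∷ []) [] (λ a b c d → :det4 b c a d := :det4 a b c d) refl

    det4-cof : ∀ u v w z → det4 u v w z ≡ dot (cof4 v w z) u
    det4-cof u v w z = by-ring (u ∷ v ∷ w ∷ z ∷ []) [] (λ u v w z → :det4 u v w z := :dot (:cof4 v w z) u) refl

    -- Five vectors of a four-dimensional space satisfy the linear relation whose coefficients are
    -- the complementary determinants; k is applied to that relation.
    cramer4 : ∀ k a b c d e → dot k a * det4 b c d e - dot k b * det4 a c d e + dot k c * det4 a b d e - dot k d * det4 a b c e + dot k e * det4 a b c d ≡ 0ℤ
    cramer4 k a b c d e = by-ring (k ∷ a ∷ b ∷ c ∷ d ∷ e ∷ []) []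
      (λ k a b c d e → :dot k a :* :det4 b c d e :- :dot k b :* :det4 a c d e :+ :dot k c :* :det4 a b d e :- :dot k d :* :det4 a b c e :+ :dot k e :* :det4 a b c d := con 0ℤ) refl

    det4-T : ∀ g h u v w z → det4 (T g h u) (T g h v) (T g h w) (T g h z) ≡ (c3 g * c4 h - c4 g * c3 h) * det4 u v w z
    det4-T g h u v w z = by-ring (g ∷ h ∷ u ∷ v ∷ w ∷ z ∷ []) [] (λ g h u v w z → let :T = λ u → p4 (x1 u) (x2 u) (:dot g u) (:dot h u) in
      :det4 (:T u) (:T v) (:T w) (:T z) := (x3 g :* x4 h :- x4 g :* x3 h) :* :det4 u v w z) refl

    -- In the chart where the last coordinate is 1 a determinant of five points is one of four
    -- differences to the first point; clearing denominators leaves the cube of the last coordinate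
    -- of P.
    det4-δ : ∀ P R₁ R₂ R₃ R₄ → det4 (δ P R₁) (δ P R₂) (δ P R₃) (δ P R₄) ≡ last P * last P * last P * det5 P R₁ R₂ R₃ R₄
    det4-δ (v5 o y) (v5 r₁ t₁) (v5 r₂ t₂) (v5 r₃ t₃) (v5 r₄ t₄) = by-ring (o ∷ r₁ ∷ r₂ ∷ r₃ ∷ r₄ ∷ []) (y ∷ t₁ ∷ t₂ ∷ t₃ ∷ t₄ ∷ [])
      (λ o r₁ r₂ r₃ r₄ y t₁ t₂ t₃ t₄ → :det4 (y :• r₁ :⊝ t₁ :• o) (y :• r₂ :⊝ t₂ :• o) (y :• r₃ :⊝ t₃ :• o) (y :• r₄ :⊝ t₄ :• o) := y :* y :* y :* :det5 o r₁ r₂ r₃ r₄ y t₁ t₂ t₃ t₄) refl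

    det5-swap₄₅ : ∀ P Q R S U → det5 P Q R U S ≡ - det5 P Q R S U
    det5-swap₄₅ (v5 r₀ t₀) (v5 r₁ t₁) (v5 r₂ t₂) (v5 r₃ t₃) (v5 r₄ t₄) = by-ring (r₀ ∷ r₁ ∷ r₂ ∷ r₃ ∷ r₄ ∷ []) (t₀ ∷ t₁ ∷ t₂ ∷ t₃ ∷ t₄ ∷ [])
      (λ r₀ r₁ r₂ r₃ r₄ t₀ t₁ t₂ t₃ t₄ → :det5 r₀ r₁ r₂ r₄ r₃ t₀ t₁ t₂ t₄ t₃ := :- :det5 r₀ r₁ r₂ r₃ r₄ t₀ t₁ t₂ t₃ t₄) refl

    det5-cof : ∀ P Q R S U → det5 P Q R S U ≡ dot5 (cof5 P Q R S) U
    det5-cof (v5 r₀ t₀) (v5 r₁ t₁) (v5 r₂ t₂) (v5 r₃ t₃) (v5 r₄ t₄) = by-ring (r₀ ∷ r₁ ∷ r₂ ∷ r₃ ∷ r₄ ∷ []) (t₀ ∷ t₁ ∷ t₂ ∷ t₃ ∷ t₄ ∷ [])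
      (λ r₀ r₁ r₂ r₃ r₄ t₀ t₁ t₂ t₃ t₄ → :det5 r₀ r₁ r₂ r₃ r₄ t₀ t₁ t₂ t₃ t₄ :=
        :dot (t₃ :• :cof4 r₀ r₁ r₂ :⊝ t₂ :• :cof4 r₀ r₁ r₃ :⊞ t₁ :• :cof4 r₀ r₂ r₃ :⊝ t₀ :• :cof4 r₁ r₂ r₃) r₄ :+ :det4 r₀ r₁ r₂ r₃ :* t₄) refl

    -- Expanding each `det5` along the last coordinates turns the sum into a combination of the six
    -- relations `cramer4` that omit one vector; the terms with κ cancel in pairs. Keeping every
    -- `det4` as an indeterminate keeps the polynomial identity small.
    cramer5 : ∀ k a b c d e f → dot5 k a * det5 b c d e f - dot5 k b * det5 a c d e f + dot5 k c * det5 a b d e f - dot5 k d * det5 a b c e f + dot5 k e * det5 a b c d f - dot5 k f * det5 a b c d e ≡ 0ℤ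
    cramer5 (v5 k κ) (v5 a ta) (v5 b tb) (v5 c tc) (v5 d td) (v5 e te) (v5 f tf) = trans
        (by-ring [] (ta ∷ tb ∷ tc ∷ td ∷ te ∷ tf ∷ κ ∷ dot k a ∷ dot k b ∷ dot k c ∷ dot k d ∷ dot k e ∷ dot k f ∷ det4 c d e f ∷ det4 b d e f ∷ det4 b c e f ∷ det4 b c d f ∷ det4 b c d e ∷ det4 a d e f ∷ det4 a c e f ∷ det4 a c d f ∷ det4 a c d e ∷ det4 a b e f ∷ det4 a b d f ∷ det4 a b d e ∷ det4 a b c f ∷ det4 a b c e ∷ det4 a b c d ∷ [])
          (λ ta tb tc td te tf κ xa xb xc xd xe xf cdef bdef bcef bcdf bcde adef acef acdf acde abef abdf abde abcf abce abcd →
            (xa :+ κ :* ta) :* (tb :* cdef :- tc :* bdef :+ td :* bcef :- te :* bcdf :+ tf :* bcde) :- (xb :+ κ :* tb) :* (ta :* cdef :- tc :* adef :+ td :* acef :- te :* acdf :+ tf :* acde)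
            :+ (xc :+ κ :* tc) :* (ta :* bdef :- tb :* adef :+ td :* abef :- te :* abdf :+ tf :* abde) :- (xd :+ κ :* td) :* (ta :* bcef :- tb :* acef :+ tc :* abef :- te :* abcf :+ tf :* abce)
            :+ (xe :+ κ :* te) :* (ta :* bcdf :- tb :* acdf :+ tc :* abdf :- td :* abcf :+ tf :* abcd) :- (xf :+ κ :* tf) :* (ta :* bcde :- tb :* acde :+ tc :* abde :- td :* abce :+ te :* abcd)
            := tb :* (xa :* cdef :- xc :* adef :+ xd :* acef :- xe :* acdf :+ xf :* acde) :- ta :* (xb :* cdef :- xc :* bdef :+ xd :* bcef :- xe :* bcdf :+ xf :* bcde)
            :- tc :* (xa :* bdef :- xb :* adef :+ xd :* abef :- xe :* abdf :+ xf :* abde) :+ td :* (xa :* bcef :- xb :* acef :+ xc :* abef :- xe :* abcf :+ xf :* abce)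
            :- te :* (xa :* bcdf :- xb :* acdf :+ xc :* abdf :- xd :* abcf :+ xf :* abcd) :+ tf :* (xa :* bcde :- xb :* acde :+ xc :* abde :- xd :* abce :+ xe :* abcd)) refl)
        (collapse (cramer4 k a c d e f) (cramer4 k b c d e f) (cramer4 k a b d e f) (cramer4 k a b c e f) (cramer4 k a b c d f) (cramer4 k a b c d e))
      where
      collapse : ∀ {P Q R S U W} → P ≡ 0ℤ → Q ≡ 0ℤ → R ≡ 0ℤ → S ≡ 0ℤ → U ≡ 0ℤ → W ≡ 0ℤ → tb * P - ta * Q - tc * R + td * S - te * U + tf * W ≡ 0ℤ
      collapse refl refl refl refl refl refl = by-ring [] (ta ∷ tb ∷ tc ∷ td ∷ te ∷ tf ∷ []) (λ ta tb tc td te tf → let z = con 0ℤ in tb :* z :- ta :* z :- tc :* z :+ td :* z :- te :* z :+ tf :* z := z) refl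

  det5-dup₄₅ : ∀ P Q R S → det5 P Q R S S ≡ 0ℤ
  det5-dup₄₅ P Q R S = x≡-x⇒x≡0 (det5-swap₄₅ P Q R S S)

  linear-span : ∀ k R₁ R₂ R₃ R₄ R₅ → det5 R₁ R₂ R₃ R₄ R₅ ≢ 0ℤ →
    dot5 k R₁ ≡ 0ℤ → dot5 k R₂ ≡ 0ℤ → dot5 k R₃ ≡ 0ℤ → dot5 k R₄ ≡ 0ℤ → dot5 k R₅ ≡ 0ℤ → ∀ V → dot5 k V ≡ 0ℤ
  linear-span k R₁ R₂ R₃ R₄ R₅ ne e₁ e₂ e₃ e₄ e₅ V
    with i*j≡0⇒i≡0∨j≡0 (dot5 k V) (trans (sym (drop (dot5 k V * det5 R₁ R₂ R₃ R₄ R₅) (det5 V R₂ R₃ R₄ R₅) (det5 V R₁ R₃ R₄ R₅) (det5 V R₁ R₂ R₄ R₅) (det5 V R₁ R₂ R₃ R₅) (det5 V R₁ R₂ R₃ R₄) e₁ e₂ e₃ e₄ e₅)) (cramer5 k V R₁ R₂ R₃ R₄ R₅))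
    where
    drop : ∀ X A B C D E {a b c d e} → a ≡ 0ℤ → b ≡ 0ℤ → c ≡ 0ℤ → d ≡ 0ℤ → e ≡ 0ℤ → X - a * A + b * B - c * C + d * D - e * E ≡ X
    drop X A B C D E refl refl refl refl refl = by-ring [] (X ∷ A ∷ B ∷ C ∷ D ∷ E ∷ [])
      (λ X A B C D E → let z = con 0ℤ in X :- z :* A :+ z :* B :- z :* C :+ z :* D :- z :* E := X) refl
  ... | inj₁ z = z
  ... | inj₂ z = ⊥-elim (ne z)

  -- The last two places of `det5 P Q S` form an alternating bilinear form, which is extended over
  -- the basis one place at a time. The pair (R₅ , R₅) is missing from the hypothesis and comes from
  -- alternation. R₅ is kept apart because in the application it belongs to a larger family than the
  -- other four.
  exchange : ∀ P Q S R₁ R₂ R₃ R₄ R₅ → det5 R₁ R₂ R₃ R₄ R₅ ≢ 0ℤ →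
    (∀ {X} → X ≡ R₁ ⊎ X ≡ R₂ ⊎ X ≡ R₃ ⊎ X ≡ R₄ → ∀ {Z} → Z ≡ R₅ ⊎ (Z ≡ R₁ ⊎ Z ≡ R₂ ⊎ Z ≡ R₃ ⊎ Z ≡ R₄) → det5 P Q S X Z ≡ 0ℤ) →
    ∀ X Z → det5 P Q S X Z ≡ 0ℤ
  exchange P Q S R₁ R₂ R₃ R₄ R₅ ne F X Z = span X r₁ r₂ r₃ r₄ r₅ Z
    where
    span : ∀ X → det5 P Q S X R₁ ≡ 0ℤ → det5 P Q S X R₂ ≡ 0ℤ → det5 P Q S X R₃ ≡ 0ℤ → det5 P Q S X R₄ ≡ 0ℤ → det5 P Q S X R₅ ≡ 0ℤ →
      ∀ Z → det5 P Q S X Z ≡ 0ℤ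
    span X e₁ e₂ e₃ e₄ e₅ Z = trans (det5-cof P Q S X Z) (linear-span (cof5 P Q S X) R₁ R₂ R₃ R₄ R₅ ne (k e₁) (k e₂) (k e₃) (k e₄) (k e₅) Z)
      where
      k : ∀ {Y} → det5 P Q S X Y ≡ 0ℤ → dot5 (cof5 P Q S X) Y ≡ 0ℤ
      k {Y} e = trans (sym (det5-cof P Q S X Y)) e
    flip : ∀ {X Z} → det5 P Q S X Z ≡ 0ℤ → det5 P Q S Z X ≡ 0ℤ
    flip {X} {Z} e = trans (det5-swap₄₅ P Q S X Z) (cong -_ e)
    row : ∀ {Y} → Y ≡ R₁ ⊎ Y ≡ R₂ ⊎ Y ≡ R₃ ⊎ Y ≡ R₄ → ∀ Z → det5 P Q S Y Z ≡ 0ℤ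
    row {Y} i = span Y (F i (inj₂ (inj₁ refl))) (F i (inj₂ (inj₂ (inj₁ refl)))) (F i (inj₂ (inj₂ (inj₂ (inj₁ refl))))) (F i (inj₂ (inj₂ (inj₂ (inj₂ refl))))) (F i (inj₁ refl))
    r₁ = flip (row (inj₁ refl) X)
    r₂ = flip (row (inj₂ (inj₁ refl)) X)
    r₃ = flip (row (inj₂ (inj₂ (inj₁ refl))) X)
    r₄ = flip (row (inj₂ (inj₂ (inj₂ refl))) X)
    r₅ = flip (span R₅ (flip (F (inj₁ refl) (inj₁ refl))) (flip (F (inj₂ (inj₁ refl)) (inj₁ refl))) (flip (F (inj₂ (inj₂ (inj₁ refl))) (inj₁ refl)))
      (flip (F (inj₂ (inj₂ (inj₂ refl))) (inj₁ refl))) (det5-dup₄₅ P Q S R₅) X)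

  det3 : V4 → V4 → V4 → ℤ
  det3 u v w = c2 u * b34 B - c3 u * b24 B + c4 u * b23 B
    where B = wedge v w

  private
    :det3 : ∀ {n} → P4 n → P4 n → P4 n → Polynomial n
    :det3 u v w = x2 u :* x34 B :- x3 u :* x24 B :+ x4 u :* x23 B
      where B = :wedge v w

  flip₁₂ flip₁₃ flip₁₄ : V4 → V4
  flip₁₂ u = v4 (c2 u) (c1 u) (c3 u) (c4 u)
  flip₁₃ u = v4 (c3 u) (c2 u) (c1 u) (c4 u)
  flip₁₄ u = v4 (c4 u) (c2 u) (c3 u) (c1 u)

  opaque
    unfolding det4
    -- Replacing the first coordinate by the functional g multiplies the determinant by `c1 g`. In
    -- the expansion along that row the terms of w and z carry the minors `det3` of u and v with a
    -- third vector, and these vanish because the three minors of u and v without the first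
    -- coordinate do.
    det4-degenerate : ∀ g u v w z → b23 (wedge u v) ≡ 0ℤ → b24 (wedge u v) ≡ 0ℤ → b34 (wedge u v) ≡ 0ℤ →
      c1 g * det4 u v w z ≡ dot g u * det3 v w z - dot g v * det3 u w z
    det4-degenerate g u v w z e₁ e₂ e₃ = trans (by-ring (g ∷ u ∷ v ∷ w ∷ z ∷ []) [] (λ g u v w z → let A = :wedge u v ; B = :wedge w z in
        x1 g :* :det4 u v w z := :dot g u :* :det3 v w z :- :dot g v :* :det3 u w z
          :+ x23 A :* (x2 g :* x24 B :+ x3 g :* x34 B :+ x1 g :* x14 B) :+ x24 A :* (x4 g :* x34 B :- x2 g :* x23 B :- x1 g :* x13 B) :- x34 A :* (x3 g :* x23 B :+ x4 g :* x24 B :- x1 g :* x12 B)) refl)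
        (drop e₁ e₂ e₃)
      where
      drop : ∀ {X P Q R P' Q' R'} → P ≡ 0ℤ → Q ≡ 0ℤ → R ≡ 0ℤ → X + P * P' + Q * Q' - R * R' ≡ X
      drop {X} {P' = P'} {Q'} {R'} refl refl refl = by-ring [] (X ∷ P' ∷ Q' ∷ R' ∷ []) (λ X P Q R → X :+ con 0ℤ :* P :+ con 0ℤ :* Q :- con 0ℤ :* R := X) refl

    det4-flip₁₂ : ∀ u v w z → det4 (flip₁₂ u) (flip₁₂ v) (flip₁₂ w) (flip₁₂ z) ≡ - det4 u v w z
    det4-flip₁₂ u v w z = by-ring (u ∷ v ∷ w ∷ z ∷ []) [] (λ u v w z → let f = λ u → p4 (x2 u) (x1 u) (x3 u) (x4 u) in :det4 (f u) (f v) (f w) (f z) := :- :det4 u v w z) refl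

    det4-flip₁₃ : ∀ u v w z → det4 (flip₁₃ u) (flip₁₃ v) (flip₁₃ w) (flip₁₃ z) ≡ - det4 u v w z
    det4-flip₁₃ u v w z = by-ring (u ∷ v ∷ w ∷ z ∷ []) [] (λ u v w z → let f = λ u → p4 (x3 u) (x2 u) (x1 u) (x4 u) in :det4 (f u) (f v) (f w) (f z) := :- :det4 u v w z) refl

    det4-flip₁₄ : ∀ u v w z → det4 (flip₁₄ u) (flip₁₄ v) (flip₁₄ w) (flip₁₄ z) ≡ - det4 u v w z
    det4-flip₁₄ u v w z = by-ring (u ∷ v ∷ w ∷ z ∷ []) [] (λ u v w z → let f = λ u → p4 (x4 u) (x2 u) (x3 u) (x1 u) in :det4 (f u) (f v) (f w) (f z) := :- :det4 u v w z) refl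

  -- A functional without first coordinate can take the place of the second coordinate in `det3`, at
  -- the price of the factor `c2 h`.
  det3-row : ∀ h u v w → c1 h ≡ 0ℤ → c2 h * det3 u v w ≡
    dot h u * b34 (wedge v w) - dot h v * b34 (wedge u w) + dot h w * b34 (wedge u v)
  det3-row h@(v4 h₁ h₂ h₃ h₄) u v w refl = by-ring (h ∷ u ∷ v ∷ w ∷ []) [] (λ h u v w → let k = p4 (con 0ℤ) (x2 h) (x3 h) (x4 h) in
    x2 h :* :det3 u v w := :dot k u :* x34 (:wedge v w) :- :dot k v :* x34 (:wedge u w) :+ :dot k w :* x34 (:wedge u v)) refl

  -- Divisibility by powers of a prime.

  *-pres-∣ : ∀ {a b c d} → a ∣ b → c ∣ d → a * c ∣ b * d
  *-pres-∣ {a} {c = c} (divides q refl) (divides r refl) = divides (q * r) (lem q a r c)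
    where
    lem : ∀ q a r c → q * a * (r * c) ≡ q * r * (a * c)
    lem = solve-∀

  ∣-resp-≡ : ∀ {a b c} → b ≡ c → a ∣ b → a ∣ c
  ∣-resp-≡ refl d = d

  ∣0 : ∀ a → a ∣ 0ℤ
  ∣0 a = divides 0ℤ refl

  ∣-size : ∀ {n m} → + n ∣ m → m ≢ 0ℤ → n ℕ.≤ abs m
  ∣-size {n} {m} d ne = ℕ.∣⇒≤ {{ℕ.≢-nonZero (λ e → ne (∣i∣≡0⇒i≡0 e))}} (∣⇒∣ᵤ d)

  %ℕ-≡⇒∣ : ∀ n .{{_ : ℕ.NonZero n}} {i j} → i %ℕ n ≡ j %ℕ n → + n ∣ i - j
  %ℕ-≡⇒∣ n {i} {j} e = divides (i /ℕ n - j /ℕ n)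
    (trans (cong₂ _-_ (a≡a%ℕn+[a/ℕn]*n i n) (trans (a≡a%ℕn+[a/ℕn]*n j n) (cong (λ r → + r + (j /ℕ n) * + n) (sym e))))
      (lem (+ (i %ℕ n)) (i /ℕ n) (j /ℕ n) (+ n)))
    where
    lem : ∀ r a b n → r + a * n - (r + b * n) ≡ (a - b) * n
    lem = solve-∀

  module _ {p : ℕ} (pp : Prime p) where

    ∣-euclid : ∀ a b → + p ∣ a * b → + p ∣ a ⊎ + p ∣ b
    ∣-euclid a b d with euclidsLemma (abs a) (abs b) pp (subst (p ℕ.∣_) (abs-* a b) (∣⇒∣ᵤ d))
    ... | inj₁ e = inj₁ (∣ᵤ⇒∣ e)
    ... | inj₂ e = inj₂ (∣ᵤ⇒∣ e)

    ∤-* : ∀ a b → ¬ + p ∣ a → ¬ + p ∣ b → ¬ + p ∣ a * b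
    ∤-* a b na nb d with ∣-euclid a b d
    ... | inj₁ e = na e
    ... | inj₂ e = nb e

    ∣-cancel : ∀ a b → ¬ + p ∣ a → + p ∣ a * b → + p ∣ b
    ∣-cancel a b na d with ∣-euclid a b d
    ... | inj₁ e = ⊥-elim (na e)
    ... | inj₂ e = e

    pw : ℕ → ℤ
    pw l = + (p ℕ.^ l)

    pw-+ : ∀ k l → pw (k ℕ.+ l) ≡ pw k * pw l
    pw-+ k l = trans (cong +_ (ℕ.^-distribˡ-+-* p k l)) (pos-* (p ℕ.^ k) (p ℕ.^ l))

    pw-suc : ∀ l → pw (suc l) ≡ + p * pw l
    pw-suc l = pos-* p (p ℕ.^ l)

    pw-cancel : ∀ l u a → ¬ + p ∣ u → pw l ∣ u * a → pw l ∣ a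
    pw-cancel zero u a nu d = divides a (sym (*-identityʳ a))
    pw-cancel (suc l) u a nu d with ∣-cancel u a nu (∣-trans (divides (pw l) (trans (pw-suc l) (*-comm (+ p) (pw l)))) d)
    ... | divides a' refl = subst (_∣ a' * + p) (trans (*-comm (pw l) (+ p)) (sym (pw-suc l))) (*-monoˡ-∣ (+ p) (pw-cancel l u a' nu d'))
      where
      instance
        nz : ℕ.NonZero p
        nz = prime⇒nonZero pp
      d' : pw l ∣ u * a'
      d' = *-cancelʳ-∣ (+ p) (subst₂ _∣_ (trans (pw-suc l) (*-comm (+ p) (pw l))) (sym (*-assoc u a' (+ p))) d)

    p∣pw-suc : ∀ l → + p ∣ pw (suc l)
    p∣pw-suc l = divides (pw l) (trans (pw-suc l) (*-comm (+ p) (pw l)))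

    pw∣pw : ∀ {k l} → k ℕ.≤ l → pw k ∣ pw l
    pw∣pw {k} {l} le = subst (λ m → pw k ∣ pw m) (ℕ.m+[n∸m]≡n le) (divides (pw (l ℕ.∸ k)) (trans (pw-+ k (l ℕ.∸ k)) (*-comm (pw k) _)))

    ∤1 : ¬ + p ∣ 1ℤ
    ∤1 d with ∣-size d (λ ())
    ... | le = ℕ.<⇒≱ (ℕ.nonTrivial⇒n>1 p {{prime⇒nonTrivial pp}}) le

  infix 4 _∣v_
  record _∣v_ (q : ℤ) (u : V4) : Set where
    constructor divs
    field
      d1 : q ∣ c1 u
      d2 : q ∣ c2 u
      d3 : q ∣ c3 u
      d4 : q ∣ c4 u
  open _∣v_ public

  ∣-quad : ∀ {q} k u → q ∣v u → q * q ∣ quad k u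
  ∣-quad k u (divs d1 d2 d3 d4) = ∣m∣n⇒∣m+n (∣m∣n⇒∣m+n (∣m∣n⇒∣m+n (∣n⇒∣m*n (c1 k) (*-pres-∣ d1 d1)) (∣n⇒∣m*n (c2 k) (*-pres-∣ d2 d2)))
    (∣n⇒∣m*n (c3 k) (*-pres-∣ d3 d3))) (∣n⇒∣m*n (c4 k) (*-pres-∣ d4 d4))

  -- Tangency of differences and divisibility of determinants.

  module _ (a b : V4) where

    OnS : V5 → Set
    OnS P = quad a (vec P) ≡ 0ℤ × quad b (vec P) ≡ last P * last P

    -- Expand the form k at last P times `vec R`, which is last R times `vec P` plus δ. For two
    -- points of the surface the pure terms cancel, so the linear term in δ is as small p-adically
    -- as the quadratic one.
    polar-δ : ∀ k P R → + 2 * last R * dot (k ⊛ vec P) (δ P R) ≡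
      last P * last P * quad k (vec R) - last R * last R * quad k (vec P) - quad k (δ P R)
    polar-δ k (v5 x y) (v5 r t) = by-ring (k ∷ x ∷ r ∷ []) (y ∷ t ∷ []) (λ k x r y t → let e = y :• r :⊝ t :• x in
      con (+ 2) :* t :* :dot (k :⊛ x) e := y :* y :* :quad k r :- t :* t :* :quad k x :- :quad k e) refl

    tangent-a : ∀ P R → OnS P → OnS R → + 2 * last R * dot (a ⊛ vec P) (δ P R) ≡ - quad a (δ P R)
    tangent-a P R (e , _) (f , _) = trans (polar-δ a P R)
      (trans (cong₂ (λ s t → last P * last P * s - last R * last R * t - quad a (δ P R)) f e) (raw (last P) (last R) (quad a (δ P R))))
      where
      raw : ∀ y t q → y * y * 0ℤ - t * t * 0ℤ - q ≡ - q
      raw = solve-∀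

    tangent-b : ∀ P R → OnS P → OnS R → + 2 * last R * dot (b ⊛ vec P) (δ P R) ≡ - quad b (δ P R)
    tangent-b P R (_ , e) (_ , f) = trans (polar-δ b P R)
      (trans (cong₂ (λ s t → last P * last P * s - last R * last R * t - quad b (δ P R)) f e) (raw (last P) (last R) (quad b (δ P R))))
      where
      raw : ∀ y t q → y * y * (t * t) - t * t * (y * y) - q ≡ - q
      raw = solve-∀

    record InΛ (q : ℤ) (P R : V5) : Set where
      constructor inΛ
      field
        near : q ∣v δ P R
        flat-a : q * q ∣ dot (a ⊛ vec P) (δ P R)
        flat-b : q * q ∣ dot (b ⊛ vec P) (δ P R)
    open InΛ public

    InΛ-1 : ∀ P R → InΛ 1ℤ P R
    InΛ-1 P R = inΛ (divs (one _) (one _) (one _) (one _)) (one _) (one _)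
      where
      one : ∀ n → 1ℤ ∣ n
      one n = divides n (sym (*-identityʳ n))

  private
    wdiv : ∀ {α β α' β'} γ {ui uj vi vj} → γ ∣ α * β' → γ ∣ β * α' → α ∣ ui → β ∣ uj → α' ∣ vi → β' ∣ vj → γ ∣ ui * vj - uj * vi
    wdiv γ g h i j i' j' = ∣m∣n⇒∣m-n (∣-trans g (*-pres-∣ i j')) (∣-trans h (*-pres-∣ j i'))

  opaque
    unfolding det4
    -- Coordinates 1, 2 have one weight and coordinates 3, 4 another, so a bivector has three kinds
    -- of minors: both light, mixed, both heavy. Every term of the pairing multiplies complementary
    -- kinds.
    pair-div : ∀ {α β γ α' β' γ'} d u v w z →
      d ∣ α * γ' → d ∣ β * β' → d ∣ γ * α' →
      α ∣ b12 (wedge u v) → β ∣ b13 (wedge u v) → β ∣ b14 (wedge u v) → β ∣ b23 (wedge u v) → β ∣ b24 (wedge u v) → γ ∣ b34 (wedge u v) →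
      α' ∣ b12 (wedge w z) → β' ∣ b13 (wedge w z) → β' ∣ b14 (wedge w z) → β' ∣ b23 (wedge w z) → β' ∣ b24 (wedge w z) → γ' ∣ b34 (wedge w z) →
      d ∣ det4 u v w z
    pair-div d u v w z αγ ββ γα i12 i13 i14 i23 i24 i34 j12 j13 j14 j23 j24 j34 =
      ∣m∣n⇒∣m+n (∣m∣n⇒∣m-n (∣m∣n⇒∣m+n (∣m∣n⇒∣m+n (∣m∣n⇒∣m-n
        (∣-trans αγ (*-pres-∣ i12 j34)) (∣-trans ββ (*-pres-∣ i13 j24))) (∣-trans ββ (*-pres-∣ i14 j23)))
        (∣-trans ββ (*-pres-∣ i23 j14))) (∣-trans ββ (*-pres-∣ i24 j13))) (∣-trans γα (*-pres-∣ i34 j12))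

  -- In each term of the determinant two vectors contribute their modulus and two its square. The
  -- vector of modulus r contributes r² or r, which gives q⁴ r² or q⁵ r, and both are multiples of
  -- q⁴ r² because r ∣ q.
  det4-T-div : ∀ q r u v w z → r ∣ q →
    q ∣ c1 u → q ∣ c2 u → q * q ∣ c3 u → q * q ∣ c4 u →
    q ∣ c1 v → q ∣ c2 v → q * q ∣ c3 v → q * q ∣ c4 v →
    q ∣ c1 w → q ∣ c2 w → q * q ∣ c3 w → q * q ∣ c4 w →
    r ∣ c1 z → r ∣ c2 z → r * r ∣ c3 z → r * r ∣ c4 z →
    q * q * (q * q) * (r * r) ∣ det4 u v w z
  det4-T-div .(s * r) r u v w z (divides s refl) u1 u2 u3 u4 v1 v2 v3 v₄ w1 w2 w3 w4 z1 z2 z3 z4 =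
    pair-div _ u v w z
      (divides 1ℤ (e₁ s r)) (divides 1ℤ (e₂ s r)) (divides s (e₃ s r))
      (wdiv (q * q) ∣-refl ∣-refl u1 u2 v1 v2)
      (wdiv (q * (q * q)) ∣-refl (divides 1ℤ (e₄ s r)) u1 u3 v1 v3) (wdiv (q * (q * q)) ∣-refl (divides 1ℤ (e₄ s r)) u1 u4 v1 v₄)
      (wdiv (q * (q * q)) ∣-refl (divides 1ℤ (e₄ s r)) u2 u3 v2 v3) (wdiv (q * (q * q)) ∣-refl (divides 1ℤ (e₄ s r)) u2 u4 v2 v₄)
      (wdiv (q * q * (q * q)) ∣-refl ∣-refl u3 u4 v3 v₄)
      (wdiv (q * r) ∣-refl ∣-refl w1 w2 z1 z2)
      (wdiv (q * (r * r)) ∣-refl (divides s (e₅ s r)) w1 w3 z1 z3) (wdiv (q * (r * r)) ∣-refl (divides s (e₅ s r)) w1 w4 z1 z4)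
      (wdiv (q * (r * r)) ∣-refl (divides s (e₅ s r)) w2 w3 z2 z3) (wdiv (q * (r * r)) ∣-refl (divides s (e₅ s r)) w2 w4 z2 z4)
      (wdiv (q * q * (r * r)) ∣-refl ∣-refl w3 w4 z3 z4)
    where
    q = s * r
    e₁ : ∀ s r → let q = s * r in q * q * (q * q * (r * r)) ≡ 1ℤ * (q * q * (q * q) * (r * r))
    e₁ = solve-∀
    e₂ : ∀ s r → let q = s * r in q * (q * q) * (q * (r * r)) ≡ 1ℤ * (q * q * (q * q) * (r * r))
    e₂ = solve-∀
    e₃ : ∀ s r → let q = s * r in q * q * (q * q) * (q * r) ≡ s * (q * q * (q * q) * (r * r))
    e₃ = solve-∀
    e₄ : ∀ s r → let q = s * r in q * q * q ≡ 1ℤ * (q * (q * q))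
    e₄ = solve-∀
    e₅ : ∀ s r → let q = s * r in q * q * r ≡ s * (q * (r * r))
    e₅ = solve-∀

  -- Two coordinate rows of the four differences are traded for the two tangential rows,
  -- whose entries are divisible by the square of the modulus.
  det5-divisible : ∀ a b q r P R₁ R₂ R₃ R₄ → r ∣ q →
    InΛ a b q P R₁ → InΛ a b q P R₂ → InΛ a b q P R₃ → InΛ a b r P R₄ →
    let x = vec P in
    q * q * (q * q) * (r * r) ∣
      (c3 (a ⊛ x) * c4 (b ⊛ x) - c4 (a ⊛ x) * c3 (b ⊛ x)) * (last P * last P * last P * det5 P R₁ R₂ R₃ R₄)
  det5-divisible a b q r P R₁ R₂ R₃ R₄ r∣q (inΛ n₁ g₁ h₁) (inΛ n₂ g₂ h₂) (inΛ n₃ g₃ h₃) (inΛ n₄ g₄ h₄) =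
    ∣-resp-≡ (trans (det4-T (a ⊛ vec P) (b ⊛ vec P) (δ P R₁) (δ P R₂) (δ P R₃) (δ P R₄))
               (cong ((c3 (a ⊛ vec P) * c4 (b ⊛ vec P) - c4 (a ⊛ vec P) * c3 (b ⊛ vec P)) *_) (det4-δ P R₁ R₂ R₃ R₄)))
      (det4-T-div q r (t R₁) (t R₂) (t R₃) (t R₄) r∣q (d1 n₁) (d2 n₁) g₁ h₁ (d1 n₂) (d2 n₂) g₂ h₂ (d1 n₃) (d2 n₃) g₃ h₃ (d1 n₄) (d2 n₄) g₄ h₄)
    where
    t : V5 → V4
    t R = T (a ⊛ vec P) (b ⊛ vec P) (δ P R)

  -- The analogue when the bivector of the first two differences is supported on planes containing the first axis.
  det4-conic-div : ∀ q r t g h u v w z → r ∣ q → t ∣ r → c1 h ≡ 0ℤ →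
    b23 (wedge u v) ≡ 0ℤ → b24 (wedge u v) ≡ 0ℤ → b34 (wedge u v) ≡ 0ℤ →
    q ∣v u → q * q ∣ dot g u → q * q ∣ dot h u →
    q ∣v v → q * q ∣ dot g v → q * q ∣ dot h v →
    r ∣v w → r * r ∣ dot h w → t ∣v z → t * t ∣ dot h z →
    q * q * (q * r * (t * t)) ∣ c2 h * (c1 g * det4 u v w z)
  det4-conic-div .(s * (k * t)) .(k * t) t g h u v w z (divides s refl) (divides k refl) h₁ e₁ e₂ e₃ nu gu hu nv gv hv nw hw nz hz =
    ∣-resp-≡ (trans (raw (c2 h) (dot g u) (det3 v w z) (dot g v) (det3 u w z)) (cong (c2 h *_) (sym (det4-degenerate g u v w z e₁ e₂ e₃))))
      (∣m∣n⇒∣m-n (*-pres-∣ gu (row v nv hv)) (*-pres-∣ gv (row u nu hu)))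
    where
    r = k * t
    q = s * r
    raw : ∀ h gu dv gv du → gu * (h * dv) - gv * (h * du) ≡ h * (gu * dv - gv * du)
    raw = solve-∀
    f₁ : ∀ s k t → let r = k * t ; q = s * r in q * q * (r * t) ≡ s * k * (q * r * (t * t))
    f₁ = solve-∀
    f₂ : ∀ s k t → let r = k * t ; q = s * r in r * r * (q * t) ≡ k * (q * r * (t * t))
    f₂ = solve-∀
    f₃ : ∀ s k t → let r = k * t ; q = s * r in t * t * (q * r) ≡ 1ℤ * (q * r * (t * t))
    f₃ = solve-∀
    w34 : ∀ {m n} x y → m ∣v x → n ∣v y → m * n ∣ b34 (wedge x y)
    w34 {m} {n} x y dx dy = wdiv (m * n) ∣-refl ∣-refl (d3 dx) (d4 dx) (d3 dy) (d4 dy)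
    -- The three terms of `det3-row` are divisible by q² r t, r² q t and t² q r; since t ∣ r ∣ q,
    -- each is a multiple of q r t².
    row : ∀ x → q ∣v x → q * q ∣ dot h x → q * r * (t * t) ∣ c2 h * det3 x w z
    row x nx hx = ∣-resp-≡ (sym (det3-row h x w z h₁)) (∣m∣n⇒∣m+n (∣m∣n⇒∣m-n
      (∣-trans (divides (s * k) (f₁ s k t)) (*-pres-∣ hx (w34 w z nw nz)))
      (∣-trans (divides k (f₂ s k t)) (*-pres-∣ hw (w34 x z nx nz))))
      (∣-trans (divides 1ℤ (f₃ s k t)) (*-pres-∣ hz (w34 x w nx nw))))

  %ℕ-small : ∀ n .{{_ : ℕ.NonZero n}} m → + n ∣ m → ∀ r s → + r ≡ m + + s → r ℕ.< n → s ℕ.< n → r ≡ s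
  %ℕ-small n m d r s e r<n s<n with ≤-total (+ r) (+ s)
  ... | inj₁ (Data.Integer.+≤+ le) = sym (close s r le s<n (subst (+ n ∣_) (trans (lem m (+ s)) (cong (λ t → + s - t) (sym e))) (∣m⇒∣-m d)))
    where
    lem : ∀ m s → - m ≡ s - (m + s)
    lem = solve-∀
    close : ∀ s r → r ℕ.≤ s → s ℕ.< n → + n ∣ + s - + r → s ≡ r
    close s r le s<n d with ℕ.m≤n⇒∃[o]m+o≡n le
    ... | zero , refl = ℕ.+-identityʳ r
    ... | suc o , refl = ⊥-elim (ℕ.<⇒≱ s<n (ℕ.≤-trans (∣-size (subst (+ n ∣_) (lem' (+ r) (+ suc o)) d) (λ ())) (ℕ.m≤n+m (suc o) r)))
      where
      lem' : ∀ r o → r + o - r ≡ o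
      lem' = solve-∀
  ... | inj₂ (Data.Integer.+≤+ le) = close r s le r<n (subst (+ n ∣_) (trans (lem m (+ s)) (cong (λ t → t - + s) (sym e))) d)
    where
    lem : ∀ m s → m ≡ m + s - s
    lem = solve-∀
    close : ∀ s r → r ℕ.≤ s → s ℕ.< n → + n ∣ + s - + r → s ≡ r
    close s r le s<n d with ℕ.m≤n⇒∃[o]m+o≡n le
    ... | zero , refl = ℕ.+-identityʳ r
    ... | suc o , refl = ⊥-elim (ℕ.<⇒≱ s<n (ℕ.≤-trans (∣-size (subst (+ n ∣_) (lem' (+ r) (+ suc o)) d) (λ ())) (ℕ.m≤n+m (suc o) r)))
      where
      lem' : ∀ r o → r + o - r ≡ o
      lem' = solve-∀

  ∣⇒%ℕ-≡ : ∀ n .{{_ : ℕ.NonZero n}} i j → + n ∣ i - j → i %ℕ n ≡ j %ℕ n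
  ∣⇒%ℕ-≡ n i j d = %ℕ-small n (i - j - (i /ℕ n - j /ℕ n) * + n) (∣m∣n⇒∣m-n d (∣n⇒∣m*n (i /ℕ n - j /ℕ n) ∣-refl)) (i %ℕ n) (j %ℕ n)
    (trans (lem (+ (i %ℕ n)) (i /ℕ n) (j /ℕ n) (+ n) (+ (j %ℕ n)))
      (cong₂ (λ s t → s - t - (i /ℕ n - j /ℕ n) * + n + + (j %ℕ n)) (sym (a≡a%ℕn+[a/ℕn]*n i n)) (sym (a≡a%ℕn+[a/ℕn]*n j n))))
    (n%ℕd<d i n) (n%ℕd<d j n)
    where
    lem : ∀ r a b n s → r ≡ r + a * n - (s + b * n) - (a - b) * n + s
    lem = solve-∀

  quotient-∣ : ∀ n .{{_ : ℕ.NonZero n}} i → + n ∣ i → i ≡ + n * (i /ℕ n)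
  quotient-∣ n i d = trans (a≡a%ℕn+[a/ℕn]*n i n) (trans (cong (λ r → + r + (i /ℕ n) * + n) zero-rem) (lem (i /ℕ n) (+ n)))
    where
    lem : ∀ a n → 0ℤ + a * n ≡ n * a
    lem = solve-∀
    zero%ℕ : ∀ n .{{_ : ℕ.NonZero n}} → 0ℤ %ℕ n ≡ 0
    zero%ℕ (suc n) = refl
    zero-rem : i %ℕ n ≡ 0
    zero-rem = trans (∣⇒%ℕ-≡ n i 0ℤ (subst (+ n ∣_) (sym (+-identityʳ i)) d)) (zero%ℕ n)

  -- Linear dependence and plane conics modulo p.

  all-or-counterexample : ∀ {A : Set} {Q : A → Set} → (∀ x → Dec (Q x)) → ∀ c → (∀ {x} → x ∈ c → Q x) ⊎ (∃[ x ] x ∈ c × ¬ Q x)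
  all-or-counterexample Q? [] = inj₁ (λ ())
  all-or-counterexample Q? (x ∷ c) with Q? x | all-or-counterexample Q? c
  ... | no ¬q | _ = inj₂ (x , here refl , ¬q)
  ... | yes q | inj₂ (y , i , ¬q) = inj₂ (y , there i , ¬q)
  ... | yes q | inj₁ h = inj₁ λ { (here refl) → q ; (there i) → h i }

  ∣-dot : ∀ {n} k u → n ∣v k → n ∣ dot k u
  ∣-dot k u (divs e1 e2 e3 e4) = ∣m∣n⇒∣m+n (∣m∣n⇒∣m+n (∣m∣n⇒∣m+n (∣m⇒∣m*n (c1 u) e1) (∣m⇒∣m*n (c2 u) e2)) (∣m⇒∣m*n (c3 u) e3)) (∣m⇒∣m*n (c4 u) e4)

  opaque
    unfolding det4
    det4-basis : det4 (v4 1ℤ 0ℤ 0ℤ 0ℤ) (v4 0ℤ 1ℤ 0ℤ 0ℤ) (v4 0ℤ 0ℤ 1ℤ 0ℤ) (v4 0ℤ 0ℤ 0ℤ 1ℤ) ≡ 1ℤ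
    det4-basis = refl

  module _ {p : ℕ} (pp : Prime p) {A : Set} (w : A → V4) (c : List A) where

    -- Unit vectors are exchanged for members of the family one at a time; when no member can enter, the cofactors give the functional.
    annihilator : (∀ {x y z t} → x ∈ c → y ∈ c → z ∈ c → t ∈ c → + p ∣ det4 (w x) (w y) (w z) (w t)) →
      ∃[ k ] ¬ (+ p ∣v k) × (∀ {x} → x ∈ c → + p ∣ dot k (w x))
    annihilator h = go₁
      where
      e1 e2 e3 e4 : V4
      e1 = v4 1ℤ 0ℤ 0ℤ 0ℤ
      e2 = v4 0ℤ 1ℤ 0ℤ 0ℤ
      e3 = v4 0ℤ 0ℤ 1ℤ 0ℤ
      e4 = v4 0ℤ 0ℤ 0ℤ 1ℤ
      Result : Set
      Result = ∃[ k ] ¬ (+ p ∣v k) × (∀ {x} → x ∈ c → + p ∣ dot k (w x))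
      functional : ∀ e u v z → ¬ + p ∣ det4 e u v z → (∀ {x} → x ∈ c → + p ∣ det4 (w x) u v z) → Result
      functional e u v z ne h = cof4 u v z , (λ d → ne (∣-resp-≡ (sym (det4-cof e u v z)) (∣-dot (cof4 u v z) e d))) ,
        λ {x} i → ∣-resp-≡ (det4-cof (w x) u v z) (h i)
      search : ∀ u v z → (∀ {x} → x ∈ c → + p ∣ det4 (w x) u v z) ⊎ (∃[ x ] x ∈ c × ¬ + p ∣ det4 (w x) u v z)
      search u v z = all-or-counterexample (λ x → + p ∣? det4 (w x) u v z) c
      neg : ∀ {m n} → m ≡ - n → ¬ + p ∣ n → ¬ + p ∣ m
      neg {m} {n} e ne d = ne (∣-resp-≡ (trans (cong -_ e) (neg-involutive n)) (∣m⇒∣-m d))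
      go₄ : ∀ x y z → x ∈ c → y ∈ c → z ∈ c → ¬ + p ∣ det4 (w x) (w y) (w z) e4 → Result
      go₄ x y z i j k ne = functional e4 (w x) (w y) (w z) (neg (trans (sym (neg-involutive _)) (cong -_ (sym (det4-rot₄ e4 (w x) (w y) (w z))))) ne) (λ t → h t i j k)
      go₃ : ∀ x y → x ∈ c → y ∈ c → ¬ + p ∣ det4 (w x) (w y) e3 e4 → Result
      go₃ x y i j ne with search (w x) (w y) e4
      ... | inj₁ all = functional e3 (w x) (w y) e4 (λ d → ne (∣-resp-≡ (sym (det4-rot₃ e3 (w x) (w y) e4)) d)) all
      ... | inj₂ (z , k , nz) = go₄ z x y k i j nz
      go₂ : ∀ x → x ∈ c → ¬ + p ∣ det4 (w x) e2 e3 e4 → Result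
      go₂ x i ne with search (w x) e3 e4
      ... | inj₁ all = functional e2 (w x) e3 e4 (neg (det4-swap₁₂ (w x) e2 e3 e4) ne) all
      ... | inj₂ (z , k , nz) = go₃ z x k i nz
      go₁ : Result
      go₁ with search e2 e3 e4
      ... | inj₁ all = functional e1 e2 e3 e4 (λ d → ∤1 pp (∣-resp-≡ det4-basis d)) all
      ... | inj₂ (z , k , nz) = go₂ z k nz

  opaque
    conic-value : (A' B' C' Γ Λ s t : ℤ) → ℤ
    conic-value A' B' C' Γ Λ s t = A' * (s * s) + B' * (s * t) + C' * (t * t) + Γ * s + Λ * t

    conic-value-≡ : ∀ A' B' C' Γ Λ s t → conic-value A' B' C' Γ Λ s t ≡ A' * (s * s) + B' * (s * t) + C' * (t * t) + Γ * s + Λ * t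
    conic-value-≡ A' B' C' Γ Λ s t = refl

    conic-value-diff : ∀ A' B' C' Γ Λ s t s' t' → conic-value A' B' C' Γ Λ s t - conic-value A' B' C' Γ Λ s' t'
      - (s - s') * (A' * (s + s') + B' * t' + Γ) ≡ (t - t') * (C' * (t + t') + B' * s + Λ)
    conic-value-diff = raw
      where
      raw : ∀ A' B' C' Γ Λ s t s' t' → (A' * (s * s) + B' * (s * t) + C' * (t * t) + Γ * s + Λ * t) - (A' * (s' * s') + B' * (s' * t') + C' * (t' * t') + Γ * s' + Λ * t')
        - (s - s') * (A' * (s + s') + B' * t' + Γ) ≡ (t - t') * (C' * (t + t') + B' * s + Λ)
      raw = solve-∀

    conic-value-swap : ∀ A' B' C' Γ Λ s t → conic-value A' B' C' Γ Λ s t ≡ conic-value C' B' A' Λ Γ t s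
    conic-value-swap = raw
      where
      raw : ∀ A' B' C' Γ Λ s t → A' * (s * s) + B' * (s * t) + C' * (t * t) + Γ * s + Λ * t ≡ C' * (t * t) + B' * (t * s) + A' * (s * s) + Λ * t + Γ * s
      raw = solve-∀

    -- This serves the case where the mixed coefficient is the only unit among the three quadratic
    -- ones: the new coefficient of t² is A' + B' + C', again a unit.
    conic-value-shear : ∀ A' B' C' Γ Λ s t → conic-value A' B' C' Γ Λ s t ≡ conic-value A' (A' + A' + B') (A' + B' + C') Γ (Γ + Λ) (s - t) t
    conic-value-shear = raw
      where
      raw : ∀ A' B' C' Γ Λ s t → A' * (s * s) + B' * (s * t) + C' * (t * t) + Γ * s + Λ * t ≡
        A' * ((s - t) * (s - t)) + (A' + A' + B') * ((s - t) * t) + (A' + B' + C') * (t * t) + Γ * (s - t) + (Γ + Λ) * t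
      raw = solve-∀

    conic-value-linear : ∀ {n} A' B' C' Γ Λ s t → n ∣ A' → n ∣ B' → n ∣ C' → n ∣ conic-value A' B' C' Γ Λ s t → n ∣ Γ * s + Λ * t
    conic-value-linear A' B' C' Γ Λ s t pA pB pC e = ∣-resp-≡ (raw A' B' C' Γ Λ s t)
      (∣m∣n⇒∣m-n e (∣m∣n⇒∣m+n (∣m∣n⇒∣m+n (∣m⇒∣m*n (s * s) pA) (∣m⇒∣m*n (s * t) pB)) (∣m⇒∣m*n (t * t) pC)))
      where
      raw : ∀ A' B' C' Γ Λ s t → A' * (s * s) + B' * (s * t) + C' * (t * t) + Γ * s + Λ * t - (A' * (s * s) + B' * (s * t) + C' * (t * t)) ≡ Γ * s + Λ * t
      raw = solve-∀

  module _ {p : ℕ} (pp : Prime p) {A : Set} where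

    private
      instance
        p≢0 : ℕ.NonZero p
        p≢0 = prime⇒nonZero pp

    same : (A → ℤ) → List A → Set
    same f c = ∀ x y → x ∈ c → y ∈ c → + p ∣ f x - f y

    residue-class : (f : A → ℤ) (c : List A) → ∃[ d ] d ⊑ c × same f d × length c ℕ.≤ p ℕ.* length d
    residue-class f c with pigeonhole (λ x → f x %ℕ p) p c (λ {x} _ → n%ℕd<d (f x) p)
    ... | k , le = fiber key k c , fiber-⊑ key k c , (λ x y i j → %ℕ-≡⇒∣ p {f x} {f y} (trans (fiber-key key {c = c} i) (sym (fiber-key key {c = c} j)))) , le
      where
      key : A → ℕ
      key x = f x %ℕ p

    private
      two-residues : (t : A → ℤ) (c : List A) →
        (∀ x y z → x ∈ c → y ∈ c → z ∈ c → + p ∣ t x - t y ⊎ + p ∣ t x - t z ⊎ + p ∣ t y - t z) →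
        ∃[ d ] d ⊑ c × same t d × length c ℕ.≤ 2 ℕ.* length d
      two-residues t c h = finish (two-values key c (λ {x} {y} {z} i j k → Data.Sum.map (∣⇒%ℕ-≡ p (t x) (t y)) (Data.Sum.map (∣⇒%ℕ-≡ p (t x) (t z)) (∣⇒%ℕ-≡ p (t y) (t z))) (h x y z i j k)))
        where
        key : A → ℕ
        key x = t x %ℕ p
        finish : (∃[ d ] d ⊑ c × (∀ {x y} → x ∈ d → y ∈ d → key x ≡ key y) × length c ℕ.≤ 2 ℕ.* length d) → _
        finish (d , d⊑c , same-d , le) = d , d⊑c , (λ x y i j → %ℕ-≡⇒∣ p {t x} {t y} (same-d {x} {y} i j)) , le

      split : (s t : A → ℤ) (c : List A) →
        (∀ x y z → + p ∣ s x - s y → + p ∣ s x - s z → x ∈ c → y ∈ c → z ∈ c → + p ∣ t x - t y ⊎ + p ∣ t x - t z ⊎ + p ∣ t y - t z) →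
        ∃[ d ] d ⊑ c × same s d × same t d × length c ℕ.≤ p ℕ.* 2 ℕ.* length d
      split s t c h = step₁ (residue-class s c)
        where
        Result : Set
        Result = ∃[ d ] d ⊑ c × same s d × same t d × length c ℕ.≤ p ℕ.* 2 ℕ.* length d
        step₂ : ∀ d → d ⊑ c → same s d → length c ℕ.≤ p ℕ.* length d → (∃[ e ] e ⊑ d × same t e × length d ℕ.≤ 2 ℕ.* length e) → Result
        step₂ d d⊑c same-s le (e , e⊑d , same-t , le') = e , ⊑-trans e⊑d d⊑c , (λ x y i j → same-s x y (proj₁ e⊑d i) (proj₁ e⊑d j)) , same-t ,
              ℕ.≤-trans le (ℕ.≤-trans (ℕ.*-monoʳ-≤ p le') (ℕ.≤-reflexive (sym (ℕ.*-assoc p 2 (length e)))))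
        step₁ : (∃[ d ] d ⊑ c × same s d × length c ℕ.≤ p ℕ.* length d) → Result
        step₁ (d , d⊑c , same-s , le) = step₂ d d⊑c same-s le
          (two-residues t d (λ x y z i j k → h x y z (same-s x y i j) (same-s x z i k) (proj₁ d⊑c i) (proj₁ d⊑c j) (proj₁ d⊑c k)))

    private
      -- For s fixed modulo p this is a quadratic equation in t with unit leading coefficient. If t
      -- x differs from both t y and t z, the cofactors in `conic-value-diff` vanish, and their
      -- difference is C' (t y - t z).
      leading : ∀ A' B' C' Γ Λ (s t : A → ℤ) (c : List A) → ¬ + p ∣ C' →
        (∀ {x} → x ∈ c → + p ∣ conic-value A' B' C' Γ Λ (s x) (t x)) →
        ∃[ d ] d ⊑ c × same s d × same t d × length c ℕ.≤ p ℕ.* 2 ℕ.* length d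
      leading A' B' C' Γ Λ s t c nC h = split s t c three
        where
        factor : ∀ {x y} → + p ∣ s x - s y → x ∈ c → y ∈ c → + p ∣ (t x - t y) * (C' * (t x + t y) + B' * s x + Λ)
        factor {x} {y} e i j = ∣-resp-≡ (conic-value-diff A' B' C' Γ Λ (s x) (t x) (s y) (t y))
          (∣m∣n⇒∣m-n (∣m∣n⇒∣m-n (h i) (h j)) (∣m⇒∣m*n (A' * (s x + s y) + B' * t y + Γ) e))
        subtract : ∀ C' Bs Λ tx ty tz → (C' * (tx + ty) + Bs + Λ) - (C' * (tx + tz) + Bs + Λ) ≡ C' * (ty - tz)
        subtract = solve-∀
        three : ∀ x y z → + p ∣ s x - s y → + p ∣ s x - s z → x ∈ c → y ∈ c → z ∈ c → + p ∣ t x - t y ⊎ + p ∣ t x - t z ⊎ + p ∣ t y - t z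
        three x y z e f i j k = decide (∣-euclid pp (t x - t y) (C' * (t x + t y) + B' * s x + Λ) (factor {x} {y} e i j))
                                       (∣-euclid pp (t x - t z) (C' * (t x + t z) + B' * s x + Λ) (factor {x} {z} f i k))
          where
          decide : (+ p ∣ t x - t y ⊎ + p ∣ C' * (t x + t y) + B' * s x + Λ) → (+ p ∣ t x - t z ⊎ + p ∣ C' * (t x + t z) + B' * s x + Λ) →
            + p ∣ t x - t y ⊎ + p ∣ t x - t z ⊎ + p ∣ t y - t z
          decide (inj₁ d) _ = inj₁ d
          decide (inj₂ _) (inj₁ d) = inj₂ (inj₁ d)
          decide (inj₂ d) (inj₂ d') = inj₂ (inj₂ (∣-cancel pp C' (t y - t z) nC
              (∣-resp-≡ (subtract C' (B' * s x) Λ (t x) (t y) (t z)) (∣m∣n⇒∣m-n d d'))))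

      linear : ∀ Γ Λ (s t : A → ℤ) (c : List A) → ¬ + p ∣ Λ → (∀ {x} → x ∈ c → + p ∣ Γ * s x + Λ * t x) →
        ∃[ d ] d ⊑ c × same s d × same t d × length c ℕ.≤ p ℕ.* 2 ℕ.* length d
      linear Γ Λ s t c nΛ h = split s t c (λ x y _ e _ i j _ → inj₁ (∣-cancel pp Λ (t x - t y) nΛ
        (∣-resp-≡ (raw Γ Λ (s x) (t x) (s y) (t y)) (∣m∣n⇒∣m-n (∣m∣n⇒∣m-n (h i) (h j)) (∣n⇒∣m*n Γ e)))))
        where
        raw : ∀ Γ Λ s t s' t' → Γ * s + Λ * t - (Γ * s' + Λ * t') - Γ * (s - s') ≡ Λ * (t - t')
        raw = solve-∀

      reorder : ∀ {s t : A → ℤ} {c : List A} → ∃[ d ] d ⊑ c × same s d × same t d × length c ℕ.≤ p ℕ.* 2 ℕ.* length d →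
        ∃[ d ] d ⊑ c × same t d × same s d × length c ℕ.≤ p ℕ.* 2 ℕ.* length d
      reorder (d , d⊑c , es , et , le) = d , d⊑c , et , es , le

    -- A plane conic over the field with p elements has at most 2p affine points.
    conic-points : ∀ A' B' C' Γ Λ (s t : A → ℤ) (c : List A) →
      ¬ (+ p ∣ A' × + p ∣ B' × + p ∣ C' × + p ∣ Γ × + p ∣ Λ) →
      (∀ {x} → x ∈ c → + p ∣ conic-value A' B' C' Γ Λ (s x) (t x)) →
      ∃[ d ] d ⊑ c × same s d × same t d × length c ℕ.≤ p ℕ.* 2 ℕ.* length d
    conic-points A' B' C' Γ Λ s t c nontrivial h = byC (+ p ∣? C')
      where
      Result : Set
      Result = ∃[ d ] d ⊑ c × same s d × same t d × length c ℕ.≤ p ℕ.* 2 ℕ.* length d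
      byΓ : + p ∣ C' → + p ∣ A' → + p ∣ B' → + p ∣ Λ → Dec (+ p ∣ Γ) → Result
      byΓ pC pA pB pΛ (yes pΓ) = ⊥-elim (nontrivial (pA , pB , pC , pΓ , pΛ))
      byΓ pC pA pB pΛ (no nΓ) = reorder {t} {s} (linear Λ Γ t s c nΓ
        (λ {x} i → ∣-resp-≡ (+-comm (Γ * s x) (Λ * t x)) (conic-value-linear A' B' C' Γ Λ (s x) (t x) pA pB pC (h i))))
      byΛ : + p ∣ C' → + p ∣ A' → + p ∣ B' → Dec (+ p ∣ Λ) → Result
      byΛ pC pA pB (yes pΛ) = byΓ pC pA pB pΛ (+ p ∣? Γ)
      byΛ pC pA pB (no nΛ) = linear Γ Λ s t c nΛ (λ {x} i → conic-value-linear A' B' C' Γ Λ (s x) (t x) pA pB pC (h i))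
      add : ∀ s t s' t' → (s - t) - (s' - t') + (t - t') ≡ s - s'
      add = solve-∀
      byB : + p ∣ C' → + p ∣ A' → Dec (+ p ∣ B') → Result
      byB pC pA (yes pB) = byΛ pC pA pB (+ p ∣? Λ)
      byB pC pA (no nB) = unshear (leading A' (A' + A' + B') (A' + B' + C') Γ (Γ + Λ) (λ x → s x - t x) t c
          (λ d → nB (∣m+n∣m⇒∣n {m = A'} {n = B'} (∣m+n∣n⇒∣m {m = A' + B'} {n = C'} d pC) pA))
          (λ {x} i → ∣-resp-≡ (conic-value-shear A' B' C' Γ Λ (s x) (t x)) (h i)))
        where
        unshear : (∃[ d ] d ⊑ c × same (λ x → s x - t x) d × same t d × length c ℕ.≤ p ℕ.* 2 ℕ.* length d) → Result
        unshear (d , d⊑c , eu , et , le) = d , d⊑c , (λ x y i j → ∣-resp-≡ (add (s x) (t x) (s y) (t y)) (∣m∣n⇒∣m+n (eu x y i j) (et x y i j))) , et , le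
      byA : + p ∣ C' → Dec (+ p ∣ A') → Result
      byA pC (yes pA) = byB pC pA (+ p ∣? B')
      byA pC (no nA) = reorder {t} {s} (leading C' B' A' Λ Γ t s c nA (λ {x} i → ∣-resp-≡ (conic-value-swap A' B' C' Γ Λ (s x) (t x)) (h i)))
      byC : Dec (+ p ∣ C') → Result
      byC (yes pC) = byA pC (+ p ∣? A')
      byC (no nC) = leading A' B' C' Γ Λ s t c nC h

  -- Refining a congruence class of points of the surface by one level.

  minor : (a b : V4) (c c' : V4 → ℤ) → ℤ
  minor a b c c' = c a * c' b - c' a * c b

  record GoodPrime (a b : V4) (p : ℕ) : Set where
    field
      isPrime : Prime p
      u2 : ¬ + p ∣ + 2
      ua1 : ¬ + p ∣ c1 a
      ua2 : ¬ + p ∣ c2 a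
      ua3 : ¬ + p ∣ c3 a
      ua4 : ¬ + p ∣ c4 a
      um12 : ¬ + p ∣ minor a b c1 c2
      um13 : ¬ + p ∣ minor a b c1 c3
      um14 : ¬ + p ∣ minor a b c1 c4
      um23 : ¬ + p ∣ minor a b c2 c3
      um24 : ¬ + p ∣ minor a b c2 c4
      um34 : ¬ + p ∣ minor a b c3 c4
  open GoodPrime public

  record UnitPoint (p : ℕ) (P : V5) : Set where
    field
      ux1 : ¬ + p ∣ c1 (vec P)
      ux2 : ¬ + p ∣ c2 (vec P)
      ux3 : ¬ + p ∣ c3 (vec P)
      ux4 : ¬ + p ∣ c4 (vec P)
      uy : ¬ + p ∣ last P
  open UnitPoint public

  dot-• : ∀ g q u → dot g (q • u) ≡ q * dot g u
  dot-• g q u = by-ring (g ∷ u ∷ []) (q ∷ []) (λ g u q → :dot g (q :• u) := q :* :dot g u) refl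

  quad-• : ∀ k q u → quad k (q • u) ≡ q * q * quad k u
  quad-• k q u = by-ring (k ∷ u ∷ []) (q ∷ []) (λ k u q → :quad k (q :• u) := q :* q :* :quad k u) refl

  quad-⊝ : ∀ k u v → quad k u - quad k v ≡ bil k (u ⊝ v) (u ⊞ v)
  quad-⊝ k u v = by-ring (k ∷ u ∷ v ∷ []) [] (λ k u v → :quad k u :- :quad k v := :bil k (u :⊝ v) (u :⊞ v)) refl

  quad-comb : ∀ k s t e f → quad k (s • e ⊞ t • f) ≡ quad k e * (s * s) + + 2 * bil k e f * (s * t) + quad k f * (t * t)
  quad-comb k s t e f = by-ring (k ∷ e ∷ f ∷ []) (s ∷ t ∷ []) (λ k e f s t →
    :quad k (s :• e :⊞ t :• f) := :quad k e :* (s :* s) :+ con (+ 2) :* :bil k e f :* (s :* t) :+ :quad k f :* (t :* t)) refl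

  ∣-bil : ∀ {n} k u v → n ∣v u → n ∣ bil k u v
  ∣-bil k u v (divs e1 e2 e3 e4) = ∣m∣n⇒∣m+n (∣m∣n⇒∣m+n (∣m∣n⇒∣m+n (∣n⇒∣m*n (c1 k) (∣m⇒∣m*n (c1 v) e1)) (∣n⇒∣m*n (c2 k) (∣m⇒∣m*n (c2 v) e2)))
    (∣n⇒∣m*n (c3 k) (∣m⇒∣m*n (c3 v) e3))) (∣n⇒∣m*n (c4 k) (∣m⇒∣m*n (c4 v) e4))

  opaque
    unfolding det4
    det4-rows : ∀ q u v w z → let s = λ x → v4 (q * c1 x) (q * c2 x) (- (q * q * c3 x)) (- (q * q * c4 x)) in
      det4 (s u) (s v) (s w) (s z) ≡ q * q * (q * q) * (q * q) * det4 u v w z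
    det4-rows q u v w z = by-ring (u ∷ v ∷ w ∷ z ∷ []) (q ∷ []) (λ u v w z q → let s = λ x → p4 (q :* x1 x) (q :* x2 x) (:- (q :* q :* x3 x)) (:- (q :* q :* x4 x)) in
      :det4 (s u) (s v) (s w) (s z) := q :* q :* (q :* q) :* (q :* q) :* :det4 u v w z) refl

    det4-• : ∀ a b c d u v w z → det4 (a • u) (b • v) (c • w) (d • z) ≡ a * b * (c * d) * det4 u v w z
    det4-• a b c d u v w z = by-ring (u ∷ v ∷ w ∷ z ∷ []) (a ∷ b ∷ c ∷ d ∷ []) (λ u v w z a b c d → :det4 (a :• u) (b :• v) (c :• w) (d :• z) := a :* b :* (c :* d) :* :det4 u v w z) refl

  -- Spanning vectors of the tangent plane {g · u = h · u = 0}, up to the factor μ = g₃h₄ - g₄h₃.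
  module Tangent (g h : V4) where
    μ : ℤ
    μ = c3 g * c4 h - c4 g * c3 h

    e₁ e₂ : V4
    e₁ = v4 μ 0ℤ (- (c1 g * c4 h - c4 g * c1 h)) (c1 g * c3 h - c3 g * c1 h)
    e₂ = v4 0ℤ μ (- (c2 g * c4 h - c4 g * c2 h)) (c2 g * c3 h - c3 g * c2 h)

    tangent-defect : ∀ u → μ • u ⊝ (c1 u • e₁ ⊞ c2 u • e₂) ≡ v4 0ℤ 0ℤ (c4 h * dot g u - c4 g * dot h u) (c3 g * dot h u - c3 h * dot g u)
    tangent-defect u =
      v4-ext (by-ring (g ∷ h ∷ u ∷ []) [] (λ g h u → x1 (:lhs g h u) := con 0ℤ) refl) (by-ring (g ∷ h ∷ u ∷ []) [] (λ g h u → x2 (:lhs g h u) := con 0ℤ) refl)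
        (by-ring (g ∷ h ∷ u ∷ []) [] (λ g h u → x3 (:lhs g h u) := x3 (:rhs g h u)) refl) (by-ring (g ∷ h ∷ u ∷ []) [] (λ g h u → x4 (:lhs g h u) := x4 (:rhs g h u)) refl)
      where
      :μ : ∀ {n} → P4 n → P4 n → Polynomial n
      :μ g h = x3 g :* x4 h :- x4 g :* x3 h
      :lhs :rhs : ∀ {n} → P4 n → P4 n → P4 n → P4 n
      :lhs g h u = :μ g h :• u :⊝ (x1 u :• p4 (:μ g h) (con 0ℤ) (:- (x1 g :* x4 h :- x4 g :* x1 h)) (x1 g :* x3 h :- x3 g :* x1 h)
        :⊞ x2 u :• p4 (con 0ℤ) (:μ g h) (:- (x2 g :* x4 h :- x4 g :* x2 h)) (x2 g :* x3 h :- x3 g :* x2 h))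
      :rhs g h u = p4 (con 0ℤ) (con 0ℤ) (x4 h :* :dot g u :- x4 g :* :dot h u) (x3 g :* :dot h u :- x3 h :* :dot g u)

    module _ {n : ℤ} where
      tangent-comb : ∀ u → n ∣ dot g u → n ∣ dot h u → n ∣v μ • u ⊝ (c1 u • e₁ ⊞ c2 u • e₂)
      tangent-comb u dg dh = subst (n ∣v_) (sym (tangent-defect u))
        (divs (∣0 n) (∣0 n) (∣m∣n⇒∣m-n (∣n⇒∣m*n (c4 h) dg) (∣n⇒∣m*n (c4 g) dh)) (∣m∣n⇒∣m-n (∣n⇒∣m*n (c3 g) dh) (∣n⇒∣m*n (c3 h) dg)))

  pencil : V4 → V4 → ℤ → ℤ → V4
  pencil a b α β = v4 (α * c1 a + β * c1 b) (α * c2 a + β * c2 b) (α * c3 a + β * c3 b) (α * c4 a + β * c4 b)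

  module _ {a b : V4} {p : ℕ} (gp : GoodPrime a b p) where

    private
      pp = isPrime gp
      ∣c : ∀ u v → ¬ + p ∣ u → + p ∣ u * v → + p ∣ v
      ∣c = ∣-cancel pp

    -- No form of the pencil vanishes on the tangent plane at a point with unit coordinates: its restriction
    -- to e₁ would be a functional killing e₁, e₂ and x, and these three are independent modulo p.
    tangent-nondegenerate : ∀ P → OnS a b P → UnitPoint p P → let open Tangent (a ⊛ vec P) (b ⊛ vec P) in
      ∀ α β → + p ∣ quad (pencil a b α β) e₁ → + p ∣ bil (pencil a b α β) e₁ e₂ → + p ∣ α × + p ∣ β
    tangent-nondegenerate (v5 x y) (ψa , ψb) up α β dA dB =
      ∣c (minor a b c1 c3) α (um13 gp) (∣-resp-≡ (rawα α β (c1 a) (c3 a) (c1 b) (c3 b)) (∣m∣n⇒∣m-n (∣n⇒∣m*n (c3 b) k1) (∣n⇒∣m*n (c1 b) k3))) ,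
      ∣c (minor a b c1 c3) β (um13 gp) (∣-resp-≡ (rawβ α β (c1 a) (c3 a) (c1 b) (c3 b)) (∣m∣n⇒∣m-n (∣n⇒∣m*n (c1 a) k3) (∣n⇒∣m*n (c3 a) k1)))
      where
      g h : V4
      g = a ⊛ x
      h = b ⊛ x
      open Tangent g h
      k = pencil a b α β
      rawα : ∀ α β a1 a3 b1 b3 → b3 * (α * a1 + β * b1) - b1 * (α * a3 + β * b3) ≡ (a1 * b3 - a3 * b1) * α
      rawα = solve-∀
      rawβ : ∀ α β a1 a3 b1 b3 → a1 * (α * a3 + β * b3) - a3 * (α * a1 + β * b1) ≡ (a1 * b3 - a3 * b1) * β
      rawβ = solve-∀
      :e₁ :e₂ : ∀ {n} → P4 n → P4 n → P4 n
      :e₁ g h = p4 (x3 g :* x4 h :- x4 g :* x3 h) (con 0ℤ) (:- (x1 g :* x4 h :- x4 g :* x1 h)) (x1 g :* x3 h :- x3 g :* x1 h)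
      :e₂ g h = p4 (con 0ℤ) (x3 g :* x4 h :- x4 g :* x3 h) (:- (x2 g :* x4 h :- x4 g :* x2 h)) (x2 g :* x3 h :- x3 g :* x2 h)
      :D : ∀ {n} → P4 n → P4 n → P4 n → Polynomial n
      :D g h x = x1 e :* (x3 f :* x4 x :- x4 f :* x3 x) :+ x1 x :* (x3 e :* x4 f :- x4 e :* x3 f)
        where
        e = :e₁ g h
        f = :e₂ g h
      -- The minor of the rows `e₁`, `e₂`, `x` in the columns 1, 3, 4. These are the columns in
      -- which the functional `k ⊛ e₁` can be nonzero, since `e₁` has second coordinate 0.
      D : ℤ
      D = μ * (c3 e₂ * c4 x - c4 e₂ * c3 x) + c1 x * (c3 e₁ * c4 e₂ - c4 e₁ * c3 e₂)
      -- The equations of the surface enter here: ψ₁(x) = 0 and ψ₂(x) = y² leave a product of units,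
      -- and y is one of them.
      D-≡ : D ≡ - (c2 x * c3 x * c4 x * minor a b c3 c4 * (c2 a * (y * y)))
      D-≡ = trans (by-ring (a ∷ b ∷ x ∷ []) [] (λ a b x → :D (a :⊛ x) (b :⊛ x) x := :- (x2 x :* x3 x :* x4 x :* (x3 a :* x4 b :- x4 a :* x3 b) :* (x2 a :* :quad b x :- x2 b :* :quad a x))) refl)
              (trans (cong₂ (λ s t → - (c2 x * c3 x * c4 x * minor a b c3 c4 * (c2 a * s - c2 b * t))) ψb ψa)
                (tidy (c2 x * c3 x * c4 x * minor a b c3 c4) (c2 a) (c2 b) (y * y)))
        where
        tidy : ∀ u a b s → - (u * (a * s - b * 0ℤ)) ≡ - (u * (a * s))
        tidy = solve-∀
      -- The pairing is a combination of g · `e₁` and h · `e₁`, and `e₁` is tangent.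
      C₀ : bil k e₁ x ≡ 0ℤ
      C₀ = by-ring (a ∷ b ∷ x ∷ []) (α ∷ β ∷ []) (λ a b x α β → :bil (α :• a :⊞ β :• b) (:e₁ (a :⊛ x) (b :⊛ x)) x := con 0ℤ) refl
      cramer₁ : D * (c1 k * μ) ≡ (c3 e₂ * c4 x - c4 e₂ * c3 x) * quad k e₁ - (c3 e₁ * c4 x - c4 e₁ * c3 x) * bil k e₁ e₂ + (c3 e₁ * c4 e₂ - c4 e₁ * c3 e₂) * bil k e₁ x
      cramer₁ = by-ring (k ∷ g ∷ h ∷ x ∷ []) [] (λ k g h x → let e = :e₁ g h ; f = :e₂ g h in
        :D g h x :* (x1 k :* x1 e) := (x3 f :* x4 x :- x4 f :* x3 x) :* :quad k e :- (x3 e :* x4 x :- x4 e :* x3 x) :* :bil k e f :+ (x3 e :* x4 f :- x4 e :* x3 f) :* :bil k e x) refl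
      cramer₃ : D * (c3 k * c3 e₁) ≡ c4 e₂ * c1 x * quad k e₁ + (μ * c4 x - c4 e₁ * c1 x) * bil k e₁ e₂ - μ * c4 e₂ * bil k e₁ x
      cramer₃ = by-ring (k ∷ g ∷ h ∷ x ∷ []) [] (λ k g h x → let e = :e₁ g h ; f = :e₂ g h in
        :D g h x :* (x3 k :* x3 e) := x4 f :* x1 x :* :quad k e :+ (x1 e :* x4 x :- x4 e :* x1 x) :* :bil k e f :- x1 e :* x4 f :* :bil k e x) refl
      p∣C₀ : + p ∣ bil k e₁ x
      p∣C₀ = ∣-resp-≡ (sym C₀) (∣0 (+ p))
      ∤neg : ∀ {n} → ¬ + p ∣ n → ¬ + p ∣ - n
      ∤neg {n} nd d = nd (∣-resp-≡ (neg-involutive n) (∣m⇒∣-m d))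
      p∤D : ¬ + p ∣ D
      p∤D = subst (λ n → ¬ + p ∣ n) (sym D-≡) (∤neg (∤-* pp (c2 x * c3 x * c4 x * minor a b c3 c4) (c2 a * (y * y))
        (∤-* pp (c2 x * c3 x * c4 x) (minor a b c3 c4) (∤-* pp (c2 x * c3 x) (c4 x) (∤-* pp (c2 x) (c3 x) (ux2 up) (ux3 up)) (ux4 up)) (um34 gp))
        (∤-* pp (c2 a) (y * y) (ua2 gp) (∤-* pp y y (uy up) (uy up)))))
      p∤μ : ¬ + p ∣ μ
      p∤μ = subst (λ n → ¬ + p ∣ n) (raw (c3 a) (c4 a) (c3 b) (c4 b) (c3 x) (c4 x)) (∤-* pp (minor a b c3 c4) (c3 x * c4 x) (um34 gp) (∤-* pp (c3 x) (c4 x) (ux3 up) (ux4 up)))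
        where
        raw : ∀ a3 a4 b3 b4 x3 x4 → (a3 * b4 - a4 * b3) * (x3 * x4) ≡ a3 * x3 * (b4 * x4) - a4 * x4 * (b3 * x3)
        raw = solve-∀
      p∤e₁₃ : ¬ + p ∣ c3 e₁
      p∤e₁₃ = ∤neg (subst (λ n → ¬ + p ∣ n) (raw (c1 a) (c4 a) (c1 b) (c4 b) (c1 x) (c4 x)) (∤-* pp (minor a b c1 c4) (c1 x * c4 x) (um14 gp) (∤-* pp (c1 x) (c4 x) (ux1 up) (ux4 up))))
        where
        raw : ∀ a3 a4 b3 b4 x3 x4 → (a3 * b4 - a4 * b3) * (x3 * x4) ≡ a3 * x3 * (b4 * x4) - a4 * x4 * (b3 * x3)
        raw = solve-∀
      k1 : + p ∣ c1 k
      k1 = ∣c μ (c1 k) p∤μ (∣-resp-≡ (*-comm (c1 k) μ) (∣c D (c1 k * μ) p∤D (∣-resp-≡ (sym cramer₁)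
        (∣m∣n⇒∣m+n (∣m∣n⇒∣m-n (∣n⇒∣m*n (c3 e₂ * c4 x - c4 e₂ * c3 x) dA) (∣n⇒∣m*n (c3 e₁ * c4 x - c4 e₁ * c3 x) dB)) (∣n⇒∣m*n (c3 e₁ * c4 e₂ - c4 e₁ * c3 e₂) p∣C₀)))))
      k3 : + p ∣ c3 k
      k3 = ∣c (c3 e₁) (c3 k) p∤e₁₃ (∣-resp-≡ (*-comm (c3 k) (c3 e₁)) (∣c D (c3 k * c3 e₁) p∤D (∣-resp-≡ (sym cramer₃)
        (∣m∣n⇒∣m-n (∣m∣n⇒∣m+n (∣n⇒∣m*n (c4 e₂ * c1 x) dA) (∣n⇒∣m*n (μ * c4 x - c4 e₁ * c1 x) dB)) (∣n⇒∣m*n (μ * c4 e₂) p∣C₀)))))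

  module Local {a b : V4} {p : ℕ} (gp : GoodPrime a b p) where

    pp = isPrime gp

    -- `level` is congruence up to scaling. `cong-y` fixes the scaling modulo p, so that modulo p
    -- the last coordinate of any member can be replaced by that of a base point.
    record Lev (l : ℕ) (c : List V5) : Set where
      field
        onS : ∀ P → P ∈ c → OnS a b P
        unit : ∀ P → P ∈ c → UnitPoint p P
        cong-y : ∀ P Q → P ∈ c → Q ∈ c → + p ∣ last P - last Q
        level : ∀ P Q → P ∈ c → Q ∈ c → pw pp l ∣v δ P Q
    open Lev public

    Lev-⊑ : ∀ {l m c d} → d ⊑ c → Lev l c → (∀ P Q → P ∈ d → Q ∈ d → pw pp m ∣v δ P Q) → Lev m d
    Lev-⊑ s lev h = record
      { onS = λ P i → onS lev P (proj₁ s i)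
      ; unit = λ P i → unit lev P (proj₁ s i)
      ; cong-y = λ P Q i j → cong-y lev P Q (proj₁ s i) (proj₁ s j)
      ; level = h }

    Dependent : List V5 → Set
    Dependent c = ∀ P Q R S U → P ∈ c → Q ∈ c → R ∈ c → S ∈ c → U ∈ c → det5 P Q R S U ≡ 0ℤ

    private
      ∣c : ∀ u v → ¬ + p ∣ u → + p ∣ u * v → + p ∣ v
      ∣c = ∣-cancel pp

      instance
        p≢0 : ℕ.NonZero p
        p≢0 = prime⇒nonZero pp

      -- The class is charted around a member P₀: `D P` is the difference to P₀ divided by p ^ (l +
      -- 1). By the polar identity `D P` is tangent at P₀ modulo p, so its first two coordinates
      -- modulo p decide the class at the next level.
      module Step (l : ℕ) (c : List V5) (lev : Lev (suc l) c) (P₀ : V5) (i₀ : P₀ ∈ c) where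
        N : ℕ
        N = p ℕ.^ suc l
        instance
          N≢0 : ℕ.NonZero N
          N≢0 = ℕ.m^n≢0 p (suc l)
        q : ℤ
        q = pw pp (suc l)
        q≢0 : q ≢ 0ℤ
        q≢0 e = ℕ.≢-nonZero⁻¹ N (+-injective e)
        x : V4
        x = vec P₀
        y : ℤ
        y = last P₀
        g h : V4
        g = a ⊛ x
        h = b ⊛ x
        open Tangent g h
        D : V5 → V4
        D P = v4 (c1 (δ P₀ P) /ℕ N) (c2 (δ P₀ P) /ℕ N) (c3 (δ P₀ P) /ℕ N) (c4 (δ P₀ P) /ℕ N)
        δ-≡ : ∀ P → P ∈ c → δ P₀ P ≡ q • D P
        δ-≡ P i = v4-ext (quotient-∣ N (c1 (δ P₀ P)) (d1 dv)) (quotient-∣ N (c2 (δ P₀ P)) (d2 dv)) (quotient-∣ N (c3 (δ P₀ P)) (d3 dv)) (quotient-∣ N (c4 (δ P₀ P)) (d4 dv))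
          where
          dv : q ∣v δ P₀ P
          dv = level lev P₀ P i₀ i
        up : UnitPoint p P₀
        up = unit lev P₀ i₀
        p∤2y : ∀ P → P ∈ c → ¬ + p ∣ + 2 * last P
        p∤2y P i = ∤-* pp (+ 2) (last P) (u2 gp) (uy (unit lev P i))

        scaled : ∀ k P → P ∈ c → + 2 * last P * dot (k ⊛ x) (δ P₀ P) ≡ - quad k (δ P₀ P) → + 2 * last P * dot (k ⊛ x) (D P) ≡ - (q * quad k (D P))
        scaled k P i e = *-cancelˡ-≡ q (+ 2 * last P * dot (k ⊛ x) (D P)) (- (q * quad k (D P))) {{≢-nonZero q≢0}}
          (trans (move q (+ 2 * last P) (dot (k ⊛ x) (D P)))
          (trans (cong (+ 2 * last P *_) (trans (sym (dot-• (k ⊛ x) q (D P))) (cong (dot (k ⊛ x)) (sym (δ-≡ P i)))))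
          (trans e (trans (cong (λ u → - quad k u) (δ-≡ P i)) (trans (cong -_ (quad-• k q (D P))) (move' q (quad k (D P))))))))
          where
          move : ∀ q s t → q * (s * t) ≡ s * (q * t)
          move = solve-∀
          move' : ∀ q s → - (q * q * s) ≡ q * - (q * s)
          move' = solve-∀

        tangent : ∀ k P → P ∈ c → + 2 * last P * dot (k ⊛ x) (δ P₀ P) ≡ - quad k (δ P₀ P) → + p ∣ dot (k ⊛ x) (D P)
        tangent k P i e = ∣c (+ 2 * last P) (dot (k ⊛ x) (D P)) (p∤2y P i)
          (∣-resp-≡ (sym (scaled k P i e)) (∣m⇒∣-m (∣m⇒∣m*n (quad k (D P)) (p∣pw-suc pp l))))

        tan-a : ∀ P → P ∈ c → + p ∣ dot g (D P)
        tan-a P i = tangent a P i (tangent-a a b P₀ P (onS lev P₀ i₀) (onS lev P i))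

        tan-b : ∀ P → P ∈ c → + p ∣ dot h (D P)
        tan-b P i = tangent b P i (tangent-b a b P₀ P (onS lev P₀ i₀) (onS lev P i))

        p∤μ : ¬ + p ∣ μ
        p∤μ = subst (λ n → ¬ + p ∣ n) (raw (c3 a) (c4 a) (c3 b) (c4 b) (c3 x) (c4 x)) (∤-* pp (minor a b c3 c4) (c3 x * c4 x) (um34 gp) (∤-* pp (c3 x) (c4 x) (ux3 up) (ux4 up)))
          where
          raw : ∀ a3 a4 b3 b4 x3 x4 → (a3 * b4 - a4 * b3) * (x3 * x4) ≡ a3 * x3 * (b4 * x4) - a4 * x4 * (b3 * x3)
          raw = solve-∀

        D-congruent : ∀ P Q → P ∈ c → Q ∈ c → + p ∣ c1 (D P) - c1 (D Q) → + p ∣ c2 (D P) - c2 (D Q) → + p ∣v D P ⊝ D Q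
        D-congruent P Q i j e₁ e₂' = divs e₁ e₂'
          (cancel (c3 E) (d3 combs) (∣m∣n⇒∣m+n (∣m⇒∣m*n (c3 e₁v) e₁) (∣m⇒∣m*n (c3 e₂v) e₂')))
          (cancel (c4 E) (d4 combs) (∣m∣n⇒∣m+n (∣m⇒∣m*n (c4 e₁v) e₁) (∣m⇒∣m*n (c4 e₂v) e₂')))
          where
          E e₁v e₂v : V4
          E = D P ⊝ D Q
          e₁v = e₁'
            where
            e₁' = Tangent.e₁ g h
          e₂v = e₂''
            where
            e₂'' = Tangent.e₂ g h
          dot-⊝ : ∀ k → dot k E ≡ dot k (D P) - dot k (D Q)
          dot-⊝ k = by-ring (k ∷ D P ∷ D Q ∷ []) [] (λ k u v → :dot k (u :⊝ v) := :dot k u :- :dot k v) refl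
          combs : + p ∣v μ • E ⊝ (c1 E • e₁v ⊞ c2 E • e₂v)
          combs = tangent-comb E (∣-resp-≡ (sym (dot-⊝ g)) (∣m∣n⇒∣m-n (tan-a P i) (tan-a Q j))) (∣-resp-≡ (sym (dot-⊝ h)) (∣m∣n⇒∣m-n (tan-b P i) (tan-b Q j)))
          cancel : ∀ e {f} → + p ∣ μ * e - f → + p ∣ f → + p ∣ e
          cancel e {f} d d' = ∣c μ e p∤μ (∣-resp-≡ (raw (μ * e) f) (∣m∣n⇒∣m+n d d'))
            where
            raw : ∀ m f → m - f + f ≡ m
            raw = solve-∀

        -- The three-term relation `raw` expresses y times the difference of P and Q through their
        -- differences to P₀. One factor p ^ (l + 1) is visible there; the last factor p comes from
        -- `cong-y` and from the congruence of the charts.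
        refined : ∀ P Q → P ∈ c → Q ∈ c → + p ∣v D P ⊝ D Q → pw pp (suc (suc l)) ∣v δ P Q
        refined P Q i j (divs f1 f2 f3 f4) = divs (coord c1 (cong c1 (δ-≡ P i)) (cong c1 (δ-≡ Q j)) f1) (coord c2 (cong c2 (δ-≡ P i)) (cong c2 (δ-≡ Q j)) f2)
            (coord c3 (cong c3 (δ-≡ P i)) (cong c3 (δ-≡ Q j)) f3) (coord c4 (cong c4 (δ-≡ P i)) (cong c4 (δ-≡ Q j)) f4)
          where
          raw : ∀ y yP yQ xP xQ x₀ → y * (yP * xQ - yQ * xP) ≡ yP * (y * xQ - yQ * x₀) - yQ * (y * xP - yP * x₀)
          raw = solve-∀
          raw' : ∀ q yP yQ dP dQ → yP * (q * dQ) - yQ * (q * dP) ≡ ((yP - yQ) * dQ - yQ * (dP - dQ)) * q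
          raw' = solve-∀
          coord : ∀ (k : V4 → ℤ) → y * k (vec P) - last P * k x ≡ q * k (D P) → y * k (vec Q) - last Q * k x ≡ q * k (D Q) → + p ∣ k (D P) - k (D Q) →
            pw pp (suc (suc l)) ∣ last P * k (vec Q) - last Q * k (vec P)
          coord k eP eQ f = pw-cancel pp (suc (suc l)) y (last P * k (vec Q) - last Q * k (vec P)) (uy up)
            (subst₂ _∣_ (sym (pw-suc pp (suc l)))
              (sym (trans (raw y (last P) (last Q) (k (vec P)) (k (vec Q)) (k x)) (trans (cong₂ (λ s t → last P * s - last Q * t) eQ eP) (raw' q (last P) (last Q) (k (D P)) (k (D Q))))))
              (*-monoˡ-∣ q (∣m∣n⇒∣m-n (∣m⇒∣m*n (k (D Q)) (cong-y lev P Q i j)) (∣n⇒∣m*n (last Q) f))))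

        finish : ∀ d → d ⊑ c → same pp (λ P → c1 (D P)) d → same pp (λ P → c2 (D P)) d → Lev (suc (suc l)) d
        finish d d⊑c s t = Lev-⊑ d⊑c lev (λ P Q i j → refined P Q (proj₁ d⊑c i) (proj₁ d⊑c j) (D-congruent P Q (proj₁ d⊑c i) (proj₁ d⊑c j) (s P Q i j) (t P Q i j)))

        -- This is 2 y T(δ) with q taken out of two coordinates and -q² out of the other two. The
        -- polar identity turns the tangential coordinates into values of the forms at `D P`, so the
        -- vanishing of the 5 × 5 determinants survives division by the power of p.
        w : V5 → V4
        w P = v4 (+ 2 * last P * c1 (D P)) (+ 2 * last P * c2 (D P)) (quad a (D P)) (quad b (D P))

        w-≡ : ∀ P → P ∈ c → + 2 * last P • T g h (δ P₀ P) ≡ v4 (q * c1 (w P)) (q * c2 (w P)) (- (q * q * c3 (w P))) (- (q * q * c4 (w P)))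
        w-≡ P i = v4-ext (first c1 (cong c1 (δ-≡ P i))) (first c2 (cong c2 (δ-≡ P i)))
          (second a (tangent-a a b P₀ P (onS lev P₀ i₀) (onS lev P i))) (second b (tangent-b a b P₀ P (onS lev P₀ i₀) (onS lev P i)))
          where
          raw : ∀ s q d → s * (q * d) ≡ q * (s * d)
          raw = solve-∀
          first : ∀ (k : V4 → ℤ) → k (δ P₀ P) ≡ q * k (D P) → + 2 * last P * k (δ P₀ P) ≡ q * (+ 2 * last P * k (D P))
          first k e = trans (cong (+ 2 * last P *_) e) (raw (+ 2 * last P) q (k (D P)))
          second : ∀ k → + 2 * last P * dot (k ⊛ x) (δ P₀ P) ≡ - quad k (δ P₀ P) → + 2 * last P * dot (k ⊛ x) (δ P₀ P) ≡ - (q * q * quad k (D P))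
          second k e = trans e (cong -_ (trans (cong (quad k) (δ-≡ P i)) (quad-• k q (D P))))

        w-dependent : Dependent c → ∀ {P Q R S} → P ∈ c → Q ∈ c → R ∈ c → S ∈ c → det4 (w P) (w Q) (w R) (w S) ≡ 0ℤ
        w-dependent dep {P} {Q} {R} {S} i j k m = nz-cancel (trans (sym (det4-rows q (w P) (w Q) (w R) (w S)))
            (trans (sym (cong₂ (λ f g' → f g') (cong₂ (λ u v → λ z → det4 u v (proj₁ z) (proj₂ z)) (w-≡ P i) (w-≡ Q j)) (cong₂ _,_ (w-≡ R k) (w-≡ S m))))
            (trans (det4-• (+ 2 * last P) (+ 2 * last Q) (+ 2 * last R) (+ 2 * last S) (T g h (δ P₀ P)) (T g h (δ P₀ Q)) (T g h (δ P₀ R)) (T g h (δ P₀ S)))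
            (trans (cong (+ 2 * last P * (+ 2 * last Q) * (+ 2 * last R * (+ 2 * last S)) *_) zero-T) (*-zeroʳ (+ 2 * last P * (+ 2 * last Q) * (+ 2 * last R * (+ 2 * last S))))))))
          where
          zero-T : det4 (T g h (δ P₀ P)) (T g h (δ P₀ Q)) (T g h (δ P₀ R)) (T g h (δ P₀ S)) ≡ 0ℤ
          zero-T = trans (det4-T g h (δ P₀ P) (δ P₀ Q) (δ P₀ R) (δ P₀ S)) (trans (cong (μ *_) (trans (det4-δ P₀ P Q R S)
            (trans (cong (y * y * y *_) (dep P₀ P Q R S i₀ i j k m)) (*-zeroʳ (y * y * y))))) (*-zeroʳ μ))
          nz-mul : ∀ {s t} → s ≢ 0ℤ → t ≢ 0ℤ → s * t ≢ 0ℤ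
          nz-mul {s} {t} ns nt e = Data.Sum.[ ns , nt ] (i*j≡0⇒i≡0∨j≡0 s e)
          q²≢0 : q * q ≢ 0ℤ
          q²≢0 = nz-mul {q} {q} q≢0 q≢0
          nz-cancel : ∀ {t} → q * q * (q * q) * (q * q) * t ≡ 0ℤ → t ≡ 0ℤ
          nz-cancel {t} e = Data.Sum.[ (λ z → ⊥-elim (nz-mul {q * q * (q * q)} {q * q} (nz-mul {q * q} {q * q} q²≢0 q²≢0) q²≢0 z)) , (λ z → z) ]
            (i*j≡0⇒i≡0∨j≡0 (q * q * (q * q) * (q * q)) e)

        -- A functional that kills all `w P` modulo p relates the first two coordinates of `D P`
        -- linearly to the two forms at `D P`. On the tangent plane the forms are quadratic in these
        -- coordinates, so the relation is a conic; the factor μ² clears the denominators of the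
        -- parametrisation by `e₁` and `e₂`.
        module Conic (k : V4) (k≢0 : ¬ (+ p ∣v k)) (kills : ∀ {P} → P ∈ c → + p ∣ dot k (w P)) where
          ck : V4
          ck = pencil a b (c3 k) (c4 k)
          A B C Γ Λ : ℤ
          A = quad ck e₁
          B = + 2 * bil ck e₁ e₂
          C = quad ck e₂
          Γ = μ * μ * (+ 2 * y * c1 k)
          Λ = μ * μ * (+ 2 * y * c2 k)
          pencil-quad : ∀ u → quad ck u ≡ c3 k * quad a u + c4 k * quad b u
          pencil-quad u = by-ring (a ∷ b ∷ u ∷ []) (c3 k ∷ c4 k ∷ []) (λ a b u α β → :quad (α :• a :⊞ β :• b) u := α :* :quad a u :+ β :* :quad b u) refl
          vanishes : ∀ {P} → P ∈ c → + p ∣ conic-value A B C Γ Λ (c1 (D P)) (c2 (D P))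
          vanishes {P} i = ∣-resp-≡ (sym (conic-value-≡ A B C Γ Λ s t)) (∣-resp-≡ (raw (μ * μ) (+ 2) (last P) y (c1 k) (c2 k) s t (c3 k * quad a (D P) + c4 k * quad b (D P)) (A * (s * s) + B * (s * t) + C * (t * t)))
              (∣m∣n⇒∣m-n (∣m∣n⇒∣m-n (∣n⇒∣m*n (μ * μ) (∣-resp-≡ (assoc (c1 k) (c2 k) (c3 k) (c4 k) (+ 2 * last P * s) (+ 2 * last P * t) (quad a (D P)) (quad b (D P))) (kills i)))
                (∣n⇒∣m*n (μ * μ * (+ 2 * (c1 k * s + c2 k * t))) (cong-y lev P P₀ i i₀))) quads))
            where
            s t : ℤ
            s = c1 (D P)
            t = c2 (D P)
            quads : + p ∣ μ * μ * (c3 k * quad a (D P) + c4 k * quad b (D P)) - (A * (s * s) + B * (s * t) + C * (t * t))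
            quads = ∣-resp-≡ (trans (sym (quad-⊝ ck (μ • D P) (s • e₁ ⊞ t • e₂)))
                  (cong₂ _-_ (trans (quad-• ck μ (D P)) (cong (μ * μ *_) (pencil-quad (D P)))) (quad-comb ck s t e₁ e₂)))
                (∣-bil ck (μ • D P ⊝ (s • e₁ ⊞ t • e₂)) (μ • D P ⊞ (s • e₁ ⊞ t • e₂)) (tangent-comb (D P) (tan-a P i) (tan-b P i)))
            assoc : ∀ k1 k2 k3 k4 u1 u2 u3 u4 → k1 * u1 + k2 * u2 + k3 * u3 + k4 * u4 ≡ k1 * u1 + k2 * u2 + (k3 * u3 + k4 * u4)
            assoc = solve-∀
            raw : ∀ m two yP y k1 k2 s t u v → m * (k1 * (two * yP * s) + k2 * (two * yP * t) + u) - m * (two * (k1 * s + k2 * t)) * (yP - y) - (m * u - v) ≡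
              v + m * (two * y * k1) * s + m * (two * y * k2) * t
            raw = solve-∀
          nontrivial : ¬ (+ p ∣ A × + p ∣ B × + p ∣ C × + p ∣ Γ × + p ∣ Λ)
          nontrivial (dA , dB , _ , dΓ , dΛ) = k≢0 (divs (unΓ (c1 k) dΓ) (unΓ (c2 k) dΛ) (proj₁ αβ) (proj₂ αβ))
            where
            αβ = tangent-nondegenerate gp P₀ (onS lev P₀ i₀) up (c3 k) (c4 k) dA (∣c (+ 2) (bil ck e₁ e₂) (u2 gp) dB)
            unΓ : ∀ n → + p ∣ μ * μ * (+ 2 * y * n) → + p ∣ n
            unΓ n d = ∣c (+ 2 * y) n (∤-* pp (+ 2) y (u2 gp) (uy up)) (∣c (μ * μ) (+ 2 * y * n) (∤-* pp μ μ p∤μ p∤μ) d)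

    child-surface : ∀ l c → Lev (suc l) c → ∃[ d ] d ⊑ c × Lev (suc (suc l)) d × length c ℕ.≤ p ℕ.* p ℕ.* length d
    child-surface l [] lev = [] , ⊑-refl , Lev-⊑ ⊑-refl lev (λ P Q ()) , z≤n
    child-surface l c@(P₀ ∷ _) lev = first (residue-class pp (λ P → c1 (S.D P)) c)
      where
      module S = Step l c lev P₀ (here refl)
      Result : Set
      Result = ∃[ d ] d ⊑ c × Lev (suc (suc l)) d × length c ℕ.≤ p ℕ.* p ℕ.* length d
      second : ∀ d → d ⊑ c → same pp (λ P → c1 (S.D P)) d → length c ℕ.≤ p ℕ.* length d →
        (∃[ e ] e ⊑ d × same pp (λ P → c2 (S.D P)) e × length d ℕ.≤ p ℕ.* length e) → Result
      second d d⊑c sd le (e , e⊑d , se , le') = e , ⊑-trans e⊑d d⊑c ,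
        S.finish e (⊑-trans e⊑d d⊑c) (λ P Q i j → sd P Q (proj₁ e⊑d i) (proj₁ e⊑d j)) se ,
        ℕ.≤-trans le (ℕ.≤-trans (ℕ.*-monoʳ-≤ p le') (ℕ.≤-reflexive (sym (ℕ.*-assoc p p (length e)))))
      first : (∃[ d ] d ⊑ c × same pp (λ P → c1 (S.D P)) d × length c ℕ.≤ p ℕ.* length d) → Result
      first (d , d⊑c , sd , le) = second d d⊑c sd le (residue-class pp (λ P → c2 (S.D P)) d)

    child-curve : ∀ l c → Lev (suc l) c → Dependent c → ∃[ d ] d ⊑ c × Lev (suc (suc l)) d × length c ℕ.≤ p ℕ.* 2 ℕ.* length d
    child-curve l [] lev dep = [] , ⊑-refl , Lev-⊑ ⊑-refl lev (λ P Q ()) , z≤n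
    child-curve l c@(P₀ ∷ _) lev dep = first (annihilator pp S.w c (λ i j k m → ∣-resp-≡ (sym (S.w-dependent dep i j k m)) (∣0 (+ p))))
      where
      module S = Step l c lev P₀ (here refl)
      Result : Set
      Result = ∃[ d ] d ⊑ c × Lev (suc (suc l)) d × length c ℕ.≤ p ℕ.* 2 ℕ.* length d
      second : (∃[ d ] d ⊑ c × same pp (λ P → c1 (S.D P)) d × same pp (λ P → c2 (S.D P)) d × length c ℕ.≤ p ℕ.* 2 ℕ.* length d) → Result
      second (d , d⊑c , sd , td , le) = d , d⊑c , S.finish d d⊑c sd td , le
      first : (∃[ k ] ¬ (+ p ∣v k) × (∀ {P} → P ∈ c → + p ∣ dot k (S.w P))) → Result
      first (k , k≢0 , kills) = second (conic-points pp C.A C.B C.C C.Γ C.Λ (λ P → c1 (S.D P)) (λ P → c2 (S.D P)) c C.nontrivial (λ {P} i → C.vanishes {P} i))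
        where module C = S.Conic k k≢0 kills

  -- Isotropic vectors of ψ₁ when α is not a square.

  *-≢0 : ∀ {s t} → s ≢ 0ℤ → t ≢ 0ℤ → s * t ≢ 0ℤ
  *-≢0 {s} ns nt e = [ ns , nt ] (i*j≡0⇒i≡0∨j≡0 s e)

  *≡0-cancel : ∀ {s} t → s ≢ 0ℤ → s * t ≡ 0ℤ → t ≡ 0ℤ
  *≡0-cancel {s} t ns e = [ (λ z → ⊥-elim (ns z)) , (λ z → z) ] (i*j≡0⇒i≡0∨j≡0 s e)

  square≡0 : ∀ {s} → s * s ≡ 0ℤ → s ≡ 0ℤ
  square≡0 {s} e = [ (λ z → z) , (λ z → z) ] (i*j≡0⇒i≡0∨j≡0 s e)

  -- After division by the greatest common divisor m' and k' are coprime while m' divides the square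
  -- of k', and this forces m' = 1.
  m²∣k²⇒m∣k : ∀ m k → m ≢ 0 → m ℕ.* m ℕ.∣ k ℕ.* k → m ℕ.∣ k
  m²∣k²⇒m∣k m k m≢0 d = go (gcd[m,n]∣m m k) (gcd[m,n]∣n m k)
    where
    g : ℕ
    g = gcd m k
    instance
      g≢0 : ℕ.NonZero g
      g≢0 = ℕ.≢-nonZero (λ e → m≢0 (gcd[m,n]≡0⇒m≡0 e))
      gg≢0 : ℕ.NonZero (g ℕ.* g)
      gg≢0 = ℕ.m*n≢0 g g
    go : g ℕ.∣ m → g ℕ.∣ k → m ℕ.∣ k
    go (ℕ.divides m' em) (ℕ.divides k' ek) = subst (ℕ._∣ k) (sym (trans em (trans (cong (ℕ._* g) m'≡1) (ℕ.*-identityˡ g)))) (gcd[m,n]∣n m k)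
      where
      coprime : Coprime m' k'
      coprime {i} (i∣m' , i∣k') = ℕ.∣1⇒≡1 (ℕ.*-cancelʳ-∣ g (subst (i ℕ.* g ℕ.∣_) (sym (ℕ.*-identityˡ g))
        (gcd-greatest (subst (i ℕ.* g ℕ.∣_) (sym em) (ℕ.*-monoˡ-∣ g i∣m')) (subst (i ℕ.* g ℕ.∣_) (sym ek) (ℕ.*-monoˡ-∣ g i∣k')))))
      lem : ∀ a b → a ℕ.* b ℕ.* (a ℕ.* b) ≡ a ℕ.* a ℕ.* (b ℕ.* b)
      lem a b = ℕ.[m*n]*[o*p]≡[m*o]*[n*p] a b a b
      squares : m' ℕ.* m' ℕ.∣ k' ℕ.* k'
      squares = ℕ.*-cancelʳ-∣ (g ℕ.* g) (subst₂ ℕ._∣_ (trans (cong (λ t → t ℕ.* t) em) (lem m' g)) (trans (cong (λ t → t ℕ.* t) ek) (lem k' g)) d)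
      m'∣k' : m' ℕ.∣ k'
      m'∣k' = coprime-divisor coprime (ℕ.∣-trans (ℕ.m∣m*n m') squares)
      m'≡1 : m' ≡ 1
      m'≡1 = coprime (ℕ.∣-refl , m'∣k')

  square-quotient : ∀ n m k → m ≢ 0ℤ → n * (m * m) ≡ k * k → ∃[ j ] n ≡ j * j
  square-quotient n m k m≢0 e = go (∣ᵤ⇒∣ {m} {k} (m²∣k²⇒m∣k (abs m) (abs k) (λ z → m≢0 (∣i∣≡0⇒i≡0 z))
      (ℕ.divides (abs n) (trans (sym (abs-* k k)) (trans (cong abs (sym e)) (trans (abs-* n (m * m)) (cong (abs n ℕ.*_) (abs-* m m))))))))
    where
    go : Data.Integer.Divisibility.Signed._∣_ m k → ∃[ j ] n ≡ j * j
    go (divides j refl) = j , *-cancelʳ-≡ n (j * j) (m * m) {{≢-nonZero (*-≢0 m≢0 m≢0)}} (trans e (raw j m))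
      where
      raw : ∀ j m → j * m * (j * m) ≡ j * j * (m * m)
      raw = solve-∀

  module Isotropic (a : V4) (nonsquare : ¬ (∃[ m ] c1 a * c2 a * c3 a * c4 a ≡ m * m)) where

    private
      -- Multiplying the equation by s gives α w'² = (s w)², so a nonzero w' would make α a square.
      cross : ∀ s t w w' → c1 a * c2 a * c3 a * c4 a ≡ s * t → s ≢ 0ℤ → s * (w * w) ≡ t * (w' * w') → w ≡ 0ℤ × w' ≡ 0ℤ
      cross s t w w' α-≡ s≢0 e = w≡0 , w'≡0
        where
        raw : ∀ s t w → s * t * (w * w) ≡ s * (t * (w * w))
        raw = solve-∀
        raw' : ∀ s w → s * (s * (w * w)) ≡ s * w * (s * w)
        raw' = solve-∀
        w'≡0 : w' ≡ 0ℤ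
        w'≡0 with w' Data.Integer.≟ 0ℤ
        ... | yes z = z
        ... | no nz = ⊥-elim (nonsquare (square-quotient (c1 a * c2 a * c3 a * c4 a) w' (s * w) nz
              (trans (cong (_* (w' * w')) α-≡) (trans (raw s t w') (trans (cong (s *_) (sym e)) (raw' s w))))))
        w≡0 : w ≡ 0ℤ
        w≡0 = square≡0 (*≡0-cancel (w * w) s≢0 (trans e (trans (cong (λ z → t * (z * z)) w'≡0) (*-zeroʳ t))))

    α≢0 : c1 a * c2 a * c3 a * c4 a ≢ 0ℤ
    α≢0 e = nonsquare (0ℤ , e)

    a1≢0 : c1 a ≢ 0ℤ
    a1≢0 e = α≢0 (trans (cong (λ z → z * c2 a * c3 a * c4 a) e) (raw (c2 a) (c3 a) (c4 a)))
      where
      raw : ∀ b c d → 0ℤ * b * c * d ≡ 0ℤ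
      raw = solve-∀
    a2≢0 : c2 a ≢ 0ℤ
    a2≢0 e = α≢0 (trans (cong (λ z → c1 a * z * c3 a * c4 a) e) (raw (c1 a) (c3 a) (c4 a)))
      where
      raw : ∀ b c d → b * 0ℤ * c * d ≡ 0ℤ
      raw = solve-∀
    a3≢0 : c3 a ≢ 0ℤ
    a3≢0 e = α≢0 (trans (cong (λ z → c1 a * c2 a * z * c4 a) e) (raw (c1 a) (c2 a) (c4 a)))
      where
      raw : ∀ b c d → b * c * 0ℤ * d ≡ 0ℤ
      raw = solve-∀
    a4≢0 : c4 a ≢ 0ℤ
    a4≢0 e = α≢0 (trans (cong (c1 a * c2 a * c3 a *_) e) (*-zeroʳ (c1 a * c2 a * c3 a)))

    -- Comparing the Gram determinants of the two halves of the variables: an isotropic plane makes α a square.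
    isotropic⇒proportional : ∀ x x' → quad a x ≡ 0ℤ → quad a x' ≡ 0ℤ → bil a x x' ≡ 0ℤ → wedge x x' ≡ b6 0ℤ 0ℤ 0ℤ 0ℤ 0ℤ 0ℤ
    isotropic⇒proportional x x' e e' f = b6-ext (proj₁ p₁) (proj₁ p₂) (proj₁ p₃) (proj₂ p₃) (proj₂ p₂) (proj₂ p₁)
      where
      raw : ∀ a1 a2 a3 a4 x1 x2 x3 x4 y1 y2 y3 y4 →
        let Q = a1 * (x1 * x1) + a2 * (x2 * x2) + a3 * (x3 * x3) + a4 * (x4 * x4)
            Q' = a1 * (y1 * y1) + a2 * (y2 * y2) + a3 * (y3 * y3) + a4 * (y4 * y4)
            F = a1 * (x1 * y1) + a2 * (x2 * y2) + a3 * (x3 * y3) + a4 * (x4 * y4)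
        in a1 * a2 * ((x1 * y2 - x2 * y1) * (x1 * y2 - x2 * y1)) ≡ a3 * a4 * ((x3 * y4 - x4 * y3) * (x3 * y4 - x4 * y3))
          + Q * (Q' - (a3 * (y3 * y3) + a4 * (y4 * y4))) - Q' * (a3 * (x3 * x3) + a4 * (x4 * x4)) + F * (+ 2 * (a3 * (x3 * y3) + a4 * (x4 * y4)) - F)
      raw = solve-∀
      kill : ∀ {Q Q' F} T u v w → Q ≡ 0ℤ → Q' ≡ 0ℤ → F ≡ 0ℤ → T + Q * u - Q' * v + F * w ≡ T
      kill T u v w refl refl refl = raw' T u v w
        where
        raw' : ∀ T u v w → T + 0ℤ * u - 0ℤ * v + 0ℤ * w ≡ T
        raw' = solve-∀
      gram : ∀ a1 a2 a3 a4 x1 x2 x3 x4 y1 y2 y3 y4 → a1 * (x1 * x1) + a2 * (x2 * x2) + a3 * (x3 * x3) + a4 * (x4 * x4) ≡ 0ℤ →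
        a1 * (y1 * y1) + a2 * (y2 * y2) + a3 * (y3 * y3) + a4 * (y4 * y4) ≡ 0ℤ → a1 * (x1 * y1) + a2 * (x2 * y2) + a3 * (x3 * y3) + a4 * (x4 * y4) ≡ 0ℤ →
        a1 * a2 * ((x1 * y2 - x2 * y1) * (x1 * y2 - x2 * y1)) ≡ a3 * a4 * ((x3 * y4 - x4 * y3) * (x3 * y4 - x4 * y3))
      gram a1 a2 a3 a4 x1 x2 x3 x4 y1 y2 y3 y4 e e' f = trans (raw a1 a2 a3 a4 x1 x2 x3 x4 y1 y2 y3 y4)
        (kill (a3 * a4 * ((x3 * y4 - x4 * y3) * (x3 * y4 - x4 * y3)))
          (a1 * (y1 * y1) + a2 * (y2 * y2) + a3 * (y3 * y3) + a4 * (y4 * y4) - (a3 * (y3 * y3) + a4 * (y4 * y4))) (a3 * (x3 * x3) + a4 * (x4 * x4))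
          (+ 2 * (a3 * (x3 * y3) + a4 * (x4 * y4)) - (a1 * (x1 * y1) + a2 * (x2 * y2) + a3 * (x3 * y3) + a4 * (x4 * y4))) e e' f)
      sw : ∀ p q r s → p + q + r + s ≡ p + r + q + s
      sw = solve-∀
      sw' : ∀ p q r s → p + q + r + s ≡ p + s + q + r
      sw' = solve-∀
      p₁ = cross (c1 a * c2 a) (c3 a * c4 a) (b12 (wedge x x')) (b34 (wedge x x')) (*-assoc (c1 a * c2 a) (c3 a) (c4 a)) (*-≢0 a1≢0 a2≢0)
        (gram (c1 a) (c2 a) (c3 a) (c4 a) (c1 x) (c2 x) (c3 x) (c4 x) (c1 x') (c2 x') (c3 x') (c4 x') e e' f)
      p₂ = cross (c1 a * c3 a) (c2 a * c4 a) (b13 (wedge x x')) (b24 (wedge x x')) (r₂ (c1 a) (c2 a) (c3 a) (c4 a)) (*-≢0 a1≢0 a3≢0)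
        (gram (c1 a) (c3 a) (c2 a) (c4 a) (c1 x) (c3 x) (c2 x) (c4 x) (c1 x') (c3 x') (c2 x') (c4 x') (trans (sym (sw (c1 a * (c1 x * c1 x)) (c2 a * (c2 x * c2 x)) (c3 a * (c3 x * c3 x)) (c4 a * (c4 x * c4 x)))) e) (trans (sym (sw (c1 a * (c1 x' * c1 x')) (c2 a * (c2 x' * c2 x')) (c3 a * (c3 x' * c3 x')) (c4 a * (c4 x' * c4 x')))) e') (trans (sym (sw (c1 a * (c1 x * c1 x')) (c2 a * (c2 x * c2 x')) (c3 a * (c3 x * c3 x')) (c4 a * (c4 x * c4 x')))) f))
        where
        r₂ : ∀ a b c d → a * b * c * d ≡ a * c * (b * d)
        r₂ = solve-∀
      p₃ = cross (c1 a * c4 a) (c2 a * c3 a) (b14 (wedge x x')) (b23 (wedge x x')) (r₃ (c1 a) (c2 a) (c3 a) (c4 a)) (*-≢0 a1≢0 a4≢0)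
        (gram (c1 a) (c4 a) (c2 a) (c3 a) (c1 x) (c4 x) (c2 x) (c3 x) (c1 x') (c4 x') (c2 x') (c3 x') (trans (sym (sw' (c1 a * (c1 x * c1 x)) (c2 a * (c2 x * c2 x)) (c3 a * (c3 x * c3 x)) (c4 a * (c4 x * c4 x)))) e) (trans (sym (sw' (c1 a * (c1 x' * c1 x')) (c2 a * (c2 x' * c2 x')) (c3 a * (c3 x' * c3 x')) (c4 a * (c4 x' * c4 x')))) e') (trans (sym (sw' (c1 a * (c1 x * c1 x')) (c2 a * (c2 x * c2 x')) (c3 a * (c3 x * c3 x')) (c4 a * (c4 x * c4 x')))) f))
        where
        r₃ : ∀ a b c d → a * b * c * d ≡ a * d * (b * c)
        r₃ = solve-∀

  dot-⊛ : ∀ k x u → dot (k ⊛ x) u ≡ bil k x u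
  dot-⊛ k x u = by-ring (k ∷ x ∷ u ∷ []) [] (λ k x u → :dot (k :⊛ x) u := :bil k x u) refl

  bil-comm : ∀ k u v → bil k u v ≡ bil k v u
  bil-comm k u v = by-ring (k ∷ u ∷ v ∷ []) [] (λ k u v → :bil k u v := :bil k v u) refl

  bil-• : ∀ k z u v → bil k (z • u) v ≡ z * bil k u v
  bil-• k z u v = by-ring (k ∷ u ∷ v ∷ []) (z ∷ []) (λ k u v z → :bil k (z :• u) v := z :* :bil k u v) refl

  bil-comb : ∀ k s u t w v → bil k (s • u ⊞ t • w) v ≡ s * bil k u v + t * bil k w v
  bil-comb k s u t w v = by-ring (k ∷ u ∷ v ∷ w ∷ []) (s ∷ t ∷ []) (λ k u v w s t → :bil k (s :• u :⊞ t :• w) v := s :* :bil k u v :+ t :* :bil k w v) refl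

  opaque
    unfolding det4
    det4-units₃₄ : ∀ u v → det4 u v (v4 0ℤ 0ℤ 1ℤ 0ℤ) (v4 0ℤ 0ℤ 0ℤ 1ℤ) ≡ c1 u * c2 v - c2 u * c1 v
    det4-units₃₄ u v = by-ring (u ∷ v ∷ []) [] (λ u v → let O = con 0ℤ ; I = con 1ℤ in :det4 u v (p4 O O I O) (p4 O O O I) := x1 u :* x2 v :- x2 u :* x1 v) refl
    det4-units₂₄ : ∀ u v → det4 u v (v4 0ℤ 1ℤ 0ℤ 0ℤ) (v4 0ℤ 0ℤ 0ℤ 1ℤ) ≡ - (c1 u * c3 v - c3 u * c1 v)
    det4-units₂₄ u v = by-ring (u ∷ v ∷ []) [] (λ u v → let O = con 0ℤ ; I = con 1ℤ in :det4 u v (p4 O I O O) (p4 O O O I) := :- (x1 u :* x3 v :- x3 u :* x1 v)) refl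
    det4-units₂₃ : ∀ u v → det4 u v (v4 0ℤ 1ℤ 0ℤ 0ℤ) (v4 0ℤ 0ℤ 1ℤ 0ℤ) ≡ c1 u * c4 v - c4 u * c1 v
    det4-units₂₃ u v = by-ring (u ∷ v ∷ []) [] (λ u v → let O = con 0ℤ ; I = con 1ℤ in :det4 u v (p4 O I O O) (p4 O O I O) := x1 u :* x4 v :- x4 u :* x1 v) refl

  module _ (a : V4) {x₀ x₁ x₂ : V4} (q₀ : quad a x₀ ≡ 0ℤ) (q₁ : quad a x₁ ≡ 0ℤ) (q₂ : quad a x₂ ≡ 0ℤ)
    (n₀₁ : bil a x₀ x₁ ≢ 0ℤ) (n₀₂ : bil a x₀ x₂ ≢ 0ℤ) (n₁₂ : bil a x₁ x₂ ≢ 0ℤ) where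

    private
      B₀₁ = bil a x₀ x₁
      B₀₂ = bil a x₀ x₂
      B₁₂ = bil a x₁ x₂

    -- Pairing the relation with x₁ and x₂ gives z B₀₁ = t B₁₂ and z B₀₂ = s B₁₂; pairing it with x₀
    -- gives s B₀₁ + t B₀₂ = 0. Together 2 B₁₂ s t = 0, whereas z ≠ 0 makes s and t nonzero.
    -- Geometrically, a line not on the quadric meets it at most twice.
    no-relation : ∀ z s t → z ≢ 0ℤ → z • x₀ ≡ s • x₁ ⊞ t • x₂ → ⊥
    no-relation z s t z≢0 e = [ (λ s≡0 → *-≢0 z≢0 n₀₂ (trans e₂ (trans (cong (_* B₁₂) s≡0) (*-zeroˡ B₁₂)))) ,
                                (λ t≡0 → *-≢0 z≢0 n₀₁ (trans e₁ (trans (cong (_* B₁₂) t≡0) (*-zeroˡ B₁₂)))) ]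
                                (i*j≡0⇒i≡0∨j≡0 s (*≡0-cancel (s * t) (*-≢0 {+ 2} (λ ()) n₁₂) product))
      where
      pairing : ∀ v → z * bil a x₀ v ≡ s * bil a x₁ v + t * bil a x₂ v
      pairing v = trans (sym (bil-• a z x₀ v)) (trans (cong (λ u → bil a u v) e) (bil-comb a s x₁ t x₂ v))
      e₁ : z * B₀₁ ≡ t * B₁₂
      e₁ = trans (pairing x₁) (trans (cong₂ (λ u v → s * u + t * v) q₁ (bil-comm a x₂ x₁)) (raw s (t * B₁₂)))
        where
        raw : ∀ s u → s * 0ℤ + u ≡ u
        raw = solve-∀
      e₂ : z * B₀₂ ≡ s * B₁₂
      e₂ = trans (pairing x₂) (trans (cong (λ u → s * B₁₂ + t * u) q₂) (raw (s * B₁₂) t))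
        where
        raw : ∀ u t → u + t * 0ℤ ≡ u
        raw = solve-∀
      e₀ : s * B₀₁ + t * B₀₂ ≡ 0ℤ
      e₀ = trans (cong₂ (λ u v → s * u + t * v) (bil-comm a x₀ x₁) (bil-comm a x₀ x₂)) (trans (sym (pairing x₀)) (trans (cong (z *_) q₀) (*-zeroʳ z)))
      product : + 2 * B₁₂ * (s * t) ≡ 0ℤ
      product = trans (raw B₁₂ s t) (trans (cong₂ (λ u v → s * u + t * v) (sym e₁) (sym e₂)) (trans (raw' z s t B₀₁ B₀₂) (trans (cong (z *_) e₀) (*-zeroʳ z))))
        where
        raw : ∀ B s t → + 2 * B * (s * t) ≡ s * (t * B) + t * (s * B)
        raw = solve-∀
        raw' : ∀ z s t B C → s * (z * B) + t * (z * C) ≡ z * (s * B + t * C)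
        raw' = solve-∀

    -- Contracting the vanishing trivector with a ⊛ x₁ shows that B₀₁ x₂ - B₁₂ x₀ is proportional to x₁, hence isotropic.
    trivector≢0 : c1 x₁ ≢ 0ℤ → (∀ v → det4 x₀ x₁ x₂ v ≡ 0ℤ) → ⊥
    trivector≢0 x≢0 h = *-≢0 (*-≢0 {+ 2} (λ ()) n₀₁) (*-≢0 n₁₂ n₀₂) (*≡0-cancel (+ 2 * B₀₁ * (B₁₂ * B₀₂)) (*-≢0 x≢0 x≢0)
        (trans (by-ring (a ∷ x₀ ∷ x₁ ∷ x₂ ∷ []) (B₀₁ ∷ B₁₂ ∷ []) (λ a x y z B C → let t = B :• z :⊝ C :• x in
            x1 y :* x1 y :* (con (+ 2) :* B :* (C :* :bil a x z)) := C :* C :* (x1 y :* x1 y) :* :quad a x :- x1 t :* x1 t :* :quad a y :+ B :* B :* (x1 y :* x1 y) :* :quad a z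
              :- x2 a :* (x1 y :* x2 t :+ x1 t :* x2 y) :* (B :* (x1 y :* x2 z :- x2 y :* x1 z) :- C :* (x1 y :* x2 x :- x2 y :* x1 x))
              :+ x3 a :* (x1 y :* x3 t :+ x1 t :* x3 y) :* (B :* (:- (x1 y :* x3 z :- x3 y :* x1 z)) :- C :* (:- (x1 y :* x3 x :- x3 y :* x1 x)))
              :- x4 a :* (x1 y :* x4 t :+ x1 t :* x4 y) :* (B :* (x1 y :* x4 z :- x4 y :* x1 z) :- C :* (x1 y :* x4 x :- x4 y :* x1 x))) refl)
          (zeros (B₁₂ * B₁₂ * (c1 x₁ * c1 x₁)) (c1 z * c1 z) (B₀₁ * B₀₁ * (c1 x₁ * c1 x₁)) (c2 a * (c1 x₁ * c2 z + c1 z * c2 x₁)) (c3 a * (c1 x₁ * c3 z + c1 z * c3 x₁)) (c4 a * (c1 x₁ * c4 z + c1 z * c4 x₁)) q₀ q₁ q₂ p₂ p₃ p₄)))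
      where
      z : V4
      z = B₀₁ • x₂ ⊝ B₁₂ • x₀
      contracted : ∀ v w → B₀₁ * det4 x₁ x₂ v w - B₁₂ * det4 x₁ x₀ v w ≡ 0ℤ
      contracted v w = trans (sym (collect (trans (dot-⊛ a x₁ x₀) (bil-comm a x₁ x₀)) (trans (dot-⊛ a x₁ x₁) q₁) (dot-⊛ a x₁ x₂) (h w) (h v)
          (trans (det4-swap₁₂ x₁ x₀ v w) refl)))
          (cramer4 (a ⊛ x₁) x₀ x₁ x₂ v w)
        where
        raw : ∀ B01 B12 D E F kv kw → B01 * D - 0ℤ * E + B12 * (- F) - kv * 0ℤ + kw * 0ℤ ≡ B01 * D - B12 * F
        raw = solve-∀
        collect : ∀ {k0 k1 k2 D012w D012v D01} → k0 ≡ B₀₁ → k1 ≡ 0ℤ → k2 ≡ B₁₂ → D012w ≡ 0ℤ → D012v ≡ 0ℤ → D01 ≡ - det4 x₁ x₀ v w →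
          k0 * det4 x₁ x₂ v w - k1 * det4 x₀ x₂ v w + k2 * D01 - dot (a ⊛ x₁) v * D012w + dot (a ⊛ x₁) w * D012v ≡ B₀₁ * det4 x₁ x₂ v w - B₁₂ * det4 x₁ x₀ v w
        collect refl refl refl refl refl refl = raw B₀₁ B₁₂ (det4 x₁ x₂ v w) (det4 x₀ x₂ v w) (det4 x₁ x₀ v w) (dot (a ⊛ x₁) v) (dot (a ⊛ x₁) w)
      p₂ : B₀₁ * (c1 x₁ * c2 x₂ - c2 x₁ * c1 x₂) - B₁₂ * (c1 x₁ * c2 x₀ - c2 x₁ * c1 x₀) ≡ 0ℤ
      p₂ = trans (cong₂ (λ s t → B₀₁ * s - B₁₂ * t) (sym (det4-units₃₄ x₁ x₂)) (sym (det4-units₃₄ x₁ x₀))) (contracted (v4 0ℤ 0ℤ 1ℤ 0ℤ) (v4 0ℤ 0ℤ 0ℤ 1ℤ))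
      p₃ : B₀₁ * - (c1 x₁ * c3 x₂ - c3 x₁ * c1 x₂) - B₁₂ * - (c1 x₁ * c3 x₀ - c3 x₁ * c1 x₀) ≡ 0ℤ
      p₃ = trans (cong₂ (λ s t → B₀₁ * s - B₁₂ * t) (sym (det4-units₂₄ x₁ x₂)) (sym (det4-units₂₄ x₁ x₀))) (contracted (v4 0ℤ 1ℤ 0ℤ 0ℤ) (v4 0ℤ 0ℤ 0ℤ 1ℤ))
      p₄ : B₀₁ * (c1 x₁ * c4 x₂ - c4 x₁ * c1 x₂) - B₁₂ * (c1 x₁ * c4 x₀ - c4 x₁ * c1 x₀) ≡ 0ℤ
      p₄ = trans (cong₂ (λ s t → B₀₁ * s - B₁₂ * t) (sym (det4-units₂₃ x₁ x₂)) (sym (det4-units₂₃ x₁ x₀))) (contracted (v4 0ℤ 1ℤ 0ℤ 0ℤ) (v4 0ℤ 0ℤ 1ℤ 0ℤ))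
      zeros : ∀ α β γ a' b' c' {p q r s t u} → p ≡ 0ℤ → q ≡ 0ℤ → r ≡ 0ℤ → s ≡ 0ℤ → t ≡ 0ℤ → u ≡ 0ℤ → α * p - β * q + γ * r - a' * s + b' * t - c' * u ≡ 0ℤ
      zeros α β γ a' b' c' refl refl refl refl refl refl = raw α β γ a' b' c'
        where
        raw : ∀ α β γ a' b' c' → α * 0ℤ - β * 0ℤ + γ * 0ℤ - a' * 0ℤ + b' * 0ℤ - c' * 0ℤ ≡ 0ℤ
        raw = solve-∀

  -- Five points of the surface in a common plane.

  record Minors≢0 (a b : V4) : Set where
    field
      m12 : minor a b c1 c2 ≢ 0ℤ
      m13 : minor a b c1 c3 ≢ 0ℤ
      m14 : minor a b c1 c4 ≢ 0ℤ
      m23 : minor a b c2 c3 ≢ 0ℤ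
      m24 : minor a b c2 c4 ≢ 0ℤ
      m34 : minor a b c3 c4 ≢ 0ℤ
  open Minors≢0 public

  -- The plane of the bivector contains a coordinate axis.
  data Axis (A : B6) : Set where
    axis₁ : b23 A ≡ 0ℤ → b24 A ≡ 0ℤ → b34 A ≡ 0ℤ → Axis A
    axis₂ : b13 A ≡ 0ℤ → b14 A ≡ 0ℤ → b34 A ≡ 0ℤ → Axis A
    axis₃ : b12 A ≡ 0ℤ → b14 A ≡ 0ℤ → b24 A ≡ 0ℤ → Axis A
    axis₄ : b12 A ≡ 0ℤ → b13 A ≡ 0ℤ → b23 A ≡ 0ℤ → Axis A

  -- In the relation `cramer5` among S, P, Q, R, X, Y the coefficients of X and Y vanish by
  -- hypothesis. What remains writes S in the span of P, Q, R, tested by a functional k.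
  expansion : ∀ S P Q R X Y → det5 S P Q R Y ≡ 0ℤ → det5 S P Q R X ≡ 0ℤ → ∀ k →
    det5 P Q R X Y * dot5 k S ≡ det5 S Q R X Y * dot5 k P + (- det5 S P R X Y) * dot5 k Q + det5 S P Q X Y * dot5 k R
  expansion S P Q R X Y e e' k = trans (raw (dot5 k S) (dot5 k P) (dot5 k Q) (dot5 k R) (det5 P Q R X Y) (det5 S Q R X Y) (det5 S P R X Y) (det5 S P Q X Y))
      (trans (cong (λ t → rhs + t) (trans (sym (drop e e')) (cramer5 k S P Q R X Y))) (+-identityʳ rhs))
    where
    rhs : ℤ
    rhs = det5 S Q R X Y * dot5 k P + (- det5 S P R X Y) * dot5 k Q + det5 S P Q X Y * dot5 k R
    sumS : ℤ
    sumS = dot5 k S * det5 P Q R X Y - dot5 k P * det5 S Q R X Y + dot5 k Q * det5 S P R X Y - dot5 k R * det5 S P Q X Y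
    raw : ∀ s p q r D A B C → D * s ≡ A * p + (- B) * q + C * r + (s * D - p * A + q * B - r * C)
    raw = solve-∀
    drop : ∀ {E F} → E ≡ 0ℤ → F ≡ 0ℤ → sumS + dot5 k X * E - dot5 k Y * F ≡ sumS
    drop refl refl = raw' sumS (dot5 k X) (dot5 k Y)
      where
      raw' : ∀ s x y → s + x * 0ℤ - y * 0ℤ ≡ s
      raw' = solve-∀

  -- If p q' - p' q were nonzero, only (0 , 0) could annihilate both pairs (p , q) and (p' , q').
  -- But (σ₂ , - σ₁) and (τ₂ , - τ₁) annihilate (σ₁ , σ₂) and (τ₁ , τ₂), as these are parallel, so
  -- all four numbers are 0; then (1 , 0) annihilates as well, a contradiction.
  common-kernel : ∀ σ₁ σ₂ τ₁ τ₂ p q p' q' → σ₁ * τ₂ - σ₂ * τ₁ ≡ 0ℤ →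
    (∀ s t → s * σ₁ + t * σ₂ ≡ 0ℤ → s * τ₁ + t * τ₂ ≡ 0ℤ → s * p + t * q ≡ 0ℤ × s * p' + t * q' ≡ 0ℤ) → p * q' - p' * q ≡ 0ℤ
  common-kernel σ₁ σ₂ τ₁ τ₂ p q p' q' parallel relations = decide (p * q' - p' * q ≟ 0ℤ)
    where
    from : ∀ s t → s * σ₁ + t * σ₂ ≡ 0ℤ → s * τ₁ + t * τ₂ ≡ 0ℤ → s * (p * q' - p' * q) ≡ 0ℤ × t * (p * q' - p' * q) ≡ 0ℤ
    from s t eX eY = trans (r₁ s t p q p' q') (trans (cong₂ (λ u v → u * q' - v * q) (proj₁ (relations s t eX eY)) (proj₂ (relations s t eX eY))) (zz q' q)) ,
                     trans (r₂ s t p q p' q') (trans (cong₂ (λ u v → p * v - p' * u) (proj₁ (relations s t eX eY)) (proj₂ (relations s t eX eY))) (zz' p p'))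
      where
      r₁ : ∀ s t p q p' q' → s * (p * q' - p' * q) ≡ (s * p + t * q) * q' - (s * p' + t * q') * q
      r₁ = solve-∀
      r₂ : ∀ s t p q p' q' → t * (p * q' - p' * q) ≡ p * (s * p' + t * q') - p' * (s * p + t * q)
      r₂ = solve-∀
      zz : ∀ s t → 0ℤ * s - 0ℤ * t ≡ 0ℤ
      zz = solve-∀
      zz' : ∀ s t → s * 0ℤ - t * 0ℤ ≡ 0ℤ
      zz' = solve-∀
    unit-comb : ∀ s t → 1ℤ * s + 0ℤ * t ≡ s
    unit-comb = solve-∀
    r : ∀ s t → s * t + (- t) * s ≡ 0ℤ
    r = solve-∀
    r' : ∀ s1 s2 t1 t2 → s2 * t1 + (- s1) * t2 ≡ - (s1 * t2 - s2 * t1)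
    r' = solve-∀
    r'' : ∀ s1 s2 t1 t2 → t2 * s1 + (- t1) * s2 ≡ s1 * t2 - s2 * t1
    r'' = solve-∀
    decide : Dec (p * q' - p' * q ≡ 0ℤ) → p * q' - p' * q ≡ 0ℤ
    decide (yes z) = z
    decide (no nz) = trans (sym (*-identityˡ (p * q' - p' * q))) (proj₁ (from 1ℤ 0ℤ
        (trans (unit-comb σ₁ σ₂) (vanish σ₁ (proj₂ (from σ₂ (- σ₁) (r σ₂ σ₁) (trans (r' σ₁ σ₂ τ₁ τ₂) (cong -_ parallel))))))
        (trans (unit-comb τ₁ τ₂) (vanish τ₁ (proj₂ (from τ₂ (- τ₁) (trans (r'' σ₁ σ₂ τ₁ τ₂) parallel) (r τ₂ τ₁)))))))
      where
      vanish : ∀ s → (- s) * (p * q' - p' * q) ≡ 0ℤ → s ≡ 0ℤ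
      vanish s e = trans (sym (neg-involutive s)) (cong -_ (first (i*j≡0⇒i≡0∨j≡0 (- s) e)))
        where
        first : - s ≡ 0ℤ ⊎ p * q' - p' * q ≡ 0ℤ → - s ≡ 0ℤ
        first (inj₁ z) = z
        first (inj₂ z) = ⊥-elim (nz z)

  module _ (a b : V4) where

    -- The polar functional at P of the form α ψ₁ + β (ψ₂ - y²) in five variables.
    form : ℤ → ℤ → V5 → V5
    form α β P = v5 (pencil a b α β ⊛ vec P) (- (β * last P))

    Φ : ℤ → ℤ → V5 → V5 → ℤ
    Φ α β P R = dot5 (form α β P) R

    Φ-expand : ∀ α β P R → Φ α β P R ≡ α * bil a (vec P) (vec R) + β * (bil b (vec P) (vec R) - last P * last R)
    Φ-expand α β (v5 x y) (v5 r t) = by-ring (a ∷ b ∷ x ∷ r ∷ []) (α ∷ β ∷ y ∷ t ∷ []) (λ a b x r α β y t →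
      :dot ((α :• a :⊞ β :• b) :⊛ x) r :+ (:- (β :* y)) :* t := α :* :bil a x r :+ β :* (:bil b x r :- y :* t)) refl

    Φ-comm : ∀ α β P R → Φ α β P R ≡ Φ α β R P
    Φ-comm α β P R = trans (Φ-expand α β P R) (trans (cong₂ (λ s t → α * s + β * t) (bil-comm a (vec P) (vec R)) (cong₂ _-_ (bil-comm b (vec P) (vec R)) (*-comm (last P) (last R)))) (sym (Φ-expand α β R P)))

    Φ-self : ∀ α β P → OnS a b P → Φ α β P P ≡ 0ℤ
    Φ-self α β P (e , f) = trans (Φ-expand α β P P) (trans (cong₂ (λ s t → α * s + β * (t - last P * last P)) e f) (raw α β (last P * last P)))
      where
      raw : ∀ α β s → α * 0ℤ + β * (s - s) ≡ 0ℤ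
      raw = solve-∀

    -- X and Y complete P₀, P₁, P₂ to a basis. The vanishing of the determinants of P₃ and P₄
    -- against X and Y removes the X and Y components, so both lie in the plane of P₀, P₁, P₂. The
    -- nonzero pairings exclude collinear triples.
    record Quintuple (P₀ P₁ P₂ P₃ P₄ X Y : V5) : Set where
      field
        s₀ : OnS a b P₀
        s₁ : OnS a b P₁
        s₂ : OnS a b P₂
        s₃ : OnS a b P₃
        s₄ : OnS a b P₄
        n₀₁ : bil a (vec P₀) (vec P₁) ≢ 0ℤ
        n₀₂ : bil a (vec P₀) (vec P₂) ≢ 0ℤ
        n₁₂ : bil a (vec P₁) (vec P₂) ≢ 0ℤ
        n₃₀ : bil a (vec P₃) (vec P₀) ≢ 0ℤ
        n₃₁ : bil a (vec P₃) (vec P₁) ≢ 0ℤ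
        n₃₂ : bil a (vec P₃) (vec P₂) ≢ 0ℤ
        n₄₀ : bil a (vec P₄) (vec P₀) ≢ 0ℤ
        n₄₁ : bil a (vec P₄) (vec P₁) ≢ 0ℤ
        n₄₂ : bil a (vec P₄) (vec P₂) ≢ 0ℤ
        n₃₄ : bil a (vec P₃) (vec P₄) ≢ 0ℤ
        y₀ : last P₀ ≢ 0ℤ
        basis : det5 P₀ P₁ P₂ X Y ≢ 0ℤ
        v₃Y : det5 P₃ P₀ P₁ P₂ Y ≡ 0ℤ
        v₃X : det5 P₃ P₀ P₁ P₂ X ≡ 0ℤ
        v₄Y : det5 P₄ P₀ P₁ P₂ Y ≡ 0ℤ
        v₄X : det5 P₄ P₀ P₁ P₂ X ≡ 0ℤ

    -- Five points of a plane, no three on a line, lie on a unique conic, so some form of the pencil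
    -- vanishes on the plane; a plane in the zero set of a diagonal form of rank ≥ 4 contains an axis.
    module _ {P₀ P₁ P₂ P₃ P₄ X Y : V5} (mn : Minors≢0 a b) (five : Quintuple P₀ P₁ P₂ P₃ P₄ X Y) where
      open Quintuple five

      private
        Δ : ℤ
        Δ = det5 P₀ P₁ P₂ X Y

        relV : ∀ S → det5 S P₀ P₁ P₂ Y ≡ 0ℤ → det5 S P₀ P₁ P₂ X ≡ 0ℤ → (c : V4 → ℤ) (e : V4) → (∀ v → dot e v ≡ c v) →
          Δ * c (vec S) ≡ det5 S P₁ P₂ X Y * c (vec P₀) + (- det5 S P₀ P₂ X Y) * c (vec P₁) + det5 S P₀ P₁ X Y * c (vec P₂)
        relV S eY eX c e h = trans (cong (Δ *_) (sym (val S))) (trans (expansion S P₀ P₁ P₂ X Y eY eX (v5 e 0ℤ))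
            (cong₂ _+_ (cong₂ _+_ (cong (det5 S P₁ P₂ X Y *_) (val P₀)) (cong ((- det5 S P₀ P₂ X Y) *_) (val P₁))) (cong (det5 S P₀ P₁ X Y *_) (val P₂))))
          where
          val : ∀ R → dot5 (v5 e 0ℤ) R ≡ c (vec R)
          val R = trans (cong (λ t → dot e (vec R) + t) (*-zeroˡ (last R))) (trans (+-identityʳ (dot e (vec R))) (h (vec R)))

        dot-e1 : ∀ v → dot (v4 1ℤ 0ℤ 0ℤ 0ℤ) v ≡ c1 v
        dot-e1 v = by-ring (v ∷ []) [] (λ v → :dot (p4 (con 1ℤ) (con 0ℤ) (con 0ℤ) (con 0ℤ)) v := x1 v) refl
        dot-e2 : ∀ v → dot (v4 0ℤ 1ℤ 0ℤ 0ℤ) v ≡ c2 v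
        dot-e2 v = by-ring (v ∷ []) [] (λ v → :dot (p4 (con 0ℤ) (con 1ℤ) (con 0ℤ) (con 0ℤ)) v := x2 v) refl
        dot-e3 : ∀ v → dot (v4 0ℤ 0ℤ 1ℤ 0ℤ) v ≡ c3 v
        dot-e3 v = by-ring (v ∷ []) [] (λ v → :dot (p4 (con 0ℤ) (con 0ℤ) (con 1ℤ) (con 0ℤ)) v := x3 v) refl
        dot-e4 : ∀ v → dot (v4 0ℤ 0ℤ 0ℤ 1ℤ) v ≡ c4 v
        dot-e4 v = by-ring (v ∷ []) [] (λ v → :dot (p4 (con 0ℤ) (con 0ℤ) (con 0ℤ) (con 1ℤ)) v := x4 v) refl

        relation : ∀ S → det5 S P₀ P₁ P₂ Y ≡ 0ℤ → det5 S P₀ P₁ P₂ X ≡ 0ℤ →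
          Δ • vec S ≡ det5 S P₁ P₂ X Y • vec P₀ ⊞ (- det5 S P₀ P₂ X Y) • vec P₁ ⊞ det5 S P₀ P₁ X Y • vec P₂
        relation S eY eX = v4-ext (relV S eY eX c1 (v4 1ℤ 0ℤ 0ℤ 0ℤ) dot-e1) (relV S eY eX c2 (v4 0ℤ 1ℤ 0ℤ 0ℤ) dot-e2) (relV S eY eX c3 (v4 0ℤ 0ℤ 1ℤ 0ℤ) dot-e3) (relV S eY eX c4 (v4 0ℤ 0ℤ 0ℤ 1ℤ) dot-e4)

        module Coeffs (S : V5) (sS : OnS a b S) (n0 : bil a (vec S) (vec P₀) ≢ 0ℤ) (n1 : bil a (vec S) (vec P₁) ≢ 0ℤ) (n2 : bil a (vec S) (vec P₂) ≢ 0ℤ)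
          (eY : det5 S P₀ P₁ P₂ Y ≡ 0ℤ) (eX : det5 S P₀ P₁ P₂ X ≡ 0ℤ) where
          A B C : ℤ
          A = det5 S P₁ P₂ X Y
          B = - det5 S P₀ P₂ X Y
          C = det5 S P₀ P₁ X Y
          rel : Δ • vec S ≡ A • vec P₀ ⊞ B • vec P₁ ⊞ C • vec P₂
          rel = relation S eY eX
          A≢0 : A ≢ 0ℤ
          A≢0 z = no-relation a {vec S} {vec P₁} {vec P₂} (proj₁ sS) (proj₁ s₁) (proj₁ s₂) n1 n2 n₁₂ Δ B C basis
            (trans rel (trans (cong (λ t → t • vec P₀ ⊞ B • vec P₁ ⊞ C • vec P₂) z) (v4-ext (raw (B * c1 (vec P₁)) (c1 (vec P₀)) (C * c1 (vec P₂))) (raw (B * c2 (vec P₁)) (c2 (vec P₀)) (C * c2 (vec P₂))) (raw (B * c3 (vec P₁)) (c3 (vec P₀)) (C * c3 (vec P₂))) (raw (B * c4 (vec P₁)) (c4 (vec P₀)) (C * c4 (vec P₂))))))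
            where
            raw : ∀ s p t → 0ℤ * p + s + t ≡ s + t
            raw = solve-∀
          C≢0 : C ≢ 0ℤ
          C≢0 z = no-relation a {vec S} {vec P₀} {vec P₁} (proj₁ sS) (proj₁ s₀) (proj₁ s₁) n0 n1 n₀₁ Δ A B basis
            (trans rel (trans (cong (λ t → A • vec P₀ ⊞ B • vec P₁ ⊞ t • vec P₂) z) (v4-ext (raw (A * c1 (vec P₀)) (c1 (vec P₂)) (B * c1 (vec P₁))) (raw (A * c2 (vec P₀)) (c2 (vec P₂)) (B * c2 (vec P₁))) (raw (A * c3 (vec P₀)) (c3 (vec P₂)) (B * c3 (vec P₁))) (raw (A * c4 (vec P₀)) (c4 (vec P₂)) (B * c4 (vec P₁))))))
            where
            raw : ∀ s p t → s + t + 0ℤ * p ≡ s + t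
            raw = solve-∀
          -- With Δ S = A P₀ + B P₁ + C P₂ and all four points on the surface, the form at Δ S is 2
          -- (A B F₀₁ + A C F₀₂ + B C F₁₂) = 0. Once F₁₂ = 0, the factor 2 A can be cancelled.
          conic : ∀ α β → Φ α β P₁ P₂ ≡ 0ℤ → B * Φ α β P₀ P₁ + C * Φ α β P₀ P₂ ≡ 0ℤ
          conic α β z = *≡0-cancel (B * F01 + C * F02) (*-≢0 {+ 2} (λ ()) A≢0) (trans (raw A B C F01 F02 F12)
              (trans (cong₂ _-_ total (trans (cong (+ 2 * (B * C) *_) z) (*-zeroʳ (+ 2 * (B * C))))) refl))
            where
            F01 F02 F12 F0 F1 F2 : ℤ
            F01 = Φ α β P₀ P₁
            F02 = Φ α β P₀ P₂
            F12 = Φ α β P₁ P₂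
            F0 = Φ α β P₀ S
            F1 = Φ α β P₁ S
            F2 = Φ α β P₂ S
            raw : ∀ A B C F01 F02 F12 → + 2 * A * (B * F01 + C * F02) ≡ A * (A * 0ℤ + B * F01 + C * F02) + B * (A * F01 + B * 0ℤ + C * F12) + C * (A * F02 + B * F12 + C * 0ℤ) - + 2 * (B * C) * F12
            raw = solve-∀
            along : ∀ R → Δ * Φ α β R S ≡ A * Φ α β R P₀ + B * Φ α β R P₁ + C * Φ α β R P₂
            along R = expansion S P₀ P₁ P₂ X Y eY eX (form α β R)
            e0 : Δ * F0 ≡ A * 0ℤ + B * F01 + C * F02
            e0 = trans (along P₀) (cong (λ t → A * t + B * F01 + C * F02) (Φ-self α β P₀ s₀))
            e1 : Δ * F1 ≡ A * F01 + B * 0ℤ + C * F12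
            e1 = trans (along P₁) (cong₂ (λ t t' → A * t + B * t' + C * F12) (Φ-comm α β P₁ P₀) (Φ-self α β P₁ s₁))
            e2 : Δ * F2 ≡ A * F02 + B * F12 + C * 0ℤ
            e2 = trans (along P₂) (cong₂ (λ t t' → t + C * t') (cong₂ (λ t t' → A * t + B * t') (Φ-comm α β P₂ P₀) (Φ-comm α β P₂ P₁)) (Φ-self α β P₂ s₂))
            total : A * (A * 0ℤ + B * F01 + C * F02) + B * (A * F01 + B * 0ℤ + C * F12) + C * (A * F02 + B * F12 + C * 0ℤ) ≡ 0ℤ
            total = trans (cong₂ _+_ (cong₂ _+_ (cong (A *_) (sym e0)) (cong (B *_) (sym e1))) (cong (C *_) (sym e2)))
              (trans (fac Δ A B C F0 F1 F2) (trans (cong (Δ *_) (trans (cong₂ _+_ (cong₂ _+_ (cong (A *_) (Φ-comm α β P₀ S)) (cong (B *_) (Φ-comm α β P₁ S))) (cong (C *_) (Φ-comm α β P₂ S)))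
                (trans (sym (along S)) (trans (cong (Δ *_) (Φ-self α β S sS)) (*-zeroʳ Δ))))) (*-zeroʳ Δ)))
              where
              fac : ∀ D A B C p q r → A * (D * p) + B * (D * q) + C * (D * r) ≡ D * (A * p + B * q + C * r)
              fac = solve-∀

        module C₃ = Coeffs P₃ s₃ n₃₀ n₃₁ n₃₂ v₃Y v₃X
        module C₄ = Coeffs P₄ s₄ n₄₀ n₄₁ n₄₂ v₄Y v₄X

        -- The member of the pencil for which P₁ and P₂ are conjugate; β ≠ 0 because the two points
        -- are not orthogonal for ψ₁.
        α β : ℤ
        α = bil b (vec P₁) (vec P₂) - last P₁ * last P₂
        β = - bil a (vec P₁) (vec P₂)

        β≢0 : β ≢ 0ℤ
        β≢0 e = n₁₂ (trans (sym (neg-involutive (bil a (vec P₁) (vec P₂)))) (cong -_ e))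

        F₁₂≡0 : Φ α β P₁ P₂ ≡ 0ℤ
        F₁₂≡0 = trans (Φ-expand α β P₁ P₂) (raw (bil a (vec P₁) (vec P₂)) α)
          where
          raw : ∀ s t → t * s + (- s) * t ≡ 0ℤ
          raw = solve-∀

        -- Otherwise P₁ and P₂ can be eliminated together from the relations for P₃ and P₄, and P₃,
        -- P₄, P₀ become collinear. Nonvanishing makes the two conic equations force F₀₁ = F₀₂ = 0,
        -- so the form vanishes on the whole plane.
        independent : C₃.C * C₄.B - C₄.C * C₃.B ≢ 0ℤ
        independent z = no-relation a {vec P₃} {vec P₄} {vec P₀} (proj₁ s₃) (proj₁ s₄) (proj₁ s₀) n₃₄ n₃₀ n₄₀ (C₄.C * Δ) (C₃.C * Δ) (C₄.C * C₃.A - C₃.C * C₄.A)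
            (*-≢0 C₄.C≢0 basis) (v4-ext (coord c1 (cong c1 C₃.rel) (cong c1 C₄.rel)) (coord c2 (cong c2 C₃.rel) (cong c2 C₄.rel)) (coord c3 (cong c3 C₃.rel) (cong c3 C₄.rel)) (coord c4 (cong c4 C₃.rel) (cong c4 C₄.rel)))
          where
          raw : ∀ A B C A' B' C' p q r → C' * (A * p + B * q + C * r) ≡ C * (A' * p + B' * q + C' * r) + (C' * A - C * A') * p - (C * B' - C' * B) * q
          raw = solve-∀
          raw' : ∀ s q → s - 0ℤ * q ≡ s
          raw' = solve-∀
          coord : ∀ (c : V4 → ℤ) → Δ * c (vec P₃) ≡ C₃.A * c (vec P₀) + C₃.B * c (vec P₁) + C₃.C * c (vec P₂) → Δ * c (vec P₄) ≡ C₄.A * c (vec P₀) + C₄.B * c (vec P₁) + C₄.C * c (vec P₂) →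
            C₄.C * Δ * c (vec P₃) ≡ C₃.C * Δ * c (vec P₄) + (C₄.C * C₃.A - C₃.C * C₄.A) * c (vec P₀)
          coord c e₃ e₄ = trans (*-assoc C₄.C Δ (c (vec P₃))) (trans (cong (C₄.C *_) e₃)
            (trans (raw C₃.A C₃.B C₃.C C₄.A C₄.B C₄.C (c (vec P₀)) (c (vec P₁)) (c (vec P₂)))
            (trans (cong₂ (λ s t → C₃.C * s + (C₄.C * C₃.A - C₃.C * C₄.A) * c (vec P₀) - t * c (vec P₁)) (sym e₄) z)
            (trans (raw' (C₃.C * (Δ * c (vec P₄)) + (C₄.C * C₃.A - C₃.C * C₄.A) * c (vec P₀)) (c (vec P₁)))
              (cong (_+ (C₄.C * C₃.A - C₃.C * C₄.A) * c (vec P₀)) (sym (*-assoc C₃.C Δ (c (vec P₄)))))))))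

        F₀₂≡0 : Φ α β P₀ P₂ ≡ 0ℤ
        F₀₂≡0 = *≡0-cancel (Φ α β P₀ P₂) independent (trans (raw C₃.B C₃.C C₄.B C₄.C (Φ α β P₀ P₁) (Φ α β P₀ P₂)) (trans (cong₂ (λ s t → C₄.B * s - C₃.B * t) (C₃.conic α β F₁₂≡0) (C₄.conic α β F₁₂≡0)) (zz C₄.B C₃.B)))
          where
          raw : ∀ B C B' C' p q → (C * B' - C' * B) * q ≡ B' * (B * p + C * q) - B * (B' * p + C' * q)
          raw = solve-∀
          zz : ∀ s t → s * 0ℤ - t * 0ℤ ≡ 0ℤ
          zz = solve-∀

        F₀₁≡0 : Φ α β P₀ P₁ ≡ 0ℤ
        F₀₁≡0 = *≡0-cancel (Φ α β P₀ P₁) independent (trans (raw C₃.B C₃.C C₄.B C₄.C (Φ α β P₀ P₁) (Φ α β P₀ P₂)) (trans (cong₂ (λ s t → C₃.C * t - C₄.C * s) (C₃.conic α β F₁₂≡0) (C₄.conic α β F₁₂≡0)) (zz C₃.C C₄.C)))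
          where
          raw : ∀ B C B' C' p q → (C * B' - C' * B) * p ≡ C * (B' * p + C' * q) - C' * (B * p + C * q)
          raw = solve-∀
          zz : ∀ s t → s * 0ℤ - t * 0ℤ ≡ 0ℤ
          zz = solve-∀

        k : V4
        k = pencil a b α β

        -- The combination of the polars at P and P₀ in which the last coordinate cancels. It still
        -- kills the plane, and its coefficients are `k ⊛ δ P₀ P`.
        χ : V5 → V5
        χ P = v5 (k ⊛ δ P₀ P) 0ℤ

        χ-Φ : ∀ P R → dot5 (χ P) R ≡ last P₀ * Φ α β P R - last P * Φ α β P₀ R
        χ-Φ (v5 x y) (v5 r t) = by-ring (k ∷ x ∷ vec P₀ ∷ r ∷ []) (β ∷ y ∷ last P₀ ∷ t ∷ []) (λ k x o r β y z t →
          :dot (k :⊛ (z :• x :⊝ y :• o)) r :+ con 0ℤ :* t := z :* (:dot (k :⊛ x) r :+ (:- (β :* y)) :* t) :- y :* (:dot (k :⊛ o) r :+ (:- (β :* z)) :* t)) refl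

        χ-kills : ∀ P R → Φ α β P R ≡ 0ℤ → Φ α β P₀ R ≡ 0ℤ → dot5 (χ P) R ≡ 0ℤ
        χ-kills P R e e' = trans (χ-Φ P R) (trans (cong₂ (λ s t → last P₀ * s - last P * t) e e') (zz (last P₀) (last P)))
          where
          zz : ∀ s t → s * 0ℤ - t * 0ℤ ≡ 0ℤ
          zz = solve-∀

        comb5 : ℤ → ℤ → ℤ → V5
        comb5 r s t = v5 (r • vec (form α β P₀) ⊞ s • vec (χ P₁) ⊞ t • vec (χ P₂)) (r * last (form α β P₀) + s * 0ℤ + t * 0ℤ)

        dot5-comb : ∀ r s t V → dot5 (comb5 r s t) V ≡ r * Φ α β P₀ V + s * dot5 (χ P₁) V + t * dot5 (χ P₂) V
        dot5-comb r s t (v5 v v') = by-ring (vec (form α β P₀) ∷ vec (χ P₁) ∷ vec (χ P₂) ∷ v ∷ []) (r ∷ s ∷ t ∷ last (form α β P₀) ∷ v' ∷ []) (λ f g h v r s t f' v' →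
          :dot (r :• f :⊞ s :• g :⊞ t :• h) v :+ (r :* f' :+ s :* con 0ℤ :+ t :* con 0ℤ) :* v' := r :* (:dot f v :+ f' :* v') :+ s :* (:dot g v :+ con 0ℤ :* v') :+ t :* (:dot h v :+ con 0ℤ :* v')) refl

        zero-functional : ∀ r s t → r * Φ α β P₀ X + s * dot5 (χ P₁) X + t * dot5 (χ P₂) X ≡ 0ℤ → r * Φ α β P₀ Y + s * dot5 (χ P₁) Y + t * dot5 (χ P₂) Y ≡ 0ℤ →
          ∀ V → r * Φ α β P₀ V + s * dot5 (χ P₁) V + t * dot5 (χ P₂) V ≡ 0ℤ
        zero-functional r s t eX eY V = trans (sym (dot5-comb r s t V)) (linear-span (comb5 r s t) P₀ P₁ P₂ X Y basis
            (at P₀ (Φ-self α β P₀ s₀) (χ-kills P₁ P₀ (trans (Φ-comm α β P₁ P₀) F₀₁≡0) (Φ-self α β P₀ s₀)) (χ-kills P₂ P₀ (trans (Φ-comm α β P₂ P₀) F₀₂≡0) (Φ-self α β P₀ s₀)))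
            (at P₁ F₀₁≡0 (χ-kills P₁ P₁ (Φ-self α β P₁ s₁) F₀₁≡0) (χ-kills P₂ P₁ (trans (Φ-comm α β P₂ P₁) F₁₂≡0) F₀₁≡0))
            (at P₂ F₀₂≡0 (χ-kills P₁ P₂ F₁₂≡0 F₀₂≡0) (χ-kills P₂ P₂ (Φ-self α β P₂ s₂) F₀₂≡0))
            (trans (dot5-comb r s t X) eX) (trans (dot5-comb r s t Y) eY) V)
          where
          at : ∀ R → Φ α β P₀ R ≡ 0ℤ → dot5 (χ P₁) R ≡ 0ℤ → dot5 (χ P₂) R ≡ 0ℤ → dot5 (comb5 r s t) R ≡ 0ℤ
          at R e e' e'' = trans (dot5-comb r s t R) (trans (cong₂ _+_ (cong₂ (λ p q → r * p + s * q) e e') (cong (t *_) e'')) (zz r s t))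
            where
            zz : ∀ r s t → r * 0ℤ + s * 0ℤ + t * 0ℤ ≡ 0ℤ
            zz = solve-∀

        σ₀ σ₁ σ₂ τ₀ τ₁ τ₂ : ℤ
        σ₀ = Φ α β P₀ X
        σ₁ = dot5 (χ P₁) X
        σ₂ = dot5 (χ P₂) X
        τ₀ = Φ α β P₀ Y
        τ₁ = dot5 (χ P₁) Y
        τ₂ = dot5 (χ P₂) Y

        -- The functionals `Φ α β P₀`, `χ P₁`, `χ P₂` kill P₀, P₁, P₂, so a combination vanishes as
        -- soon as it vanishes at X and Y. The cross product of the value vectors gives such a
        -- combination. At the last basis vector only the first functional is nonzero, with value -β
        -- y₀, so its coefficient must be 0.
        parallel : σ₁ * τ₂ - σ₂ * τ₁ ≡ 0ℤ
        parallel = *≡0-cancel (σ₁ * τ₂ - σ₂ * τ₁) (*-≢0 β≢0 y₀) (trans (by-ring (k ⊛ vec P₀ ∷ k ⊛ δ P₀ P₁ ∷ k ⊛ δ P₀ P₂ ∷ []) (σ₁ * τ₂ - σ₂ * τ₁ ∷ σ₂ * τ₀ - σ₀ * τ₂ ∷ σ₀ * τ₁ - σ₁ * τ₀ ∷ β ∷ last P₀ ∷ [])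
              (λ p q w r s t β y → let O = con 0ℤ ; I = con (+ 1) ; o = p4 O O O O in β :* y :* r := :- (r :* (:dot p o :+ (:- (β :* y)) :* I) :+ s :* (:dot q o :+ O :* I) :+ t :* (:dot w o :+ O :* I))) refl)
            (cong -_ (zero-functional (σ₁ * τ₂ - σ₂ * τ₁) (σ₂ * τ₀ - σ₀ * τ₂) (σ₀ * τ₁ - σ₁ * τ₀) (raw₁ σ₀ σ₁ σ₂ τ₀ τ₁ τ₂) (raw₂ σ₀ σ₁ σ₂ τ₀ τ₁ τ₂) (v5 (v4 0ℤ 0ℤ 0ℤ 0ℤ) 1ℤ))))
          where
          raw₁ : ∀ s0 s1 s2 t0 t1 t2 → (s1 * t2 - s2 * t1) * s0 + (s2 * t0 - s0 * t2) * s1 + (s0 * t1 - s1 * t0) * s2 ≡ 0ℤ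
          raw₁ = solve-∀
          raw₂ : ∀ s0 s1 s2 t0 t1 t2 → (s1 * t2 - s2 * t1) * t0 + (s2 * t0 - s0 * t2) * t1 + (s0 * t1 - s1 * t0) * t2 ≡ 0ℤ
          raw₂ = solve-∀

        no-Φ : ∀ s t → s * σ₁ + t * σ₂ ≡ 0ℤ → s * τ₁ + t * τ₂ ≡ 0ℤ → ∀ V → s * dot5 (χ P₁) V + t * dot5 (χ P₂) V ≡ 0ℤ
        no-Φ s t eX eY V = trans (sym (raw (Φ α β P₀ V) (s * dot5 (χ P₁) V) (t * dot5 (χ P₂) V)))
            (zero-functional 0ℤ s t (trans (raw σ₀ (s * σ₁) (t * σ₂)) eX) (trans (raw τ₀ (s * τ₁) (t * τ₂)) eY) V)
          where
          raw : ∀ f u v → 0ℤ * f + u + v ≡ u + v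
          raw = solve-∀

        pair≡0 : ∀ (c c' : V4 → ℤ) e e' → (∀ v → dot v e ≡ c v) → (∀ v → dot v e' ≡ c' v) →
          c (k ⊛ δ P₀ P₁) * c' (k ⊛ δ P₀ P₂) - c' (k ⊛ δ P₀ P₁) * c (k ⊛ δ P₀ P₂) ≡ 0ℤ
        pair≡0 c c' e e' h h' = common-kernel σ₁ σ₂ τ₁ τ₂ (c (k ⊛ δ P₀ P₁)) (c (k ⊛ δ P₀ P₂)) (c' (k ⊛ δ P₀ P₁)) (c' (k ⊛ δ P₀ P₂)) parallel
            (λ s t eX eY → kills s t c e h eX eY , kills s t c' e' h' eX eY)
          where
          value : ∀ P (c : V4 → ℤ) e → (∀ v → dot v e ≡ c v) → dot5 (χ P) (v5 e 0ℤ) ≡ c (k ⊛ δ P₀ P)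
          value P c e h = trans (+-identityʳ (dot (k ⊛ δ P₀ P) e)) (h (k ⊛ δ P₀ P))
          kills : ∀ s t (c : V4 → ℤ) e → (∀ v → dot v e ≡ c v) → s * σ₁ + t * σ₂ ≡ 0ℤ → s * τ₁ + t * τ₂ ≡ 0ℤ → s * c (k ⊛ δ P₀ P₁) + t * c (k ⊛ δ P₀ P₂) ≡ 0ℤ
          kills s t c e h eX eY = trans (cong₂ (λ u v → s * u + t * v) (sym (value P₁ c e h)) (sym (value P₂ c e h))) (no-Φ s t eX eY (v5 e 0ℤ))

        W≡0 : ∀ k k' d d' e e' → k * d * (k' * e') - k' * d' * (k * e) ≡ 0ℤ → k ≢ 0ℤ → k' ≢ 0ℤ → d * e' - d' * e ≡ 0ℤ
        W≡0 k k' d d' e e' z nk nk' = *≡0-cancel (d * e' - d' * e) (*-≢0 nk nk') (trans (raw k k' d d' e e') z)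
          where
          raw : ∀ k k' d d' e e' → k * k' * (d * e' - d' * e) ≡ k * d * (k' * e') - k' * d' * (k * e)
          raw = solve-∀

        other : ∀ a₁ b₁ a₂ b₂ → a₁ * b₂ - a₂ * b₁ ≢ 0ℤ → α * a₁ + β * b₁ ≡ 0ℤ → α * a₂ + β * b₂ ≢ 0ℤ
        other a₁ b₁ a₂ b₂ nm z z' = β≢0 ([ (λ e → e) , (λ e → ⊥-elim (nm e)) ] (i*j≡0⇒i≡0∨j≡0 β (trans (raw α β a₁ b₁ a₂ b₂) (trans (cong₂ (λ s t → a₁ * t - a₂ * s) z z') (zz a₁ a₂)))))
          where
          raw : ∀ α β a₁ b₁ a₂ b₂ → β * (a₁ * b₂ - a₂ * b₁) ≡ a₁ * (α * a₂ + β * b₂) - a₂ * (α * a₁ + β * b₁)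
          raw = solve-∀
          zz : ∀ s t → s * 0ℤ - t * 0ℤ ≡ 0ℤ
          zz = solve-∀

        v1 : ∀ v → dot v (v4 1ℤ 0ℤ 0ℤ 0ℤ) ≡ c1 v
        v1 v = by-ring (v ∷ []) [] (λ v → :dot v (p4 (con 1ℤ) (con 0ℤ) (con 0ℤ) (con 0ℤ)) := x1 v) refl
        v2 : ∀ v → dot v (v4 0ℤ 1ℤ 0ℤ 0ℤ) ≡ c2 v
        v2 v = by-ring (v ∷ []) [] (λ v → :dot v (p4 (con 0ℤ) (con 1ℤ) (con 0ℤ) (con 0ℤ)) := x2 v) refl
        v3 : ∀ v → dot v (v4 0ℤ 0ℤ 1ℤ 0ℤ) ≡ c3 v
        v3 v = by-ring (v ∷ []) [] (λ v → :dot v (p4 (con 0ℤ) (con 0ℤ) (con 1ℤ) (con 0ℤ)) := x3 v) refl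
        v4′ : ∀ v → dot v (v4 0ℤ 0ℤ 0ℤ 1ℤ) ≡ c4 v
        v4′ v = by-ring (v ∷ []) [] (λ v → :dot v (p4 (con 0ℤ) (con 0ℤ) (con 0ℤ) (con 1ℤ)) := x4 v) refl

        δ₁ δ₂ : V4
        δ₁ = δ P₀ P₁
        δ₂ = δ P₀ P₂
        w12 : c1 k ≢ 0ℤ → c2 k ≢ 0ℤ → b12 (wedge δ₁ δ₂) ≡ 0ℤ
        w12 = W≡0 (c1 k) (c2 k) (c1 δ₁) (c2 δ₁) (c1 δ₂) (c2 δ₂) (pair≡0 c1 c2 (v4 1ℤ 0ℤ 0ℤ 0ℤ) (v4 0ℤ 1ℤ 0ℤ 0ℤ) v1 v2)
        w13 : c1 k ≢ 0ℤ → c3 k ≢ 0ℤ → b13 (wedge δ₁ δ₂) ≡ 0ℤ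
        w13 = W≡0 (c1 k) (c3 k) (c1 δ₁) (c3 δ₁) (c1 δ₂) (c3 δ₂) (pair≡0 c1 c3 (v4 1ℤ 0ℤ 0ℤ 0ℤ) (v4 0ℤ 0ℤ 1ℤ 0ℤ) v1 v3)
        w14 : c1 k ≢ 0ℤ → c4 k ≢ 0ℤ → b14 (wedge δ₁ δ₂) ≡ 0ℤ
        w14 = W≡0 (c1 k) (c4 k) (c1 δ₁) (c4 δ₁) (c1 δ₂) (c4 δ₂) (pair≡0 c1 c4 (v4 1ℤ 0ℤ 0ℤ 0ℤ) (v4 0ℤ 0ℤ 0ℤ 1ℤ) v1 v4′)
        w23 : c2 k ≢ 0ℤ → c3 k ≢ 0ℤ → b23 (wedge δ₁ δ₂) ≡ 0ℤ
        w23 = W≡0 (c2 k) (c3 k) (c2 δ₁) (c3 δ₁) (c2 δ₂) (c3 δ₂) (pair≡0 c2 c3 (v4 0ℤ 1ℤ 0ℤ 0ℤ) (v4 0ℤ 0ℤ 1ℤ 0ℤ) v2 v3)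
        w24 : c2 k ≢ 0ℤ → c4 k ≢ 0ℤ → b24 (wedge δ₁ δ₂) ≡ 0ℤ
        w24 = W≡0 (c2 k) (c4 k) (c2 δ₁) (c4 δ₁) (c2 δ₂) (c4 δ₂) (pair≡0 c2 c4 (v4 0ℤ 1ℤ 0ℤ 0ℤ) (v4 0ℤ 0ℤ 0ℤ 1ℤ) v2 v4′)
        w34 : c3 k ≢ 0ℤ → c4 k ≢ 0ℤ → b34 (wedge δ₁ δ₂) ≡ 0ℤ
        w34 = W≡0 (c3 k) (c4 k) (c3 δ₁) (c4 δ₁) (c3 δ₂) (c4 δ₂) (pair≡0 c3 c4 (v4 0ℤ 0ℤ 1ℤ 0ℤ) (v4 0ℤ 0ℤ 0ℤ 1ℤ) v3 v4′)

        o12 : c1 k ≡ 0ℤ → c2 k ≢ 0ℤ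
        o12 = other (c1 a) (c1 b) (c2 a) (c2 b) (m12 mn)
        o13 : c1 k ≡ 0ℤ → c3 k ≢ 0ℤ
        o13 = other (c1 a) (c1 b) (c3 a) (c3 b) (m13 mn)
        o14 : c1 k ≡ 0ℤ → c4 k ≢ 0ℤ
        o14 = other (c1 a) (c1 b) (c4 a) (c4 b) (m14 mn)
        o23 : c2 k ≡ 0ℤ → c3 k ≢ 0ℤ
        o23 = other (c2 a) (c2 b) (c3 a) (c3 b) (m23 mn)
        o24 : c2 k ≡ 0ℤ → c4 k ≢ 0ℤ
        o24 = other (c2 a) (c2 b) (c4 a) (c4 b) (m24 mn)
        o34 : c3 k ≡ 0ℤ → c4 k ≢ 0ℤ
        o34 = other (c3 a) (c3 b) (c4 a) (c4 b) (m34 mn)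

      plane-contains-axis : Axis (wedge (δ P₀ P₁) (δ P₀ P₂))
      -- At most one entry of `k` is 0 because the minors of a, b are nonzero. A minor of the
      -- differences vanishes when both entries of `k` at its indices are nonzero, so those that
      -- avoid the index of a zero entry vanish. With no zero entry all minors vanish and any axis
      -- can be named.
      plane-contains-axis = by₁ (c1 k ≟ 0ℤ)
        where
        by₃ : c1 k ≢ 0ℤ → c2 k ≢ 0ℤ → Dec (c3 k ≡ 0ℤ) → Axis (wedge δ₁ δ₂)
        by₃ n₁ n₂ (yes z) = axis₃ (w12 n₁ n₂) (w14 n₁ (o34 z)) (w24 n₂ (o34 z))
        by₃ n₁ n₂ (no n₃) = axis₄ (w12 n₁ n₂) (w13 n₁ n₃) (w23 n₂ n₃)
        by₂ : c1 k ≢ 0ℤ → Dec (c2 k ≡ 0ℤ) → Axis (wedge δ₁ δ₂)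
        by₂ n₁ (yes z) = axis₂ (w13 n₁ (o23 z)) (w14 n₁ (o24 z)) (w34 (o23 z) (o24 z))
        by₂ n₁ (no n₂) = by₃ n₁ n₂ (c3 k ≟ 0ℤ)
        by₁ : Dec (c1 k ≡ 0ℤ) → Axis (wedge δ₁ δ₂)
        by₁ (yes z) = axis₁ (w23 (o12 z) (o13 z)) (w24 (o12 z) (o14 z)) (w34 (o13 z) (o14 z))
        by₁ (no n₁) = by₂ n₁ (c2 k ≟ 0ℤ)

-- Size, content and divisibility of nonzero determinants.

module Counting where
  open import Defs renaming (M to count)
  import Data.List.Relation.Unary.Unique.Propositional.Properties as Unique
  import Data.Nat.Divisibility as ℕ
  import Data.Nat.Properties as ℕ
  import Data.Nat.Solver as ℕS
  import Data.Vec.Properties as Vec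
  open import Data.Empty using (⊥-elim; ⊥)
  open import Data.Fin as Fin using (Fin; zero; suc)
  open import Data.Integer using (ℤ; +_; _+_; _*_; _-_; -_; 0ℤ; 1ℤ; _≟_; ≢-nonZero; -[1+_]) renaming (∣_∣ to abs)
  open import Data.Integer.DivMod using (_/ℕ_)
  open import Data.Integer.Divisibility.Signed
  open import Data.Integer.Properties hiding (_≟_)
  open import Data.Integer.Tactic.RingSolver using (solve-∀)
  open import Data.List.Base using (List; []; _∷_; length; _++_; map; concatMap; filter; upTo)
  open import Data.List.Membership.Propositional using (_∈_)
  open import Data.List.Membership.Propositional.Properties using (∈-++⁺ʳ; ∈-++⁻; ∈-map⁻; ∈-filter⁻; ∈-upTo⁻)
  open import Data.List.Properties using (length-map)
  open import Data.List.Relation.Unary.All as All using (All; []; _∷_)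
  open import Data.List.Relation.Unary.AllPairs using ([]; _∷_)
  open import Data.List.Relation.Unary.Any using (here; there)
  open import Data.List.Relation.Unary.Unique.Propositional using (Unique)
  open import Data.Nat as ℕ using (ℕ; zero; suc; s≤s; z≤n)
  open import Data.Nat.GCD using (gcd; gcd[m,n]∣m; gcd[m,n]∣n; c*gcd[m,n]≡gcd[cm,cn])
  open import Data.Nat.Primality using (Prime; prime⇒nonZero; prime⇒nonTrivial)
  open import Data.Product using (∃-syntax; _×_; _,_; proj₁; proj₂)
  open import Data.Sum using (_⊎_; inj₁; inj₂)
  open import Data.Unit using (⊤; tt)
  open import Data.Vec.Base using (Vec; []; _∷_; lookup)
  open import Function.Base using (_∘_)
  open import Relation.Binary.PropositionalEquality hiding ([_])
  open import Relation.Nullary using (Dec; yes; no; ¬_)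
  open import Relation.Nullary.Decidable using (¬?)
  open import Relation.Unary using (Decidable)
  open Naturals
  open Geometry

  record _≤v_ (u : V4) (n : ℕ) : Set where
    constructor bounds
    field
      l1 : abs (c1 u) ℕ.≤ n
      l2 : abs (c2 u) ℕ.≤ n
      l3 : abs (c3 u) ℕ.≤ n
      l4 : abs (c4 u) ℕ.≤ n
  open _≤v_ public

  abs-*-≤ : ∀ {m n i j} → abs i ℕ.≤ m → abs j ℕ.≤ n → abs (i * j) ℕ.≤ m ℕ.* n
  abs-*-≤ {i = i} {j} p q = ℕ.≤-trans (ℕ.≤-reflexive (abs-* i j)) (ℕ.*-mono-≤ p q)

  abs-+-≤ : ∀ {m n i j} → abs i ℕ.≤ m → abs j ℕ.≤ n → abs (i + j) ℕ.≤ m ℕ.+ n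
  abs-+-≤ {i = i} {j} p q = ℕ.≤-trans (∣i+j∣≤∣i∣+∣j∣ i j) (ℕ.+-mono-≤ p q)

  abs-−-≤ : ∀ {m n i j} → abs i ℕ.≤ m → abs j ℕ.≤ n → abs (i - j) ℕ.≤ m ℕ.+ n
  abs-−-≤ {i = i} {j} p q = ℕ.≤-trans (∣i-j∣≤∣i∣+∣j∣ i j) (ℕ.+-mono-≤ p q)

  opaque
    unfolding det4
    det4-bound : ∀ n u v w z → u ≤v n → v ≤v n → w ≤v n → z ≤v n → abs (det4 u v w z) ℕ.≤ 24 ℕ.* n ℕ.^ 4
    det4-bound n u v w z bu bv bw bz = ℕ.≤-trans
      (sum6 (b12 A * b34 B) (b13 A * b24 B) (b14 A * b23 B) (b23 A * b14 B) (b24 A * b13 B) (b34 A * b12 B)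
        (m {b12 A} {b34 B} (w12 u v bu bv) (w34 w z bw bz)) (m {b13 A} {b24 B} (w13 u v bu bv) (w24 w z bw bz)) (m {b14 A} {b23 B} (w14 u v bu bv) (w23 w z bw bz))
        (m {b23 A} {b14 B} (w23 u v bu bv) (w14 w z bw bz)) (m {b24 A} {b13 B} (w24 u v bu bv) (w13 w z bw bz)) (m {b34 A} {b12 B} (w34 u v bu bv) (w12 w z bw bz)))
      (ℕ.≤-reflexive (solve 1 (λ n → let nn = n :* n :+ n :* n ; t = nn :* nn in t :+ t :+ t :+ t :+ t :+ t := con 24 :* (n :* (n :* (n :* (n :* con 1))))) refl n))
      where
      open ℕS.+-*-Solver
      A B : B6
      A = wedge u v
      B = wedge w z
      sum6 : ∀ p q r s t o {k} → abs p ℕ.≤ k → abs q ℕ.≤ k → abs r ℕ.≤ k → abs s ℕ.≤ k → abs t ℕ.≤ k → abs o ℕ.≤ k →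
        abs (p - q + r + s - t + o) ℕ.≤ k ℕ.+ k ℕ.+ k ℕ.+ k ℕ.+ k ℕ.+ k
      sum6 p q r s t o lp lq lr ls lt lo = abs-+-≤ {i = p - q + r + s - t} {o} (abs-−-≤ {i = p - q + r + s} {t} (abs-+-≤ {i = p - q + r} {s} (abs-+-≤ {i = p - q} {r} (abs-−-≤ {i = p} {q} lp lq) lr) ls) lt) lo
      m : ∀ {i j} → abs i ℕ.≤ n ℕ.* n ℕ.+ n ℕ.* n → abs j ℕ.≤ n ℕ.* n ℕ.+ n ℕ.* n → abs (i * j) ℕ.≤ (n ℕ.* n ℕ.+ n ℕ.* n) ℕ.* (n ℕ.* n ℕ.+ n ℕ.* n)
      m {i} {j} = abs-*-≤ {i = i} {j}
      W : ℤ → ℤ → ℤ → ℤ → Set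
      W p q r s = abs (p * q - r * s) ℕ.≤ n ℕ.* n ℕ.+ n ℕ.* n
      ww : ∀ {p q r s} → abs p ℕ.≤ n → abs q ℕ.≤ n → abs r ℕ.≤ n → abs s ℕ.≤ n → W p q r s
      ww {p} {q} {r} {s} a b c d = abs-−-≤ {i = p * q} {r * s} (abs-*-≤ {i = p} {q} a b) (abs-*-≤ {i = r} {s} c d)
      w12 : ∀ u v → u ≤v n → v ≤v n → abs (b12 (wedge u v)) ℕ.≤ n ℕ.* n ℕ.+ n ℕ.* n
      w12 u v p q = ww {c1 u} {c2 v} {c2 u} {c1 v} (l1 p) (l2 q) (l2 p) (l1 q)
      w13 : ∀ u v → u ≤v n → v ≤v n → abs (b13 (wedge u v)) ℕ.≤ n ℕ.* n ℕ.+ n ℕ.* n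
      w13 u v p q = ww {c1 u} {c3 v} {c3 u} {c1 v} (l1 p) (l3 q) (l3 p) (l1 q)
      w14 : ∀ u v → u ≤v n → v ≤v n → abs (b14 (wedge u v)) ℕ.≤ n ℕ.* n ℕ.+ n ℕ.* n
      w14 u v p q = ww {c1 u} {c4 v} {c4 u} {c1 v} (l1 p) (l4 q) (l4 p) (l1 q)
      w23 : ∀ u v → u ≤v n → v ≤v n → abs (b23 (wedge u v)) ℕ.≤ n ℕ.* n ℕ.+ n ℕ.* n
      w23 u v p q = ww {c2 u} {c3 v} {c3 u} {c2 v} (l2 p) (l3 q) (l3 p) (l2 q)
      w24 : ∀ u v → u ≤v n → v ≤v n → abs (b24 (wedge u v)) ℕ.≤ n ℕ.* n ℕ.+ n ℕ.* n
      w24 u v p q = ww {c2 u} {c4 v} {c4 u} {c2 v} (l2 p) (l4 q) (l4 p) (l2 q)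
      w34 : ∀ u v → u ≤v n → v ≤v n → abs (b34 (wedge u v)) ℕ.≤ n ℕ.* n ℕ.+ n ℕ.* n
      w34 u v p q = ww {c3 u} {c4 v} {c4 u} {c3 v} (l3 p) (l4 q) (l4 p) (l3 q)

    det4-content : ∀ g u v w z → g ∣v u → g ∣v v → g ∣v w → g ∣v z → g * g * (g * g) ∣ det4 u v w z
    det4-content g u v w z du dv dw dz = pair-div (g * g * (g * g)) u v w z ∣-refl ∣-refl ∣-refl
        (ww (d1 du) (d2 dv) (d2 du) (d1 dv)) (ww (d1 du) (d3 dv) (d3 du) (d1 dv)) (ww (d1 du) (d4 dv) (d4 du) (d1 dv))
        (ww (d2 du) (d3 dv) (d3 du) (d2 dv)) (ww (d2 du) (d4 dv) (d4 du) (d2 dv)) (ww (d3 du) (d4 dv) (d4 du) (d3 dv))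
        (ww (d1 dw) (d2 dz) (d2 dw) (d1 dz)) (ww (d1 dw) (d3 dz) (d3 dw) (d1 dz)) (ww (d1 dw) (d4 dz) (d4 dw) (d1 dz))
        (ww (d2 dw) (d3 dz) (d3 dw) (d2 dz)) (ww (d2 dw) (d4 dz) (d4 dw) (d2 dz)) (ww (d3 dw) (d4 dz) (d4 dw) (d3 dz))
      where
      ww : ∀ {p q r s} → g ∣ p → g ∣ q → g ∣ r → g ∣ s → g * g ∣ p * q - r * s
      ww a b c d = ∣m∣n⇒∣m-n (*-pres-∣ a b) (*-pres-∣ c d)

  record Bounded (n : ℕ) (P : V5) : Set where
    constructor bounded
    field
      vec≤ : vec P ≤v n
      last≤ : abs (last P) ℕ.≤ n
  open Bounded public

  opaque
    unfolding det5
    det5-bound : ∀ n P Q R S U → Bounded n P → Bounded n Q → Bounded n R → Bounded n S → Bounded n U → abs (det5 P Q R S U) ℕ.≤ 120 ℕ.* n ℕ.^ 5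
    det5-bound n P Q R S U p q r s u = ℕ.≤-trans
      (sum5 (last P * det4 (vec Q) (vec R) (vec S) (vec U)) (last Q * det4 (vec P) (vec R) (vec S) (vec U)) (last R * det4 (vec P) (vec Q) (vec S) (vec U)) (last S * det4 (vec P) (vec Q) (vec R) (vec U)) (last U * det4 (vec P) (vec Q) (vec R) (vec S))
        (m P p {det4 (vec Q) (vec R) (vec S) (vec U)} (b Q R S U q r s u)) (m Q q {det4 (vec P) (vec R) (vec S) (vec U)} (b P R S U p r s u)) (m R r {det4 (vec P) (vec Q) (vec S) (vec U)} (b P Q S U p q s u)) (m S s {det4 (vec P) (vec Q) (vec R) (vec U)} (b P Q R U p q r u)) (m U u {det4 (vec P) (vec Q) (vec R) (vec S)} (b P Q R S p q r s)))
      (ℕ.≤-reflexive (solve 2 (λ n t → n :* (con 24 :* t) :+ n :* (con 24 :* t) :+ n :* (con 24 :* t) :+ n :* (con 24 :* t) :+ n :* (con 24 :* t) := con 120 :* (n :* t)) refl n (n ℕ.^ 4)))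
      where
      open ℕS.+-*-Solver
      sum5 : ∀ p q r s t {k} → abs p ℕ.≤ k → abs q ℕ.≤ k → abs r ℕ.≤ k → abs s ℕ.≤ k → abs t ℕ.≤ k →
        abs (p - q + r - s + t) ℕ.≤ k ℕ.+ k ℕ.+ k ℕ.+ k ℕ.+ k
      sum5 p q r s t lp lq lr ls lt = abs-+-≤ {i = p - q + r - s} {t} (abs-−-≤ {i = p - q + r} {s} (abs-+-≤ {i = p - q} {r} (abs-−-≤ {i = p} {q} lp lq) lr) ls) lt
      b : ∀ Q R S U → Bounded n Q → Bounded n R → Bounded n S → Bounded n U → abs (det4 (vec Q) (vec R) (vec S) (vec U)) ℕ.≤ 24 ℕ.* n ℕ.^ 4
      b Q R S U q r s u = det4-bound n (vec Q) (vec R) (vec S) (vec U) (vec≤ q) (vec≤ r) (vec≤ s) (vec≤ u)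
      m : ∀ P → Bounded n P → ∀ {d} → abs d ℕ.≤ 24 ℕ.* n ℕ.^ 4 → abs (last P * d) ℕ.≤ n ℕ.* (24 ℕ.* n ℕ.^ 4)
      m P p {d} = abs-*-≤ {i = last P} {d} (last≤ p)

    det5-content : ∀ g P Q R S U → g ∣v vec P → g ∣v vec Q → g ∣v vec R → g ∣v vec S → g ∣v vec U → g * g * (g * g) ∣ det5 P Q R S U
    det5-content g P Q R S U p q r s u = ∣m∣n⇒∣m+n (∣m∣n⇒∣m-n (∣m∣n⇒∣m+n (∣m∣n⇒∣m-n
      (∣n⇒∣m*n (last P) (det4-content g (vec Q) (vec R) (vec S) (vec U) q r s u)) (∣n⇒∣m*n (last Q) (det4-content g (vec P) (vec R) (vec S) (vec U) p r s u)))
      (∣n⇒∣m*n (last R) (det4-content g (vec P) (vec Q) (vec S) (vec U) p q s u))) (∣n⇒∣m*n (last S) (det4-content g (vec P) (vec Q) (vec R) (vec U) p q r u)))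
      (∣n⇒∣m*n (last U) (det4-content g (vec P) (vec Q) (vec R) (vec S) p q r s))

  -- Four of the five columns are divisible by g, which contributes g⁴. As p does not divide g, this
  -- is coprime to the power of p, so the product divides the nonzero determinant and is at most its
  -- absolute value.
  det5-inequality : ∀ {p} (pp : Prime p) e g n P Q R S U → ¬ + p ∣ + g →
    + g ∣v vec P → + g ∣v vec Q → + g ∣v vec R → + g ∣v vec S → + g ∣v vec U →
    Bounded n P → Bounded n Q → Bounded n R → Bounded n S → Bounded n U →
    det5 P Q R S U ≢ 0ℤ → pw pp e ∣ det5 P Q R S U → p ℕ.^ e ℕ.* g ℕ.^ 4 ℕ.≤ 120 ℕ.* n ℕ.^ 5
  det5-inequality {p} pp e g n P Q R S U p∤g dP dQ dR dS dU bP bQ bR bS bU ne div =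
    ℕ.≤-trans (go (det5-content (+ g) P Q R S U dP dQ dR dS dU)) (det5-bound n P Q R S U bP bQ bR bS bU)
    where
    G : ℤ
    G = + g * + g * (+ g * + g)
    p∤G : ¬ + p ∣ G
    p∤G = ∤-* pp (+ g * + g) (+ g * + g) (∤-* pp (+ g) (+ g) p∤g p∤g) (∤-* pp (+ g) (+ g) p∤g p∤g)
    G≡ : G ≡ + (g ℕ.^ 4)
    G≡ = trans (cong₂ _*_ (sym (pos-* g g)) (sym (pos-* g g))) (trans (sym (pos-* (g ℕ.* g) (g ℕ.* g))) (cong +_ (solve 1 (λ g → g :* g :* (g :* g) := g :* (g :* (g :* (g :* con 1)))) refl g)))
      where open ℕS.+-*-Solver
    go : G ∣ det5 P Q R S U → p ℕ.^ e ℕ.* g ℕ.^ 4 ℕ.≤ abs (det5 P Q R S U)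
    go (divides t eq) = ∣-size (subst₂ _∣_ (trans (cong (pw pp e *_) G≡) (sym (pos-* (p ℕ.^ e) (g ℕ.^ 4)))) (sym eq)
        (*-monoˡ-∣ G (pw-cancel pp e G t p∤G (∣-resp-≡ (trans eq (*-comm t G)) div)))) ne

  private
    dot-flip₁₂ : ∀ g u → dot (flip₁₂ g) (flip₁₂ u) ≡ dot g u
    dot-flip₁₂ g u = raw (c1 g * c1 u) (c2 g * c2 u) (c3 g * c3 u) (c4 g * c4 u)
      where
      raw : ∀ p q r s → q + p + r + s ≡ p + q + r + s
      raw = solve-∀
    dot-flip₁₃ : ∀ g u → dot (flip₁₃ g) (flip₁₃ u) ≡ dot g u
    dot-flip₁₃ g u = raw (c1 g * c1 u) (c2 g * c2 u) (c3 g * c3 u) (c4 g * c4 u)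
      where
      raw : ∀ p q r s → r + q + p + s ≡ p + q + r + s
      raw = solve-∀
    dot-flip₁₄ : ∀ g u → dot (flip₁₄ g) (flip₁₄ u) ≡ dot g u
    dot-flip₁₄ g u = raw (c1 g * c1 u) (c2 g * c2 u) (c3 g * c3 u) (c4 g * c4 u)
      where
      raw : ∀ p q r s → s + q + r + p ≡ p + q + r + s
      raw = solve-∀

    dot-pencil : ∀ a b x s t u → dot ((s • b ⊝ t • a) ⊛ x) u ≡ s * dot (b ⊛ x) u - t * dot (a ⊛ x) u
    dot-pencil a b x s t u = raw s t (c1 a) (c2 a) (c3 a) (c4 a) (c1 b) (c2 b) (c3 b) (c4 b) (c1 x) (c2 x) (c3 x) (c4 x) (c1 u) (c2 u) (c3 u) (c4 u)
      where
      raw : ∀ s t a1 a2 a3 a4 b1 b2 b3 b4 x1 x2 x3 x4 u1 u2 u3 u4 →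
        (s * b1 - t * a1) * x1 * u1 + (s * b2 - t * a2) * x2 * u2 + (s * b3 - t * a3) * x3 * u3 + (s * b4 - t * a4) * x4 * u4 ≡
        s * (b1 * x1 * u1 + b2 * x2 * u2 + b3 * x3 * u3 + b4 * x4 * u4) - t * (a1 * x1 * u1 + a2 * x2 * u2 + a3 * x3 * u3 + a4 * x4 * u4)
      raw = solve-∀

    self-minor : ∀ s t x → (s * t - t * s) * x ≡ 0ℤ
    self-minor = solve-∀

    neg≡0 : ∀ {m n} → m ≡ - n → n ≡ 0ℤ → m ≡ 0ℤ
    neg≡0 e refl = e

  -- The form of the pencil without the variable of the axis supplies the second tangential row.
  module _ {a b : V4} {p : ℕ} (gp : GoodPrime a b p) where

    private
      pp = isPrime gp

      ∤-minor : ∀ {s t s' t' x} → ¬ + p ∣ s * t' - s' * t → ¬ + p ∣ x → ¬ + p ∣ (s * t' - t * s') * x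
      ∤-minor {s} {t} {s'} {t'} {x} n nx = ∤-* pp (s * t' - t * s') x (λ d → n (∣-resp-≡ (raw s t s' t') d)) nx
        where
        raw : ∀ s t s' t' → s * t' - t * s' ≡ s * t' - s' * t
        raw = solve-∀

      ∤-minor' : ∀ {s t s' t' x} → ¬ + p ∣ s' * t - s * t' → ¬ + p ∣ x → ¬ + p ∣ (s * t' - t * s') * x
      ∤-minor' {s} {t} {s'} {t'} {x} n nx = ∤-* pp (s * t' - t * s') x (λ d → n (∣-resp-≡ (raw s t s' t') (∣m⇒∣-m d))) nx
        where
        raw : ∀ s t s' t' → - (s * t' - t * s') ≡ s' * t - s * t'
        raw = solve-∀

    det4-axis-div : ∀ e e₃ e₄ P R₁ R₂ R₃ R₄ → UnitPoint p P → e₃ ℕ.≤ e → e₄ ℕ.≤ e₃ →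
      InΛ a b (pw pp e) P R₁ → InΛ a b (pw pp e) P R₂ → InΛ a b (pw pp e₃) P R₃ → InΛ a b (pw pp e₄) P R₄ →
      Axis (wedge (δ P R₁) (δ P R₂)) → pw pp (3 ℕ.* e ℕ.+ e₃ ℕ.+ 2 ℕ.* e₄) ∣ det4 (δ P R₁) (δ P R₂) (δ P R₃) (δ P R₄)
    det4-axis-div e e₃ e₄ P R₁ R₂ R₃ R₄ up e₃≤e e₄≤e₃ (inΛ n₁ f₁ h₁) (inΛ n₂ f₂ h₂) (inΛ n₃ f₃ h₃) (inΛ n₄ f₄ h₄) = cases
      where
      q r t : ℤ
      q = pw pp e
      r = pw pp e₃
      t = pw pp e₄
      x : V4
      x = vec P
      g : V4
      g = a ⊛ x
      E : ℕ
      E = 3 ℕ.* e ℕ.+ e₃ ℕ.+ 2 ℕ.* e₄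
      δ₁ δ₂ δ₃ δ₄ : V4
      δ₁ = δ P R₁
      δ₂ = δ P R₂
      δ₃ = δ P R₃
      δ₄ = δ P R₄
      E-≡ : q * q * (q * r * (t * t)) ≡ pw pp E
      E-≡ = trans (cong₂ (λ s s' → s * s') (sym (pw-+ pp e e)) (cong₂ _*_ (sym (pw-+ pp e e₃)) (sym (pw-+ pp e₄ e₄))))
        (trans (cong (pw pp (e ℕ.+ e) *_) (sym (pw-+ pp (e ℕ.+ e₃) (e₄ ℕ.+ e₄)))) (trans (sym (pw-+ pp (e ℕ.+ e) (e ℕ.+ e₃ ℕ.+ (e₄ ℕ.+ e₄))))
          (cong (pw pp) (solve 3 (λ e f g → e :+ e :+ (e :+ f :+ (g :+ g)) := con 3 :* e :+ f :+ con 2 :* g) refl e e₃ e₄))))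
        where open ℕS.+-*-Solver
      r∣q : r ∣ q
      r∣q = pw∣pw pp e₃≤e
      t∣r : t ∣ r
      t∣r = pw∣pw pp e₄≤e₃
      H : ℤ → ℤ → V4
      H s s' = (s • b ⊝ s' • a) ⊛ x
      Hdiv : ∀ {n} s s' u → n ∣ dot (a ⊛ x) u → n ∣ dot (b ⊛ x) u → n ∣ dot (H s s') u
      Hdiv s s' u da db = ∣-resp-≡ (sym (dot-pencil a b x s s' u)) (∣m∣n⇒∣m-n (∣n⇒∣m*n s db) (∣n⇒∣m*n s' da))
      strip : ∀ u v {d d'} → ¬ + p ∣ u → ¬ + p ∣ v → d' ≡ - d → q * q * (q * r * (t * t)) ∣ u * (v * d') → pw pp E ∣ d
      strip u v {d} {d'} nu nv e div = ∣-resp-≡ (trans (cong -_ e) (neg-involutive d)) (∣m⇒∣-m (pw-cancel pp E v d' nv (pw-cancel pp E u (v * d') nu (subst (_∣ u * (v * d')) E-≡ div))))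
      f12 : ∀ {n u} → n ∣v u → n ∣v flip₁₂ u
      f12 (divs e1 e2 e3 e4) = divs e2 e1 e3 e4
      f13 : ∀ {n u} → n ∣v u → n ∣v flip₁₃ u
      f13 (divs e1 e2 e3 e4) = divs e3 e2 e1 e4
      f14 : ∀ {n u} → n ∣v u → n ∣v flip₁₄ u
      f14 (divs e1 e2 e3 e4) = divs e4 e2 e3 e1
      swap-neg : ∀ p q r s → p * q - r * s ≡ - (r * s - p * q)
      swap-neg = solve-∀
      cases : Axis (wedge δ₁ δ₂) → pw pp E ∣ det4 δ₁ δ₂ δ₃ δ₄
      cases (axis₁ z₁ z₂ z₃) = pw-cancel pp E (c1 g) (det4 δ₁ δ₂ δ₃ δ₄) (∤-* pp (c1 a) (c1 x) (ua1 gp) (ux1 up))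
        (pw-cancel pp E (c2 h) (c1 g * det4 δ₁ δ₂ δ₃ δ₄) (∤-minor {c1 a} {c1 b} {c2 a} {c2 b} (um12 gp) (ux2 up)) (subst (_∣ c2 h * (c1 g * det4 δ₁ δ₂ δ₃ δ₄)) E-≡
          (det4-conic-div q r t g h δ₁ δ₂ δ₃ δ₄ r∣q t∣r (self-minor (c1 a) (c1 b) (c1 x)) z₁ z₂ z₃ n₁ f₁ (Hdiv (c1 a) (c1 b) δ₁ f₁ h₁) n₂ f₂ (Hdiv (c1 a) (c1 b) δ₂ f₂ h₂)
            n₃ (Hdiv (c1 a) (c1 b) δ₃ f₃ h₃) n₄ (Hdiv (c1 a) (c1 b) δ₄ f₄ h₄))))
        where
        h : V4
        h = H (c1 a) (c1 b)
      -- The other axes are reduced to the first by exchanging two coordinates; this changes the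
      -- sign of the determinant, which `strip` removes together with the two unit factors.
      cases (axis₂ z₁ z₂ z₃) = strip (c1 h) (c2 g) (∤-minor' {c2 a} {c2 b} {c1 a} {c1 b} (um12 gp) (ux1 up)) (∤-* pp (c2 a) (c2 x) (ua2 gp) (ux2 up)) (det4-flip₁₂ δ₁ δ₂ δ₃ δ₄)
          (det4-conic-div q r t (flip₁₂ g) (flip₁₂ h) (flip₁₂ δ₁) (flip₁₂ δ₂) (flip₁₂ δ₃) (flip₁₂ δ₄) r∣q t∣r (self-minor (c2 a) (c2 b) (c2 x)) z₁ z₂ z₃
            (f12 n₁) (fd g δ₁ f₁) (fd h δ₁ (Hdiv (c2 a) (c2 b) δ₁ f₁ h₁)) (f12 n₂) (fd g δ₂ f₂) (fd h δ₂ (Hdiv (c2 a) (c2 b) δ₂ f₂ h₂))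
            (f12 n₃) (fd h δ₃ (Hdiv (c2 a) (c2 b) δ₃ f₃ h₃)) (f12 n₄) (fd h δ₄ (Hdiv (c2 a) (c2 b) δ₄ f₄ h₄)))
        where
        h : V4
        h = H (c2 a) (c2 b)
        fd : ∀ {n} g u → n ∣ dot g u → n ∣ dot (flip₁₂ g) (flip₁₂ u)
        fd g u = ∣-resp-≡ (sym (dot-flip₁₂ g u))
      cases (axis₃ z₁ z₂ z₃) = strip (c2 h) (c3 g) (∤-minor' {c3 a} {c3 b} {c2 a} {c2 b} (um23 gp) (ux2 up)) (∤-* pp (c3 a) (c3 x) (ua3 gp) (ux3 up)) (det4-flip₁₃ δ₁ δ₂ δ₃ δ₄)
          (det4-conic-div q r t (flip₁₃ g) (flip₁₃ h) (flip₁₃ δ₁) (flip₁₃ δ₂) (flip₁₃ δ₃) (flip₁₃ δ₄) r∣q t∣r (self-minor (c3 a) (c3 b) (c3 x))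
            (neg≡0 (swap-neg (c2 δ₁) (c1 δ₂) (c1 δ₁) (c2 δ₂)) z₁) z₃ z₂
            (f13 n₁) (fd g δ₁ f₁) (fd h δ₁ (Hdiv (c3 a) (c3 b) δ₁ f₁ h₁)) (f13 n₂) (fd g δ₂ f₂) (fd h δ₂ (Hdiv (c3 a) (c3 b) δ₂ f₂ h₂))
            (f13 n₃) (fd h δ₃ (Hdiv (c3 a) (c3 b) δ₃ f₃ h₃)) (f13 n₄) (fd h δ₄ (Hdiv (c3 a) (c3 b) δ₄ f₄ h₄)))
        where
        h : V4
        h = H (c3 a) (c3 b)
        fd : ∀ {n} g u → n ∣ dot g u → n ∣ dot (flip₁₃ g) (flip₁₃ u)
        fd g u = ∣-resp-≡ (sym (dot-flip₁₃ g u))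
      cases (axis₄ z₁ z₂ z₃) = strip (c2 h) (c4 g) (∤-minor' {c4 a} {c4 b} {c2 a} {c2 b} (um24 gp) (ux2 up)) (∤-* pp (c4 a) (c4 x) (ua4 gp) (ux4 up)) (det4-flip₁₄ δ₁ δ₂ δ₃ δ₄)
          (det4-conic-div q r t (flip₁₄ g) (flip₁₄ h) (flip₁₄ δ₁) (flip₁₄ δ₂) (flip₁₄ δ₃) (flip₁₄ δ₄) r∣q t∣r (self-minor (c4 a) (c4 b) (c4 x))
            z₃ (neg≡0 (swap-neg (c2 δ₁) (c1 δ₂) (c1 δ₁) (c2 δ₂)) z₁) (neg≡0 (swap-neg (c3 δ₁) (c1 δ₂) (c1 δ₁) (c3 δ₂)) z₂)
            (f14 n₁) (fd g δ₁ f₁) (fd h δ₁ (Hdiv (c4 a) (c4 b) δ₁ f₁ h₁)) (f14 n₂) (fd g δ₂ f₂) (fd h δ₂ (Hdiv (c4 a) (c4 b) δ₂ f₂ h₂))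
            (f14 n₃) (fd h δ₃ (Hdiv (c4 a) (c4 b) δ₃ f₃ h₃)) (f14 n₄) (fd h δ₄ (Hdiv (c4 a) (c4 b) δ₄ f₄ h₄)))
        where
        h : V4
        h = H (c4 a) (c4 b)
        fd : ∀ {n} g u → n ∣ dot g u → n ∣ dot (flip₁₄ g) (flip₁₄ u)
        fd g u = ∣-resp-≡ (sym (dot-flip₁₄ g u))

  -- The three stages of the descent on one congruence class.

  search : ∀ {A : Set} {Q W : A → Set} → (∀ x → Q x ⊎ W x) → ∀ c → (∀ {x} → x ∈ c → Q x) ⊎ (∃[ x ] x ∈ c × W x)
  search f [] = inj₁ (λ ())
  search f (x ∷ c) with f x | search f c
  ... | inj₂ w | _ = inj₂ (x , here refl , w)
  ... | inj₁ q | inj₂ (y , i , w) = inj₂ (y , there i , w)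
  ... | inj₁ q | inj₁ h = inj₁ λ { (here refl) → q ; (there i) → h i }

  record Vanishing (c₁ c₂ c₃ c₄ c₅ : List V5) : Set where
    constructor vanishes
    field
      at : ∀ {P} → P ∈ c₁ → ∀ {Q} → Q ∈ c₂ → ∀ {R} → R ∈ c₃ → ∀ {S} → S ∈ c₄ → ∀ {U} → U ∈ c₅ → det5 P Q R S U ≡ 0ℤ
  open Vanishing

  NonVanishing : (c₁ c₂ c₃ c₄ c₅ : List V5) → Set
  NonVanishing c₁ c₂ c₃ c₄ c₅ = ∃[ P ] P ∈ c₁ × ∃[ Q ] Q ∈ c₂ × ∃[ R ] R ∈ c₃ × ∃[ S ] S ∈ c₄ × ∃[ U ] U ∈ c₅ × det5 P Q R S U ≢ 0ℤ

  vanishing? : ∀ c₁ c₂ c₃ c₄ c₅ → Vanishing c₁ c₂ c₃ c₄ c₅ ⊎ NonVanishing c₁ c₂ c₃ c₄ c₅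
  vanishing? c₁ c₂ c₃ c₄ c₅ = wrap (search (λ P → search (λ Q → search (λ R → search (λ S → search (λ U → zero? (det5 P Q R S U)) c₅) c₄) c₃) c₂) c₁)
    where
    zero? : ∀ z → z ≡ 0ℤ ⊎ z ≢ 0ℤ
    zero? z with z ≟ 0ℤ
    ... | yes e = inj₁ e
    ... | no ne = inj₂ ne
    wrap : (∀ {P} → P ∈ c₁ → ∀ {Q} → Q ∈ c₂ → ∀ {R} → R ∈ c₃ → ∀ {S} → S ∈ c₄ → ∀ {U} → U ∈ c₅ → det5 P Q R S U ≡ 0ℤ) ⊎ NonVanishing c₁ c₂ c₃ c₄ c₅ → Vanishing c₁ c₂ c₃ c₄ c₅ ⊎ NonVanishing c₁ c₂ c₃ c₄ c₅
    wrap (inj₁ v) = inj₁ (vanishes v)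
    wrap (inj₂ w) = inj₂ w

  nonVanishing? : ∀ c₁ c₂ c₃ c₄ c₅ → Dec (NonVanishing c₁ c₂ c₃ c₄ c₅)
  nonVanishing? c₁ c₂ c₃ c₄ c₅ = decide (vanishing? c₁ c₂ c₃ c₄ c₅)
    where
    decide : Vanishing c₁ c₂ c₃ c₄ c₅ ⊎ NonVanishing c₁ c₂ c₃ c₄ c₅ → Dec (NonVanishing c₁ c₂ c₃ c₄ c₅)
    decide (inj₁ v) = no λ { (P , i , Q , j , R , k , S , l , U , m , ne) → ne (at v i j k l m) }
    decide (inj₂ w) = yes w

  vanishing : ∀ c₁ c₂ c₃ c₄ c₅ → ¬ NonVanishing c₁ c₂ c₃ c₄ c₅ → Vanishing c₁ c₂ c₃ c₄ c₅
  vanishing c₁ c₂ c₃ c₄ c₅ n = decide (vanishing? c₁ c₂ c₃ c₄ c₅)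
    where
    decide : Vanishing c₁ c₂ c₃ c₄ c₅ ⊎ NonVanishing c₁ c₂ c₃ c₄ c₅ → Vanishing c₁ c₂ c₃ c₄ c₅
    decide (inj₁ v) = v
    decide (inj₂ w) = ⊥-elim (n w)

  -- The factors p² of the first descent are enlarged to (2 p)², so that one exponent s = 2 l + k +
  -- k' covers both the power of p and the power of 2.
  descents : ∀ p .{{_ : ℕ.NonZero p}} l k k' {N N' N''} → N ℕ.≤ (p ℕ.* p) ℕ.^ l ℕ.* N' → N' ℕ.≤ (p ℕ.* 2) ℕ.^ k ℕ.* N'' → N'' ℕ.≤ (p ℕ.* 2) ℕ.^ k' ℕ.* 4 →
    N ℕ.≤ 4 ℕ.* (p ℕ.^ (l ℕ.+ l ℕ.+ k ℕ.+ k') ℕ.* 2 ℕ.^ (l ℕ.+ l ℕ.+ k ℕ.+ k'))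
  descents p l k k' {N} {N'} {N''} h h' h'' = begin
    N                                                  ≤⟨ h ⟩
    (p ℕ.* p) ℕ.^ l ℕ.* N'                             ≤⟨ ℕ.*-mono-≤ (ℕ.^-monoˡ-≤ l (ℕ.*-mono-≤ (ℕ.m≤m*n p 2) (ℕ.m≤m*n p 2))) (ℕ.≤-trans h' (ℕ.*-monoʳ-≤ ((p ℕ.* 2) ℕ.^ k) h'')) ⟩
    (r ℕ.* r) ℕ.^ l ℕ.* (r ℕ.^ k ℕ.* (r ℕ.^ k' ℕ.* 4)) ≡⟨ cong (ℕ._* (r ℕ.^ k ℕ.* (r ℕ.^ k' ℕ.* 4))) (^-distribʳ-* l r r) ⟩
    r ℕ.^ l ℕ.* r ℕ.^ l ℕ.* (r ℕ.^ k ℕ.* (r ℕ.^ k' ℕ.* 4)) ≡⟨ regroup (r ℕ.^ l) (r ℕ.^ k) (r ℕ.^ k') ⟩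
    4 ℕ.* (r ℕ.^ l ℕ.* r ℕ.^ l ℕ.* r ℕ.^ k ℕ.* r ℕ.^ k') ≡⟨ cong (4 ℕ.*_) powers ⟩
    4 ℕ.* (p ℕ.^ s ℕ.* 2 ℕ.^ s)                        ∎
    where
    open ℕ.≤-Reasoning
    open ℕS.+-*-Solver
    r s : ℕ
    r = p ℕ.* 2
    s = l ℕ.+ l ℕ.+ k ℕ.+ k'
    regroup : ∀ a b c → a ℕ.* a ℕ.* (b ℕ.* (c ℕ.* 4)) ≡ 4 ℕ.* (a ℕ.* a ℕ.* b ℕ.* c)
    regroup = solve 3 (λ a b c → a :* a :* (b :* (c :* con 4)) := con 4 :* (a :* a :* b :* c)) refl
    powers : r ℕ.^ l ℕ.* r ℕ.^ l ℕ.* r ℕ.^ k ℕ.* r ℕ.^ k' ≡ p ℕ.^ s ℕ.* 2 ℕ.^ s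
    powers = trans (cong (ℕ._* r ℕ.^ k') (trans (cong (ℕ._* r ℕ.^ k) (sym (ℕ.^-distribˡ-+-* r l l))) (sym (ℕ.^-distribˡ-+-* r (l ℕ.+ l) k))))
      (trans (sym (ℕ.^-distribˡ-+-* r (l ℕ.+ l ℕ.+ k) k')) (^-distribʳ-* s p 2))

  module Stages {a b : V4} {p : ℕ} (gp : GoodPrime a b p) (mn : Minors≢0 a b)
    (g n : ℕ) (p∤g : ¬ + p ∣ + g) (1≤g : 1 ℕ.≤ g) (g≤n : g ℕ.≤ n) where

    open Local gp

    opaque
      X : ℕ
      X = 120 ℕ.* n ℕ.^ 5

      X-≡ : X ≡ 120 ℕ.* n ℕ.^ 5
      X-≡ = refl

    record Inside (c : List V5) : Set where
      field
        content : ∀ P → P ∈ c → + g ∣v vec P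
        small : ∀ P → P ∈ c → Bounded n P
    open Inside

    -- The absence of rational lines on ψ₁ = 0 in the form used by the stages: orthogonal isotropic
    -- vectors would span such a line.
    Separated : List V5 → Set
    Separated c = ∀ P Q → P ∈ c → Q ∈ c → P ≢ Q → bil a (vec P) (vec Q) ≢ 0ℤ

    private
      instance
        p≢0 : ℕ.NonZero p
        p≢0 = prime⇒nonZero pp

      2≤p : 2 ℕ.≤ p
      2≤p = ℕ.nonTrivial⇒n>1 p {{prime⇒nonTrivial pp}}

      g⁴≥1 : 1 ℕ.≤ g ℕ.^ 4
      g⁴≥1 = 1≤^ g 4 1≤g

      -- A crude bound from l < 2 ^ l ≤ p ^ l, whose purpose is to make each descent terminate.
      level≤X : ∀ l e → l ℕ.≤ e → p ℕ.^ e ℕ.* g ℕ.^ 4 ℕ.≤ X → l ℕ.≤ X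
      level≤X l e l≤e h = begin
        l                     ≤⟨ ℕ.<⇒≤ (n<2^n l) ⟩
        2 ℕ.^ l               ≤⟨ ℕ.^-monoˡ-≤ l 2≤p ⟩
        p ℕ.^ l               ≤⟨ ℕ.^-monoʳ-≤ p l≤e ⟩
        p ℕ.^ e               ≤⟨ ℕ.m≤m*n (p ℕ.^ e) (g ℕ.^ 4) {{ℕ.>-nonZero g⁴≥1}} ⟩
        p ℕ.^ e ℕ.* g ℕ.^ 4   ≤⟨ h ⟩
        X                     ∎
        where open ℕ.≤-Reasoning

      weaken : ∀ e e' → e' ℕ.≤ e → p ℕ.^ e ℕ.* g ℕ.^ 4 ℕ.≤ X → p ℕ.^ e' ℕ.* g ℕ.^ 4 ℕ.≤ X
      weaken e e' le h = ℕ.≤-trans (ℕ.*-monoˡ-≤ (g ℕ.^ 4) (ℕ.^-monoʳ-≤ p le)) h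

      Λ-of-Lev : ∀ l c → Lev l c → ∀ P Q → P ∈ c → Q ∈ c → InΛ a b (pw pp l) P Q
      Λ-of-Lev l c lev P Q i j = inΛ dv (flat (dot (a ⊛ vec P) (δ P Q)) (quad a (δ P Q)) (tangent-a a b P Q (onS lev P i) (onS lev Q j)) (∣-quad a (δ P Q) dv))
          (flat (dot (b ⊛ vec P) (δ P Q)) (quad b (δ P Q)) (tangent-b a b P Q (onS lev P i) (onS lev Q j)) (∣-quad b (δ P Q) dv))
        where
        q : ℤ
        q = pw pp l
        dv : q ∣v δ P Q
        dv = level lev P Q i j
        flat : ∀ d s → + 2 * last Q * d ≡ - s → q * q ∣ s → q * q ∣ d
        flat d s e div = subst (_∣ d) (pw-+ pp l l) (pw-cancel pp (l ℕ.+ l) (+ 2 * last Q) d (∤-* pp (+ 2) (last Q) (u2 gp) (uy (unit lev Q j)))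
          (subst (_∣ + 2 * last Q * d) (sym (pw-+ pp l l)) (∣-resp-≡ (sym e) (∣m⇒∣-m div))))

      cancel-y : ∀ e P d → UnitPoint p P → pw pp e ∣ last P * last P * last P * d → pw pp e ∣ d
      cancel-y e P d up = pw-cancel pp e (last P * last P * last P) d (∤-* pp (last P * last P) (last P) (∤-* pp (last P) (last P) (uy up) (uy up)) (uy up))

      generic-inequality : ∀ e e' P Q R S U → UnitPoint p P → e' ℕ.≤ e →
        InΛ a b (pw pp e) P Q → InΛ a b (pw pp e) P R → InΛ a b (pw pp e) P S → InΛ a b (pw pp e') P U →
        + g ∣v vec P → + g ∣v vec Q → + g ∣v vec R → + g ∣v vec S → + g ∣v vec U →
        Bounded n P → Bounded n Q → Bounded n R → Bounded n S → Bounded n U →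
        det5 P Q R S U ≢ 0ℤ → p ℕ.^ (4 ℕ.* e ℕ.+ 2 ℕ.* e') ℕ.* g ℕ.^ 4 ℕ.≤ X
      generic-inequality e e' P Q R S U up e'≤e iQ iR iS iU dP dQ dR dS dU bP bQ bR bS bU ne =
        ℕ.≤-trans (det5-inequality pp E g n P Q R S U p∤g dP dQ dR dS dU bP bQ bR bS bU ne
          (cancel-y E P (det5 P Q R S U) up (pw-cancel pp E μ (last P * last P * last P * det5 P Q R S U) p∤μ
            (subst (_∣ μ * (last P * last P * last P * det5 P Q R S U)) E-≡ (det5-divisible a b (pw pp e) (pw pp e') P Q R S U (pw∣pw pp e'≤e) iQ iR iS iU))))) (ℕ.≤-reflexive (sym X-≡))
        where
        E : ℕ
        E = 4 ℕ.* e ℕ.+ 2 ℕ.* e'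
        x : V4
        x = vec P
        μ : ℤ
        μ = c3 (a ⊛ x) * c4 (b ⊛ x) - c4 (a ⊛ x) * c3 (b ⊛ x)
        p∤μ : ¬ + p ∣ μ
        p∤μ = subst (λ n → ¬ + p ∣ n) (raw (c3 a) (c4 a) (c3 b) (c4 b) (c3 x) (c4 x)) (∤-* pp (minor a b c3 c4) (c3 x * c4 x) (um34 gp) (∤-* pp (c3 x) (c4 x) (ux3 up) (ux4 up)))
          where
          raw : ∀ a3 a4 b3 b4 x3 x4 → (a3 * b4 - a4 * b3) * (x3 * x4) ≡ a3 * x3 * (b4 * x4) - a4 * x4 * (b3 * x3)
          raw = solve-∀
        E-≡ : pw pp e * pw pp e * (pw pp e * pw pp e) * (pw pp e' * pw pp e') ≡ pw pp E
        E-≡ = trans (cong₂ _*_ (trans (cong₂ _*_ (sym (pw-+ pp e e)) (sym (pw-+ pp e e))) (sym (pw-+ pp (e ℕ.+ e) (e ℕ.+ e)))) (sym (pw-+ pp e' e')))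
          (trans (sym (pw-+ pp (e ℕ.+ e ℕ.+ (e ℕ.+ e)) (e' ℕ.+ e'))) (cong (pw pp) (solve 2 (λ e f → e :+ e :+ (e :+ e) :+ (f :+ f) := con 4 :* e :+ con 2 :* f) refl e e')))
          where open ℕS.+-*-Solver

    Ambient : ℕ → List V5 → List V5 → Set
    Ambient l G c = ∀ P R → P ∈ c → R ∈ G → InΛ a b (pw pp l) P R

    -- What the first stage hands on: `c'` lies in a hyperplane by `dep`, while the family `G₅`
    -- still spans by `basis`. `G₅` is congruent to the points of `c'` at the level l₅, one behind
    -- `c'` itself, and `amb` records this for later borrowing.
    record Top (c : List V5) : Set where
      field
        l₅ : ℕ
        G₅ : List V5
        c' : List V5
        sub : c' ⊑ c
        lev : Lev (suc l₅) c'
        dep : Dependent c'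
        len : length c ℕ.≤ (p ℕ.* p) ℕ.^ l₅ ℕ.* length c'
        amb : Ambient l₅ G₅ c'
        in₅ : Inside G₅
        c'⊆G₅ : ∀ {P} → P ∈ c' → P ∈ G₅
        basis : NonVanishing G₅ G₅ G₅ G₅ G₅
        bound : p ℕ.^ (6 ℕ.* l₅) ℕ.* g ℕ.^ 4 ℕ.≤ X

    private
      dependent : ∀ c → Vanishing c c c c c → Dependent c
      dependent c v P Q R S U i j k l m = at v i j k l m

      -- A spanning family for a class that is dependent from the beginning. The factor g gives the
      -- vectors the required content, g ≤ n keeps them in the box, and at l₅ = 0 the required
      -- congruences are modulo 1.
      frame : List V5
      frame = v5 (v4 (+ g) 0ℤ 0ℤ 0ℤ) 0ℤ ∷ v5 (v4 0ℤ (+ g) 0ℤ 0ℤ) 0ℤ ∷ v5 (v4 0ℤ 0ℤ (+ g) 0ℤ) 0ℤ ∷ v5 (v4 0ℤ 0ℤ 0ℤ (+ g)) 0ℤ ∷ v5 (v4 0ℤ 0ℤ 0ℤ 0ℤ) 1ℤ ∷ []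

      opaque
        unfolding det4 det5
        frame-det : det5 (v5 (v4 (+ g) 0ℤ 0ℤ 0ℤ) 0ℤ) (v5 (v4 0ℤ (+ g) 0ℤ 0ℤ) 0ℤ) (v5 (v4 0ℤ 0ℤ (+ g) 0ℤ) 0ℤ) (v5 (v4 0ℤ 0ℤ 0ℤ (+ g)) 0ℤ) (v5 (v4 0ℤ 0ℤ 0ℤ 0ℤ) 1ℤ) ≢ 0ℤ
        frame-det e = *-≢0 {+ g * + g} {+ g * + g} (*-≢0 {+ g} {+ g} g≢0 g≢0) (*-≢0 {+ g} {+ g} g≢0 g≢0) (trans (sym (raw (+ g))) e)
          where
          g≢0 : + g ≢ 0ℤ
          g≢0 z = ℕ.<⇒≢ 1≤g (sym (+-injective z))
          W : ℤ → ℤ → ℤ → ℤ → ℤ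
          W p q r s = p * q - r * s
          raw : ∀ g → det5 (v5 (v4 g 0ℤ 0ℤ 0ℤ) 0ℤ) (v5 (v4 0ℤ g 0ℤ 0ℤ) 0ℤ) (v5 (v4 0ℤ 0ℤ g 0ℤ) 0ℤ) (v5 (v4 0ℤ 0ℤ 0ℤ g) 0ℤ) (v5 (v4 0ℤ 0ℤ 0ℤ 0ℤ) 1ℤ) ≡ g * g * (g * g)
          raw g = trans (zeros (det4 e2 e3 e4 e0) (det4 e1 e3 e4 e0) (det4 e1 e2 e4 e0) (det4 e1 e2 e3 e0) (det4 e1 e2 e3 e4)) (poly g)
            where
            e1 e2 e3 e4 e0 : V4
            e1 = v4 g 0ℤ 0ℤ 0ℤ
            e2 = v4 0ℤ g 0ℤ 0ℤ
            e3 = v4 0ℤ 0ℤ g 0ℤ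
            e4 = v4 0ℤ 0ℤ 0ℤ g
            e0 = v4 0ℤ 0ℤ 0ℤ 0ℤ
            zeros : ∀ p q r s t → 0ℤ * p - 0ℤ * q + 0ℤ * r - 0ℤ * s + 1ℤ * t ≡ t
            zeros = solve-∀
            poly : ∀ g → (g * g - 0ℤ * 0ℤ) * (g * g - 0ℤ * 0ℤ) - (g * 0ℤ - 0ℤ * 0ℤ) * (0ℤ * g - 0ℤ * 0ℤ) + (g * 0ℤ - 0ℤ * 0ℤ) * (0ℤ * 0ℤ - g * 0ℤ)
              + (0ℤ * 0ℤ - 0ℤ * g) * (0ℤ * g - 0ℤ * 0ℤ) - (0ℤ * 0ℤ - 0ℤ * g) * (0ℤ * 0ℤ - g * 0ℤ) + (0ℤ * 0ℤ - 0ℤ * 0ℤ) * (0ℤ * 0ℤ - 0ℤ * 0ℤ) ≡ g * g * (g * g)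
            poly = solve-∀

      in-frame : Inside frame
      in-frame = record
        { content = λ { _ (here refl) → divs r z z z ; _ (there (here refl)) → divs z r z z ; _ (there (there (here refl))) → divs z z r z
                      ; _ (there (there (there (here refl)))) → divs z z z r ; _ (there (there (there (there (here refl))))) → divs z z z z }
        ; small = λ { _ (here refl) → bounded (bounds g≤n z≤n z≤n z≤n) z≤n ; _ (there (here refl)) → bounded (bounds z≤n g≤n z≤n z≤n) z≤n
                    ; _ (there (there (here refl))) → bounded (bounds z≤n z≤n g≤n z≤n) z≤n ; _ (there (there (there (here refl)))) → bounded (bounds z≤n z≤n z≤n g≤n) z≤n
                    ; _ (there (there (there (there (here refl))))) → bounded (bounds z≤n z≤n z≤n z≤n) (ℕ.≤-trans 1≤g g≤n) } }
        where
        z : + g ∣ 0ℤ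
        z = ∣0 (+ g)
        r : + g ∣ + g
        r = ∣-refl

      g⁴≤X : g ℕ.^ 4 ℕ.≤ X
      g⁴≤X = begin
        g ℕ.^ 4             ≤⟨ ℕ.^-monoˡ-≤ 4 g≤n ⟩
        n ℕ.^ 4             ≤⟨ ℕ.^-monoʳ-≤ n {{ℕ.>-nonZero (ℕ.≤-trans 1≤g g≤n)}} (ℕ.n≤1+n 4) ⟩
        n ℕ.^ 5             ≤⟨ ℕ.m≤n*m (n ℕ.^ 5) 120 ⟩
        120 ℕ.* n ℕ.^ 5     ≡⟨ sym X-≡ ⟩
        X                   ∎
        where open ℕ.≤-Reasoning

    Inside-⊆ : ∀ {c d} → (∀ {P} → P ∈ d → P ∈ c) → Inside c → Inside d
    Inside-⊆ s ins = record { content = λ P i → content ins P (s i) ; small = λ P i → small ins P (s i) }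

    top : ∀ c → Lev 1 c → Inside c → Top c
    top c lev₁ ins = decide (vanishing? c c c c c)
      where
      LevS : ℕ → List V5 → Set
      LevS l d = Lev (suc l) d × d ⊑ c
      Good : List V5 → Set
      Good d = NonVanishing d d d d d
      step : ∀ l d → LevS l d → ∃[ e ] e ⊑ d × LevS (suc l) e × length d ℕ.≤ p ℕ.* p ℕ.* length e
      step l d (lv , s) = wrap (child-surface l d lv)
        where
        wrap : (∃[ e ] e ⊑ d × Lev (suc (suc l)) e × length d ℕ.≤ p ℕ.* p ℕ.* length e) → _
        wrap (e , e⊑d , lv' , le) = e , e⊑d , (lv' , ⊑-trans e⊑d s) , le
      inequality : ∀ l d → LevS l d → Good d → p ℕ.^ (4 ℕ.* suc l ℕ.+ 2 ℕ.* suc l) ℕ.* g ℕ.^ 4 ℕ.≤ X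
      inequality l d (lv , s) (P , i , Q , j , R , k , S , m , U , o , ne) = generic-inequality (suc l) (suc l) P Q R S U (unit lv P i) ℕ.≤-refl
        (Λ P Q i j) (Λ P R i k) (Λ P S i m) (Λ P U i o)
        (cn P i) (cn Q j) (cn R k) (cn S m) (cn U o) (sm P i) (sm Q j) (sm R k) (sm S m) (sm U o) ne
        where
        Λ = Λ-of-Lev (suc l) d lv
        ins' = Inside-⊆ (proj₁ s) ins
        cn = content ins'
        sm = small ins'
      six : ∀ l → 4 ℕ.* l ℕ.+ 2 ℕ.* l ≡ 6 ℕ.* l
      six = solve 1 (λ l → con 4 :* l :+ con 2 :* l := con 6 :* l) refl
        where open ℕS.+-*-Solver
      bounded' : ∀ l d → LevS l d → Good d → l ℕ.≤ X
      bounded' l d lv gd = level≤X l (4 ℕ.* suc l ℕ.+ 2 ℕ.* suc l) (ℕ.≤-trans (ℕ.n≤1+n l) (ℕ.≤-trans (ℕ.m≤n*m (suc l) 4) (ℕ.m≤m+n (4 ℕ.* suc l) (2 ℕ.* suc l)))) (inequality l d lv gd)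
      both : ∀ {A B C : Set} → (A → C) → (B → C) → A ⊎ B → C
      both f h (inj₁ x) = f x
      both f h (inj₂ x) = h x
      one : ∀ P R → InΛ a b (pw pp 0) P R
      one P R = InΛ-1 a b P R
      decide : Vanishing c c c c c ⊎ Good c → Top c
      decide (inj₁ v) = record
        { l₅ = 0 ; G₅ = frame ++ c ; c' = c ; sub = ⊑-refl ; lev = lev₁ ; dep = dependent c v
        ; len = ℕ.≤-reflexive (sym (ℕ.*-identityˡ (length c)))
        ; amb = λ P R _ _ → one P R
        ; in₅ = record { content = λ P i → both (content in-frame P) (content ins P) (∈-++⁻ frame i) ; small = λ P i → both (small in-frame P) (small ins P) (∈-++⁻ frame i) }
        ; c'⊆G₅ = ∈-++⁺ʳ frame
        ; basis = _ , here refl , _ , there (here refl) , _ , there (there (here refl)) , _ , there (there (there (here refl))) , _ , there (there (there (there (here refl)))) , frame-det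
        ; bound = ℕ.≤-trans (ℕ.≤-reflexive (ℕ.*-identityˡ (g ℕ.^ 4))) g⁴≤X }
      decide (inj₂ gd) = finish (descend LevS Good (λ d → nonVanishing? d d d d d) (p ℕ.* p) X step bounded' 0 c (lev₁ , ⊑-refl) gd)
        where
        finish : (∃[ m ] ∃[ d ] ∃[ e ] d ⊑ c × LevS (m ℕ.+ 0) d × Good d × e ⊑ d × LevS (suc (m ℕ.+ 0)) e × ¬ Good e × length c ℕ.≤ (p ℕ.* p) ℕ.^ suc m ℕ.* length e) → Top c
        finish (m , d , e , d⊑c , levd , gd , e⊑d , (leve , e⊑c) , ¬ge , le) = record
          { l₅ = suc (m ℕ.+ 0) ; G₅ = d ; c' = e ; sub = e⊑c ; lev = leve ; dep = dependent e (vanishing e e e e e ¬ge)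
          ; len = subst (λ t → length c ℕ.≤ (p ℕ.* p) ℕ.^ suc t ℕ.* length e) (sym (ℕ.+-identityʳ m)) le
          ; amb = λ P R i j → Λ-of-Lev (suc (m ℕ.+ 0)) d (proj₁ levd) P R (proj₁ e⊑d i) j
          ; in₅ = Inside-⊆ (proj₁ d⊑c) ins
          ; c'⊆G₅ = proj₁ e⊑d
          ; basis = gd
          ; bound = subst (λ t → p ℕ.^ t ℕ.* g ℕ.^ 4 ℕ.≤ X) (six (suc (m ℕ.+ 0))) (inequality (m ℕ.+ 0) d levd gd) }

    -- As `G₅` spans, `van` says that any four points of `c''` are linearly dependent, so `c''` lies
    -- in a plane. By `basis₄` four points of `G₄` are independent and a point of `G₅` completes
    -- them to a basis; when no descent takes place `G₄` is `G₅` itself.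
    record Mid {c : List V5} (t : Top c) : Set where
      open Top t
      field
        k₄ : ℕ
        G₄ : List V5
        c'' : List V5
        sub₄ : c'' ⊑ c'
        lev₄ : Lev (suc (k₄ ℕ.+ l₅)) c''
        van : Vanishing c'' c'' c'' c'' G₅
        len₄ : length c' ℕ.≤ (p ℕ.* 2) ℕ.^ k₄ ℕ.* length c''
        amb₄ : Ambient (k₄ ℕ.+ l₅) G₄ c''
        G₄⊆G₅ : ∀ {P} → P ∈ G₄ → P ∈ G₅
        basis₄ : NonVanishing G₄ G₄ G₄ G₄ G₅
        bound₄ : p ℕ.^ (4 ℕ.* (k₄ ℕ.+ l₅) ℕ.+ 2 ℕ.* l₅) ℕ.* g ℕ.^ 4 ℕ.≤ X

    mid : ∀ {c} (t : Top c) → Mid t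
    mid {c} t = decide (vanishing? c' c' c' c' G₅)
      where
      open Top t
      LevS : ℕ → List V5 → Set
      LevS l d = Lev (suc l) d × d ⊑ c' × l₅ ℕ.≤ l
      Good : List V5 → Set
      Good d = NonVanishing d d d d G₅
      step : ∀ l d → LevS l d → ∃[ e ] e ⊑ d × LevS (suc l) e × length d ℕ.≤ p ℕ.* 2 ℕ.* length e
      step l d (lv , s , le₅) = wrap (child-curve l d lv (λ P Q R S U i j k m o → dep P Q R S U (proj₁ s i) (proj₁ s j) (proj₁ s k) (proj₁ s m) (proj₁ s o)))
        where
        wrap : (∃[ e ] e ⊑ d × Lev (suc (suc l)) e × length d ℕ.≤ p ℕ.* 2 ℕ.* length e) → _
        wrap (e , e⊑d , lv' , le) = e , e⊑d , (lv' , ⊑-trans e⊑d s , ℕ.m≤n⇒m≤1+n le₅) , le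
      inequality : ∀ l d → LevS l d → Good d → p ℕ.^ (4 ℕ.* suc l ℕ.+ 2 ℕ.* l₅) ℕ.* g ℕ.^ 4 ℕ.≤ X
      inequality l d (lv , s , le₅) (P , i , Q , j , R , k , S , m , U , o , ne) = generic-inequality (suc l) l₅ P Q R S U (unit lv P i) (ℕ.m≤n⇒m≤1+n le₅)
        (Λ P Q i j) (Λ P R i k) (Λ P S i m) (amb P U (proj₁ s i) o)
        (cn P (up i)) (cn Q (up j)) (cn R (up k)) (cn S (up m)) (cn U o) (sm P (up i)) (sm Q (up j)) (sm R (up k)) (sm S (up m)) (sm U o) ne
        where
        Λ = Λ-of-Lev (suc l) d lv
        cn = content in₅
        sm = small in₅
        up : ∀ {P} → P ∈ d → P ∈ G₅
        up i = c'⊆G₅ (proj₁ s i)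
      bounded' : ∀ l d → LevS l d → Good d → l ℕ.≤ X
      bounded' l d lv gd = level≤X l (4 ℕ.* suc l ℕ.+ 2 ℕ.* l₅) (ℕ.≤-trans (ℕ.n≤1+n l) (ℕ.≤-trans (ℕ.m≤n*m (suc l) 4) (ℕ.m≤m+n (4 ℕ.* suc l) (2 ℕ.* l₅)))) (inequality l d lv gd)
      six : ∀ l → 6 ℕ.* l ≡ 4 ℕ.* l ℕ.+ 2 ℕ.* l
      six = solve 1 (λ l → con 6 :* l := con 4 :* l :+ con 2 :* l) refl
        where open ℕS.+-*-Solver
      decide : Vanishing c' c' c' c' G₅ ⊎ Good c' → Mid t
      decide (inj₁ v) = record
        { k₄ = 0 ; G₄ = G₅ ; c'' = c' ; sub₄ = ⊑-refl ; lev₄ = lev ; van = v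
        ; len₄ = ℕ.≤-reflexive (sym (ℕ.*-identityˡ (length c')))
        ; amb₄ = amb ; G₄⊆G₅ = λ i → i ; basis₄ = basis
        ; bound₄ = subst (λ e → p ℕ.^ e ℕ.* g ℕ.^ 4 ℕ.≤ X) (six l₅) bound }
      decide (inj₂ gd) = finish (descend LevS Good (λ d → nonVanishing? d d d d G₅) (p ℕ.* 2) X step bounded' l₅ c' (lev , ⊑-refl , ℕ.≤-refl) gd)
        where
        finish : (∃[ m ] ∃[ d ] ∃[ e ] d ⊑ c' × LevS (m ℕ.+ l₅) d × Good d × e ⊑ d × LevS (suc (m ℕ.+ l₅)) e × ¬ Good e × length c' ℕ.≤ (p ℕ.* 2) ℕ.^ suc m ℕ.* length e) → Mid t
        finish (m , d , e , d⊑c' , levd , gd , e⊑d , (leve , e⊑c' , _) , ¬ge , le) = record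
          { k₄ = suc m ; G₄ = d ; c'' = e ; sub₄ = e⊑c' ; lev₄ = leve ; van = vanishing e e e e G₅ ¬ge
          ; len₄ = le
          ; amb₄ = λ P R i j → Λ-of-Lev (suc (m ℕ.+ l₅)) d (proj₁ levd) P R (proj₁ e⊑d i) j
          ; G₄⊆G₅ = λ i → c'⊆G₅ (proj₁ d⊑c' i)
          ; basis₄ = gd
          ; bound₄ = inequality (m ℕ.+ l₅) d levd gd }

    private
      ∤⇒≢0 : ∀ {z} → ¬ + p ∣ z → z ≢ 0ℤ
      ∤⇒≢0 nd e = nd (∣-resp-≡ (sym e) (∣0 (+ p)))

    module _ {c : List V5} (t : Top c) (md : Mid t) (sep : Separated c) where
      open Top t
      open Mid md

      -- The Steinitz exchange with the basis found in `G₄` and `G₅`. If no completion existed,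
      -- `exchange` would make all determinants containing P, Q, R vanish, so the trivector of their
      -- first four coordinates would be 0, against `trivector≢0`.
      exchanged : ∀ P Q R → OnS a b P → OnS a b Q → OnS a b R → bil a (vec P) (vec Q) ≢ 0ℤ → bil a (vec P) (vec R) ≢ 0ℤ → bil a (vec Q) (vec R) ≢ 0ℤ →
        c1 (vec Q) ≢ 0ℤ → ∃[ A ] A ∈ G₄ × ∃[ B ] B ∈ G₅ × det5 P Q R A B ≢ 0ℤ
      exchanged P Q R sP sQ sR nPQ nPR nQR x≢0 = decide (vanishing? (P ∷ []) (Q ∷ []) (R ∷ []) G₄ G₅)
        where
        Result : Set
        Result = ∃[ A ] A ∈ G₄ × ∃[ B ] B ∈ G₅ × det5 P Q R A B ≢ 0ℤ
        decide : Vanishing (P ∷ []) (Q ∷ []) (R ∷ []) G₄ G₅ ⊎ NonVanishing (P ∷ []) (Q ∷ []) (R ∷ []) G₄ G₅ → Result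
        decide (inj₂ (_ , here refl , _ , here refl , _ , here refl , A , i , B , j , ne)) = A , i , B , j , ne
        decide (inj₁ v) = ⊥-elim (impossible basis₄)
          where
          impossible : NonVanishing G₄ G₄ G₄ G₄ G₅ → ⊥
          impossible (R₁ , i₁ , R₂ , i₂ , R₃ , i₃ , R₄ , i₄ , R₅ , i₅ , ne) = trivector≢0 a {vec P} {vec Q} {vec R} (proj₁ sP) (proj₁ sQ) (proj₁ sR) nPQ nPR nQR x≢0 flat₄
            where
            inG₄ : ∀ {Y} → Y ≡ R₁ ⊎ Y ≡ R₂ ⊎ Y ≡ R₃ ⊎ Y ≡ R₄ → Y ∈ G₄
            inG₄ (inj₁ refl) = i₁
            inG₄ (inj₂ (inj₁ refl)) = i₂
            inG₄ (inj₂ (inj₂ (inj₁ refl))) = i₃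
            inG₄ (inj₂ (inj₂ (inj₂ refl))) = i₄
            inG₅ : ∀ {Y} → Y ≡ R₅ ⊎ (Y ≡ R₁ ⊎ Y ≡ R₂ ⊎ Y ≡ R₃ ⊎ Y ≡ R₄) → Y ∈ G₅
            inG₅ (inj₁ refl) = i₅
            inG₅ (inj₂ o) = G₄⊆G₅ (inG₄ o)
            all : ∀ X Z → det5 P Q R X Z ≡ 0ℤ
            all = exchange P Q R R₁ R₂ R₃ R₄ R₅ ne (λ o o' → at v (here refl) (here refl) (here refl) (inG₄ o) (inG₅ o'))
            flat₄ : ∀ v → det4 (vec P) (vec Q) (vec R) v ≡ 0ℤ
            flat₄ v = trans (sym (at-last P Q R (v5 v 0ℤ))) (all (v5 v 0ℤ) (v5 (v4 0ℤ 0ℤ 0ℤ 0ℤ) 1ℤ))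
              where
              at-last : ∀ P Q R S → det5 P Q R S (v5 (v4 0ℤ 0ℤ 0ℤ 0ℤ) 1ℤ) ≡ det4 (vec P) (vec Q) (vec R) (vec S)
              at-last (v5 r₀ t₀) (v5 r₁ t₁) (v5 r₂ t₂) (v5 r₃ t₃) = trans (det5-cof (v5 r₀ t₀) (v5 r₁ t₁) (v5 r₂ t₂) (v5 r₃ t₃) (v5 (v4 0ℤ 0ℤ 0ℤ 0ℤ) 1ℤ)) (raw (c1 (vec k)) (c2 (vec k)) (c3 (vec k)) (c4 (vec k)) (last k))
                where
                k : V5
                k = cof5 (v5 r₀ t₀) (v5 r₁ t₁) (v5 r₂ t₂) (v5 r₃ t₃)
                raw : ∀ p q r s t → p * 0ℤ + q * 0ℤ + r * 0ℤ + s * 0ℤ + t * 1ℤ ≡ t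
                raw = solve-∀

      -- Five points put an axis into the plane of the first three. The determinant of these three
      -- with A in `G₄` and U in `G₅` is nonzero, and the axis gives the exponent: 3 (l + 1) from
      -- the two differences inside the class, k₄ + l₅ from A and 2 l₅ from U.
      conic-inequality : ∀ l d → Lev (suc l) d → d ⊑ c'' → Unique d → 5 ℕ.≤ length d → k₄ ℕ.+ l₅ ℕ.≤ l →
        p ℕ.^ (3 ℕ.* suc l ℕ.+ (k₄ ℕ.+ l₅) ℕ.+ 2 ℕ.* l₅) ℕ.* g ℕ.^ 4 ℕ.≤ X
      conic-inequality l [] _ _ _ () _
      conic-inequality l (_ ∷ []) _ _ _ (s≤s ()) _
      conic-inequality l (_ ∷ _ ∷ []) _ _ _ (s≤s (s≤s ())) _
      conic-inequality l (_ ∷ _ ∷ _ ∷ []) _ _ _ (s≤s (s≤s (s≤s ()))) _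
      conic-inequality l (_ ∷ _ ∷ _ ∷ _ ∷ []) _ _ _ (s≤s (s≤s (s≤s (s≤s ())))) _
      conic-inequality l d@(P₀ ∷ P₁ ∷ P₂ ∷ P₃ ∷ P₄ ∷ _) lv s ((n01 ∷ n02 ∷ n03 ∷ n04 ∷ _) ∷ (n12 ∷ n13 ∷ n14 ∷ _) ∷ (n23 ∷ n24 ∷ _) ∷ (n34 ∷ _) ∷ _) _ l₄≤l =
          use (exchanged P₀ P₁ P₂ (onS lv P₀ i0) (onS lv P₁ i1) (onS lv P₂ i2) (B i0 i1 n01) (B i0 i2 n02) (B i1 i2 n12) (∤⇒≢0 (ux1 (unit lv P₁ i1))))
        where
        i0 : P₀ ∈ d
        i0 = here refl
        i1 : P₁ ∈ d
        i1 = there (here refl)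
        i2 : P₂ ∈ d
        i2 = there (there (here refl))
        i3 : P₃ ∈ d
        i3 = there (there (there (here refl)))
        i4 : P₄ ∈ d
        i4 = there (there (there (there (here refl))))
        inc : ∀ {P} → P ∈ d → P ∈ c
        inc i = proj₁ sub (proj₁ sub₄ (proj₁ s i))
        inG : ∀ {P} → P ∈ d → P ∈ G₅
        inG i = c'⊆G₅ (proj₁ sub₄ (proj₁ s i))
        B : ∀ {P Q} → P ∈ d → Q ∈ d → P ≢ Q → bil a (vec P) (vec Q) ≢ 0ℤ
        B {P} {Q} i j = sep P Q (inc i) (inc j)
        Bˢ : ∀ {P Q} → P ∈ d → Q ∈ d → Q ≢ P → bil a (vec P) (vec Q) ≢ 0ℤ
        Bˢ i j ne = B i j (ne ∘ sym)
        vs : ∀ {P Q R S U} → P ∈ d → Q ∈ d → R ∈ d → S ∈ d → U ∈ G₅ → det5 P Q R S U ≡ 0ℤ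
        vs i j k m o = at van (proj₁ s i) (proj₁ s j) (proj₁ s k) (proj₁ s m) o
        E : ℕ
        E = 3 ℕ.* suc l ℕ.+ (k₄ ℕ.+ l₅) ℕ.+ 2 ℕ.* l₅
        use : (∃[ A ] A ∈ G₄ × ∃[ B ] B ∈ G₅ × det5 P₀ P₁ P₂ A B ≢ 0ℤ) → p ℕ.^ E ℕ.* g ℕ.^ 4 ℕ.≤ X
        use (A , iA , U , iU , ne) = ℕ.≤-trans (det5-inequality pp E g n P₀ P₁ P₂ A U p∤g (cn P₀ (inG i0)) (cn P₁ (inG i1)) (cn P₂ (inG i2)) (cn A (G₄⊆G₅ iA)) (cn U iU)
            (sm P₀ (inG i0)) (sm P₁ (inG i1)) (sm P₂ (inG i2)) (sm A (G₄⊆G₅ iA)) (sm U iU) ne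
            (cancel-y E P₀ (det5 P₀ P₁ P₂ A U) up (∣-resp-≡ (det4-δ P₀ P₁ P₂ A U)
              (det4-axis-div gp (suc l) (k₄ ℕ.+ l₅) l₅ P₀ P₁ P₂ A U up (ℕ.m≤n⇒m≤1+n l₄≤l) (ℕ.m≤n+m l₅ k₄)
                (Λ P₀ P₁ i0 i1) (Λ P₀ P₂ i0 i2) (amb₄ P₀ A (proj₁ s i0) iA) (amb P₀ U (proj₁ sub₄ (proj₁ s i0)) iU) axis)))) (ℕ.≤-reflexive (sym X-≡))
          where
          Λ = Λ-of-Lev (suc l) d lv
          cn = content in₅
          sm = small in₅
          up : UnitPoint p P₀
          up = unit lv P₀ i0
          axis : Axis (wedge (δ P₀ P₁) (δ P₀ P₂))
          axis = plane-contains-axis a b mn (record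
            { s₀ = onS lv P₀ i0 ; s₁ = onS lv P₁ i1 ; s₂ = onS lv P₂ i2 ; s₃ = onS lv P₃ i3 ; s₄ = onS lv P₄ i4
            ; n₀₁ = B i0 i1 n01 ; n₀₂ = B i0 i2 n02 ; n₁₂ = B i1 i2 n12
            ; n₃₀ = Bˢ i3 i0 n03 ; n₃₁ = Bˢ i3 i1 n13 ; n₃₂ = Bˢ i3 i2 n23
            ; n₄₀ = Bˢ i4 i0 n04 ; n₄₁ = Bˢ i4 i1 n14 ; n₄₂ = Bˢ i4 i2 n24 ; n₃₄ = B i3 i4 n34
            ; y₀ = ∤⇒≢0 (uy up) ; basis = ne
            ; v₃Y = vs i3 i0 i1 i2 iU ; v₃X = vs i3 i0 i1 i2 (G₄⊆G₅ iA) ; v₄Y = vs i4 i0 i1 i2 iU ; v₄X = vs i4 i0 i1 i2 (G₄⊆G₅ iA) })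

      low : Unique c'' → ∃[ k₃ ] length c'' ℕ.≤ (p ℕ.* 2) ℕ.^ k₃ ℕ.* 4 × p ℕ.^ (6 ℕ.* l₅ ℕ.+ 3 ℕ.* k₄ ℕ.+ 3 ℕ.* k₃) ℕ.* g ℕ.^ 4 ℕ.≤ X
      low uq = decide (5 ℕ.≤? length c'')
        where
        open ℕS.+-*-Solver
        Result : Set
        Result = ∃[ k₃ ] length c'' ℕ.≤ (p ℕ.* 2) ℕ.^ k₃ ℕ.* 4 × p ℕ.^ (6 ℕ.* l₅ ℕ.+ 3 ℕ.* k₄ ℕ.+ 3 ℕ.* k₃) ℕ.* g ℕ.^ 4 ℕ.≤ X
        LevS : ℕ → List V5 → Set
        LevS l d = Lev (suc l) d × d ⊑ c'' × k₄ ℕ.+ l₅ ℕ.≤ l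
        Good : List V5 → Set
        Good d = 5 ℕ.≤ length d
        step : ∀ l d → LevS l d → ∃[ e ] e ⊑ d × LevS (suc l) e × length d ℕ.≤ p ℕ.* 2 ℕ.* length e
        step l d (lv , s , le₅) = wrap (child-curve l d lv (λ P Q R S U i j k m o → dep P Q R S U (up i) (up j) (up k) (up m) (up o)))
          where
          up : ∀ {P} → P ∈ d → P ∈ c'
          up i = proj₁ sub₄ (proj₁ s i)
          wrap : (∃[ e ] e ⊑ d × Lev (suc (suc l)) e × length d ℕ.≤ p ℕ.* 2 ℕ.* length e) → _
          wrap (e , e⊑d , lv' , le) = e , e⊑d , (lv' , ⊑-trans e⊑d s , ℕ.m≤n⇒m≤1+n le₅) , le
        inequality : ∀ l d → LevS l d → Good d → p ℕ.^ (3 ℕ.* suc l ℕ.+ (k₄ ℕ.+ l₅) ℕ.+ 2 ℕ.* l₅) ℕ.* g ℕ.^ 4 ℕ.≤ X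
        inequality l d (lv , s , le₅) gd = conic-inequality l d lv s (proj₂ s uq) gd le₅
        bounded' : ∀ l d → LevS l d → Good d → l ℕ.≤ X
        bounded' l d lv gd = level≤X l (3 ℕ.* suc l ℕ.+ (k₄ ℕ.+ l₅) ℕ.+ 2 ℕ.* l₅) (ℕ.≤-trans (ℕ.n≤1+n l) (ℕ.≤-trans (ℕ.m≤n*m (suc l) 3) (ℕ.≤-trans (ℕ.m≤m+n (3 ℕ.* suc l) (k₄ ℕ.+ l₅)) (ℕ.m≤m+n (3 ℕ.* suc l ℕ.+ (k₄ ℕ.+ l₅)) (2 ℕ.* l₅))))) (inequality l d lv gd)
        decide : Dec (Good c'') → Result
        -- At most four points are left and k₃ = 0. The exponent of the second stage is 6 l₅ + 4 k₄,
        -- which covers 6 l₅ + 3 k₄.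
        decide (no ≱) = 0 , ℕ.≤-trans (ℕ.≤-pred (ℕ.≰⇒> ≱)) (ℕ.≤-reflexive (sym (ℕ.*-identityˡ 4))) ,
          weaken (4 ℕ.* (k₄ ℕ.+ l₅) ℕ.+ 2 ℕ.* l₅) (6 ℕ.* l₅ ℕ.+ 3 ℕ.* k₄ ℕ.+ 3 ℕ.* 0) (ℕ.≤-trans (ℕ.m≤m+n (6 ℕ.* l₅ ℕ.+ 3 ℕ.* k₄ ℕ.+ 3 ℕ.* 0) k₄) (ℕ.≤-reflexive (solve 2 (λ k l → con 6 :* l :+ con 3 :* k :+ con 3 :* con 0 :+ k := con 4 :* (k :+ l) :+ con 2 :* l) refl k₄ l₅))) bound₄
        decide (yes gd) = finish (descend LevS Good (λ d → 5 ℕ.≤? length d) (p ℕ.* 2) X step bounded' (k₄ ℕ.+ l₅) c'' (lev₄ , ⊑-refl , ℕ.≤-refl) gd)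
          where
          finish : (∃[ m ] ∃[ d ] ∃[ e ] d ⊑ c'' × LevS (m ℕ.+ (k₄ ℕ.+ l₅)) d × Good d × e ⊑ d × LevS (suc (m ℕ.+ (k₄ ℕ.+ l₅))) e × ¬ Good e × length c'' ℕ.≤ (p ℕ.* 2) ℕ.^ suc m ℕ.* length e) → Result
          finish (m , d , e , d⊑c , levd , gd , e⊑d , _ , ¬ge , le) = suc m , ℕ.≤-trans le (ℕ.*-monoʳ-≤ ((p ℕ.* 2) ℕ.^ suc m) (ℕ.≤-pred (ℕ.≰⇒> ¬ge))) ,
            weaken (3 ℕ.* suc (m ℕ.+ (k₄ ℕ.+ l₅)) ℕ.+ (k₄ ℕ.+ l₅) ℕ.+ 2 ℕ.* l₅) (6 ℕ.* l₅ ℕ.+ 3 ℕ.* k₄ ℕ.+ 3 ℕ.* suc m) (ℕ.≤-trans (ℕ.m≤m+n (6 ℕ.* l₅ ℕ.+ 3 ℕ.* k₄ ℕ.+ 3 ℕ.* suc m) k₄) (ℕ.≤-reflexive (solve 3 (λ k l m → con 6 :* l :+ con 3 :* k :+ con 3 :* (con 1 :+ m) :+ k := con 3 :* (con 1 :+ (m :+ (k :+ l))) :+ (k :+ l) :+ con 2 :* l) refl k₄ l₅ m))) (inequality (m ℕ.+ (k₄ ℕ.+ l₅)) d levd gd)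

    Bound : List V5 → Set
    Bound c = ∃[ s ] length c ℕ.≤ 4 ℕ.* (p ℕ.^ s ℕ.* 2 ℕ.^ s) × p ℕ.^ (3 ℕ.* s) ℕ.* g ℕ.^ 4 ℕ.≤ X

    private
      conclude : ∀ {c} (t : Top c) (md : Mid t) → Separated c → Unique c → Bound c
      conclude {c} t md sep uq = finish (low t md sep (proj₂ sub₄ (proj₂ sub uq)))
        where
        open Top t
        open Mid md
        open ℕS.+-*-Solver
        finish : (∃[ k₃ ] length c'' ℕ.≤ (p ℕ.* 2) ℕ.^ k₃ ℕ.* 4 × p ℕ.^ (6 ℕ.* l₅ ℕ.+ 3 ℕ.* k₄ ℕ.+ 3 ℕ.* k₃) ℕ.* g ℕ.^ 4 ℕ.≤ X) → Bound c
        finish (k₃ , le , bd) = l₅ ℕ.+ l₅ ℕ.+ k₄ ℕ.+ k₃ , descents p l₅ k₄ k₃ len len₄ le ,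
          subst (λ e → p ℕ.^ e ℕ.* g ℕ.^ 4 ℕ.≤ X) (solve 3 (λ l k k' → con 6 :* l :+ con 3 :* k :+ con 3 :* k' := con 3 :* (l :+ l :+ k :+ k')) refl l₅ k₄ k₃) bd

    class-bound : ∀ c → Lev 1 c → Inside c → Separated c → Unique c → Bound c
    class-bound c lev₁ ins = through (top c lev₁ ins)
      where
      through : Top c → Separated c → Unique c → Bound c
      through t = conclude t (mid t)

  -- From the bound for one class to a count of all points.

  cont : V4 → ℕ
  cont x = gcd (gcd (abs (c1 x)) (abs (c2 x))) (gcd (abs (c3 x)) (abs (c4 x)))

  cont∣ : ∀ x → cont x ℕ.∣ abs (c1 x) × cont x ℕ.∣ abs (c2 x) × cont x ℕ.∣ abs (c3 x) × cont x ℕ.∣ abs (c4 x)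
  cont∣ x = ℕ.∣-trans l (gcd[m,n]∣m (abs (c1 x)) (abs (c2 x))) , ℕ.∣-trans l (gcd[m,n]∣n (abs (c1 x)) (abs (c2 x))) ,
            ℕ.∣-trans r (gcd[m,n]∣m (abs (c3 x)) (abs (c4 x))) , ℕ.∣-trans r (gcd[m,n]∣n (abs (c3 x)) (abs (c4 x)))
    where
    l = gcd[m,n]∣m (gcd (abs (c1 x)) (abs (c2 x))) (gcd (abs (c3 x)) (abs (c4 x)))
    r = gcd[m,n]∣n (gcd (abs (c1 x)) (abs (c2 x))) (gcd (abs (c3 x)) (abs (c4 x)))

  *-cont : ∀ k x → k ℕ.* cont x ≡ gcd (gcd (k ℕ.* abs (c1 x)) (k ℕ.* abs (c2 x))) (gcd (k ℕ.* abs (c3 x)) (k ℕ.* abs (c4 x)))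
  *-cont k x = trans (c*gcd[m,n]≡gcd[cm,cn] k (gcd (abs (c1 x)) (abs (c2 x))) (gcd (abs (c3 x)) (abs (c4 x))))
    (cong₂ gcd (c*gcd[m,n]≡gcd[cm,cn] k (abs (c1 x)) (abs (c2 x))) (c*gcd[m,n]≡gcd[cm,cn] k (abs (c3 x)) (abs (c4 x))))

  abs≡⇒± : ∀ i j → abs i ≡ abs j → i ≡ j ⊎ i ≡ - j
  abs≡⇒± (+ m) (+ .m) refl = inj₁ refl
  abs≡⇒± (+ .(suc n)) -[1+ n ] refl = inj₂ refl
  abs≡⇒± -[1+ m ] (+ .(suc m)) refl = inj₂ refl
  abs≡⇒± -[1+ m ] -[1+ .m ] refl = inj₁ refl

  -- Proportional vectors of the same content differ by a sign, which a congruence modulo an odd prime rules out.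
  proportional⇒≡ : ∀ {p} → Prime p → ¬ + p ∣ + 2 → ∀ (c : V4 → ℤ) x y → cont x ≡ cont y → cont y ≢ 0 → ¬ + p ∣ c x → + p ∣ c x - c y →
    c x * c1 y ≡ c y * c1 x → c x * c2 y ≡ c y * c2 x → c x * c3 y ≡ c y * c3 x → c x * c4 y ≡ c y * c4 x → x ≡ y
  proportional⇒≡ {p} pp p∤2 c x y same-cont cont≢0 p∤c p∣diff e1 e2 e3 e4 = v4-ext (coord (c1 x) (c1 y) e1) (coord (c2 x) (c2 y) e2) (coord (c3 x) (c3 y) e3) (coord (c4 x) (c4 y) e4)
    where
    absolute : ∀ {s t} → c x * s ≡ c y * t → abs (c x) ℕ.* abs s ≡ abs (c y) ℕ.* abs t
    absolute {s} {t} e = trans (sym (abs-* (c x) s)) (trans (cong abs e) (abs-* (c y) t))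
    abs-≡ : abs (c x) ≡ abs (c y)
    abs-≡ = ℕ.*-cancelʳ-≡ (abs (c x)) (abs (c y)) (cont y) {{ℕ.≢-nonZero cont≢0}}
      (trans (*-cont (abs (c x)) y) (trans (cong₂ gcd (cong₂ gcd (absolute e1) (absolute e2)) (cong₂ gcd (absolute e3) (absolute e4)))
        (trans (sym (*-cont (abs (c y)) x)) (cong (abs (c y) ℕ.*_) same-cont))))
    c-≡ : c x ≡ c y
    c-≡ = decide (abs≡⇒± (c x) (c y) abs-≡)
      where
      double : ∀ s → s - - s ≡ + 2 * s
      double = solve-∀
      decide : c x ≡ c y ⊎ c x ≡ - c y → c x ≡ c y
      decide (inj₁ e) = e
      decide (inj₂ e) = ⊥-elim (∤-* pp (+ 2) (c x) p∤2 p∤c (∣-resp-≡ (trans (cong (λ s → c x - s) (trans (sym (neg-involutive (c y))) (cong -_ (sym e)))) (double (c x))) p∣diff))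
    c≢0 : c y ≢ 0ℤ
    c≢0 z = p∤c (subst (+ p ∣_) (sym (trans c-≡ z)) (divides 0ℤ refl))
    coord : ∀ s t → c x * t ≡ c y * s → s ≡ t
    coord s t e = *-cancelˡ-≡ (c y) s t {{≢-nonZero c≢0}} (trans (sym e) (cong (_* t) c-≡))

  dyadic : ∀ n → 1 ℕ.≤ n → ∃[ L ] 2 ℕ.^ L ℕ.≤ n × n ℕ.< 2 ℕ.^ suc L
  dyadic (suc zero) _ = 0 , s≤s z≤n , s≤s (s≤s z≤n)
  dyadic (suc (suc n)) _ with dyadic (suc n) (s≤s z≤n)
  ... | L , lo , hi with suc (suc n) ℕ.<? 2 ℕ.^ suc L
  ...   | yes lt = L , ℕ.m≤n⇒m≤1+n lo , lt
  ...   | no ≮ = suc L , ℕ.≮⇒≥ ≮ , ℕ.≤-trans (s≤s hi) (ℕ.≤-trans (ℕ.+-monoˡ-≤ (2 ℕ.^ suc L) (1≤^ 2 (suc L) (s≤s z≤n))) (ℕ.≤-reflexive (cong (λ m → 2 ℕ.^ suc L ℕ.+ m) (sym (ℕ.+-identityʳ (2 ℕ.^ suc L))))))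

  -- The estimate for a class of fixed content g whose points agree modulo p, in the form shared by
  -- the surface and the conics. Its two parts together bound the class by a multiple of X ^ (1/3) 2
  -- ^ s / g.
  Local : (Y : V4 → ℤ) (nn : V4 → ℕ) (t n X : ℕ) → List V4 → Set
  Local Y nn t n X c = ∀ {p} g d → (pp : Prime p) → 2 ℕ.^ t ℕ.≤ p → d ⊑ c → (∀ x → x ∈ d → ¬ p ℕ.∣ nn x) → (∀ x → x ∈ d → cont x ≡ g) → 1 ℕ.≤ g → g ℕ.≤ n →
    same pp c1 d → same pp c2 d → same pp c3 d → same pp c4 d → same pp Y d →
    ∃[ s ] length d ℕ.≤ 4 ℕ.* (p ℕ.^ s ℕ.* 2 ℕ.^ s) × (p ℕ.^ s ℕ.* g) ℕ.^ 3 ℕ.≤ X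

  pipeline-constant : ℕ → ℕ
  pipeline-constant t = (2 ℕ.* (3 ℕ.* t)) ℕ.^ (3 ℕ.* t) ℕ.* (2 ℕ.^ (18 ℕ.* t) ℕ.* (suc (proj₁ (small-nondivisor (18 ℕ.* t))) ℕ.* (2 ℕ.^ t) ℕ.!)) ℕ.* 64 ℕ.^ t

  -- For each content g the points are sorted by a prime chosen for each point separately, then by
  -- five residues, and `local` bounds the class that is kept. This gives g f(g) ≤ V with V ^ (3 t)
  -- under control, and `harmonic` sums over g. Powers 3 t replace fractional exponents throughout:
  -- n pays for the logarithm, W for the primes and residues, and the last factor X for 2 ^ s.
  pipeline : ∀ Y nn t n W X (c : List V4) → 1 ℕ.≤ t → 1 ℕ.≤ n → 1 ℕ.≤ W → Unique c →
    (∀ x → x ∈ c → 1 ℕ.≤ nn x × nn x ℕ.≤ W) → (∀ x → x ∈ c → 1 ℕ.≤ cont x × cont x ℕ.≤ n) → Local Y nn t n X c →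
    length c ℕ.^ (3 ℕ.* t) ℕ.≤ pipeline-constant t ℕ.* (n ℕ.* W ℕ.* (X ℕ.^ t ℕ.* X))
  pipeline Y nn t n W X c 1≤t 1≤n 1≤W uq nn-bound cont-bound local = assemble (dyadic n 1≤n)
    where
    open ℕ.≤-Reasoning
    u F C W' : ℕ
    -- Six factors of size at most suc Z are lost, one for the choice of the prime and five for the
    -- residues. Their power 3 t is the power 18 t of suc Z, which the choice of primes keeps linear
    -- in W.
    u = 18 ℕ.* t
    -- Avoiding the divisors of this factorial forces p > 2 ^ t, whence 2 ^ (3 t s) ≤ p ^ (3 s) ≤ X.
    F = (2 ℕ.^ t) ℕ.!
    C = proj₁ (small-nondivisor u)
    W' = suc C ℕ.* (W ℕ.* F)
    1≤u : 1 ℕ.≤ u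
    1≤u = ℕ.≤-trans 1≤t (ℕ.m≤n*m t 18)
    1≤3t : 1 ℕ.≤ 3 ℕ.* t
    1≤3t = ℕ.≤-trans 1≤t (ℕ.m≤n*m t 3)
    1≤F : 1 ℕ.≤ F
    1≤F = ℕ.1≤n! (2 ℕ.^ t)
    N : V4 → ℕ
    N x = nn x ℕ.* F
    choose : ℕ → ℕ
    -- A default value: `N` is positive on `c`.
    choose zero = 0
    choose (suc k) = proj₁ (proj₂ (small-nondivisor u) (suc k) (s≤s z≤n))
    choose-spec : ∀ k → 1 ℕ.≤ k → Prime (choose k) × ¬ choose k ℕ.∣ k × choose k ℕ.^ u ℕ.≤ C ℕ.* k
    choose-spec (suc k) _ = proj₂ (proj₂ (small-nondivisor u) (suc k) (s≤s z≤n))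
    key : V4 → ℕ
    key x = choose (N x)
    N≥1 : ∀ x → x ∈ c → 1 ℕ.≤ N x
    N≥1 x i = ℕ.*-mono-≤ (proj₁ (nn-bound x i)) 1≤F
    spec : ∀ x → x ∈ c → Prime (key x) × ¬ key x ℕ.∣ N x × key x ℕ.^ u ℕ.≤ C ℕ.* N x
    spec x i = choose-spec (N x) (N≥1 x i)
    rootZ : ∃[ z ] z ℕ.^ u ℕ.≤ W' × W' ℕ.< suc z ℕ.^ u
    rootZ = root u 1≤u W'
    Z : ℕ
    Z = proj₁ rootZ
    key<Z : ∀ {x} → x ∈ c → key x ℕ.< suc Z
    key<Z {x} i = ℕ.≰⇒> (λ sZ≤ → ℕ.<⇒≱ (proj₂ (proj₂ rootZ)) (begin
      suc Z ℕ.^ u   ≤⟨ ℕ.^-monoˡ-≤ u sZ≤ ⟩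
      key x ℕ.^ u   ≤⟨ proj₂ (proj₂ (spec x i)) ⟩
      C ℕ.* N x     ≤⟨ ℕ.*-mono-≤ (ℕ.n≤1+n C) (ℕ.*-monoˡ-≤ F (proj₂ (nn-bound x i))) ⟩
      W'          ∎))
    1≤Z : 1 ℕ.≤ Z
    1≤Z = ℕ.n≢0⇒n>0 (λ z → ℕ.<⇒≱ (subst (λ z → W' ℕ.< suc z ℕ.^ u) z (proj₂ (proj₂ rootZ))) (ℕ.≤-trans (ℕ.≤-reflexive (ℕ.^-zeroˡ u)) (ℕ.*-mono-≤ (s≤s (z≤n {C})) (ℕ.*-mono-≤ 1≤W 1≤F))))
    Zpow : suc Z ℕ.^ u ℕ.≤ 2 ℕ.^ u ℕ.* W'
    Zpow = begin
      suc Z ℕ.^ u       ≤⟨ ℕ.^-monoˡ-≤ u (ℕ.≤-trans (ℕ.+-monoˡ-≤ Z 1≤Z) (ℕ.≤-reflexive (cong (λ m → Z ℕ.+ m) (sym (ℕ.+-identityʳ Z))))) ⟩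
      (2 ℕ.* Z) ℕ.^ u     ≡⟨ ^-distribʳ-* u 2 Z ⟩
      2 ℕ.^ u ℕ.* Z ℕ.^ u   ≤⟨ ℕ.*-monoʳ-≤ (2 ℕ.^ u) (proj₁ (proj₂ rootZ)) ⟩
      2 ℕ.^ u ℕ.* W'      ∎
    G : ℕ
    G = suc Z ℕ.^ u ℕ.* (64 ℕ.^ t ℕ.* (X ℕ.^ t ℕ.* X))
    rootV : ∃[ v ] v ℕ.^ (3 ℕ.* t) ℕ.≤ G × G ℕ.< suc v ℕ.^ (3 ℕ.* t)
    rootV = root (3 ℕ.* t) 1≤3t G
    V : ℕ
    V = proj₁ rootV
    f : ℕ → ℕ
    f g = length (fiber cont g c)

    class-power : ∀ {p} → 2 ℕ.^ t ℕ.≤ p → p ℕ.< suc Z → ∀ g s m → m ℕ.≤ suc Z ℕ.* (p ℕ.* (p ℕ.* (p ℕ.* (p ℕ.* (p ℕ.* (4 ℕ.* (p ℕ.^ s ℕ.* 2 ℕ.^ s))))))) → (p ℕ.^ s ℕ.* g) ℕ.^ 3 ℕ.≤ X → 1 ℕ.≤ g → (g ℕ.* m) ℕ.^ (3 ℕ.* t) ℕ.≤ G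
    class-power {p} 2^t≤p p<Z g s m le bd 1≤g = begin
      (g ℕ.* m) ℕ.^ (3 ℕ.* t)                                        ≤⟨ ℕ.^-monoˡ-≤ (3 ℕ.* t) (ℕ.*-monoʳ-≤ g (ℕ.≤-trans le (ℕ.*-monoʳ-≤ (suc Z) (five (five (five (five (five ℕ.≤-refl)))))))) ⟩
      (g ℕ.* (z ℕ.* (z ℕ.* (z ℕ.* (z ℕ.* (z ℕ.* (z ℕ.* (4 ℕ.* (q ℕ.* 2 ℕ.^ s))))))))) ℕ.^ (3 ℕ.* t) ≡⟨ cong (ℕ._^ (3 ℕ.* t)) (solve 4 (λ g z q r → g :* (z :* (z :* (z :* (z :* (z :* (z :* (con 4 :* (q :* r)))))))) := (z :* (z :* (z :* (z :* (z :* (z :* con 1)))))) :* (con 4 :* (r :* (q :* g)))) refl g z q (2 ℕ.^ s)) ⟩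
      (z ℕ.^ 6 ℕ.* (4 ℕ.* (2 ℕ.^ s ℕ.* (q ℕ.* g)))) ℕ.^ (3 ℕ.* t)              ≡⟨ ^-distribʳ-* (3 ℕ.* t) (z ℕ.^ 6) (4 ℕ.* (2 ℕ.^ s ℕ.* (q ℕ.* g))) ⟩
      (z ℕ.^ 6) ℕ.^ (3 ℕ.* t) ℕ.* (4 ℕ.* (2 ℕ.^ s ℕ.* (q ℕ.* g))) ℕ.^ (3 ℕ.* t)    ≡⟨ cong₂ ℕ._*_ (trans (ℕ.^-*-assoc z 6 (3 ℕ.* t)) (cong (z ℕ.^_) (sym (ℕ.*-assoc 6 3 t)))) (trans (^-distribʳ-* (3 ℕ.* t) 4 (2 ℕ.^ s ℕ.* (q ℕ.* g))) (cong₂ ℕ._*_ (sym (ℕ.^-*-assoc 4 3 t)) (^-distribʳ-* (3 ℕ.* t) (2 ℕ.^ s) (q ℕ.* g)))) ⟩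
      z ℕ.^ u ℕ.* (64 ℕ.^ t ℕ.* ((2 ℕ.^ s) ℕ.^ (3 ℕ.* t) ℕ.* (q ℕ.* g) ℕ.^ (3 ℕ.* t))) ≤⟨ ℕ.*-monoʳ-≤ (z ℕ.^ u) (ℕ.*-monoʳ-≤ (64 ℕ.^ t) (ℕ.*-mono-≤ two (ℕ.≤-trans (ℕ.≤-reflexive (sym (ℕ.^-*-assoc (q ℕ.* g) 3 t))) (ℕ.^-monoˡ-≤ t bd)))) ⟩
      z ℕ.^ u ℕ.* (64 ℕ.^ t ℕ.* (X ℕ.* X ℕ.^ t))                           ≡⟨ cong (λ w → z ℕ.^ u ℕ.* (64 ℕ.^ t ℕ.* w)) (ℕ.*-comm X (X ℕ.^ t)) ⟩
      G                                                        ∎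
      where
      open ℕS.+-*-Solver
      z q : ℕ
      z = suc Z
      q = p ℕ.^ s
      five : ∀ {m m'} → m ℕ.≤ m' → p ℕ.* m ℕ.≤ z ℕ.* m'
      five = ℕ.*-mono-≤ (ℕ.<⇒≤ p<Z)
      two : (2 ℕ.^ s) ℕ.^ (3 ℕ.* t) ℕ.≤ X
      two = begin
        (2 ℕ.^ s) ℕ.^ (3 ℕ.* t)   ≡⟨ trans (ℕ.^-*-assoc 2 s (3 ℕ.* t)) (trans (cong (2 ℕ.^_) (trans (solve 2 (λ s t → s :* (con 3 :* t) := t :* (s :* con 3)) refl s t) refl)) (sym (ℕ.^-*-assoc 2 t (s ℕ.* 3)))) ⟩
        (2 ℕ.^ t) ℕ.^ (s ℕ.* 3)   ≤⟨ ℕ.^-monoˡ-≤ (s ℕ.* 3) 2^t≤p ⟩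
        p ℕ.^ (s ℕ.* 3)         ≡⟨ sym (ℕ.^-*-assoc p s 3) ⟩
        q ℕ.^ 3               ≤⟨ ℕ.^-monoˡ-≤ 3 (ℕ.m≤m*n q g {{ℕ.>-nonZero 1≤g}}) ⟩
        (q ℕ.* g) ℕ.^ 3         ≤⟨ bd ⟩
        X                   ∎

    content-class : ∀ g → 1 ℕ.≤ g → g ℕ.≤ n → (g ℕ.* f g) ℕ.^ (3 ℕ.* t) ℕ.≤ G
    content-class g 1≤g g≤n = by-prime (pigeonhole key (suc Z) cg (λ i → key<Z (proj₁ (fiber-⊑ cont g c) i)))
      where
      cg : List V4
      cg = fiber cont g c
      by-prime : (∃[ p ] length cg ℕ.≤ suc Z ℕ.* length (fiber key p cg)) → (g ℕ.* f g) ℕ.^ (3 ℕ.* t) ℕ.≤ G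
      by-prime (p , le) = nonempty (fiber key p cg) refl
        where
        nonempty : ∀ d → d ≡ fiber key p cg → (g ℕ.* f g) ℕ.^ (3 ℕ.* t) ℕ.≤ G
        nonempty [] e = ℕ.≤-trans (ℕ.≤-reflexive (trans (cong (λ m → (g ℕ.* m) ℕ.^ (3 ℕ.* t)) empty) (trans (cong (ℕ._^ (3 ℕ.* t)) (ℕ.*-zeroʳ g)) (0^ (3 ℕ.* t) 1≤3t)))) z≤n
          where
          0^ : ∀ k → 1 ℕ.≤ k → 0 ℕ.^ k ≡ 0
          0^ (suc k) _ = refl
          empty : f g ≡ 0
          empty = ℕ.n≤0⇒n≡0 (ℕ.≤-trans le (ℕ.≤-reflexive (trans (cong (λ d → suc Z ℕ.* length d) (sym e)) (ℕ.*-zeroʳ (suc Z)))))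
        nonempty d@(x ∷ _) e = residues (residue-class pp c1 d)
          where
          s₀ : d ⊑ cg
          s₀ = subst (_⊑ cg) (sym e) (fiber-⊑ key p cg)
          d⊑c : d ⊑ c
          d⊑c = ⊑-trans s₀ (fiber-⊑ cont g c)
          keyed : ∀ y → y ∈ d → key y ≡ p
          keyed y i = fiber-key key {c = cg} (subst (y ∈_) e i)
          x∈c : x ∈ c
          x∈c = proj₁ d⊑c (here refl)
          pp : Prime p
          pp = subst Prime (keyed x (here refl)) (proj₁ (spec x x∈c))
          avoids : ∀ y → y ∈ d → ¬ p ℕ.∣ N y
          avoids y i = subst (λ q → ¬ q ℕ.∣ N y) (keyed y i) (proj₁ (proj₂ (spec y (proj₁ d⊑c i))))
          p<Z : p ℕ.< suc Z
          p<Z = subst (ℕ._< suc Z) (keyed x (here refl)) (key<Z x∈c)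
          2^t≤p : 2 ℕ.^ t ℕ.≤ p
          2^t≤p = ℕ.<⇒≤ (ℕ.≰⇒> (λ p≤ → avoids x (here refl) (ℕ.∣n⇒∣m*n (nn x) (ℕ.∣-trans p∣p! (ℕ.m≤n⇒m!∣n! p≤)))))
            where
            p∣p! : p ℕ.∣ p ℕ.!
            p∣p! = go p (prime⇒nonZero pp)
              where
              go : ∀ p → ℕ.NonZero p → p ℕ.∣ p ℕ.!
              go (suc k) _ = ℕ.m∣m*n (k ℕ.!)
          Result : Set
          Result = (g ℕ.* f g) ℕ.^ (3 ℕ.* t) ℕ.≤ G
          restrict : ∀ h {d d' : List V4} → d' ⊑ d → same pp h d → same pp h d'
          restrict h s sd y z i j = sd y z (proj₁ s i) (proj₁ s j)
          chain : ∀ m₁ m₂ m₃ m₄ m₅ m₆ → length d ℕ.≤ p ℕ.* m₁ → m₁ ℕ.≤ p ℕ.* m₂ → m₂ ℕ.≤ p ℕ.* m₃ → m₃ ℕ.≤ p ℕ.* m₄ → m₄ ℕ.≤ p ℕ.* m₅ → m₅ ℕ.≤ m₆ → f g ℕ.≤ suc Z ℕ.* (p ℕ.* (p ℕ.* (p ℕ.* (p ℕ.* (p ℕ.* m₆)))))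
          chain _ _ _ _ _ _ l₁ l₂ l₃ l₄ l₅ l₆ = ℕ.≤-trans le (ℕ.*-monoʳ-≤ (suc Z) (subst (λ d → length d ℕ.≤ _) e (ℕ.≤-trans l₁ (ℕ.*-monoʳ-≤ p (ℕ.≤-trans l₂ (ℕ.*-monoʳ-≤ p (ℕ.≤-trans l₃ (ℕ.*-monoʳ-≤ p (ℕ.≤-trans l₄ (ℕ.*-monoʳ-≤ p (ℕ.≤-trans l₅ (ℕ.*-monoʳ-≤ p l₆))))))))))))
          residues : (∃[ d₁ ] d₁ ⊑ d × same pp c1 d₁ × length d ℕ.≤ p ℕ.* length d₁) → Result
          residues (d₁ , s₁ , r₁ , l₁) = second (residue-class pp c2 d₁)
            where
            second : (∃[ d₂ ] d₂ ⊑ d₁ × same pp c2 d₂ × length d₁ ℕ.≤ p ℕ.* length d₂) → Result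
            second (d₂ , s₂ , r₂ , l₂) = third (residue-class pp c3 d₂)
              where
              third : (∃[ d₃ ] d₃ ⊑ d₂ × same pp c3 d₃ × length d₂ ℕ.≤ p ℕ.* length d₃) → Result
              third (d₃ , s₃ , r₃ , l₃) = fourth (residue-class pp c4 d₃)
                where
                fourth : (∃[ d₄ ] d₄ ⊑ d₃ × same pp c4 d₄ × length d₃ ℕ.≤ p ℕ.* length d₄) → Result
                fourth (d₄ , s₄ , r₄ , l₄) = fifth (residue-class pp Y d₄)
                  where
                  fifth : (∃[ d₅ ] d₅ ⊑ d₄ × same pp Y d₅ × length d₄ ℕ.≤ p ℕ.* length d₅) → Result
                  fifth (d₅ , s₅ , r₅ , l₅) = done (local g d₅ pp 2^t≤p (⊑-trans sub d⊑c)
                      (λ y i dv → avoids y (proj₁ sub i) (ℕ.∣m⇒∣m*n F dv)) (λ y i → fiber-key cont {c = c} (proj₁ s₀ (proj₁ sub i))) 1≤g g≤n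
                      (restrict c1 s₂₅ r₁) (restrict c2 s₃₅ r₂) (restrict c3 s₄₅ r₃) (restrict c4 s₅ r₄) r₅)
                    where
                    s₄₅ : d₅ ⊑ d₃
                    s₄₅ = ⊑-trans s₅ s₄
                    s₃₅ : d₅ ⊑ d₂
                    s₃₅ = ⊑-trans s₄₅ s₃
                    s₂₅ : d₅ ⊑ d₁
                    s₂₅ = ⊑-trans s₃₅ s₂
                    sub : d₅ ⊑ d
                    sub = ⊑-trans s₂₅ s₁
                    done : (∃[ s ] length d₅ ℕ.≤ 4 ℕ.* (p ℕ.^ s ℕ.* 2 ℕ.^ s) × (p ℕ.^ s ℕ.* g) ℕ.^ 3 ℕ.≤ X) → Result
                    done (s , cnt , bd) = class-power 2^t≤p p<Z g s (f g) (chain (length d₁) (length d₂) (length d₃) (length d₄) (length d₅) (4 ℕ.* (p ℕ.^ s ℕ.* 2 ℕ.^ s)) l₁ l₂ l₃ l₄ l₅ cnt) bd 1≤g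

    f≤V : ∀ g → g ℕ.* f g ℕ.≤ V
    f≤V g = by-case (fiber cont g c) refl
      where
      by-case : ∀ d → d ≡ fiber cont g c → g ℕ.* f g ℕ.≤ V
      by-case [] e = ℕ.≤-trans (ℕ.≤-reflexive (trans (cong (λ d → g ℕ.* length d) (sym e)) (ℕ.*-zeroʳ g))) z≤n
      by-case (x ∷ _) e = ℕ.≤-pred (ℕ.≰⇒> (λ sV≤ → ℕ.<⇒≱ (proj₂ (proj₂ rootV)) (ℕ.≤-trans (ℕ.^-monoˡ-≤ (3 ℕ.* t) sV≤) (content-class g
          (subst (1 ℕ.≤_) cx≡g (proj₁ (cont-bound x x∈c))) (subst (ℕ._≤ n) cx≡g (proj₂ (cont-bound x x∈c)))))))
        where
        x∈ : x ∈ fiber cont g c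
        x∈ = subst (x ∈_) e (here refl)
        x∈c : x ∈ c
        x∈c = proj₁ (fiber-⊑ cont g c) x∈
        cx≡g : cont x ≡ g
        cx≡g = fiber-key cont {c = c} x∈
    f0 : f 0 ≡ 0
    f0 = by-case (fiber cont 0 c) refl
      where
      by-case : ∀ d → d ≡ fiber cont 0 c → f 0 ≡ 0
      by-case [] e = cong length (sym e)
      by-case (x ∷ _) e = ⊥-elim (ℕ.<⇒≱ (proj₁ (cont-bound x (proj₁ (fiber-⊑ cont 0 c) x∈))) (ℕ.≤-reflexive (fiber-key cont {c = c} x∈)))
        where
        x∈ : x ∈ fiber cont 0 c
        x∈ = subst (x ∈_) e (here refl)

    assemble : (∃[ L ] 2 ℕ.^ L ℕ.≤ n × n ℕ.< 2 ℕ.^ suc L) → length c ℕ.^ (3 ℕ.* t) ℕ.≤ pipeline-constant t ℕ.* (n ℕ.* W ℕ.* (X ℕ.^ t ℕ.* X))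
    assemble (L , lo , hi) = begin
      length c ℕ.^ (3 ℕ.* t)                              ≤⟨ ℕ.^-monoˡ-≤ (3 ℕ.* t) (ℕ.≤-trans (length≤sum-fibers cont (2 ℕ.^ suc L) c (λ {x} i → ℕ.≤-<-trans (proj₂ (cont-bound x i)) hi)) (harmonic V f f0 f≤V (suc L))) ⟩
      (suc L ℕ.* V) ℕ.^ (3 ℕ.* t)                           ≡⟨ ^-distribʳ-* (3 ℕ.* t) (suc L) V ⟩
      -- The power of the logarithm becomes a constant times 2 ^ L ≤ n, and V, Z are replaced by the
      -- quantities whose roots they are.
      suc L ℕ.^ (3 ℕ.* t) ℕ.* V ℕ.^ (3 ℕ.* t)                   ≤⟨ ℕ.*-mono-≤ (ℕ.≤-trans (poly≤exp (3 ℕ.* t) 1≤3t L) (ℕ.*-monoʳ-≤ ((2 ℕ.* (3 ℕ.* t)) ℕ.^ (3 ℕ.* t)) lo)) (ℕ.≤-trans (proj₁ (proj₂ rootV)) (ℕ.*-monoˡ-≤ (64 ℕ.^ t ℕ.* (X ℕ.^ t ℕ.* X)) Zpow)) ⟩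
      ((2 ℕ.* (3 ℕ.* t)) ℕ.^ (3 ℕ.* t) ℕ.* n) ℕ.* ((2 ℕ.^ u ℕ.* (suc C ℕ.* (W ℕ.* F))) ℕ.* (64 ℕ.^ t ℕ.* (X ℕ.^ t ℕ.* X))) ≡⟨ solve 8 (λ a n b c w f d x → (a :* n) :* ((b :* (c :* (w :* f))) :* (d :* x)) := a :* (b :* (c :* f)) :* d :* (n :* w :* x)) refl ((2 ℕ.* (3 ℕ.* t)) ℕ.^ (3 ℕ.* t)) n (2 ℕ.^ u) (suc C) W F (64 ℕ.^ t) (X ℕ.^ t ℕ.* X) ⟩
      pipeline-constant t ℕ.* (n ℕ.* W ℕ.* (X ℕ.^ t ℕ.* X))     ∎
      where open ℕS.+-*-Solver

  -- Points on a diagonal conic.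

  module Conic (A B C : ℤ) (A≢0 : A ≢ 0ℤ) (B≢0 : B ≢ 0ℤ) (C≢0 : C ≢ 0ℤ) (u v w : V4 → ℤ) (nn : V4 → ℕ) (n : ℕ) (1≤n : 1 ℕ.≤ n) (c : List V4)
    (uq : Unique c)
    (on : ∀ x → x ∈ c → A * (u x * u x) + B * (v x * v x) + C * (w x * w x) ≡ 0ℤ)
    (small : ∀ x → x ∈ c → abs (u x) ℕ.≤ n × abs (v x) ℕ.≤ n × abs (w x) ℕ.≤ n)
    (content : ∀ x → x ∈ c → + cont x ∣ u x × + cont x ∣ v x × + cont x ∣ w x)
    (units : ∀ {p} x → x ∈ c → ¬ p ℕ.∣ nn x → ¬ + p ∣ + 2 × ¬ + p ∣ B × ¬ + p ∣ v x × ¬ + p ∣ w x)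
    (w-residue : ∀ {p} x y → + p ∣ c1 x - c1 y → + p ∣ c2 x - c2 y → + p ∣ c3 x - c3 y → + p ∣ c4 x - c4 y → + p ∣ u x - u y × + p ∣ v x - v y × + p ∣ w x - w y)
    (determined : ∀ {p} → Prime p → ∀ x y → x ∈ c → y ∈ c → ¬ p ℕ.∣ nn x → ¬ p ℕ.∣ nn y → cont x ≡ cont y → cont y ≢ 0 →
      + p ∣ c1 x - c1 y → + p ∣ c2 x - c2 y → + p ∣ c3 x - c3 y → + p ∣ c4 x - c4 y →
      w x * u y ≡ w y * u x → w x * v y ≡ w y * v x → x ≡ y)
    where

    k : ℕ
    k = abs A ℕ.+ abs B ℕ.+ abs C

    X : ℕ
    X = (k ℕ.* n) ℕ.^ 3

    private
      F : V4 → V4 → ℤ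
      F x y = A * (u x * u y) + B * (v x * v y) + C * (w x * w y)

      σ τ ρ : V4 → V4 → ℤ
      σ x y = w x * u y - w y * u x
      τ x y = w x * v y - w y * v x
      ρ x y = u x * v y - u y * v x

      -- The left side is the form at w P' - w' P, whose third coordinate is 0. Since the form
      -- vanishes at P and at P', only the cross term remains.
      polar : ∀ A B C u v w u' v' w' → A * (u * u) + B * (v * v) + C * (w * w) ≡ 0ℤ → A * (u' * u') + B * (v' * v') + C * (w' * w') ≡ 0ℤ →
        A * ((w * u' - w' * u) * (w * u' - w' * u)) + B * ((w * v' - w' * v) * (w * v' - w' * v)) ≡ - (+ 2 * (w * w') * (A * (u * u') + B * (v * v') + C * (w * w')))
      polar A B C u v w u' v' w' e e' = trans (raw A B C u v w u' v' w') (trans (cong₂ (λ s t → w' * w' * s + w * w * t - + 2 * (w * w') * (A * (u * u') + B * (v * v') + C * (w * w'))) e e')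
          (tidy (w' * w') (w * w) (+ 2 * (w * w') * (A * (u * u') + B * (v * v') + C * (w * w')))))
        where
        raw : ∀ A B C u v w u' v' w' → A * ((w * u' - w' * u) * (w * u' - w' * u)) + B * ((w * v' - w' * v) * (w * v' - w' * v)) ≡
          w' * w' * (A * (u * u) + B * (v * v) + C * (w * w)) + w * w * (A * (u' * u') + B * (v' * v') + C * (w' * w')) - + 2 * (w * w') * (A * (u * u') + B * (v * v') + C * (w * w'))
        raw = solve-∀
        tidy : ∀ s t z → s * 0ℤ + t * 0ℤ - z ≡ - z
        tidy = solve-∀

      -- A zero of the polar form of two points of a nondegenerate conic makes them proportional.
      polar≡0 : ∀ x y → x ∈ c → y ∈ c → F x y ≡ 0ℤ → σ x y ≡ 0ℤ × τ x y ≡ 0ℤ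
      polar≡0 x y i j z = σ≡0 , τ≡0
        where
        vanish : ∀ {f} s → f ≡ 0ℤ → - (+ 2 * s * f) ≡ 0ℤ
        vanish s refl = cong -_ (*-zeroʳ (+ 2 * s))
        eστ : A * (σ x y * σ x y) + B * (τ x y * τ x y) ≡ 0ℤ
        eστ = trans (polar A B C (u x) (v x) (w x) (u y) (v y) (w y) (on x i) (on y j)) (vanish (w x * w y) z)
        rotate : ∀ p q r → q + r + p ≡ p + q + r
        rotate = solve-∀
        rotate' : ∀ p q r → r + p + q ≡ p + q + r
        rotate' = solve-∀
        eρσ : B * (ρ x y * ρ x y) + C * ((u x * w y - u y * w x) * (u x * w y - u y * w x)) ≡ 0ℤ
        eρσ = trans (polar B C A (v x) (w x) (u x) (v y) (w y) (u y) (trans (rotate (A * (u x * u x)) (B * (v x * v x)) (C * (w x * w x))) (on x i)) (trans (rotate (A * (u y * u y)) (B * (v y * v y)) (C * (w y * w y))) (on y j)))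
          (vanish (u x * u y) (trans (rotate (A * (u x * u y)) (B * (v x * v y)) (C * (w x * w y))) z))
        eτρ : C * ((v x * w y - v y * w x) * (v x * w y - v y * w x)) + A * ((v x * u y - v y * u x) * (v x * u y - v y * u x)) ≡ 0ℤ
        eτρ = trans (polar C A B (w x) (u x) (v x) (w y) (u y) (v y) (trans (rotate' (A * (u x * u x)) (B * (v x * v x)) (C * (w x * w x))) (on x i)) (trans (rotate' (A * (u y * u y)) (B * (v y * v y)) (C * (w y * w y))) (on y j)))
          (vanish (v x * v y) (trans (rotate' (A * (u x * u y)) (B * (v x * v y)) (C * (w x * w y))) z))
        -- Weighting the three binary forms in σ, τ, ρ by B, -A and C cancels σ² and ρ² and leaves 2
        -- B C τ².
        raw : ∀ A B C u v w u' v' w' → let τ = w * v' - w' * v in + 2 * (B * C) * (τ * τ) ≡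
          B * (C * ((v * w' - v' * w) * (v * w' - v' * w)) + A * ((v * u' - v' * u) * (v * u' - v' * u)))
          - A * (B * ((u * v' - u' * v) * (u * v' - u' * v)) + C * ((u * w' - u' * w) * (u * w' - u' * w)))
          + C * (A * ((w * u' - w' * u) * (w * u' - w' * u)) + B * (τ * τ))
        raw = solve-∀
        zz : ∀ p q r → p * 0ℤ - q * 0ℤ + r * 0ℤ ≡ 0ℤ
        zz = solve-∀
        τ≡0 : τ x y ≡ 0ℤ
        τ≡0 = square≡0 (*≡0-cancel (τ x y * τ x y) (*-≢0 {+ 2} (λ ()) (*-≢0 B≢0 C≢0)) (trans (raw A B C (u x) (v x) (w x) (u y) (v y) (w y))
          (trans (cong₂ _+_ (cong₂ (λ s t → B * s - A * t) eτρ eρσ) (cong (C *_) eστ)) (zz B A C))))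
        σ≡0 : σ x y ≡ 0ℤ
        σ≡0 = square≡0 (*≡0-cancel (σ x y * σ x y) A≢0 (trans (trans (sym (+-identityʳ (A * (σ x y * σ x y)))) (cong (λ r → A * (σ x y * σ x y) + r) (sym (trans (cong (λ s → B * (s * s)) τ≡0) (*-zeroʳ B))))) eστ))

      1≤k : 1 ℕ.≤ k
      1≤k = ℕ.≤-trans (ℕ.n≢0⇒n>0 (λ z → A≢0 (∣i∣≡0⇒i≡0 z))) (ℕ.≤-trans (ℕ.m≤m+n (abs A) (abs B)) (ℕ.m≤m+n (abs A ℕ.+ abs B) (abs C)))

    module _ {p : ℕ} (g : ℕ) (d₀ : List V4) (pp : Prime p) (d₀⊑c : d₀ ⊑ c) (avoid : ∀ x → x ∈ d₀ → ¬ p ℕ.∣ nn x) (of-content : ∀ x → x ∈ d₀ → cont x ≡ g)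
      (1≤g : 1 ℕ.≤ g) (g≤n : g ℕ.≤ n) (r1 : same pp c1 d₀) (r2 : same pp c2 d₀) (r3 : same pp c3 d₀) (r4 : same pp c4 d₀) where

      private
        instance
          p≢0 : ℕ.NonZero p
          p≢0 = prime⇒nonZero pp

        ∈c : ∀ {x} → x ∈ d₀ → x ∈ c
        ∈c = proj₁ d₀⊑c

        unit : ∀ x → x ∈ d₀ → ¬ + p ∣ + 2 × ¬ + p ∣ B × ¬ + p ∣ v x × ¬ + p ∣ w x
        unit x i = units x (∈c i) (avoid x i)

        congruent : ∀ x y → x ∈ d₀ → y ∈ d₀ → + p ∣ u x - u y × + p ∣ v x - v y × + p ∣ w x - w y
        congruent x y i j = w-residue x y (r1 x y i j) (r2 x y i j) (r3 x y i j) (r4 x y i j)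

        LevS : ℕ → List V4 → Set
        LevS l d = d ⊑ d₀ × (∀ x y → x ∈ d → y ∈ d → pw pp (suc l) ∣ σ x y) × (∀ x y → x ∈ d → y ∈ d → pw pp (suc l) ∣ τ x y)

        start : LevS 0 d₀
        start = ⊑-refl , (λ x y i j → ratio (w x) (u x) (w y) (u y) (proj₁ (congruent x y i j)) (proj₂ (proj₂ (congruent x y i j)))) ,
                         (λ x y i j → ratio (w x) (v x) (w y) (v y) (proj₁ (proj₂ (congruent x y i j))) (proj₂ (proj₂ (congruent x y i j))))
          where
          raw' : ∀ w u w' u' → (w - w') * u - w * (u - u') ≡ w * u' - w' * u
          raw' = solve-∀
          ratio : ∀ w u w' u' → + p ∣ u - u' → + p ∣ w - w' → pw pp 1 ∣ w * u' - w' * u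
          ratio w u w' u' du dw = subst (_∣ w * u' - w' * u) (cong +_ (sym (ℕ.*-identityʳ p))) (∣-resp-≡ (raw' w u w' u') (∣m∣n⇒∣m-n (∣m⇒∣m*n u dw) (∣n⇒∣m*n w du)))

        -- Modulo p the tangent line A u₀ D₁ + B v₀ D₂ ≡ 0 determines D₂ from D₁, as B v₀ is a unit.
        -- So one residue suffices and a class splits into only p parts.
        step : ∀ l d → LevS l d → ∃[ e ] e ⊑ d × LevS (suc l) e × length d ℕ.≤ p ℕ.* length e
        step l [] (s , _ , _) = [] , ⊑-refl , (s , (λ x y ()) , (λ x y ())) , z≤n
        step l d@(x₀ ∷ _) (s , hσ , hτ) = finish (residue-class pp (λ x → σ x₀ x /ℕ N) d)
          where
          N : ℕ
          N = p ℕ.^ suc l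
          instance
            N≢0 : ℕ.NonZero N
            N≢0 = ℕ.m^n≢0 p (suc l)
          q : ℤ
          q = pw pp (suc l)
          q≢0 : q ≢ 0ℤ
          q≢0 e = ℕ.≢-nonZero⁻¹ N (+-injective e)
          i₀ : x₀ ∈ d
          i₀ = here refl
          D₁ D₂ : V4 → ℤ
          D₁ x = σ x₀ x /ℕ N
          D₂ x = τ x₀ x /ℕ N
          σ-≡ : ∀ x → x ∈ d → σ x₀ x ≡ q * D₁ x
          σ-≡ x i = quotient-∣ N (σ x₀ x) (hσ x₀ x i₀ i)
          τ-≡ : ∀ x → x ∈ d → τ x₀ x ≡ q * D₂ x
          τ-≡ x i = quotient-∣ N (τ x₀ x) (hτ x₀ x i₀ i)
          up : ∀ {x} → x ∈ d → x ∈ d₀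
          up = proj₁ s
          p∤w : ∀ x → x ∈ d → ¬ + p ∣ w x
          p∤w x i = proj₂ (proj₂ (proj₂ (unit x (up i))))
          tangent : ∀ x → x ∈ d → + p ∣ A * u x₀ * D₁ x + B * v x₀ * D₂ x
          tangent x i = ∣-cancel pp (+ 2 * w x) (A * u x₀ * D₁ x + B * v x₀ * D₂ x) (∤-* pp (+ 2) (w x) (proj₁ (unit x (up i))) (p∤w x i))
            (∣-resp-≡ (sym line) (∣m⇒∣-m (∣m⇒∣m*n (A * (D₁ x * D₁ x) + B * (D₂ x * D₂ x)) (p∣pw-suc pp l))))
            where
            raw : ∀ A B C u v w u₀ v₀ w₀ → let s = w₀ * u - w * u₀ ; t = w₀ * v - w * v₀ in + 2 * w * (A * u₀ * s + B * v₀ * t) ≡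
              w₀ * w₀ * (A * (u * u) + B * (v * v) + C * (w * w)) - w * w * (A * (u₀ * u₀) + B * (v₀ * v₀) + C * (w₀ * w₀)) - (A * (s * s) + B * (t * t))
            raw = solve-∀
            tidy : ∀ s t z → s * 0ℤ - t * 0ℤ - z ≡ - z
            tidy = solve-∀
            raw' : ∀ q z A B u₀ v₀ D E → q * (z * (A * u₀ * D + B * v₀ * E)) ≡ z * (A * u₀ * (q * D) + B * v₀ * (q * E))
            raw' = solve-∀
            raw'' : ∀ q A B D E → - (A * (q * D * (q * D)) + B * (q * E * (q * E))) ≡ q * - (q * (A * (D * D) + B * (E * E)))
            raw'' = solve-∀
            whole : + 2 * w x * (A * u x₀ * σ x₀ x + B * v x₀ * τ x₀ x) ≡ - (A * (σ x₀ x * σ x₀ x) + B * (τ x₀ x * τ x₀ x))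
            whole = trans (raw A B C (u x) (v x) (w x) (u x₀) (v x₀) (w x₀)) (trans (cong₂ (λ e f → w x₀ * w x₀ * e - w x * w x * f - (A * (σ x₀ x * σ x₀ x) + B * (τ x₀ x * τ x₀ x))) (on x (∈c (up i))) (on x₀ (∈c (up i₀))))
              (tidy (w x₀ * w x₀) (w x * w x) (A * (σ x₀ x * σ x₀ x) + B * (τ x₀ x * τ x₀ x))))
            line : + 2 * w x * (A * u x₀ * D₁ x + B * v x₀ * D₂ x) ≡ - (q * (A * (D₁ x * D₁ x) + B * (D₂ x * D₂ x)))
            line = *-cancelˡ-≡ q (+ 2 * w x * (A * u x₀ * D₁ x + B * v x₀ * D₂ x)) (- (q * (A * (D₁ x * D₁ x) + B * (D₂ x * D₂ x)))) {{≢-nonZero q≢0}}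
              (trans (raw' q (+ 2 * w x) A B (u x₀) (v x₀) (D₁ x) (D₂ x)) (trans (cong₂ (λ e f → + 2 * w x * (A * u x₀ * e + B * v x₀ * f)) (sym (σ-≡ x i)) (sym (τ-≡ x i)))
                (trans whole (trans (cong₂ (λ e f → - (A * (e * e) + B * (f * f))) (σ-≡ x i) (τ-≡ x i)) (raw'' q A B (D₁ x) (D₂ x))))))
          same-D₂ : ∀ x y → x ∈ d → y ∈ d → + p ∣ D₁ x - D₁ y → + p ∣ D₂ x - D₂ y
          same-D₂ x y i j e = ∣-cancel pp (B * v x₀) (D₂ x - D₂ y) (∤-* pp B (v x₀) (proj₁ (proj₂ (unit x₀ (up i₀)))) (proj₁ (proj₂ (proj₂ (unit x₀ (up i₀))))))
            (∣-resp-≡ (raw (A * u x₀) (B * v x₀) (D₁ x) (D₁ y) (D₂ x) (D₂ y)) (∣m∣n⇒∣m-n (∣m∣n⇒∣m-n (tangent x i) (tangent y j)) (∣n⇒∣m*n (A * u x₀) e)))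
            where
            raw : ∀ s t D D' E E' → s * D + t * E - (s * D' + t * E') - s * (D - D') ≡ t * (E - E')
            raw = solve-∀
          refine : ∀ (h : V4 → ℤ) (D : V4 → ℤ) → (∀ x → x ∈ d → w x₀ * h x - w x * h x₀ ≡ q * D x) → ∀ x y → x ∈ d → y ∈ d → + p ∣ D x - D y → pw pp (suc (suc l)) ∣ w x * h y - w y * h x
          refine h D D-≡ x y i j e = pw-cancel pp (suc (suc l)) (w x₀) (w x * h y - w y * h x) (p∤w x₀ i₀)
            (subst₂ _∣_ (sym (pw-suc pp (suc l))) (sym (trans (raw (w x₀) (w x) (w y) (h x) (h y) (h x₀)) (trans (cong₂ (λ s t → w x * s - w y * t) (D-≡ y j) (D-≡ x i)) (raw' q (w x) (w y) (D x) (D y)))))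
              (*-monoˡ-∣ q (∣m∣n⇒∣m-n (∣m⇒∣m*n (D y) (proj₂ (proj₂ (congruent x y (up i) (up j))))) (∣n⇒∣m*n (w y) e))))
            where
            raw : ∀ y yP yQ xP xQ x₀ → y * (yP * xQ - yQ * xP) ≡ yP * (y * xQ - yQ * x₀) - yQ * (y * xP - yP * x₀)
            raw = solve-∀
            raw' : ∀ q yP yQ dP dQ → yP * (q * dQ) - yQ * (q * dP) ≡ ((yP - yQ) * dQ - yQ * (dP - dQ)) * q
            raw' = solve-∀
          finish : (∃[ e ] e ⊑ d × same pp D₁ e × length d ℕ.≤ p ℕ.* length e) → ∃[ e ] e ⊑ d × LevS (suc l) e × length d ℕ.≤ p ℕ.* length e
          finish (e , e⊑d , sm , le) = e , e⊑d , (⊑-trans e⊑d s ,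
            (λ x y i j → refine u D₁ σ-≡ x y (proj₁ e⊑d i) (proj₁ e⊑d j) (sm x y i j)) ,
            (λ x y i j → refine v D₂ τ-≡ x y (proj₁ e⊑d i) (proj₁ e⊑d j) (same-D₂ x y (proj₁ e⊑d i) (proj₁ e⊑d j) (sm x y i j)))) , le

        Good : List V4 → Set
        Good d = 2 ℕ.≤ length d

        -- For two distinct points the polar form F is nonzero. It is divisible by p ^ (2 l + 2) and
        -- by g², which are coprime, and it is at most (k n)² in absolute value. The square root is
        -- then cubed to fit the common shape of `Local`.
        inequality : ∀ l d → LevS l d → Good d → (p ℕ.^ suc l ℕ.* g) ℕ.^ 3 ℕ.≤ X
        inequality l [] _ ()
        inequality l (_ ∷ []) _ (s≤s ())
        inequality l d@(x ∷ y ∷ _) (s , hσ , hτ) _ = ℕ.^-monoˡ-≤ 3 (^-cancelʳ-≤ 2 {p ℕ.^ suc l ℕ.* g} {k ℕ.* n} (s≤s z≤n) (ℕ.≤-trans (go gg∣F) F-bound))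
          where
          open ℕS.+-*-Solver
          i : x ∈ d
          i = here refl
          j : y ∈ d
          j = there (here refl)
          up : ∀ {x} → x ∈ d → x ∈ d₀
          up = proj₁ s
          x≢y : x ≢ y
          x≢y = first (proj₂ s (proj₂ d₀⊑c uq))
            where
            first : Unique d → x ≢ y
            first ((ne ∷ _) ∷ _) = ne
          L : ℕ
          L = suc l ℕ.+ suc l
          F≢0 : F x y ≢ 0ℤ
          F≢0 z = x≢y (determined pp x y (∈c (up i)) (∈c (up j)) (avoid x (up i)) (avoid y (up j)) (trans (of-content x (up i)) (sym (of-content y (up j))))
              (λ z → ℕ.<⇒≢ 1≤g (sym (trans (sym (of-content y (up j))) z))) (r1 x y (up i) (up j)) (r2 x y (up i) (up j)) (r3 x y (up i) (up j)) (r4 x y (up i) (up j))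
              (minus (proj₁ (polar≡0 x y (∈c (up i)) (∈c (up j)) z))) (minus (proj₂ (polar≡0 x y (∈c (up i)) (∈c (up j)) z))))
            where
            minus : ∀ {s t} → s - t ≡ 0ℤ → s ≡ t
            minus {s} {t} e = i-j≡0⇒i≡j s t e
          pL∣F : pw pp L ∣ F x y
          pL∣F = pw-cancel pp L (+ 2 * (w x * w y)) (F x y) (∤-* pp (+ 2) (w x * w y) (proj₁ (unit x (up i))) (∤-* pp (w x) (w y) (proj₂ (proj₂ (proj₂ (unit x (up i))))) (proj₂ (proj₂ (proj₂ (unit y (up j)))))))
            (∣-resp-≡ (neg-involutive (+ 2 * (w x * w y) * F x y)) (∣m⇒∣-m (∣-resp-≡ (polar A B C (u x) (v x) (w x) (u y) (v y) (w y) (on x (∈c (up i))) (on y (∈c (up j))))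
              (subst (_∣ A * (σ x y * σ x y) + B * (τ x y * τ x y)) (sym (pw-+ pp (suc l) (suc l)))
                (∣m∣n⇒∣m+n (∣n⇒∣m*n A (*-pres-∣ (hσ x y i j) (hσ x y i j))) (∣n⇒∣m*n B (*-pres-∣ (hτ x y i j) (hτ x y i j))))))))
          gd : ∀ x → x ∈ d → + g ∣ u x × + g ∣ v x × + g ∣ w x
          gd x i = subst (λ g → + g ∣ u x × + g ∣ v x × + g ∣ w x) (of-content x (up i)) (content x (∈c (up i)))
          gg∣F : + g * + g ∣ F x y
          gg∣F = ∣m∣n⇒∣m+n (∣m∣n⇒∣m+n (∣n⇒∣m*n A (*-pres-∣ (proj₁ (gd x i)) (proj₁ (gd y j)))) (∣n⇒∣m*n B (*-pres-∣ (proj₁ (proj₂ (gd x i))) (proj₁ (proj₂ (gd y j))))))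
            (∣n⇒∣m*n C (*-pres-∣ (proj₂ (proj₂ (gd x i))) (proj₂ (proj₂ (gd y j)))))
          p∤g : ¬ + p ∣ + g
          p∤g dv = proj₂ (proj₂ (proj₂ (unit x (up i)))) (∣-trans dv (proj₂ (proj₂ (gd x i))))
          F-bound : abs (F x y) ℕ.≤ (k ℕ.* n) ℕ.^ 2
          F-bound = ℕ.≤-trans (abs-+-≤ {i = A * (u x * u y) + B * (v x * v y)} {C * (w x * w y)} (abs-+-≤ {i = A * (u x * u y)} {B * (v x * v y)} (term A (u x) (u y) (proj₁ bx) (proj₁ by)) (term B (v x) (v y) (proj₁ (proj₂ bx)) (proj₁ (proj₂ by)))) (term C (w x) (w y) (proj₂ (proj₂ bx)) (proj₂ (proj₂ by))))
              (ℕ.≤-trans (ℕ.≤-reflexive (solve 4 (λ a b c m → a :* m :+ b :* m :+ c :* m := con 1 :* ((a :+ b :+ c) :* m)) refl (abs A) (abs B) (abs C) (n ℕ.* n)))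
              (ℕ.≤-trans (ℕ.*-monoˡ-≤ (k ℕ.* (n ℕ.* n)) 1≤k) (ℕ.≤-reflexive (solve 2 (λ k n → k :* (k :* (n :* n)) := k :* n :* (k :* n :* con 1)) refl k n))))
            where
            bx = small x (∈c (up i))
            by = small y (∈c (up j))
            term : ∀ A s t → abs s ℕ.≤ n → abs t ℕ.≤ n → abs (A * (s * t)) ℕ.≤ abs A ℕ.* (n ℕ.* n)
            term A s t bs bt = abs-*-≤ {i = A} {s * t} ℕ.≤-refl (abs-*-≤ {i = s} {t} bs bt)
          go : + g * + g ∣ F x y → (p ℕ.^ suc l ℕ.* g) ℕ.^ 2 ℕ.≤ abs (F x y)
          go (divides z eq) = ℕ.≤-trans (ℕ.≤-reflexive shape) (∣-size (subst₂ _∣_ (trans (cong (pw pp L *_) (sym (pos-* g g))) (sym (pos-* (p ℕ.^ L) (g ℕ.* g)))) (sym eq)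
              (*-monoˡ-∣ (+ g * + g) (pw-cancel pp L (+ g * + g) z (∤-* pp (+ g) (+ g) p∤g p∤g) (∣-resp-≡ (trans eq (*-comm z (+ g * + g))) pL∣F)))) F≢0)
            where
            shape : (p ℕ.^ suc l ℕ.* g) ℕ.^ 2 ≡ p ℕ.^ L ℕ.* (g ℕ.* g)
            shape = trans (solve 2 (λ q g → q :* g :* (q :* g :* con 1) := q :* q :* (g :* g)) refl (p ℕ.^ suc l) g) (cong (ℕ._* (g ℕ.* g)) (sym (ℕ.^-distribˡ-+-* p (suc l) (suc l))))

        level≤X : ∀ l d → LevS l d → Good d → l ℕ.≤ X
        level≤X l d lv gd = begin
          l                            ≤⟨ ℕ.<⇒≤ (n<2^n l) ⟩
          2 ℕ.^ l                      ≤⟨ ℕ.^-monoˡ-≤ l (ℕ.nonTrivial⇒n>1 p {{prime⇒nonTrivial pp}}) ⟩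
          p ℕ.^ l                      ≤⟨ ℕ.^-monoʳ-≤ p (ℕ.n≤1+n l) ⟩
          p ℕ.^ suc l                  ≤⟨ ℕ.m≤m*n (p ℕ.^ suc l) g {{ℕ.>-nonZero 1≤g}} ⟩
          p ℕ.^ suc l ℕ.* g            ≤⟨ ℕ.≤-trans (ℕ.≤-reflexive (sym (ℕ.^-identityʳ (p ℕ.^ suc l ℕ.* g)))) (ℕ.^-monoʳ-≤ (p ℕ.^ suc l ℕ.* g) {{ℕ.m*n≢0 (p ℕ.^ suc l) g {{ℕ.m^n≢0 p (suc l)}} {{ℕ.>-nonZero 1≤g}}}} (s≤s (z≤n {2}))) ⟩
          (p ℕ.^ suc l ℕ.* g) ℕ.^ 3    ≤⟨ inequality l d lv gd ⟩
          X                            ∎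
          where open ℕ.≤-Reasoning

      conic-class : ∃[ s ] length d₀ ℕ.≤ 4 ℕ.* (p ℕ.^ s ℕ.* 2 ℕ.^ s) × (p ℕ.^ s ℕ.* g) ℕ.^ 3 ℕ.≤ X
      conic-class = decide (2 ℕ.≤? length d₀)
        where
        Result : Set
        Result = ∃[ s ] length d₀ ℕ.≤ 4 ℕ.* (p ℕ.^ s ℕ.* 2 ℕ.^ s) × (p ℕ.^ s ℕ.* g) ℕ.^ 3 ℕ.≤ X
        decide : Dec (Good d₀) → Result
        decide (no ≱) = 0 , ℕ.≤-trans (ℕ.≤-pred (ℕ.≰⇒> ≱)) (s≤s z≤n) , ℕ.^-monoˡ-≤ 3 (ℕ.≤-trans (ℕ.≤-reflexive (ℕ.*-identityˡ g)) (ℕ.≤-trans g≤n (ℕ.m≤n*m n k {{ℕ.>-nonZero 1≤k}})))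
        decide (yes gd) = finish (descend LevS Good (λ d → 2 ℕ.≤? length d) p X step level≤X 0 d₀ start gd)
          where
          finish : (∃[ m ] ∃[ d ] ∃[ e ] d ⊑ d₀ × LevS (m ℕ.+ 0) d × Good d × e ⊑ d × LevS (suc (m ℕ.+ 0)) e × ¬ Good e × length d₀ ℕ.≤ p ℕ.^ suc m ℕ.* length e) → Result
          finish (m , d , e , _ , levd , gd , _ , _ , ¬ge , le) = suc m ,
            ℕ.≤-trans le (ℕ.≤-trans (ℕ.*-monoʳ-≤ (p ℕ.^ suc m) (ℕ.≤-trans (ℕ.≤-pred (ℕ.≰⇒> ¬ge)) (1≤^ 2 (suc m) (s≤s z≤n)))) (ℕ.m≤n*m (p ℕ.^ suc m ℕ.* 2 ℕ.^ suc m) 4)) ,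
            subst (λ t → (p ℕ.^ suc t ℕ.* g) ℕ.^ 3 ℕ.≤ X) (ℕ.+-identityʳ m) (inequality (m ℕ.+ 0) d levd gd)

    conic-local : ∀ t Y → Local Y nn t n X c
    conic-local t Y g d pp _ d⊑c av oc 1≤g g≤n r1 r2 r3 r4 _ = conic-class g d pp d⊑c av oc 1≤g g≤n r1 r2 r3 r4

  -- The box of integer vectors, square roots and binary forms.

  +-cancelˡ : ∀ s t t' → s + t ≡ s + t' → t ≡ t'
  +-cancelˡ s t t' e = trans (raw s t) (trans (cong (_- s) e) (sym (raw s t')))
    where
    raw : ∀ s t → t ≡ s + t - s
    raw = solve-∀

  private
    -- The triangle inequality for i - B with i ≤ 2 B; the factor 3 affects constants only.
    range-bound : ∀ B {z} → z ∈ range B → abs z ℕ.≤ 3 ℕ.* B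
    range-bound B i = go (∈-map⁻ (λ i → + i - + B) i)
      where
      go : ∀ {z} → ∃[ i ] i ∈ upTo (suc (B ℕ.+ B)) × z ≡ + i - + B → abs z ℕ.≤ 3 ℕ.* B
      go (i , j , refl) = ℕ.≤-trans (∣i-j∣≤∣i∣+∣j∣ (+ i) (+ B)) (ℕ.≤-trans (ℕ.+-monoˡ-≤ B (ℕ.≤-pred (∈-upTo⁻ j)))
        (ℕ.≤-reflexive (solve 1 (λ b → b :+ b :+ b := con 3 :* b) refl B)))
        where open ℕS.+-*-Solver

    range-unique : ∀ B → Unique (range B)
    range-unique B = Unique.map⁺ (λ {i} {j} e → +-injective (+-cancelˡ (- + B) (+ i) (+ j) (trans (+-comm (- + B) (+ i)) (trans e (+-comm (+ j) (- + B)))))) (Unique.upTo⁺ (suc (B ℕ.+ B)))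

    ∈-prefixed : ∀ {n} (bs : List (Vec ℤ n)) r {z v} → (z ∷ v) ∈ concatMap (λ x → map (x ∷_) bs) r → z ∈ r × v ∈ bs
    ∈-prefixed bs (x ∷ r) {z} {v} i = split (∈-++⁻ (map (x ∷_) bs) i)
      where
      split : (z ∷ v) ∈ map (x ∷_) bs ⊎ (z ∷ v) ∈ concatMap (λ x → map (x ∷_) bs) r → z ∈ x ∷ r × v ∈ bs
      split (inj₁ j) = here (Vec.∷-injectiveˡ (proj₂ (proj₂ (∈-map⁻ (x ∷_) j)))) ,
        subst (_∈ bs) (sym (Vec.∷-injectiveʳ (proj₂ (proj₂ (∈-map⁻ (x ∷_) j))))) (proj₁ (proj₂ (∈-map⁻ (x ∷_) j)))
      split (inj₂ j) = there (proj₁ (∈-prefixed bs r j)) , proj₂ (∈-prefixed bs r j)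

    prefixed-unique : ∀ {n} (bs : List (Vec ℤ n)) r → Unique bs → Unique r → Unique (concatMap (λ x → map (x ∷_) bs) r)
    prefixed-unique bs [] ub [] = []
    prefixed-unique bs (x ∷ r) ub (x∉r ∷ ur) = Unique.++⁺ (Unique.map⁺ Vec.∷-injectiveʳ ub) (prefixed-unique bs r ub ur) disjoint
      where
      disjoint : ∀ {v} → v ∈ map (x ∷_) bs × v ∈ concatMap (λ x → map (x ∷_) bs) r → ⊥
      disjoint {z ∷ v} (i , j) = All.lookup x∉r (proj₁ (∈-prefixed bs r j)) (sym (Vec.∷-injectiveˡ (proj₂ (proj₂ (∈-map⁻ (x ∷_) i)))))

  box-unique : ∀ n B → Unique (box n B)
  box-unique zero B = [] ∷ []
  box-unique (suc n) B = prefixed-unique (box n B) (range B) (box-unique n B) (range-unique B)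

  toV4 : Vec ℤ 4 → V4
  toV4 (x₁ ∷ x₂ ∷ x₃ ∷ x₄ ∷ []) = v4 x₁ x₂ x₃ x₄

  toV4-injective : ∀ {x y} → toV4 x ≡ toV4 y → x ≡ y
  toV4-injective {_ ∷ _ ∷ _ ∷ _ ∷ []} {_ ∷ _ ∷ _ ∷ _ ∷ []} refl = refl

  box-bound : ∀ B x → x ∈ box 4 B → toV4 x ≤v (3 ℕ.* B)
  box-bound B (x₁ ∷ x₂ ∷ x₃ ∷ x₄ ∷ []) i = bounds (range-bound B (proj₁ p₁)) (range-bound B (proj₁ p₂)) (range-bound B (proj₁ p₃)) (range-bound B (proj₁ p₄))
    where
    p₁ = ∈-prefixed (box 3 B) (range B) i
    p₂ = ∈-prefixed (box 2 B) (range B) (proj₂ p₁)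
    p₃ = ∈-prefixed (box 1 B) (range B) (proj₂ p₂)
    p₄ = ∈-prefixed (box 0 B) (range B) (proj₂ p₃)

  diagForm-quad : ∀ c x → diagForm c x ≡ quad (toV4 c) (toV4 x)
  diagForm-quad (_ ∷ _ ∷ _ ∷ _ ∷ []) (_ ∷ _ ∷ _ ∷ _ ∷ []) = refl

  abs-square : ∀ m → + abs m * + abs m ≡ m * m
  abs-square (+ m) = refl
  abs-square -[1+ m ] = refl

  -- A definite choice of y turns each counted x into exactly one point of the surface. The value 0
  -- is a default where ψ₂(x) is not a square.
  squareRoot : V4 → V4 → ℤ
  squareRoot b x = root-of (isSquare? (quad b x))
    where
    root-of : Dec (IsSquare (quad b x)) → ℤ
    root-of (yes (m , _)) = + abs m
    root-of (no _) = 0ℤ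

  squareRoot-square : ∀ b x → IsSquare (quad b x) → quad b x ≡ squareRoot b x * squareRoot b x
  squareRoot-square b x sq with isSquare? (quad b x)
  ... | yes (m , e) = trans e (sym (abs-square m))
  ... | no n = ⊥-elim (n sq)

  quad-bound : ∀ k u n → u ≤v n → abs (quad k u) ℕ.≤ (abs (c1 k) ℕ.+ abs (c2 k) ℕ.+ abs (c3 k) ℕ.+ abs (c4 k)) ℕ.* (n ℕ.* n)
  quad-bound k u n (bounds b1 b2 b3 b4) = ℕ.≤-trans
    (abs-+-≤ {i = c1 k * (c1 u * c1 u) + c2 k * (c2 u * c2 u) + c3 k * (c3 u * c3 u)} {c4 k * (c4 u * c4 u)}
      (abs-+-≤ {i = c1 k * (c1 u * c1 u) + c2 k * (c2 u * c2 u)} {c3 k * (c3 u * c3 u)} (abs-+-≤ {i = c1 k * (c1 u * c1 u)} {c2 k * (c2 u * c2 u)} (term (c1 k) (c1 u) b1) (term (c2 k) (c2 u) b2)) (term (c3 k) (c3 u) b3)) (term (c4 k) (c4 u) b4))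
    (ℕ.≤-reflexive (solve 5 (λ a b c d m → a :* m :+ b :* m :+ c :* m :+ d :* m := (a :+ b :+ c :+ d) :* m) refl (abs (c1 k)) (abs (c2 k)) (abs (c3 k)) (abs (c4 k)) (n ℕ.* n)))
    where
    open ℕS.+-*-Solver
    term : ∀ A s → abs s ℕ.≤ n → abs (A * (s * s)) ℕ.≤ abs A ℕ.* (n ℕ.* n)
    term A s bs = abs-*-≤ {i = A} {s * s} ℕ.≤-refl (abs-*-≤ {i = s} {s} bs bs)

  squares⇒± : ∀ s t → s * s ≡ t * t → s ≡ t ⊎ s ≡ - t
  squares⇒± s t e = split (i*j≡0⇒i≡0∨j≡0 (s - t) (trans (raw s t) (trans (cong (_- t * t) e) (+-inverseʳ (t * t)))))
    where
    raw : ∀ s t → (s - t) * (s + t) ≡ s * s - t * t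
    raw = solve-∀
    split : s - t ≡ 0ℤ ⊎ s + t ≡ 0ℤ → s ≡ t ⊎ s ≡ - t
    split (inj₁ z) = inj₁ (i-j≡0⇒i≡j s t z)
    split (inj₂ z) = inj₂ (trans (raw' s t) (trans (cong (_- t) z) (+-identityˡ (- t))))
      where
      raw' : ∀ s t → s ≡ s + t - t
      raw' = solve-∀

  encode : ℤ → ℕ
  encode (+ m) = 2 ℕ.* m
  encode -[1+ m ] = suc (2 ℕ.* m)

  encode-injective : ∀ s t → encode s ≡ encode t → s ≡ t
  encode-injective (+ m) (+ n) e = cong +_ (ℕ.*-cancelˡ-≡ m n 2 e)
  encode-injective (+ m) -[1+ n ] e = ⊥-elim (ℕ.even≢odd m n e)
  encode-injective -[1+ m ] (+ n) e = ⊥-elim (ℕ.even≢odd n m (sym e))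
  encode-injective -[1+ m ] -[1+ n ] e = cong -[1+_] (ℕ.*-cancelˡ-≡ m n 2 (ℕ.suc-injective e))

  encode-bound : ∀ s n → abs s ℕ.≤ n → encode s ℕ.< suc (2 ℕ.* n)
  encode-bound (+ m) n le = s≤s (ℕ.*-monoʳ-≤ 2 le)
  encode-bound -[1+ m ] n le = s≤s (ℕ.≤-trans (ℕ.≤-trans (ℕ.n≤1+n (suc (2 ℕ.* m))) (ℕ.≤-reflexive (solve 1 (λ m → con 1 :+ (con 1 :+ con 2 :* m) := con 2 :* (con 1 :+ m)) refl m))) (ℕ.*-monoʳ-≤ 2 le))
    where open ℕS.+-*-Solver

  -- The value of r is one of 2 n + 1 ≤ 3 n integers, and it determines s up to sign because C ≠ 0.
  two-variables : ∀ A C (r s : V4 → ℤ) n (c : List V4) → C ≢ 0ℤ → 1 ℕ.≤ n → Unique c → (∀ x → x ∈ c → abs (r x) ℕ.≤ n) →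
    (∀ x → x ∈ c → A * (r x * r x) + C * (s x * s x) ≡ 0ℤ) → (∀ x y → x ∈ c → y ∈ c → r x ≡ r y → s x ≡ s y → x ≡ y) → length c ℕ.≤ 6 ℕ.* n
  two-variables A C r s n c C≢0 1≤n uq small on det = by-r (pigeonhole (λ x → encode (r x)) (suc (2 ℕ.* n)) c (λ {x} i → encode-bound (r x) n (small x i)))
    where
    by-r : (∃[ k ] length c ℕ.≤ suc (2 ℕ.* n) ℕ.* length (fiber (λ x → encode (r x)) k c)) → length c ℕ.≤ 6 ℕ.* n
    by-r (k , le) = by-s (two-values (λ x → encode (s x)) d (λ {x} {y} {z} i j o → three x y z i j o))
      where
      d : List V4
      d = fiber (λ x → encode (r x)) k c
      d⊑c : d ⊑ c
      d⊑c = fiber-⊑ (λ x → encode (r x)) k c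
      same-r : ∀ x y → x ∈ d → y ∈ d → r x ≡ r y
      same-r x y i j = encode-injective (r x) (r y) (trans (fiber-key (λ x → encode (r x)) {c = c} i) (sym (fiber-key (λ x → encode (r x)) {c = c} j)))
      squares : ∀ x y → x ∈ d → y ∈ d → s x * s x ≡ s y * s y
      squares x y i j = *-cancelˡ-≡ C (s x * s x) (s y * s y) {{≢-nonZero C≢0}} (+-cancelˡ (A * (r x * r x)) (C * (s x * s x)) (C * (s y * s y))
        (trans (on x (proj₁ d⊑c i)) (trans (sym (on y (proj₁ d⊑c j))) (cong (λ z → A * (z * z) + C * (s y * s y)) (sym (same-r x y i j))))))
      three : ∀ x y z → x ∈ d → y ∈ d → z ∈ d → encode (s x) ≡ encode (s y) ⊎ encode (s x) ≡ encode (s z) ⊎ encode (s y) ≡ encode (s z)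
      three x y z i j o = decide (squares⇒± (s x) (s y) (squares x y i j)) (squares⇒± (s x) (s z) (squares x z i o))
        where
        decide : s x ≡ s y ⊎ s x ≡ - s y → s x ≡ s z ⊎ s x ≡ - s z → encode (s x) ≡ encode (s y) ⊎ encode (s x) ≡ encode (s z) ⊎ encode (s y) ≡ encode (s z)
        decide (inj₁ e) _ = inj₁ (cong encode e)
        decide (inj₂ _) (inj₁ e) = inj₂ (inj₁ (cong encode e))
        decide (inj₂ e) (inj₂ e') = inj₂ (inj₂ (cong encode (neg-injective (trans (sym e) e'))))
      by-s : (∃[ e ] e ⊑ d × (∀ {x y} → x ∈ e → y ∈ e → encode (s x) ≡ encode (s y)) × length d ℕ.≤ 2 ℕ.* length e) → length c ℕ.≤ 6 ℕ.* n
      by-s (e , e⊑d , same-s , le') = ℕ.≤-trans le (ℕ.≤-trans (ℕ.*-mono-≤ (ℕ.≤-trans (ℕ.+-monoˡ-≤ (2 ℕ.* n) 1≤n) (ℕ.≤-refl {n ℕ.+ 2 ℕ.* n})) (ℕ.≤-trans le' (ℕ.*-monoʳ-≤ 2 (one e (proj₂ (⊑-trans e⊑d d⊑c) uq)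
          (λ x y i j → det x y (proj₁ (⊑-trans e⊑d d⊑c) i) (proj₁ (⊑-trans e⊑d d⊑c) j) (same-r x y (proj₁ e⊑d i) (proj₁ e⊑d j)) (encode-injective (s x) (s y) (same-s i j)))))))
          (ℕ.≤-reflexive (solve 1 (λ n → (n :+ con 2 :* n) :* con 2 := con 6 :* n) refl n)))
        where
        open ℕS.+-*-Solver
        one : ∀ (e : List V4) → Unique e → (∀ x y → x ∈ e → y ∈ e → x ≡ y) → length e ℕ.≤ 1
        one [] _ _ = z≤n
        one (x ∷ []) _ _ = s≤s z≤n
        one (x ∷ y ∷ _) ((ne ∷ _) ∷ _) h = ⊥-elim (ne (h x y (here refl) (there (here refl))))

  -- The class estimate for points with no zero coordinate.

  size : List ℤ → ℕ
  size [] = 1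
  size (z ∷ zs) = abs z ℕ.* size zs

  ∤-size : ∀ {p} zs → ¬ p ℕ.∣ size zs → All (λ z → ¬ + p ∣ z) zs
  ∤-size [] nd = []
  ∤-size (z ∷ zs) nd = (λ dv → nd (ℕ.∣m⇒∣m*n (size zs) (∣⇒∣ᵤ dv))) ∷ ∤-size zs (λ dv → nd (ℕ.∣n⇒∣m*n (abs z) dv))

  1≤size : ∀ {zs} → All (_≢ 0ℤ) zs → 1 ℕ.≤ size zs
  1≤size [] = s≤s z≤n
  1≤size (z≢0 ∷ ne) = ℕ.*-mono-≤ (ℕ.n≢0⇒n>0 (λ e → z≢0 (∣i∣≡0⇒i≡0 e))) (1≤size ne)

  size≤ : ∀ {n zs} → All (λ z → abs z ℕ.≤ n) zs → size zs ℕ.≤ n ℕ.^ length zs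
  size≤ [] = s≤s z≤n
  size≤ (le ∷ les) = ℕ.*-mono-≤ le (size≤ les)

  constants : V4 → V4 → List ℤ
  constants a b = + 2 ∷ c1 a ∷ c2 a ∷ c3 a ∷ c4 a ∷ minor a b c1 c2 ∷ minor a b c1 c3 ∷ minor a b c1 c4 ∷ minor a b c2 c3 ∷ minor a b c2 c4 ∷ minor a b c3 c4 ∷ []

  coordinates : V5 → List ℤ
  coordinates P = c1 (vec P) ∷ c2 (vec P) ∷ c3 (vec P) ∷ c4 (vec P) ∷ last P ∷ []

  module Generic (a b : V4) (nonsquare : ¬ (∃[ m ] c1 a * c2 a * c3 a * c4 a ≡ m * m)) (mn : Minors≢0 a b) (Y : V4 → ℤ) (n : ℕ) (1≤n : 1 ℕ.≤ n) (c : List V4)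
    (uq : Unique c) (on : ∀ x → x ∈ c → OnS a b (v5 x (Y x))) (small : ∀ x → x ∈ c → Bounded n (v5 x (Y x))) where

    -- Avoiding the divisors of this single number makes a prime good for a, b and makes the point a
    -- unit point. Its size is a constant times at most n⁵, so such a prime can be found among the
    -- small ones.
    nn : V4 → ℕ
    nn x = size (constants a b) ℕ.* size (coordinates (v5 x (Y x)))

    private
      goodPrime : ∀ {p} x → Prime p → ¬ p ℕ.∣ nn x → GoodPrime a b p
      goodPrime {p} x pp nd = fields (∤-size (constants a b) (λ dv → nd (ℕ.∣m⇒∣m*n (size (coordinates (v5 x (Y x)))) dv)))
        where
        fields : All (λ z → ¬ + p ∣ z) (constants a b) → GoodPrime a b p
        fields (n₀ ∷ n₁ ∷ n₂ ∷ n₃ ∷ n₄ ∷ n₅ ∷ n₆ ∷ n₇ ∷ n₈ ∷ n₉ ∷ n₁₀ ∷ []) = record { isPrime = pp ; u2 = n₀ ; ua1 = n₁ ; ua2 = n₂ ; ua3 = n₃ ; ua4 = n₄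
          ; um12 = n₅ ; um13 = n₆ ; um14 = n₇ ; um23 = n₈ ; um24 = n₉ ; um34 = n₁₀ }

      unitPoint : ∀ {p} x → ¬ p ℕ.∣ nn x → UnitPoint p (v5 x (Y x))
      unitPoint {p} x nd = fields (∤-size (coordinates (v5 x (Y x))) (λ dv → nd (ℕ.∣n⇒∣m*n (size (constants a b)) dv)))
        where
        fields : All (λ z → ¬ + p ∣ z) (coordinates (v5 x (Y x))) → UnitPoint p (v5 x (Y x))
        fields (n₁ ∷ n₂ ∷ n₃ ∷ n₄ ∷ n₅ ∷ []) = record { ux1 = n₁ ; ux2 = n₂ ; ux3 = n₃ ; ux4 = n₄ ; uy = n₅ }

    X : ℕ
    X = 120 ℕ.* n ℕ.^ 5

    generic-local : ∀ t → Local Y nn t n X c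
    generic-local t {p} g [] pp _ _ _ _ 1≤g g≤n _ _ _ _ _ = 0 , z≤n , (begin
        (1 ℕ.* g) ℕ.^ 3     ≤⟨ ℕ.^-monoˡ-≤ 3 (ℕ.≤-trans (ℕ.≤-reflexive (ℕ.*-identityˡ g)) g≤n) ⟩
        n ℕ.^ 3             ≤⟨ ℕ.^-monoʳ-≤ n {{ℕ.>-nonZero 1≤n}} (s≤s (s≤s (s≤s (z≤n {2})))) ⟩
        n ℕ.^ 5             ≤⟨ ℕ.m≤n*m (n ℕ.^ 5) 120 ⟩
        X                   ∎)
      where open ℕ.≤-Reasoning
    generic-local t {p} g d@(x₀ ∷ _) pp _ d⊑c avoid of-content 1≤g g≤n r1 r2 r3 r4 r5 = finish (S.class-bound D lev inside separated (Unique.map⁺ (cong vec) (proj₂ d⊑c uq)))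
      where
      P : V4 → V5
      P x = v5 x (Y x)
      D : List V5
      D = map P d
      gp : GoodPrime a b p
      gp = goodPrime x₀ pp (avoid x₀ (here refl))
      up : ∀ x → x ∈ d → UnitPoint p (P x)
      up x i = unitPoint x (avoid x i)
      g∣ : ∀ x → x ∈ d → + g ∣v x
      g∣ x i = subst (λ g → + g ∣v x) (of-content x i) (divs (∣ᵤ⇒∣ (proj₁ (cont∣ x))) (∣ᵤ⇒∣ (proj₁ (proj₂ (cont∣ x)))) (∣ᵤ⇒∣ (proj₁ (proj₂ (proj₂ (cont∣ x))))) (∣ᵤ⇒∣ (proj₂ (proj₂ (proj₂ (cont∣ x))))))
      p∤g : ¬ + p ∣ + g
      p∤g dv = ux1 (up x₀ (here refl)) (∣-trans dv (d1 (g∣ x₀ (here refl))))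
      module S = Stages gp mn g n p∤g 1≤g g≤n
      module L = Local gp
      pull : ∀ {Q : V5 → Set} → (∀ x → x ∈ d → Q (P x)) → ∀ R → R ∈ D → Q R
      pull {Q} h R i = go (∈-map⁻ P i)
        where
        go : (∃[ x ] x ∈ d × R ≡ P x) → Q R
        go (x , j , refl) = h x j
      pull₂ : ∀ {Q : V5 → V5 → Set} → (∀ x y → x ∈ d → y ∈ d → Q (P x) (P y)) → ∀ R S → R ∈ D → S ∈ D → Q R S
      pull₂ {Q} h R S i j = pull {λ R → Q R S} (λ x i' → pull {λ S → Q (P x) S} (λ y j' → h x y i' j') S j) R i
      ratio : ∀ y x y' x' → + p ∣ x - x' → + p ∣ y - y' → pw (isPrime gp) 1 ∣ y * x' - y' * x
      ratio y x y' x' dx dy = subst (_∣ y * x' - y' * x) (cong +_ (sym (ℕ.*-identityʳ p))) (∣-resp-≡ (raw y x y' x') (∣m∣n⇒∣m-n (∣m⇒∣m*n x dy) (∣n⇒∣m*n y dx)))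
        where
        raw : ∀ y x y' x' → (y - y') * x - y * (x - x') ≡ y * x' - y' * x
        raw = solve-∀
      lev : L.Lev 1 D
      lev = record
        { onS = pull {OnS a b} (λ x i → on x (proj₁ d⊑c i))
        ; unit = pull {UnitPoint p} up
        ; cong-y = pull₂ {λ R S → + p ∣ last R - last S} r5
        ; level = pull₂ {λ R S → pw (isPrime gp) 1 ∣v δ R S} (λ x y i j → divs (ratio (Y x) (c1 x) (Y y) (c1 y) (r1 x y i j) (r5 x y i j)) (ratio (Y x) (c2 x) (Y y) (c2 y) (r2 x y i j) (r5 x y i j))
            (ratio (Y x) (c3 x) (Y y) (c3 y) (r3 x y i j) (r5 x y i j)) (ratio (Y x) (c4 x) (Y y) (c4 y) (r4 x y i j) (r5 x y i j))) }
      inside : S.Inside D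
      inside = record { content = pull {λ R → + g ∣v vec R} g∣ ; small = pull {Bounded n} (λ x i → small x (proj₁ d⊑c i)) }
      separated : S.Separated D
      -- Orthogonal solutions are proportional because α is not a square; with equal contents and
      -- congruent coordinates they coincide.
      separated = pull₂ {λ R S → R ≢ S → bil a (vec R) (vec S) ≢ 0ℤ} (λ x y i j ne z → ne (cong P (equal x y i j (Isotropic.isotropic⇒proportional a nonsquare x y (proj₁ (on x (proj₁ d⊑c i))) (proj₁ (on y (proj₁ d⊑c j))) z))))
        where
        equal : ∀ x y → x ∈ d → y ∈ d → wedge x y ≡ b6 0ℤ 0ℤ 0ℤ 0ℤ 0ℤ 0ℤ → x ≡ y
        equal x y i j e = proportional⇒≡ pp (u2 gp) c1 x y (trans (of-content x i) (sym (of-content y j))) (λ z → ℕ.<⇒≢ 1≤g (sym (trans (sym (of-content y j)) z))) (ux1 (up x i)) (r1 x y i j)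
            (*-comm (c1 x) (c1 y)) (row (c1 x) (c2 x) (c1 y) (c2 y) (cong b12 e)) (row (c1 x) (c3 x) (c1 y) (c3 y) (cong b13 e)) (row (c1 x) (c4 x) (c1 y) (c4 y) (cong b14 e))
          where
          row : ∀ s t s' t' → s * t' - t * s' ≡ 0ℤ → s * t' ≡ s' * t
          row s t s' t' z = trans (i-j≡0⇒i≡j (s * t') (t * s') z) (*-comm t s')
      finish : S.Bound D → ∃[ s ] length d ℕ.≤ 4 ℕ.* (p ℕ.^ s ℕ.* 2 ℕ.^ s) × (p ℕ.^ s ℕ.* g) ℕ.^ 3 ℕ.≤ X
      finish (s , le , bd) = s , subst (ℕ._≤ 4 ℕ.* (p ℕ.^ s ℕ.* 2 ℕ.^ s)) (length-map P d) le , (begin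
          (p ℕ.^ s ℕ.* g) ℕ.^ 3            ≡⟨ ^-distribʳ-* 3 (p ℕ.^ s) g ⟩
          (p ℕ.^ s) ℕ.^ 3 ℕ.* g ℕ.^ 3      ≡⟨ cong (ℕ._* g ℕ.^ 3) (trans (ℕ.^-*-assoc p s 3) (cong (p ℕ.^_) (ℕ.*-comm s 3))) ⟩
          p ℕ.^ (3 ℕ.* s) ℕ.* g ℕ.^ 3      ≤⟨ ℕ.*-monoʳ-≤ (p ℕ.^ (3 ℕ.* s)) (ℕ.^-monoʳ-≤ g {{ℕ.>-nonZero 1≤g}} (ℕ.n≤1+n 3)) ⟩
          p ℕ.^ (3 ℕ.* s) ℕ.* g ℕ.^ 4      ≤⟨ bd ⟩
          S.X                              ≡⟨ S.X-≡ ⟩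
          X                                ∎)
        where open ℕ.≤-Reasoning

  -- Coordinates by index and their rearrangement.

  pattern i₁ = zero
  pattern i₂ = suc zero
  pattern i₃ = suc (suc zero)
  pattern i₄ = suc (suc (suc zero))

  coord : Fin 4 → V4 → ℤ
  coord i₁ = c1
  coord i₂ = c2
  coord i₃ = c3
  coord i₄ = c4

  by-coordinates : ∀ {Q : Fin 4 → Set} → Q i₁ → Q i₂ → Q i₃ → Q i₄ → ∀ i → Q i
  by-coordinates q₁ q₂ q₃ q₄ i₁ = q₁
  by-coordinates q₁ q₂ q₃ q₄ i₂ = q₂
  by-coordinates q₁ q₂ q₃ q₄ i₃ = q₃
  by-coordinates q₁ q₂ q₃ q₄ i₄ = q₄

  coord-ext : ∀ {x y} → (∀ i → coord i x ≡ coord i y) → x ≡ y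
  coord-ext e = v4-ext (e i₁) (e i₂) (e i₃) (e i₄)

  coord≤ : ∀ {x n} → x ≤v n → ∀ i → abs (coord i x) ℕ.≤ n
  coord≤ (bounds b₁ b₂ b₃ b₄) = by-coordinates b₁ b₂ b₃ b₄

  cont∣coord : ∀ x i → + cont x ∣ coord i x
  cont∣coord x = by-coordinates (∣ᵤ⇒∣ (proj₁ (cont∣ x))) (∣ᵤ⇒∣ (proj₁ (proj₂ (cont∣ x)))) (∣ᵤ⇒∣ (proj₁ (proj₂ (proj₂ (cont∣ x))))) (∣ᵤ⇒∣ (proj₂ (proj₂ (proj₂ (cont∣ x)))))

  cont-bounds : ∀ {x n} i → coord i x ≢ 0ℤ → x ≤v n → 1 ℕ.≤ cont x × cont x ℕ.≤ n
  cont-bounds {x} {n} i ne le = ℕ.n≢0⇒n>0 (λ z → ne (∣i∣≡0⇒i≡0 (ℕ.0∣⇒≡0 (subst (ℕ._∣ abs (coord i x)) z dv)))) ,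
      ℕ.≤-trans (ℕ.∣⇒≤ {{ℕ.≢-nonZero (λ z → ne (∣i∣≡0⇒i≡0 z))}} dv) (coord≤ le i)
    where
    dv : cont x ℕ.∣ abs (coord i x)
    dv = ∣⇒∣ᵤ (cont∣coord x i)

  term : V4 → V4 → Fin 4 → ℤ
  term k x i = coord i k * (coord i x * coord i x)

  -- A permutation of the four coordinates in the two forms in which it acts: as a case distinction
  -- over indices and as a reordering of a sum. It lets one proof treat every position of the zero
  -- coordinates.
  record Arrangement (u v w z : Fin 4) : Set₁ where
    constructor arrangement
    field
      each : ∀ {Q : Fin 4 → Set} → Q u → Q v → Q w → Q z → ∀ i → Q i
      regroup : ∀ (t : Fin 4 → ℤ) → t i₁ + t i₂ + t i₃ + t i₄ ≡ t u + t v + t w + t z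

    sum-≡ : ∀ k x → quad k x ≡ term k x u + term k x v + term k x w + term k x z
    sum-≡ k x = regroup (term k x)
  open Arrangement

  arrange-1234 : Arrangement i₁ i₂ i₃ i₄
  arrange-1234 = arrangement (λ p q r s → by-coordinates p q r s) (λ _ → refl)

  arrange-1243 : Arrangement i₁ i₂ i₄ i₃
  arrange-1243 = arrangement (λ p q s r → by-coordinates p q r s) (λ t → raw (t i₁) (t i₂) (t i₃) (t i₄))
    where
    raw : ∀ p q r s → p + q + r + s ≡ p + q + s + r
    raw = solve-∀

  arrange-1342 : Arrangement i₁ i₃ i₄ i₂
  arrange-1342 = arrangement (λ p r s q → by-coordinates p q r s) (λ t → raw (t i₁) (t i₂) (t i₃) (t i₄))
    where
    raw : ∀ p q r s → p + q + r + s ≡ p + r + s + q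
    raw = solve-∀

  arrange-2341 : Arrangement i₂ i₃ i₄ i₁
  arrange-2341 = arrangement (λ q r s p → by-coordinates p q r s) (λ t → raw (t i₁) (t i₂) (t i₃) (t i₄))
    where
    raw : ∀ p q r s → p + q + r + s ≡ q + r + s + p
    raw = solve-∀

  arrange-3412 : Arrangement i₃ i₄ i₁ i₂
  arrange-3412 = arrangement (λ r s p q → by-coordinates p q r s) (λ t → raw (t i₁) (t i₂) (t i₃) (t i₄))
    where
    raw : ∀ p q r s → p + q + r + s ≡ r + s + p + q
    raw = solve-∀

  arrange-2413 : Arrangement i₂ i₄ i₁ i₃
  arrange-2413 = arrangement (λ q s p r → by-coordinates p q r s) (λ t → raw (t i₁) (t i₂) (t i₃) (t i₄))
    where
    raw : ∀ p q r s → p + q + r + s ≡ q + s + p + r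
    raw = solve-∀

  arrange-2314 : Arrangement i₂ i₃ i₁ i₄
  arrange-2314 = arrangement (λ q r p s → by-coordinates p q r s) (λ t → raw (t i₁) (t i₂) (t i₃) (t i₄))
    where
    raw : ∀ p q r s → p + q + r + s ≡ q + r + p + s
    raw = solve-∀

  arrange-1423 : Arrangement i₁ i₄ i₂ i₃
  arrange-1423 = arrangement (λ p s q r → by-coordinates p q r s) (λ t → raw (t i₁) (t i₂) (t i₃) (t i₄))
    where
    raw : ∀ p q r s → p + q + r + s ≡ p + s + q + r
    raw = solve-∀

  arrange-1324 : Arrangement i₁ i₃ i₂ i₄
  arrange-1324 = arrangement (λ p r q s → by-coordinates p q r s) (λ t → raw (t i₁) (t i₂) (t i₃) (t i₄))
    where
    raw : ∀ p q r s → p + q + r + s ≡ p + r + q + s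
    raw = solve-∀

  term≡0 : ∀ k x i → coord i x ≡ 0ℤ → term k x i ≡ 0ℤ
  term≡0 k x i e = trans (cong (λ z → coord i k * (z * z)) e) (*-zeroʳ (coord i k))

  +-^-≤ : ∀ m k l → (k ℕ.+ l) ℕ.^ m ℕ.≤ 2 ℕ.^ m ℕ.* (k ℕ.^ m ℕ.+ l ℕ.^ m)
  +-^-≤ m k l = by-order (ℕ.≤-total k l)
    where
    open ℕ.≤-Reasoning
    double : ∀ k → k ℕ.+ k ≡ 2 ℕ.* k
    double k = cong (k ℕ.+_) (sym (ℕ.+-identityʳ k))
    by-order : k ℕ.≤ l ⊎ l ℕ.≤ k → (k ℕ.+ l) ℕ.^ m ℕ.≤ 2 ℕ.^ m ℕ.* (k ℕ.^ m ℕ.+ l ℕ.^ m)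
    by-order (inj₁ le) = begin
      (k ℕ.+ l) ℕ.^ m                       ≤⟨ ℕ.^-monoˡ-≤ m (ℕ.≤-trans (ℕ.+-monoˡ-≤ l le) (ℕ.≤-reflexive (double l))) ⟩
      (2 ℕ.* l) ℕ.^ m                       ≡⟨ ^-distribʳ-* m 2 l ⟩
      2 ℕ.^ m ℕ.* l ℕ.^ m                   ≤⟨ ℕ.*-monoʳ-≤ (2 ℕ.^ m) (ℕ.m≤n+m (l ℕ.^ m) (k ℕ.^ m)) ⟩
      2 ℕ.^ m ℕ.* (k ℕ.^ m ℕ.+ l ℕ.^ m)     ∎
    by-order (inj₂ le) = begin
      (k ℕ.+ l) ℕ.^ m                       ≤⟨ ℕ.^-monoˡ-≤ m (ℕ.≤-trans (ℕ.+-monoʳ-≤ k le) (ℕ.≤-reflexive (double k))) ⟩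
      (2 ℕ.* k) ℕ.^ m                       ≡⟨ ^-distribʳ-* m 2 k ⟩
      2 ℕ.^ m ℕ.* k ℕ.^ m                   ≤⟨ ℕ.*-monoʳ-≤ (2 ℕ.^ m) (ℕ.m≤m+n (k ℕ.^ m) (l ℕ.^ m)) ⟩
      2 ℕ.^ m ℕ.* (k ℕ.^ m ℕ.+ l ℕ.^ m)     ∎

  -- The number of solutions of each type.

  module Count (a b : V4) (nonsquare : ¬ (∃[ m ] c1 a * c2 a * c3 a * c4 a ≡ m * m)) (mn : Minors≢0 a b) (Y : V4 → ℤ) where

    Point : ℕ → V4 → Set
    Point n x = OnS a b (v5 x (Y x)) × Bounded n (v5 x (Y x))

    -- The bound n ^ (5/3 + 11/(3 t)) with the root cleared, where t is free to grow. The summand 11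
    -- is 1 for the logarithm, 5 for the choice of primes and residues, and 5 for the powers of 2.
    Few : (V4 → Set) → Set
    Few P = ∀ t → 1 ℕ.≤ t → ∃[ K ] (∀ n c → 1 ℕ.≤ n → Unique c → (∀ x → x ∈ c → Point n x × P x) → length c ℕ.^ (3 ℕ.* t) ℕ.≤ K ℕ.* n ℕ.^ (5 ℕ.* t ℕ.+ 11))

    few-⊆ : ∀ {P Q : V4 → Set} → (∀ x → P x → Q x) → Few Q → Few P
    few-⊆ {P} {Q} P⊆Q few t 1≤t = proj₁ (few t 1≤t) , λ n c 1≤n uq h → proj₂ (few t 1≤t) n c 1≤n uq (λ x i → proj₁ (h x i) , P⊆Q x (proj₂ (h x i)))

    few-split : ∀ {P D : V4 → Set} → Decidable D → Few (λ x → P x × D x) → Few (λ x → P x × ¬ D x) → Few P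
    few-split {P} {D} D? few⁺ few⁻ t 1≤t = combine (few⁺ t 1≤t) (few⁻ t 1≤t)
      where
      m E : ℕ
      m = 3 ℕ.* t
      E = 5 ℕ.* t ℕ.+ 11
      combine : (∃[ K ] (∀ n c → 1 ℕ.≤ n → Unique c → (∀ x → x ∈ c → Point n x × P x × D x) → length c ℕ.^ m ℕ.≤ K ℕ.* n ℕ.^ E)) →
        (∃[ K ] (∀ n c → 1 ℕ.≤ n → Unique c → (∀ x → x ∈ c → Point n x × P x × ¬ D x) → length c ℕ.^ m ℕ.≤ K ℕ.* n ℕ.^ E)) →
        ∃[ K ] (∀ n c → 1 ℕ.≤ n → Unique c → (∀ x → x ∈ c → Point n x × P x) → length c ℕ.^ m ℕ.≤ K ℕ.* n ℕ.^ E)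
      combine (K , bd) (K' , bd') = 2 ℕ.^ m ℕ.* (K ℕ.+ K') , λ n c 1≤n uq h → begin
          length c ℕ.^ m                                                                ≡⟨ cong (ℕ._^ m) (length-split D? c) ⟩
          (length (filter D? c) ℕ.+ length (filter ¬D? c)) ℕ.^ m                        ≤⟨ +-^-≤ m (length (filter D? c)) (length (filter ¬D? c)) ⟩
          2 ℕ.^ m ℕ.* (length (filter D? c) ℕ.^ m ℕ.+ length (filter ¬D? c) ℕ.^ m)
            ≤⟨ ℕ.*-monoʳ-≤ (2 ℕ.^ m) (ℕ.+-mono-≤
                 (bd n (filter D? c) 1≤n (proj₂ (filter-⊑ D? c) uq) (λ x i → let (j , d) = ∈-filter⁻ D? i in proj₁ (h x j) , proj₂ (h x j) , d))
                 (bd' n (filter ¬D? c) 1≤n (proj₂ (filter-⊑ ¬D? c) uq) (λ x i → let (j , d) = ∈-filter⁻ ¬D? i in proj₁ (h x j) , proj₂ (h x j) , d))) ⟩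
          2 ℕ.^ m ℕ.* (K ℕ.* n ℕ.^ E ℕ.+ K' ℕ.* n ℕ.^ E)                                ≡⟨ trans (cong (2 ℕ.^ m ℕ.*_) (sym (ℕ.*-distribʳ-+ (n ℕ.^ E) K K'))) (sym (ℕ.*-assoc (2 ℕ.^ m) (K ℕ.+ K') (n ℕ.^ E))) ⟩
          2 ℕ.^ m ℕ.* (K ℕ.+ K') ℕ.* n ℕ.^ E                                            ∎
        where
        open ℕ.≤-Reasoning
        ¬D? : Decidable (λ x → ¬ D x)
        ¬D? x = ¬? (D? x)

    few-local : ∀ {P : V4 → Set} ω ξ (nn : V4 → ℕ) (X : ℕ → ℕ) i → 1 ℕ.≤ ω → (∀ n → 1 ℕ.≤ n → X n ℕ.≤ ξ ℕ.* n ℕ.^ 5) →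
      (∀ n x → Point n x → P x → coord i x ≢ 0ℤ × 1 ℕ.≤ nn x × nn x ℕ.≤ ω ℕ.* n ℕ.^ 5) →
      (∀ t n c → 1 ℕ.≤ n → Unique c → (∀ x → x ∈ c → Point n x × P x) → Local Y nn t n (X n) c) → Few P
    few-local {P} ω ξ nn X i 1≤ω X≤ facts local t 1≤t = pipeline-constant t ℕ.* (ω ℕ.* (ξ ℕ.^ t ℕ.* ξ)) , λ n c 1≤n uq h → begin
        length c ℕ.^ (3 ℕ.* t)
          ≤⟨ pipeline Y nn t n (ω ℕ.* n ℕ.^ 5) (X n) c 1≤t 1≤n (ℕ.*-mono-≤ 1≤ω (1≤^ n 5 1≤n)) uq (λ x j → proj₂ (facts n x (proj₁ (h x j)) (proj₂ (h x j))))
               (λ x j → cont-bounds i (proj₁ (facts n x (proj₁ (h x j)) (proj₂ (h x j)))) (vec≤ (proj₂ (proj₁ (h x j))))) (local t n c 1≤n uq h) ⟩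
        pipeline-constant t ℕ.* (n ℕ.* (ω ℕ.* n ℕ.^ 5) ℕ.* (X n ℕ.^ t ℕ.* X n))
          ≤⟨ ℕ.*-monoʳ-≤ (pipeline-constant t) (ℕ.*-monoʳ-≤ (n ℕ.* (ω ℕ.* n ℕ.^ 5)) (ℕ.*-mono-≤ (ℕ.≤-trans (ℕ.^-monoˡ-≤ t (X≤ n 1≤n)) (ℕ.≤-reflexive (trans (^-distribʳ-* t ξ (n ℕ.^ 5)) (cong (ξ ℕ.^ t ℕ.*_) (ℕ.^-*-assoc n 5 t))))) (X≤ n 1≤n))) ⟩
        pipeline-constant t ℕ.* (n ℕ.* (ω ℕ.* n ℕ.^ 5) ℕ.* (ξ ℕ.^ t ℕ.* n ℕ.^ (5 ℕ.* t) ℕ.* (ξ ℕ.* n ℕ.^ 5)))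
          ≡⟨ solve 6 (λ c n w m x y → c :* (n :* (w :* (n :^ 5)) :* (x :* m :* (y :* (n :^ 5)))) := c :* (w :* (x :* y)) :* (m :* (n :^ 11))) refl (pipeline-constant t) n ω (n ℕ.^ (5 ℕ.* t)) (ξ ℕ.^ t) ξ ⟩
        pipeline-constant t ℕ.* (ω ℕ.* (ξ ℕ.^ t ℕ.* ξ)) ℕ.* (n ℕ.^ (5 ℕ.* t) ℕ.* n ℕ.^ 11)
          ≡⟨ cong (pipeline-constant t ℕ.* (ω ℕ.* (ξ ℕ.^ t ℕ.* ξ)) ℕ.*_) (sym (ℕ.^-distribˡ-+-* n (5 ℕ.* t) 11)) ⟩
        pipeline-constant t ℕ.* (ω ℕ.* (ξ ℕ.^ t ℕ.* ξ)) ℕ.* n ℕ.^ (5 ℕ.* t ℕ.+ 11) ∎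
      where
      open ℕ.≤-Reasoning
      open ℕS.+-*-Solver

    few-generic : Few (λ x → (∀ i → coord i x ≢ 0ℤ) × Y x ≢ 0ℤ)
    few-generic = few-local (size (constants a b)) 120 nn (λ n → 120 ℕ.* n ℕ.^ 5) i₁ 1≤constants (λ n _ → ℕ.≤-refl)
        (λ n x pt (ne , ny) → ne i₁ , ℕ.*-mono-≤ 1≤constants (1≤size (ne i₁ ∷ ne i₂ ∷ ne i₃ ∷ ne i₄ ∷ ny ∷ [])) ,
          ℕ.*-monoʳ-≤ (size (constants a b)) (size≤ {zs = coordinates (v5 x (Y x))} (coord≤ (vec≤ (proj₂ pt)) i₁ ∷ coord≤ (vec≤ (proj₂ pt)) i₂ ∷ coord≤ (vec≤ (proj₂ pt)) i₃ ∷ coord≤ (vec≤ (proj₂ pt)) i₄ ∷ last≤ (proj₂ pt) ∷ [])))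
        (λ t n c 1≤n uq h → Generic.generic-local a b nonsquare mn Y n 1≤n c uq (λ x i → proj₁ (proj₁ (h x i))) (λ x i → proj₂ (proj₁ (h x i))) t)
      where
      nn : V4 → ℕ
      nn x = size (constants a b) ℕ.* size (coordinates (v5 x (Y x)))
      open Isotropic a nonsquare
      1≤constants : 1 ℕ.≤ size (constants a b)
      1≤constants = 1≤size {constants a b} ((λ ()) ∷ a1≢0 ∷ a2≢0 ∷ a3≢0 ∷ a4≢0 ∷ m12 mn ∷ m13 mn ∷ m14 mn ∷ m23 mn ∷ m24 mn ∷ m34 mn ∷ [])

    few-two : ∀ {P : V4 → Set} {r s z z'} → Arrangement r s z z' → coord s a ≢ 0ℤ → (∀ x → P x → coord z x ≡ 0ℤ × coord z' x ≡ 0ℤ) → Few P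
    few-two {P} {r} {s} {z} {z'} arr C≢0 zeros t 1≤t = 6 ℕ.^ (3 ℕ.* t) , λ n c 1≤n uq h → begin
        length c ℕ.^ (3 ℕ.* t)                      ≤⟨ ℕ.^-monoˡ-≤ (3 ℕ.* t) (two-variables (coord r a) (coord s a) (coord r) (coord s) n c C≢0 1≤n uq (λ x i → coord≤ (vec≤ (proj₂ (proj₁ (h x i)))) r)
                                                         (λ x i → on x (proj₁ (proj₁ (proj₁ (h x i)))) (zeros x (proj₂ (h x i)))) (λ x y i j → determined x y (zeros x (proj₂ (h x i))) (zeros y (proj₂ (h y j))))) ⟩
        (6 ℕ.* n) ℕ.^ (3 ℕ.* t)                     ≡⟨ ^-distribʳ-* (3 ℕ.* t) 6 n ⟩
        6 ℕ.^ (3 ℕ.* t) ℕ.* n ℕ.^ (3 ℕ.* t)         ≤⟨ ℕ.*-monoʳ-≤ (6 ℕ.^ (3 ℕ.* t)) (^-monoʳ-1≤ n 1≤n (ℕ.≤-trans (ℕ.*-monoˡ-≤ t (s≤s (s≤s (s≤s (z≤n {2}))))) (ℕ.m≤m+n (5 ℕ.* t) 11))) ⟩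
        6 ℕ.^ (3 ℕ.* t) ℕ.* n ℕ.^ (5 ℕ.* t ℕ.+ 11)  ∎
      where
      open ℕ.≤-Reasoning
      on : ∀ x → quad a x ≡ 0ℤ → coord z x ≡ 0ℤ × coord z' x ≡ 0ℤ → coord r a * (coord r x * coord r x) + coord s a * (coord s x * coord s x) ≡ 0ℤ
      on x e (e₃ , e₄) = trans (raw (term a x r) (term a x s)) (trans (cong₂ (λ m k → term a x r + term a x s + m + k) (sym (term≡0 a x z e₃)) (sym (term≡0 a x z' e₄))) (trans (sym (sum-≡ arr a x)) e))
        where
        raw : ∀ m k → m + k ≡ m + k + 0ℤ + 0ℤ
        raw = solve-∀
      determined : ∀ x y → coord z x ≡ 0ℤ × coord z' x ≡ 0ℤ → coord z y ≡ 0ℤ × coord z' y ≡ 0ℤ → coord r x ≡ coord r y → coord s x ≡ coord s y → x ≡ y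
      determined x y (e₃ , e₄) (f₃ , f₄) er es = coord-ext (each arr {λ i → coord i x ≡ coord i y} er es (trans e₃ (sym f₃)) (trans e₄ (sym f₄)))

    -- The points on a conic in the coordinates u, v, w; the remaining coordinate z is determined by these up to a common factor.
    few-conic : ∀ {P : V4 → Set} {u v w z} → Arrangement u v w z → ∀ e A B C → A ≢ 0ℤ → B ≢ 0ℤ → C ≢ 0ℤ →
      (∀ n x → Point n x → P x → A * (coord u x * coord u x) + B * (coord v x * coord v x) + C * (coord w x * coord w x) ≡ 0ℤ) →
      (∀ x → P x → coord v x ≢ 0ℤ × coord w x ≢ 0ℤ × coord e x ≢ 0ℤ) →
      (∀ {p} n → Prime p → ¬ + p ∣ + 2 → ∀ x y → Point n x → Point n y → P x → P y → ¬ + p ∣ coord w x → ¬ + p ∣ coord e x → + p ∣ coord w x - coord w y → + p ∣ coord z x - coord z y →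
        coord w x * coord u y ≡ coord w y * coord u x → coord w x * coord v y ≡ coord w y * coord v x → coord w x * coord z y ≡ coord w y * coord z x) → Few P
    few-conic {P} {u} {v} {w} {z} arr e A B C A≢0 B≢0 C≢0 on nonzero extra = few-local (size fixed) ((abs A ℕ.+ abs B ℕ.+ abs C) ℕ.^ 3) nn (λ n → ((abs A ℕ.+ abs B ℕ.+ abs C) ℕ.* n) ℕ.^ 3) v 1≤fixed X≤
        (λ n x pt px → proj₁ (nonzero x px) , ℕ.*-mono-≤ 1≤fixed (1≤size (proj₁ (nonzero x px) ∷ proj₁ (proj₂ (nonzero x px)) ∷ proj₂ (proj₂ (nonzero x px)) ∷ [])) ,
          ℕ.*-monoʳ-≤ (size fixed) (ℕ.≤-trans (size≤ {zs = coord v x ∷ coord w x ∷ coord e x ∷ []} (coord≤ (vec≤ (proj₂ pt)) v ∷ coord≤ (vec≤ (proj₂ pt)) w ∷ coord≤ (vec≤ (proj₂ pt)) e ∷ [])) (^-monoʳ-1≤ n (1≤bound n x px pt) (s≤s (s≤s (s≤s (z≤n {2})))))))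
        (λ t n c 1≤n uq h → Conic.conic-local A B C A≢0 B≢0 C≢0 (coord u) (coord v) (coord w) nn n 1≤n c uq (λ x i → on n x (proj₁ (h x i)) (proj₂ (h x i)))
          (λ x i → let le = coord≤ (vec≤ (proj₂ (proj₁ (h x i)))) in le u , le v , le w) (λ x i → cont∣coord x u , cont∣coord x v , cont∣coord x w)
          (λ x i nd → let un = units x nd in proj₁ un , proj₁ (proj₂ un) , proj₁ (proj₂ (proj₂ un)) , proj₁ (proj₂ (proj₂ (proj₂ un))))
          (λ x y r₁ r₂ r₃ r₄ → let r = by-coordinates r₁ r₂ r₃ r₄ in r u , r v , r w)
          (λ pp x y i j nx ny sc c≢0 r₁ r₂ r₃ r₄ eu ev → determined n pp x y (proj₁ (h x i)) (proj₁ (h y j)) (proj₂ (h x i)) (proj₂ (h y j)) nx sc c≢0 (by-coordinates r₁ r₂ r₃ r₄) eu ev) t Y)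
      where
      fixed : List ℤ
      fixed = + 2 ∷ B ∷ []
      nn : V4 → ℕ
      nn x = size fixed ℕ.* size (coord v x ∷ coord w x ∷ coord e x ∷ [])
      1≤fixed : 1 ℕ.≤ size fixed
      1≤fixed = 1≤size {fixed} ((λ ()) ∷ B≢0 ∷ [])
      1≤bound : ∀ n x → P x → Point n x → 1 ℕ.≤ n
      1≤bound n x px pt = ℕ.≤-trans (ℕ.n≢0⇒n>0 (λ z → proj₁ (nonzero x px) (∣i∣≡0⇒i≡0 z))) (coord≤ (vec≤ (proj₂ pt)) v)
      X≤ : ∀ n → 1 ℕ.≤ n → ((abs A ℕ.+ abs B ℕ.+ abs C) ℕ.* n) ℕ.^ 3 ℕ.≤ (abs A ℕ.+ abs B ℕ.+ abs C) ℕ.^ 3 ℕ.* n ℕ.^ 5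
      X≤ n 1≤n = ℕ.≤-trans (ℕ.≤-reflexive (^-distribʳ-* 3 (abs A ℕ.+ abs B ℕ.+ abs C) n)) (ℕ.*-monoʳ-≤ ((abs A ℕ.+ abs B ℕ.+ abs C) ℕ.^ 3) (^-monoʳ-1≤ n 1≤n (s≤s (s≤s (s≤s (z≤n {2}))))))
      units : ∀ {p} x → ¬ p ℕ.∣ nn x → ¬ + p ∣ + 2 × ¬ + p ∣ B × ¬ + p ∣ coord v x × ¬ + p ∣ coord w x × ¬ + p ∣ coord e x
      units {p} x nd = collect (∤-size fixed (λ dv → nd (ℕ.∣m⇒∣m*n (size (coord v x ∷ coord w x ∷ coord e x ∷ [])) dv))) (∤-size (coord v x ∷ coord w x ∷ coord e x ∷ []) (λ dv → nd (ℕ.∣n⇒∣m*n (size fixed) dv)))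
        where
        collect : All (λ z → ¬ + p ∣ z) fixed → All (λ z → ¬ + p ∣ z) (coord v x ∷ coord w x ∷ coord e x ∷ []) → ¬ + p ∣ + 2 × ¬ + p ∣ B × ¬ + p ∣ coord v x × ¬ + p ∣ coord w x × ¬ + p ∣ coord e x
        collect (n₁ ∷ n₂ ∷ []) (n₃ ∷ n₄ ∷ n₅ ∷ []) = n₁ , n₂ , n₃ , n₄ , n₅
      determined : ∀ {p} n → Prime p → ∀ x y → Point n x → Point n y → P x → P y → ¬ p ℕ.∣ nn x → cont x ≡ cont y → cont y ≢ 0 → (∀ i → + p ∣ coord i x - coord i y) →
        coord w x * coord u y ≡ coord w y * coord u x → coord w x * coord v y ≡ coord w y * coord v x → x ≡ y
      determined {p} n pp x y ptx pty px py nx sc c≢0 r eu ev = proportional⇒≡ pp (proj₁ un) (coord w) x y sc c≢0 (proj₁ (proj₂ (proj₂ (proj₂ un)))) (r w) (all-rows i₁) (all-rows i₂) (all-rows i₃) (all-rows i₄)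
        where
        un = units x nx
        all-rows : ∀ i → coord w x * coord i y ≡ coord w y * coord i x
        all-rows = each arr {λ i → coord w x * coord i y ≡ coord w y * coord i x} eu ev (*-comm (coord w x) (coord w y))
          (extra n pp (proj₁ un) x y ptx pty px py (proj₁ (proj₂ (proj₂ (proj₂ un)))) (proj₂ (proj₂ (proj₂ (proj₂ un)))) (r w) (r z) eu ev)

    few-one-zero : ∀ {P : V4 → Set} {u v w z} → Arrangement u v w z → coord u a ≢ 0ℤ → coord v a ≢ 0ℤ → coord w a ≢ 0ℤ → (∀ x → P x → coord z x ≡ 0ℤ × coord v x ≢ 0ℤ × coord w x ≢ 0ℤ) → Few P
    few-one-zero {P} {u} {v} {w} {z} arr A≢0 B≢0 C≢0 facts = few-conic arr w (coord u a) (coord v a) (coord w a) A≢0 B≢0 C≢0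
        (λ n x pt px → on x (proj₁ (proj₁ pt)) (proj₁ (facts x px))) (λ x px → proj₁ (proj₂ (facts x px)) , proj₂ (proj₂ (facts x px)) , proj₂ (proj₂ (facts x px)))
        (λ n pp _ x y ptx pty px py _ _ _ _ _ _ → vanish x y (proj₁ (facts x px)) (proj₁ (facts y py)))
      where
      on : ∀ x → quad a x ≡ 0ℤ → coord z x ≡ 0ℤ → term a x u + term a x v + term a x w ≡ 0ℤ
      on x e e₄ = trans (sym (+-identityʳ (term a x u + term a x v + term a x w))) (trans (cong (λ m → term a x u + term a x v + term a x w + m) (sym (term≡0 a x z e₄))) (trans (sym (sum-≡ arr a x)) e))
      vanish : ∀ x y → coord z x ≡ 0ℤ → coord z y ≡ 0ℤ → coord w x * coord z y ≡ coord w y * coord z x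
      vanish x y e f = trans (cong (coord w x *_) f) (trans (*-zeroʳ (coord w x)) (sym (trans (cong (coord w y *_) e) (*-zeroʳ (coord w y)))))

    -- On ψ₁ = ψ₂ = 0 eliminating x₄ leaves a conic, and ψ₁ = 0 gives x₄ up to sign; the sign is fixed modulo an odd prime.
    few-Y≡0 : Few (λ x → (∀ i → coord i x ≢ 0ℤ) × Y x ≡ 0ℤ)
    few-Y≡0 = few-conic arrange-1234 i₄ (minor a b c1 c4) (minor a b c2 c4) (minor a b c3 c4) (m14 mn) (m24 mn) (m34 mn)
        (λ n x pt px → on x (proj₁ (proj₁ pt)) (trans (proj₂ (proj₁ pt)) (cong (λ y → y * y) (proj₂ px)))) (λ x px → proj₁ px i₂ , proj₁ px i₃ , proj₁ px i₄)
        (λ n pp p∤2 x y ptx pty _ _ nw ne rw rz eu ev → extra pp p∤2 x y (proj₁ (proj₁ ptx)) (proj₁ (proj₁ pty)) nw ne rw rz eu ev)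
      where
      on : ∀ x → quad a x ≡ 0ℤ → quad b x ≡ 0ℤ → minor a b c1 c4 * (c1 x * c1 x) + minor a b c2 c4 * (c2 x * c2 x) + minor a b c3 c4 * (c3 x * c3 x) ≡ 0ℤ
      on x e f = trans (raw (c1 a) (c2 a) (c3 a) (c4 a) (c1 b) (c2 b) (c3 b) (c4 b) (c1 x) (c2 x) (c3 x) (c4 x)) (trans (cong₂ (λ m k → c4 b * m - c4 a * k) e f) (zz (c4 b) (c4 a)))
        where
        raw : ∀ a₁ a₂ a₃ a₄ b₁ b₂ b₃ b₄ x₁ x₂ x₃ x₄ → (a₁ * b₄ - a₄ * b₁) * (x₁ * x₁) + (a₂ * b₄ - a₄ * b₂) * (x₂ * x₂) + (a₃ * b₄ - a₄ * b₃) * (x₃ * x₃) ≡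
          b₄ * (a₁ * (x₁ * x₁) + a₂ * (x₂ * x₂) + a₃ * (x₃ * x₃) + a₄ * (x₄ * x₄)) - a₄ * (b₁ * (x₁ * x₁) + b₂ * (x₂ * x₂) + b₃ * (x₃ * x₃) + b₄ * (x₄ * x₄))
        raw = solve-∀
        zz : ∀ m k → m * 0ℤ - k * 0ℤ ≡ 0ℤ
        zz = solve-∀
      extra : ∀ {p} → Prime p → ¬ + p ∣ + 2 → ∀ x y → quad a x ≡ 0ℤ → quad a y ≡ 0ℤ → ¬ + p ∣ c3 x → ¬ + p ∣ c4 x → + p ∣ c3 x - c3 y → + p ∣ c4 x - c4 y →
        c3 x * c1 y ≡ c3 y * c1 x → c3 x * c2 y ≡ c3 y * c2 x → c3 x * c4 y ≡ c3 y * c4 x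
      extra {p} pp p∤2 x y e f n₃ n₄ r₃ r₄ e₁ e₂ = choose (squares⇒± (c3 x * c4 y) (c3 y * c4 x) squares)
        where
        raw : ∀ a₁ a₂ a₃ a₄ x₁ x₂ x₃ x₄ y₁ y₂ y₃ y₄ → a₄ * (x₃ * y₄ * (x₃ * y₄)) ≡
          x₃ * x₃ * (a₁ * (y₁ * y₁) + a₂ * (y₂ * y₂) + a₃ * (y₃ * y₃) + a₄ * (y₄ * y₄)) - (a₁ * (x₃ * y₁ * (x₃ * y₁)) + a₂ * (x₃ * y₂ * (x₃ * y₂)) + a₃ * (x₃ * y₃ * (x₃ * y₃)))
        raw = solve-∀
        raw' : ∀ a₁ a₂ a₃ a₄ x₁ x₂ x₃ x₄ x' y₃ → x' * x' * 0ℤ - (a₁ * (y₃ * x₁ * (y₃ * x₁)) + a₂ * (y₃ * x₂ * (y₃ * x₂)) + a₃ * (x₃ * y₃ * (x₃ * y₃))) ≡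
          a₄ * (y₃ * x₄ * (y₃ * x₄)) - y₃ * y₃ * (a₁ * (x₁ * x₁) + a₂ * (x₂ * x₂) + a₃ * (x₃ * x₃) + a₄ * (x₄ * x₄))
        raw' = solve-∀
        tidy : ∀ s t → s - t * t * 0ℤ ≡ s
        tidy = solve-∀
        scaled : c4 a * (c3 x * c4 y * (c3 x * c4 y)) ≡ c4 a * (c3 y * c4 x * (c3 y * c4 x))
        scaled = trans (raw (c1 a) (c2 a) (c3 a) (c4 a) (c1 x) (c2 x) (c3 x) (c4 x) (c1 y) (c2 y) (c3 y) (c4 y))
          (trans (cong (λ m → c3 x * c3 x * m - (c1 a * (c3 x * c1 y * (c3 x * c1 y)) + c2 a * (c3 x * c2 y * (c3 x * c2 y)) + c3 a * (c3 x * c3 y * (c3 x * c3 y)))) f)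
          (trans (cong₂ (λ m k → c3 x * c3 x * 0ℤ - (c1 a * (m * m) + c2 a * (k * k) + c3 a * (c3 x * c3 y * (c3 x * c3 y)))) e₁ e₂)
          (trans (raw' (c1 a) (c2 a) (c3 a) (c4 a) (c1 x) (c2 x) (c3 x) (c4 x) (c3 x) (c3 y))
          (trans (cong (λ m → c4 a * (c3 y * c4 x * (c3 y * c4 x)) - c3 y * c3 y * m) e) (tidy (c4 a * (c3 y * c4 x * (c3 y * c4 x))) (c3 y))))))
        squares : c3 x * c4 y * (c3 x * c4 y) ≡ c3 y * c4 x * (c3 y * c4 x)
        squares = *-cancelˡ-≡ (c4 a) (c3 x * c4 y * (c3 x * c4 y)) (c3 y * c4 x * (c3 y * c4 x)) {{≢-nonZero (Isotropic.a4≢0 a nonsquare)}} scaled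
        -- If the products were opposite, the congruences between x and y would make 2 x₃ x₄
        -- divisible by p.
        sum : ∀ x₃ x₄ y₃ y₄ → (x₃ * y₄ - - (y₃ * x₄)) + (x₃ - y₃) * x₄ + x₃ * (x₄ - y₄) ≡ + 2 * (x₃ * x₄)
        sum = solve-∀
        choose : c3 x * c4 y ≡ c3 y * c4 x ⊎ c3 x * c4 y ≡ - (c3 y * c4 x) → c3 x * c4 y ≡ c3 y * c4 x
        choose (inj₁ g) = g
        choose (inj₂ g) = ⊥-elim (∤-* pp (+ 2) (c3 x * c4 x) p∤2 (∤-* pp (c3 x) (c4 x) n₃ n₄)
          (∣-resp-≡ (sum (c3 x) (c4 x) (c3 y) (c4 y)) (∣m∣n⇒∣m+n (∣m∣n⇒∣m+n (∣-resp-≡ (sym (trans (cong (_- - (c3 y * c4 x)) g) (+-inverseʳ (- (c3 y * c4 x))))) (divides 0ℤ refl)) (∣m⇒∣m*n (c4 x) r₃)) (∣n⇒∣m*n (c3 x) r₄))))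

    private
      zero? : ∀ i → Decidable (λ x → coord i x ≡ 0ℤ)
      zero? i x = coord i x ≟ 0ℤ

    -- Two zero coordinates leave a binary form, one leaves a conic, and none leaves the surface,
    -- from which the conic Y = 0 is split off. All coefficients of ψ₁ are nonzero because α is, so
    -- the restricted forms are nondegenerate.
    few-all : Few (λ _ → ⊤)
    few-all = few-split (zero? i₁)
        (few-split (zero? i₂) (few-two arrange-3412 a4≢0 (λ x ((_ , z₁) , z₂) → z₁ , z₂))
        (few-split (zero? i₃) (few-two arrange-2413 a4≢0 (λ x (((_ , z₁) , _) , z₃) → z₁ , z₃))
        (few-split (zero? i₄) (few-two arrange-2314 a3≢0 (λ x ((((_ , z₁) , _) , _) , z₄) → z₁ , z₄))
        (few-one-zero arrange-2341 a2≢0 a3≢0 a4≢0 (λ x ((((_ , z₁) , n₂) , n₃) , n₄) → z₁ , n₃ , n₄)))))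
        (few-split (zero? i₂)
          (few-split (zero? i₃) (few-two arrange-1423 a4≢0 (λ x (((_ , _) , z₂) , z₃) → z₂ , z₃))
          (few-split (zero? i₄) (few-two arrange-1324 a3≢0 (λ x ((((_ , _) , z₂) , _) , z₄) → z₂ , z₄))
          (few-one-zero arrange-1342 a1≢0 a3≢0 a4≢0 (λ x ((((_ , n₁) , z₂) , n₃) , n₄) → z₂ , n₃ , n₄))))
          (few-split (zero? i₃)
            (few-split (zero? i₄) (few-two arrange-1234 a2≢0 (λ x ((((_ , _) , _) , z₃) , z₄) → z₃ , z₄))
            (few-one-zero arrange-1243 a1≢0 a2≢0 a4≢0 (λ x ((((_ , n₁) , n₂) , z₃) , n₄) → z₃ , n₂ , n₄)))
            (few-split (zero? i₄) (few-one-zero arrange-1234 a1≢0 a2≢0 a3≢0 (λ x ((((_ , n₁) , n₂) , n₃) , z₄) → z₄ , n₂ , n₃))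
            (few-split (λ x → Y x ≟ 0ℤ) (few-⊆ (λ x (((((_ , n₁) , n₂) , n₃) , n₄) , y) → by-coordinates n₁ n₂ n₃ n₄ , y) few-Y≡0)
              (few-⊆ (λ x (((((_ , n₁) , n₂) , n₃) , n₄) , y) → by-coordinates n₁ n₂ n₃ n₄ , y) few-generic)))))
      where open Isotropic a nonsquare

  -- Translation to the counting function.

  minors≢0 : ∀ a b → (∀ (i j : Fin 4) → i Fin.< j → lookup a i * lookup b j - lookup a j * lookup b i ≢ + 0) → Minors≢0 (toV4 a) (toV4 b)
  minors≢0 (_ ∷ _ ∷ _ ∷ _ ∷ []) (_ ∷ _ ∷ _ ∷ _ ∷ []) h = record
    { m12 = h i₁ i₂ (s≤s z≤n) ; m13 = h i₁ i₃ (s≤s z≤n) ; m14 = h i₁ i₄ (s≤s z≤n)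
    ; m23 = h i₂ i₃ (s≤s (s≤s z≤n)) ; m24 = h i₂ i₄ (s≤s (s≤s z≤n)) ; m34 = h i₃ i₄ (s≤s (s≤s (s≤s z≤n))) }

  coeffProd-toV4 : ∀ a → coeffProd a ≡ c1 (toV4 a) * c2 (toV4 a) * c3 (toV4 a) * c4 (toV4 a)
  coeffProd-toV4 (_ ∷ _ ∷ _ ∷ _ ∷ []) = refl

  module _ (a b : Vec ℤ 4) where

    private
      β κ : ℕ
      β = abs (c1 (toV4 b)) ℕ.+ abs (c2 (toV4 b)) ℕ.+ abs (c3 (toV4 b)) ℕ.+ abs (c4 (toV4 b))
      -- The coordinates are at most 3 B, and y² ≤ β (3 B)² is at most (κ B)², so κ B bounds all
      -- five coordinates.
      κ = 3 ℕ.* suc β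

      solutions : ℕ → List V4
      solutions B = map toV4 (filter (counted? a b) (box 4 B))

      solutions-unique : ∀ B → Unique (solutions B)
      solutions-unique B = Unique.map⁺ toV4-injective (Unique.filter⁺ (counted? a b) (box-unique 4 B))

      Y : V4 → ℤ
      Y = squareRoot (toV4 b)

      root-bound : ∀ B y m → m ≡ y * y → abs m ℕ.≤ β ℕ.* (3 ℕ.* B ℕ.* (3 ℕ.* B)) → abs y ℕ.≤ κ ℕ.* B
      root-bound B y m e le = ^-cancelʳ-≤ 2 (s≤s z≤n) (begin
          abs y ℕ.^ 2                                 ≡⟨ trans (cong (abs y ℕ.*_) (ℕ.*-identityʳ (abs y))) (sym (trans (cong abs e) (abs-* y y))) ⟩
          abs m                                       ≤⟨ le ⟩
          β ℕ.* (3 ℕ.* B ℕ.* (3 ℕ.* B))               ≤⟨ ℕ.*-monoˡ-≤ (3 ℕ.* B ℕ.* (3 ℕ.* B)) (ℕ.≤-trans (ℕ.n≤1+n β) (ℕ.m≤m*n (suc β) (suc β))) ⟩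
          suc β ℕ.* suc β ℕ.* (3 ℕ.* B ℕ.* (3 ℕ.* B)) ≡⟨ solve 2 (λ s B → s :* s :* (con 3 :* B :* (con 3 :* B)) := (con 3 :* s :* B) :* ((con 3 :* s :* B) :* con 1)) refl (suc β) B ⟩
          (κ ℕ.* B) ℕ.^ 2                             ∎)
        where
        open ℕ.≤-Reasoning
        open ℕS.+-*-Solver
        open import Data.Integer.Properties using (abs-*)

      solutions-sound : ∀ B x → x ∈ solutions B → (quad (toV4 a) x ≡ 0ℤ × quad (toV4 b) x ≡ Y x * Y x) × Bounded (κ ℕ.* B) (v5 x (Y x))
      solutions-sound B x i = from-box (∈-map⁻ toV4 i)
        where
        from-box : (∃[ v ] v ∈ filter (counted? a b) (box 4 B) × x ≡ toV4 v) → (quad (toV4 a) x ≡ 0ℤ × quad (toV4 b) x ≡ Y x * Y x) × Bounded (κ ℕ.* B) (v5 x (Y x))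
        from-box (v , j , refl) = (trans (sym (diagForm-quad a v)) (proj₁ counted) , ψ₂≡) ,
            bounded (bounds (widen (l1 small)) (widen (l2 small)) (widen (l3 small)) (widen (l4 small))) (root-bound B (Y (toV4 v)) (quad (toV4 b) (toV4 v)) ψ₂≡ (quad-bound (toV4 b) (toV4 v) (3 ℕ.* B) small))
          where
          counted : Counted a b v
          counted = proj₂ (∈-filter⁻ (counted? a b) {xs = box 4 B} j)
          small : toV4 v ≤v (3 ℕ.* B)
          small = box-bound B v (proj₁ (∈-filter⁻ (counted? a b) {xs = box 4 B} j))
          ψ₂≡ : quad (toV4 b) (toV4 v) ≡ Y (toV4 v) * Y (toV4 v)
          ψ₂≡ = squareRoot-square (toV4 b) (toV4 v) (subst IsSquare (diagForm-quad b v) (proj₂ counted))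
          widen : ∀ {m} → m ℕ.≤ 3 ℕ.* B → m ℕ.≤ κ ℕ.* B
          widen le = ℕ.≤-trans le (ℕ.*-monoˡ-≤ B (ℕ.m≤m*n 3 (suc β)))

    M-bound : (∀ (i j : Fin 4) → i Fin.< j → lookup a i * lookup b j - lookup a j * lookup b i ≢ + 0) → ¬ IsSquare (coeffProd a) →
      ∀ t → 1 ℕ.≤ t → ∃[ K ] (∀ B → 1 ℕ.≤ B → count a b B ℕ.^ (3 ℕ.* t) ℕ.≤ K ℕ.* B ℕ.^ (5 ℕ.* t ℕ.+ 11))
    M-bound minors nonsquare t 1≤t = use (Count.few-all (toV4 a) (toV4 b) (λ sq → nonsquare (subst IsSquare (sym (coeffProd-toV4 a)) sq)) (minors≢0 a b minors) Y t 1≤t)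
      where
      E : ℕ
      E = 5 ℕ.* t ℕ.+ 11
      use : (∃[ K ] (∀ n c → 1 ℕ.≤ n → Unique c → (∀ x → x ∈ c → ((quad (toV4 a) x ≡ 0ℤ × quad (toV4 b) x ≡ Y x * Y x) × Bounded n (v5 x (Y x))) × ⊤) → length c ℕ.^ (3 ℕ.* t) ℕ.≤ K ℕ.* n ℕ.^ E)) →
        ∃[ K ] (∀ B → 1 ℕ.≤ B → count a b B ℕ.^ (3 ℕ.* t) ℕ.≤ K ℕ.* B ℕ.^ E)
      use (K , bd) = K ℕ.* κ ℕ.^ E , λ B 1≤B → begin
          count a b B ℕ.^ (3 ℕ.* t)                   ≡⟨ cong (ℕ._^ (3 ℕ.* t)) (sym (length-map toV4 (filter (counted? a b) (box 4 B)))) ⟩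
          length (solutions B) ℕ.^ (3 ℕ.* t)      ≤⟨ bd (κ ℕ.* B) (solutions B) (ℕ.≤-trans 1≤B (ℕ.m≤n*m B κ)) (solutions-unique B) (λ x i → solutions-sound B x i , tt) ⟩
          K ℕ.* (κ ℕ.* B) ℕ.^ E                   ≡⟨ trans (cong (K ℕ.*_) (^-distribʳ-* E κ B)) (sym (ℕ.*-assoc K (κ ℕ.^ E) (B ℕ.^ E))) ⟩
          K ℕ.* κ ℕ.^ E ℕ.* B ℕ.^ E               ∎
        where open ℕ.≤-Reasoning

-- The theorem for rational ε = p/q, with both sides raised to the power 3 q.

open Naturals using (power-root; ^-monoʳ-1≤)
open Counting using (M-bound)
open import Defs
open import Data.Nat using (ℕ; _≤_; _<_; _^_; _+_; _*_)
open import Data.Integer using (ℤ; +_; _-_)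
open import Data.Fin using (Fin; _<_)
open import Data.Vec using (Vec; lookup)
open import Data.Product using (∃-syntax; _,_)
open import Relation.Nullary using (¬_)
open import Relation.Binary.PropositionalEquality using (_≢_; cong; refl)
open import Data.Nat.Properties using (≤-trans; ≤-reflexive; +-monoʳ-≤; *-monoʳ-≤; m≤n*m)
open import Data.Nat.Solver using (module +-*-Solver)

theorem1p3 : (a b : Vec ℤ 4) →
    (∀ (i j : Fin 4) → i Data.Fin.< j →
    lookup a i Data.Integer.* lookup b j - lookup a j Data.Integer.* lookup b i ≢ + 0) →
    ¬ IsSquare (coeffProd a) →
    (p q : ℕ) → 0 Data.Nat.< p → 0 Data.Nat.< q →
    ∃[ C ] (∀ (B : ℕ) → 1 ≤ B →
    M a b B ^ (3 * q) ≤ C * B ^ (5 * q + 3 * p))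
theorem1p3 a b minors nonsquare p q 0<p 0<q = conclude (M-bound a b minors nonsquare (11 * q) (≤-trans 0<q (m≤n*m q 11)))
  where
  open +-*-Solver
  -- With t = 11 q the excess 11 is at most 33 p, so the exponent is at most 11 times 5 q + 3 p; an
  -- eleventh root then gives the claim.
  exponent : 5 * (11 * q) + 11 ≤ (5 * q + 3 * p) * 11
  exponent = ≤-trans (+-monoʳ-≤ (5 * (11 * q)) (*-monoʳ-≤ 11 (≤-trans 0<p (m≤n*m p 3))))
    (≤-reflexive (solve 2 (λ p q → con 5 :* (con 11 :* q) :+ con 11 :* (con 3 :* p) := (con 5 :* q :+ con 3 :* p) :* con 11) refl p q))
  conclude : (∃[ K ] (∀ B → 1 ≤ B → M a b B ^ (3 * (11 * q)) ≤ K * B ^ (5 * (11 * q) + 11))) →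
    ∃[ C ] (∀ (B : ℕ) → 1 ≤ B → M a b B ^ (3 * q) ≤ C * B ^ (5 * q + 3 * p))
  conclude (K , bd) = Data.Nat.suc K , λ B 1≤B → power-root 11 (3 * q) (5 * q + 3 * p) {K} {M a b B} {B} (Data.Nat.s≤s Data.Nat.z≤n)
      (≤-trans (≤-reflexive (cong (M a b B ^_) (solve 1 (λ q → con 3 :* q :* con 11 := con 3 :* (con 11 :* q)) refl q)))
      (≤-trans (bd B 1≤B) (*-monoʳ-≤ K (^-monoʳ-1≤ B 1≤B exponent))))
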